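{- A finite simple graph $G$ belongs to $FP$ if and only if every 3-connected component of $G$ is, up to isomorphism, of one of the following types: (0) a cycle $C_n$ or an $n$-fold multiedge (two vertices joined by $n$ parallel edges), $n>2$, where any of the edges may be virtual; (1) the wheel $W_3$ (that is, $K_4$), where only spoke edges (the three edges at one fixed vertex chosen as the hub) may be virtual; (2) a wheel $W_k$, $k>2$, where only rim edges may be virtual; (3) the prism $\overline{C_6}$, where only edges not belonging to a triangle may be virtual.
   Context: $FP = N_{\circ}(K_5^-,K_{3,3}^-)$ is the class of finite simple graphs having neither $K_5^-$ nor $K_{3,3}^-$ as a minor, where $K_5^-$ and $K_{3,3}^-$ are $K_5$ and $K_{3,3}$ with one edge deleted, and a minor of $G$ is a graph obtained from $G$ by vertex deletions, edge deletions and edge contractions. $W_k$ is the wheel with $k$ spokes: a cycle of length $k$ (its edges are the rim edges) together with a hub vertex joined to each cycle vertex by a spoke edge. $\overline{C_6}$, the complement of the 6-cycle, is the triangular prism: two disjoint triangles joined by a perfect matching. The 3-connected components of a graph are the Tutte (triconnected) components of its blocks with at least three vertices: such a block is decomposed along its 2-vertex separations, in the canonical way, into cycles of length at least 3, multiedges with at least 3 parallel edges, and 3-connected simple graphs with at least 4 vertices; these components are in general multigraphs. At each splitting along a vertex pair $\{a,b\}$ a new edge $ab$ is added to both parts; these added edges are called virtual edges, the other edges of the components being edges of $G$. -}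

module Defs where

open import Data.Fin using (Fin; zero; suc; toℕ; fromℕ; inject₁; punchIn)
open import Data.Fin.Patterns
open import Data.Fin.Properties using (any?) renaming (_≟_ to _≟ᶠ_)
open import Data.Fin.Subset using (Subset; ⁅_⁆; _∪_; _∩_; ∣_∣; _∈_; _∉_)
import Data.Fin.Subset as Subset
open import Data.List using (List; []; _∷_; [_]; _++_; foldr; length; map; replicate; tabulate; allFin)
import Data.List.Membership.Propositional as List
open import Data.List.Relation.Binary.Permutation.Propositional using (_↭_)
open import Data.List.Relation.Binary.Pointwise using (Pointwise)
open import Data.List.Relation.Unary.All using (All)
open import Data.List.Relation.Unary.AllPairs using (AllPairs)
open import Data.List.Relation.Unary.Any using (Any)
open import Data.Nat using (ℕ; zero; suc; _≤_; _<_; _>_; _<?_)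
open import Data.Product using (Σ; ∃; ∃-syntax; _×_; _,_)
open import Data.Sum using (_⊎_; inj₁; inj₂)
import Data.Product as Product
import Data.Sum as Sum
open import Function using (_∘_)
open import Function.Bundles using (_↔_; _⇔_; Inverse)
open import Function.Definitions using (Injective)
open import Relation.Binary.Construct.Closure.ReflexiveTransitive using (Star)
open import Relation.Binary.Definitions using (Decidable; Symmetric; Irreflexive)
open import Relation.Binary.PropositionalEquality using (_≡_; _≢_; refl; sym)
open import Relation.Nullary using (¬_; Dec)
open import Relation.Nullary.Decidable using (_×-dec_; _⊎-dec_; ¬?)

record Graph (n : ℕ) : Set₁ where
  infix 4 _~_
  field
    _~_      : Fin n → Fin n → Set
    ~-sym    : Symmetric _~_
    ~-irrefl : Irreflexive _≡_ _~_
    _~?_     : Decidable _~_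

infix 4 _≅_
_≅_ : ∀ {m n} → Graph m → Graph n → Set
_≅_ {m} {n} G H = Σ (Fin m ↔ Fin n) λ f →
  ∀ i j → (Graph._~_ G i j) ⇔ (Graph._~_ H (Inverse.to f i) (Inverse.to f j))

deleteVertex : ∀ {n} → Graph (suc n) → Fin (suc n) → Graph n
deleteVertex G v = record
  { _~_      = λ i j → punchIn v i ~ punchIn v j
  ; ~-sym    = ~-sym
  ; ~-irrefl = λ { refl → ~-irrefl refl }
  ; _~?_     = λ i j → punchIn v i ~? punchIn v j
  }
  where open Graph G

SamePair : ∀ {n} → Fin n → Fin n → Fin n → Fin n → Set
SamePair i j u v = (i ≡ u × j ≡ v) ⊎ (i ≡ v × j ≡ u)

deleteEdge : ∀ {n} → Graph n → Fin n → Fin n → Graph n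
deleteEdge G u v = record
  { _~_      = λ i j → i ~ j × ¬ SamePair i j u v
  ; ~-sym    = λ (p , q) → ~-sym p , q ∘ Sum.swap ∘ Sum.map Product.swap Product.swap
  ; ~-irrefl = λ eq (p , _) → ~-irrefl eq p
  ; _~?_     = λ i j → (i ~? j) ×-dec
      ¬? (((i ≟ᶠ u) ×-dec (j ≟ᶠ v)) ⊎-dec ((i ≟ᶠ v) ×-dec (j ≟ᶠ u)))
  }
  where open Graph G

-- The vertex x of a graph becomes i when v is merged into u and the
-- remaining vertices are renumbered along punchIn v.
Becomes : ∀ {n} (u v : Fin (suc n)) → Fin (suc n) → Fin n → Set
Becomes u v x i = (x ≡ punchIn v i) ⊎ (x ≡ v × punchIn v i ≡ u)

-- Loops and repeated edges produced by the contraction are discarded.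
contract : ∀ {n} → Graph (suc n) → Fin (suc n) → Fin (suc n) → Graph n
contract G u v = record
  { _~_      = λ i j → i ≢ j × ∃[ x ] ∃[ y ] (Becomes u v x i × Becomes u v y j × x ~ y)
  ; ~-sym    = λ (i≢j , x , y , p , q , r) → i≢j ∘ sym , y , x , q , p , ~-sym r
  ; ~-irrefl = λ eq (i≢j , _) → i≢j eq
  ; _~?_     = λ i j → ¬? (i ≟ᶠ j) ×-dec
      any? λ x → any? λ y → becomes? x i ×-dec becomes? y j ×-dec (x ~? y)
  }
  where
  open Graph G
  becomes? : Decidable (Becomes u v)
  becomes? x i = (x ≟ᶠ punchIn v i) ⊎-dec ((x ≟ᶠ v) ×-dec (punchIn v i ≟ᶠ u))

infix 4 _≼_
data _≼_ {m} (H : Graph m) : ∀ {n} → Graph n → Set₁ where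
  iso           : ∀ {n} {G : Graph n} → H ≅ G → H ≼ G
  delete-vertex : ∀ {n} {G : Graph (suc n)} v → H ≼ deleteVertex G v → H ≼ G
  delete-edge   : ∀ {n} {G : Graph n} {u v} → Graph._~_ G u v →
                  H ≼ deleteEdge G u v → H ≼ G
  contract-edge : ∀ {n} {G : Graph (suc n)} {u v} → Graph._~_ G u v →
                  H ≼ contract G u v → H ≼ G

complete : ∀ n → Graph n
complete n = record
  { _~_      = _≢_
  ; ~-sym    = λ p → p ∘ sym
  ; ~-irrefl = λ eq p → p eq
  ; _~?_     = λ i j → ¬? (i ≟ᶠ j)
  }

-- The two sides are {0,1,2} and {3,4,5}.
K₃₃ : Graph 6
K₃₃ = record
  { _~_      = λ i j → (Left i × ¬ Left j) ⊎ (¬ Left i × Left j)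
  ; ~-sym    = λ p → Sum.swap (Sum.map Product.swap Product.swap p)
  ; ~-irrefl = λ { refl (inj₁ (p , q)) → q p ; refl (inj₂ (p , q)) → p q }
  ; _~?_     = λ i j → (left? i ×-dec ¬? (left? j)) ⊎-dec (¬? (left? i) ×-dec left? j)
  }
  where
  Left : Fin 6 → Set
  Left i = toℕ i < 3
  left? : ∀ i → Dec (Left i)
  left? i = toℕ i <? 3

K₅⁻ : Graph 5
K₅⁻ = deleteEdge (complete 5) 0F 1F

K₃₃⁻ : Graph 6
K₃₃⁻ = deleteEdge K₃₃ 0F 3F

FP : ∀ {n} → Graph n → Set₁
FP G = ¬ (K₅⁻ ≼ G) × ¬ (K₃₃⁻ ≼ G)

record Edge (n : ℕ) (L : Set) : Set where
  constructor edge
  field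
    end₁ end₂ : Fin n
    label     : L

open Edge public

-- A multigraph without isolated vertices whose vertices are among Fin n
-- is given by its edges, as a list up to permutation; the order of the
-- two ends of an edge is immaterial.  Its vertices are the ends of its
-- edges, not all of Fin n.
MultiGraph : ℕ → Set → Set
MultiGraph n L = List (Edge n L)

module _ {n : ℕ} {L : Set} where

  vertices : MultiGraph n L → Subset n
  vertices = foldr (λ e S → (⁅ end₁ e ⁆ ∪ ⁅ end₂ e ⁆) ∪ S) Subset.⊥

  order : MultiGraph n L → ℕ
  order M = ∣ vertices M ∣

  Joins : Fin n → Fin n → Edge n L → Set
  Joins u v e = SamePair (end₁ e) (end₂ e) u v

  Parallel : Edge n L → Edge n L → Set
  Parallel e e′ = Joins (end₁ e′) (end₂ e′) e

  Simple : MultiGraph n L → Set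
  Simple M = All (λ e → end₁ e ≢ end₂ e) M × AllPairs (λ e e′ → ¬ Parallel e e′) M

  StepAvoiding : Subset n → MultiGraph n L → Fin n → Fin n → Set
  StepAvoiding X M u v = u ∉ X × v ∉ X × Any (Joins u v) M

  ConnectedWithout : Subset n → MultiGraph n L → Set
  ConnectedWithout X M = ∀ u v → u ∈ vertices M → v ∈ vertices M → u ∉ X → v ∉ X →
    Star (StepAvoiding X M) u v

  -- Deleting fewer than k vertices never disconnects M.
  Unseparated : ℕ → MultiGraph n L → Set
  Unseparated k M = ∀ X → ∣ X ∣ < k → ConnectedWithout X M

  3-Connected : MultiGraph n L → Set
  3-Connected M = order M > 3 × Unseparated 3 M

data Kind : Set where
  real    : Kind
  virtual : ℕ → Kind

module _ {n : ℕ} (G : Graph n) where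
  open Graph G

  Subgraph : MultiGraph n Kind → Set
  Subgraph B = Simple B × All (λ e → end₁ e ~ end₂ e × label e ≡ real) B

  _⊑_ : MultiGraph n Kind → MultiGraph n Kind → Set
  B ⊑ B′ = All (λ e → Any (Parallel e) B′) B

  -- A maximal connected subgraph without a cutvertex.  Being an edge
  -- list it has no isolated vertices, so that one-vertex blocks are left
  -- out; only blocks with at least three vertices are used.
  Block : MultiGraph n Kind → Set
  Block B = Subgraph B × Unseparated 2 B ×
    (∀ B′ → Subgraph B′ → Unseparated 2 B′ → B ⊑ B′ → B′ ⊑ B)

data Status : Set where
  must-be-real may-be-virtual : Status

Template : ℕ → Set
Template m = MultiGraph m Status

data Permits : Status → Kind → Set where
  real    : ∀ {s} → Permits s real
  virtual : ∀ {ℓ} → Permits may-be-virtual (virtual ℓ)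

-- f is the vertex map of an isomorphism from T onto H, the edge map being
-- given by position after reordering H.  As the templates below have no
-- isolated vertices, f hits exactly the vertices of H.
_HasType_ : ∀ {n m} → MultiGraph n Kind → Template m → Set
_HasType_ {n} {m} H T = Σ (Fin m → Fin n) λ f → Injective _≡_ _≡_ f ×
  ∃[ H′ ] (H ↭ H′ ×
    Pointwise (λ e t → Joins (f (end₁ t)) (f (end₂ t)) e × Permits (label t) (label e)) H′ T)

cyclePairs : ∀ k → List (Fin k × Fin k)
cyclePairs zero    = []
cyclePairs (suc k) = (fromℕ k , zero) ∷ tabulate (λ i → inject₁ i , suc i)

cycle : ∀ k → Template k
cycle k = map (λ (i , j) → edge i j may-be-virtual) (cyclePairs k)

multiedge : ℕ → Template 2
multiedge k = replicate k (edge 0F 1F may-be-virtual)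

-- The hub is vertex zero.
wheel : (rim spoke : Status) (k : ℕ) → Template (suc k)
wheel rim spoke k =
  map (λ (i , j) → edge (suc i) (suc j) rim) (cyclePairs k) ++
  map (λ i → edge zero (suc i) spoke) (allFin k)

prism : Template 6
prism =
  edge 0F 1F must-be-real   ∷ edge 1F 2F must-be-real   ∷ edge 2F 0F must-be-real ∷
  edge 3F 4F must-be-real   ∷ edge 4F 5F must-be-real   ∷ edge 5F 3F must-be-real ∷
  edge 0F 3F may-be-virtual ∷ edge 1F 4F may-be-virtual ∷ edge 2F 5F may-be-virtual ∷ []

module _ {n : ℕ} where

  IsCycle : MultiGraph n Kind → Set
  IsCycle H = ∃[ k ] (k > 2 × H HasType cycle k)

  IsMultiedge : MultiGraph n Kind → Set
  IsMultiedge H = ∃[ k ] (k > 2 × H HasType multiedge k)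

  record SplitsAlong (a b : Fin n) (H E₁ E₂ : MultiGraph n Kind) : Set where
    field
      partition : H ↭ E₁ ++ E₂
      size₁     : 2 ≤ length E₁
      size₂     : 2 ≤ length E₂
      distinct  : a ≢ b
      separates : vertices E₁ ∩ vertices E₂ ≡ ⁅ a ⁆ ∪ ⁅ b ⁆

  -- Splittings B k Hs: Hs arises from B by k successive splits.  The two
  -- copies of the virtual edge created by a split are labelled with the
  -- number of earlier splits, so that each label belongs to one split.
  data Splittings (B : MultiGraph n Kind) : ℕ → List (MultiGraph n Kind) → Set where
    none  : Splittings B 0 [ B ]
    split : ∀ {k Hs H Hs′ a b E₁ E₂} →
            Splittings B k Hs →
            Hs ↭ H ∷ Hs′ →
            SplitsAlong a b H E₁ E₂ →
            Splittings B (suc k)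
              ((edge a b (virtual k) ∷ E₁) ∷ (edge a b (virtual k) ∷ E₂) ∷ Hs′)

  ShareVirtualEdge : MultiGraph n Kind → MultiGraph n Kind → Set
  ShareVirtualEdge H H′ = ∃[ ℓ ]
    (Any (λ e → label e ≡ virtual ℓ) H × Any (λ e → label e ≡ virtual ℓ) H′)

  -- The last condition singles out the canonical decomposition, which is
  -- unique up to the naming of virtual edges: cycles are not split
  -- further into cycles, nor multiedges into multiedges.
  record TutteDecomposition (B : MultiGraph n Kind) (Hs : List (MultiGraph n Kind)) : Set where
    field
      {splits}  : ℕ
      obtained  : Splittings B splits Hs
      pieces    : All (λ H → IsCycle H ⊎ IsMultiedge H ⊎ (Simple H × 3-Connected H)) Hs
      canonical : AllPairs (λ H H′ → ShareVirtualEdge H H′ →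
                    ¬ (IsCycle H × IsCycle H′) × ¬ (IsMultiedge H × IsMultiedge H′)) Hs

  ThreeConnectedComponent : Graph n → MultiGraph n Kind → Set
  ThreeConnectedComponent G H = ∃[ B ] (Block G B × order B > 2 ×
    ∃[ Hs ] (TutteDecomposition B Hs × H List.∈ Hs))

  data Allowed (H : MultiGraph n Kind) : Set where
    is-cycle     : ∀ {k} → k > 2 → H HasType cycle k → Allowed H
    is-multiedge : ∀ {k} → k > 2 → H HasType multiedge k → Allowed H
    is-W₃        : H HasType wheel must-be-real may-be-virtual 3 → Allowed H
    is-wheel     : ∀ {k} → k > 2 → H HasType wheel may-be-virtual must-be-real k → Allowed H
    is-prism     : H HasType prism → Allowed H

module Submission where

-- A minor is a model by connected branch sets. In G a virtual edge stands for a
-- path with an interior vertex on the other side of its splitting, so the graph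
-- obtained from a component by subdividing its virtual edges (its hat) is a minor
-- of G. Conversely K₅⁻ and K₃₃⁻, being nearly 3-connected, survive in the hat of
-- one of the two parts of every splitting. So G belongs to FP exactly if the hats
-- of its components do. Allowed components have this property because of a vertex
-- cover of size two, a hub whose deletion leaves maximum degree two, or a count
-- of the minor's edges at the three subdivided edges of the prism. Conversely, a
-- 3-connected graph without these minors is a wheel or a prism: contract an edge
-- so that it stays 3-connected (Thomassen) and undo the contraction; a virtual
-- edge in a wrong place then produces K₃₃⁻. Canonical decompositions exist since
-- a decomposition into cycles, multiedges and 3-connected pieces with the fewest
-- splittings is canonical: cycles or multiedges that share a virtual edge could
-- be merged.

open import Defs
open import Data.Bool using (Bool; true; false; if_then_else_; _∧_; _∨_; not; T)
open import Data.Bool.Properties using () renaming (_≟_ to _≟ᵇ_)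
open import Data.Empty using (⊥; ⊥-elim)
open import Data.Fin using (Fin; zero; suc; toℕ; fromℕ; inject₁; punchIn; punchOut; combine; pinch)
open import Data.Fin.Patterns
open import Data.Fin.Permutation.Components using (transpose)
open import Data.Fin.Properties using
  (any?; all?; toℕ-injective; toℕ-inject₁; toℕ-fromℕ; toℕ<n; punchIn-injective; punchInᵢ≢i;
   punchIn-punchOut; punchOut-punchIn; punchOut-cong; punchOut-injective; pigeonhole; suc-injective;
   inject₁-injective; fromℕ≢inject₁; combine-injective) renaming (_≟_ to _≟ᶠ_)
open import Data.Fin.Relation.Unary.Top using (view; ‵fromℕ; ‵inject₁)
open import Data.Fin.Subset using (Subset; ⁅_⁆; _∪_; _∩_; ∣_∣; _∈_; _∉_; _⊆_)
open import Data.Fin.Subset.Properties using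
  (_∈?_; x∈⁅x⁆; x∈⁅y⁆⇒x≡y; x∈p∪q⁻; x∈p∪q⁺; x∈p∩q⁻; x∈p∩q⁺; ∩-comm; ⊆-antisym; ∉⊥; anySubset?;
   p⊂q⇒∣p∣<∣q∣; p⊆q⇒∣p∣≤∣q∣; ∣p∣≤n; x∈p⇒∣p-x∣<∣p∣; x∈p∧x≢y⇒x∈p-y; ∣⁅x⁆∣≡1)
open import Data.List using
  (List; []; _∷_; [_]; _++_; length; map; tabulate; allFin; filter; cartesianProduct; lookup)
open import Data.List.Membership.Propositional using (find; lose) renaming (_∈_ to _∈ˡ_; _∉_ to _∉ˡ_)
open import Data.List.Membership.Propositional.Properties using
  (∈-allFin; ∈-cartesianProduct⁺; ∈-∃++; ∈-++⁺ˡ; ∈-++⁺ʳ; ∈-++⁻; ∈-map⁺; ∈-map⁻; ∈-tabulate⁺;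
   ∈-tabulate⁻; ∈-filter⁺; ∈-filter⁻; ∈-lookup)
import Data.List.Properties as ListP
import Data.List.Relation.Binary.Permutation.Propositional as Perm
open import Data.List.Relation.Binary.Permutation.Propositional using
  (_↭_; ↭-refl; ↭-sym; ↭-trans; ↭-prep; ↭-swap; ↭-reflexive)
open import Data.List.Relation.Binary.Permutation.Propositional.Properties using
  (All-resp-↭; Any-resp-↭; ∈-resp-↭; ↭-length; ++⁺ˡ; ++⁺ʳ; shift; drop-∷; ++-comm; map⁺;
   ++-identityʳ; shifts) renaming (++⁺ to ++⁺-↭; ++-assoc to ++-assoc-↭)
import Data.List.Relation.Binary.Pointwise as PW
open import Data.List.Relation.Binary.Pointwise using (Pointwise; []; _∷_)
import Data.List.Relation.Unary.All as All
open import Data.List.Relation.Unary.All using (All; []; _∷_)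
import Data.List.Relation.Unary.All.Properties as AllP
import Data.List.Relation.Unary.AllPairs as AllPairs
open import Data.List.Relation.Unary.AllPairs using (AllPairs; []; _∷_)
import Data.List.Relation.Unary.AllPairs.Properties as AllPairsP
import Data.List.Relation.Unary.Any as Any
open import Data.List.Relation.Unary.Any using (Any; here; there)
import Data.List.Relation.Unary.Any.Properties as AnyP
open import Data.List.Relation.Unary.Unique.Propositional using (Unique)
import Data.List.Relation.Unary.Unique.Propositional.Properties as UniqueP
import Data.Maybe as Maybe
open import Data.Maybe using (Maybe; just; nothing; _>>=_)
open import Data.Maybe.Properties using (just-injective) renaming (≡-dec to Maybe-≡-dec)
open import Data.Nat using (ℕ; zero; suc; _≤ᵇ_; _≡ᵇ_; _+_; _*_; _∸_; _≤_; _<_; _>_; _<?_; z≤n; s≤s; pred)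
open import Data.Nat.Induction using (<-wellFounded)
open import Data.Nat.Properties using
  (≤⇒≤ᵇ; ≡ᵇ⇒≡; ≤-refl; ≤-trans; <-irrefl; ≤-reflexive; m≤n⇒m≤1+n; <-≤-trans; ≤-<-trans; <-trans; ≮⇒≥;
   ≤∧≢⇒<; +-suc; +-comm; m≤n+m; +-mono-≤; <⇒≢; <-cmp; ≤-pred; ∸-monoʳ-<) renaming (_≟_ to _≟ⁿ_; suc-injective to ℕ-suc-injective)
import Data.Product as Product
open import Data.Product using (Σ; ∃; ∃₂; _×_; _,_; proj₁; proj₂)
import Data.Sum as Sum
open import Data.Sum using (_⊎_; inj₁; inj₂; [_,_]′)
open import Data.Sum.Properties using (inj₁-injective; inj₂-injective)
import Data.Vec as Vec
import Data.Vec.Properties as VecP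
open import Function using (_∘_; id; case_of_; flip; const)
open import Function.Bundles using (_↔_; _⇔_; Inverse; Equivalence; mk⇔; mk↔ₛ′)
open import Function.Definitions using (Injective)
open import Induction.WellFounded using (Acc; acc)
open import Relation.Binary.Construct.Closure.ReflexiveTransitive using
  (Star; ε; _◅_; _◅◅_; kleisliStar) renaming (reverse to Star-reverse; map to Star-map)
open import Relation.Binary.Definitions using (Symmetric; DecidableEquality; tri<; tri≈; tri>)
open import Relation.Binary.PropositionalEquality using
  (_≡_; _≢_; refl; sym; cong; cong₂; subst; subst₂; trans)
open import Relation.Nullary using (¬_; Dec; yes; no; does; contradiction)
open import Relation.Nullary.Decidable using
  (_×-dec_; _⊎-dec_; ¬?; toWitness; True; map′; decidable-stable; dec-true; _→-dec_)


-- Minor models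

-- Virtual edges are subdivided, not merely kept as edges, because K₃₃⁻ has two vertices of degree
-- two: the branch set of such a vertex can lie wholly beyond a splitting, and the subdividing
-- vertex then takes its place. For the same reason the position of virtual edges matters: the
-- vertex that subdivides a misplaced one acts as a vertex of degree two of K₃₃⁻. Facts about K₅⁻
-- and K₃₃⁻ themselves are finite and left to evaluation. Wheels of every size are reduced to two
-- patterns: a four-cycle whose two opposite pairs are both linked from outside, and a rim
-- contracted to five sets. K₄ and W₄ are exceptional in the undoing of contractions. Splitting a
-- vertex of K₄ is the step that can produce K₅⁻, and splitting the hub of W₄ is the step that
-- produces the prism; from five spokes on, splitting the hub always yields K₃₃⁻. The existence of a
-- decomposition serves to refute a minor, so it is stated as a double negation.

record Model {U V : Set} (S : U → U → Set) (R : V → V → Set) : Set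
Inside : {U V : Set} (R : V → V → Set) (φ : V → Maybe U) (x : U) → V → V → Set
Inside R φ x v w = R v w × φ v ≡ just x × φ w ≡ just x

-- A minor model: φ sends each vertex to the branch set containing it.
-- Branch sets of isolated vertices of S may be empty.
record Model {U} {V} S R where
  constructor model
  field
    φ     : V → Maybe U
    conn  : ∀ {v w x} → φ v ≡ just x → φ w ≡ just x → Star (Inside R φ x) v w
    edges : ∀ {x y} → S x y → ∃₂ λ v w → φ v ≡ just x × φ w ≡ just y × R v w

>>=-just : {A B : Set} {m : Maybe A} {f : A → Maybe B} {b : B} →
           (m >>= f) ≡ just b → ∃ λ a → m ≡ just a × f a ≡ just b
>>=-just {m = just a} eq = a , refl , eq

just->>= : {A B : Set} {m : Maybe A} (f : A → Maybe B) {a : A} {b : Maybe B} →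
           m ≡ just a → f a ≡ b → (m >>= f) ≡ b
just->>= f refl eq = eq

infixl 5 _⨾_
-- The branch set of x is the union of the branch sets in N of the vertices that form its branch set
-- in M. It is connected because every edge of a path inside the latter is realised by an edge
-- between two of the former.
_⨾_ : {U V W : Set} {S : U → U → Set} {R : V → V → Set} {Q : W → W → Set} →
      Model S R → Model R Q → Model S Q
_⨾_ {S = S} {R} {Q} M N = record
  { φ = φ
  ; conn = λ p q → let (a , pa , qa) = >>=-just p ; (b , pb , qb) = >>=-just q in
                   lift (M.conn qa qb) qb pa pb
  ; edges = λ s → let (a , b , pa , pb , r) = M.edges s
                      (v , w , pv , pw , q) = N.edges r in
                  v , w , just->>= M.φ pv pa , just->>= M.φ pw pb , q
  }
  where
  module M = Model M
  module N = Model N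
  φ = λ w → N.φ w >>= M.φ
  within : ∀ {x a v w} → M.φ a ≡ just x → Star (Inside Q N.φ a) v w → Star (Inside Q φ x) v w
  within e = Star-map λ (q , p₁ , p₂) → q , just->>= M.φ p₁ e , just->>= M.φ p₂ e
  lift : ∀ {x a b v w} → Star (Inside R M.φ x) a b → M.φ b ≡ just x →
         N.φ v ≡ just a → N.φ w ≡ just b → Star (Inside Q φ x) v w
  lift ε e p q = within e (N.conn p q)
  lift ((r , e₁ , e₂) ◅ st) e p q with N.edges r
  ... | v′ , w′ , p′ , q′ , s =
    within e₁ (N.conn p p′) ◅◅ (s , just->>= M.φ p′ e₁ , just->>= M.φ q′ e₂) ◅ lift st e q′ q

-- Branch sets with at most one vertex are trivially connected: this is the embedding of a subgraph,
-- given by its partial inverse.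
injection-model : {U V : Set} {S : U → U → Set} {R : V → V → Set} (φ : V → Maybe U) →
                  (∀ {v w x} → φ v ≡ just x → φ w ≡ just x → v ≡ w) →
                  (∀ {x y} → S x y → ∃₂ λ v w → φ v ≡ just x × φ w ≡ just y × R v w) →
                  Model S R
injection-model φ inj edges = record
  { φ = φ ; conn = λ p q → case inj p q of λ { refl → ε } ; edges = edges }

id-model : {V : Set} {S R : V → V → Set} → (∀ {x y} → S x y → R x y) → Model S R
id-model f = injection-model just (λ { refl refl → refl }) (λ s → _ , _ , refl , refl , f s)

infix 4 _≼ᵐ_
_≼ᵐ_ : ∀ {k n} → Graph k → Graph n → Set
K ≼ᵐ G = Model (Graph._~_ K) (Graph._~_ G)

-- Minor operations and models

module _ {n : ℕ} {u v : Fin (suc n)} (v≢u : v ≢ u) where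

  -- `contract` is phrased with the relation `Becomes`; this is the function whose graph that
  -- relation is.
  merge : Fin (suc n) → Fin n
  merge x with v ≟ᶠ x
  ... | yes _ = punchOut v≢u
  ... | no  p = punchOut p

  merge-v : merge v ≡ merge u
  merge-v with v ≟ᶠ v | v ≟ᶠ u
  ... | no p  | _ = contradiction refl p
  ... | yes _ | yes p = contradiction p v≢u
  ... | yes _ | no p = punchOut-cong v refl

  merge-punchIn : ∀ i → merge (punchIn v i) ≡ i
  merge-punchIn i with v ≟ᶠ punchIn v i
  ... | yes p = contradiction (sym p) (punchInᵢ≢i v i)
  ... | no p = trans (punchOut-cong v refl) (punchOut-punchIn v)

  punchIn-merge : ∀ {x} → v ≢ x → punchIn v (merge x) ≡ x
  punchIn-merge {x} p with v ≟ᶠ x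
  ... | yes q = contradiction q p
  ... | no q = punchIn-punchOut q

  merge-fibre : ∀ {x y} → merge x ≡ merge y → x ≡ y ⊎ (x ≡ v × y ≡ u) ⊎ (x ≡ u × y ≡ v)
  merge-fibre {x} {y} e with v ≟ᶠ x | v ≟ᶠ y
  ... | yes refl | yes refl = inj₁ refl
  ... | yes refl | no q = inj₂ (inj₁ (refl , sym (punchOut-injective v≢u q e)))
  ... | no p | yes refl = inj₂ (inj₂ (punchOut-injective p v≢u e , refl))
  ... | no p | no q = inj₁ (punchOut-injective p q e)

  becomes⇒merge : ∀ {x i} → Becomes u v x i → merge x ≡ i
  becomes⇒merge {i = i} (inj₁ refl) = merge-punchIn i
  becomes⇒merge {i = i} (inj₂ (refl , refl)) = trans merge-v (merge-punchIn i)

  merge⇒becomes : ∀ {x i} → merge x ≡ i → Becomes u v x i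
  merge⇒becomes {x} refl with v ≟ᶠ x
  ... | yes refl = inj₂ (refl , punchIn-punchOut v≢u)
  ... | no q = inj₁ (sym (punchIn-punchOut q))

module _ {n : ℕ} (G : Graph n) where
  open Graph G
  ~⇒≢ : ∀ {u v} → u ~ v → u ≢ v
  ~⇒≢ p refl = ~-irrefl refl p

module _ {n : ℕ} (G : Graph (suc n)) where
  open Graph G

  contract⇐ : ∀ {u v x y} (p : v ≢ u) → x ~ y → merge p x ≢ merge p y →
              Graph._~_ (contract G u v) (merge p x) (merge p y)
  contract⇐ p r q = q , _ , _ , merge⇒becomes p refl , merge⇒becomes p refl , r

  deleteVertex-model : ∀ v → deleteVertex G v ≼ᵐ G
  deleteVertex-model v = injection-model φ inj λ {x} {y} r → _ , _ , φ-in x , φ-in y , r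
    where
    φ : Fin (suc n) → Maybe (Fin n)
    φ x with v ≟ᶠ x
    ... | yes _ = nothing
    ... | no p = just (punchOut p)
    φ-in : ∀ x → φ (punchIn v x) ≡ just x
    φ-in x with v ≟ᶠ punchIn v x
    ... | yes p = contradiction (sym p) (punchInᵢ≢i v x)
    ... | no p = cong just (trans (punchOut-cong v refl) (punchOut-punchIn v))
    inj : ∀ {a b x} → φ a ≡ just x → φ b ≡ just x → a ≡ b
    inj {a} {b} p q with v ≟ᶠ a | v ≟ᶠ b
    ... | no r | no s = punchOut-injective r s (just-injective (trans p (sym q)))

  contract-model : ∀ {u v} → u ~ v → contract G u v ≼ᵐ G
  contract-model {u} {v} u~v = record { φ = just ∘ merge v≢u ; conn = conn ; edges = edges }
    where
    v≢u = ~⇒≢ G (~-sym u~v)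
    conn : ∀ {a b x} → just (merge v≢u a) ≡ just x → just (merge v≢u b) ≡ just x →
           Star (Inside _~_ (just ∘ merge v≢u) x) a b
    conn p q with merge-fibre v≢u (just-injective (trans p (sym q)))
    ... | inj₁ refl = ε
    ... | inj₂ (inj₁ (refl , refl)) = (~-sym u~v , p , q) ◅ ε
    ... | inj₂ (inj₂ (refl , refl)) = (u~v , p , q) ◅ ε
    edges : ∀ {x y} → Graph._~_ (contract G u v) x y → _
    edges (_ , a , b , p , q , r) =
      a , b , cong just (becomes⇒merge v≢u p) , cong just (becomes⇒merge v≢u q) , r

≼⇒model : ∀ {k n} {K : Graph k} {G : Graph n} → K ≼ G → K ≼ᵐ G
≼⇒model (iso (f , e)) = injection-model (just ∘ Inverse.from f)
  (λ p q → trans (sym (Inverse.strictlyInverseˡ f _))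
             (trans (cong (Inverse.to f) (just-injective (trans p (sym q))))
               (Inverse.strictlyInverseˡ f _)))
  (λ {x} {y} r → _ , _ , cong just (Inverse.strictlyInverseʳ f x) ,
                         cong just (Inverse.strictlyInverseʳ f y) , Equivalence.to (e x y) r)
≼⇒model {G = G} (delete-vertex v p) = ≼⇒model p ⨾ deleteVertex-model G v
≼⇒model (delete-edge _ p) = ≼⇒model p ⨾ id-model proj₁
≼⇒model {G = G} (contract-edge r p) = ≼⇒model p ⨾ contract-model G r

spanning : ∀ {k n} (K : Graph k) (G : Graph n) (f : Fin k ↔ Fin n) →
           (∀ {i j} → Graph._~_ K i j → Graph._~_ G (Inverse.to f i) (Inverse.to f j)) → K ≼ G
spanning {k} {n} K G f sub =
  go G sub (cartesianProduct (allFin n) (allFin n))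
     (λ {i} {j} _ → ∈-cartesianProduct⁺ (∈-allFin i) (∈-allFin j))
  where
  open Inverse f
  Extra : Graph n → Fin n → Fin n → Set
  Extra G i j = Graph._~_ G i j × ¬ Graph._~_ K (from i) (from j)
  go : ∀ G → (∀ {i j} → Graph._~_ K i j → Graph._~_ G (to i) (to j)) →
       ∀ L → (∀ {i j} → Extra G i j → (i , j) ∈ˡ L) → K ≼ G
  go G sub [] all = iso (f , λ i j → mk⇔ sub (λ r → back r))
    where
    back : ∀ {i j} → Graph._~_ G (to i) (to j) → Graph._~_ K i j
    back {i} {j} r with Graph._~?_ K i j
    ... | yes p = p
    ... | no q with all (r , subst₂ (λ a b → ¬ Graph._~_ K a b) (sym (strictlyInverseʳ i))
                                    (sym (strictlyInverseʳ j)) q)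
    ... | ()
  go G sub ((u , v) ∷ L) all with Graph._~?_ G u v | Graph._~?_ K (from u) (from v)
  ... | no p | _ = go G sub L λ e → case all e of λ { (here refl) → contradiction (proj₁ e) p ; (there q) → q }
  ... | yes _ | yes p = go G sub L λ e → case all e of λ { (here refl) → contradiction p (proj₂ e) ; (there q) → q }
  ... | yes p | no q = delete-edge p (go (deleteEdge G u v)
    (λ {i} {j} r → sub r , λ
      { (inj₁ (refl , refl)) → q (subst₂ (Graph._~_ K) (sym (strictlyInverseʳ i)) (sym (strictlyInverseʳ j)) r)
      ; (inj₂ (refl , refl)) → q (subst₂ (Graph._~_ K) (sym (strictlyInverseʳ j)) (sym (strictlyInverseʳ i)) (Graph.~-sym K r)) })
    L λ ((r , s) , e) → case all (r , e) of λ
      { (here refl) → contradiction (inj₁ (refl , refl)) s ; (there t) → t })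

module _ {k} (K : Graph k) where
  record Onto {n} (G : Graph n) : Set where
    field
      branches : K ≼ᵐ G
      nonempty : ∀ x → ∃ λ v → Model.φ branches v ≡ just x

  -- A vertex outside all branch sets is deleted; a branch set with two vertices has an edge to
  -- contract; otherwise the branch sets form a bijection and only edges remain to be deleted. The
  -- recursion is on the number of vertices.
  onto⇒≼ : ∀ {n} {G : Graph n} → Onto G → K ≼ G
  onto⇒≼ {n} {G} O with any? (λ v → Maybe-≡-dec _≟ᶠ_ (Model.φ (Onto.branches O) v) nothing)
  onto⇒≼ {suc n} {G} O | yes (v , e) =
    delete-vertex v (onto⇒≼ record { branches = record { φ = φ ∘ punchIn v ; conn = λ p q → conn′ (conn p q) refl refl ; edges = edges′ } ; nonempty = nonempty′ })
    where
    open Onto O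
    open Model branches
    open Graph G
    away : ∀ {x a} → φ a ≡ just x → ∃ λ b → punchIn v b ≡ a
    away {a = a} p with v ≟ᶠ a
    ... | yes refl = case trans (sym p) e of λ ()
    ... | no q = punchOut q , punchIn-punchOut q
    conn′ : ∀ {x s t a b} → Star (Inside _~_ φ x) s t → punchIn v a ≡ s → punchIn v b ≡ t →
            Star (Inside (Graph._~_ (deleteVertex G v)) (φ ∘ punchIn v) x) a b
    conn′ {a = a} {b} ε refl q rewrite punchIn-injective v b a q = ε
    conn′ ((r , p₁ , p₂) ◅ st) refl q with away p₂
    ... | c , refl = (r , p₁ , p₂) ◅ conn′ st refl q
    edges′ : ∀ {x y} → Graph._~_ K x y → _
    edges′ r with edges r
    ... | s , t , p , q , g with away p | away q
    ... | a , refl | b , refl = a , b , p , q , g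
    nonempty′ : ∀ x → _
    nonempty′ x with nonempty x
    ... | s , p with away p
    ... | a , refl = a , p
  ... | no tot with any? (λ v → any? λ w → ¬? (v ≟ᶠ w) ×-dec Maybe-≡-dec _≟ᶠ_ (Model.φ (Onto.branches O) v) (Model.φ (Onto.branches O) w))
  ... | no inj = spanning K G (mk↔ₛ′ rep val rep-val val-rep) λ {i} {j} r →
      let (s , t , p , q , g) = edges r in
      subst₂ _~_ (uniq p (proj₂ (nonempty i))) (uniq q (proj₂ (nonempty j))) g
    where
    open Onto O
    open Model branches
    open Graph G
    rep = λ x → proj₁ (nonempty x)
    uniq : ∀ {s t x} → φ s ≡ just x → φ t ≡ just x → s ≡ t
    uniq {s} {t} p q with s ≟ᶠ t
    ... | yes e = e
    ... | no e = contradiction (s , t , e , trans p (sym q)) inj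
    total : ∀ v → ∃ λ x → φ v ≡ just x
    total v with φ v in eq
    ... | just x = x , refl
    ... | nothing = contradiction (v , eq) tot
    val = λ v → proj₁ (total v)
    rep-val : ∀ v → rep (val v) ≡ v
    rep-val v = uniq (proj₂ (nonempty (val v))) (proj₂ (total v))
    val-rep : ∀ x → val (rep x) ≡ x
    val-rep x = just-injective (trans (sym (proj₂ (total (rep x)))) (proj₂ (nonempty x)))
  onto⇒≼ {suc n} {G} O | no tot | yes (v , w , v≢w , e) = finish (first (conn fv (trans (sym e) fv)))
    where
    open Onto O
    open Model branches
    open Graph G
    total : ∀ v → ∃ λ x → φ v ≡ just x
    total v with φ v in eq
    ... | just x = x , refl
    ... | nothing = contradiction (v , eq) tot
    x₀ = proj₁ (total v)
    fv = proj₂ (total v)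
    -- The edge to contract is the first one of a path from v to w inside their branch set; its
    -- other end s is merged into v.
    first : Star (Inside _~_ φ x₀) v w → ∃ λ s → v ~ s × φ s ≡ just x₀
    first ε = contradiction refl v≢w
    first ((r , _ , p) ◅ _) = _ , r , p
    finish : (∃ λ s → v ~ s × φ s ≡ just x₀) → K ≼ G
    finish (s , v~s , fs) = contract-edge v~s (onto⇒≼ record
      { branches = record { φ = φ′ ; conn = conn′ ; edges = edges′ }
      ; nonempty = λ x → π (proj₁ (nonempty x)) , trans (φ-π (proj₁ (nonempty x))) (proj₂ (nonempty x)) })
      where
      s≢v = ~⇒≢ G (~-sym v~s)
      π = merge s≢v
      φ′ = φ ∘ punchIn s
      φ-π : ∀ a → φ′ (π a) ≡ φ a
      φ-π a with s ≟ᶠ a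
      ... | yes refl = trans (cong φ (punchIn-punchOut s≢v)) (trans fv (sym fs))
      ... | no p = cong φ (punchIn-punchOut p)
      step : ∀ {x a b} → Inside _~_ φ x a b →
             Star (Inside (Graph._~_ (contract G v s)) φ′ x) (π a) (π b)
      step {a = a} {b} (r , p , q) with π a ≟ᶠ π b
      ... | yes e rewrite e = ε
      ... | no e = (contract⇐ G s≢v r e , trans (φ-π a) p , trans (φ-π b) q) ◅ ε
      conn′ : ∀ {a b x} → φ′ a ≡ just x → φ′ b ≡ just x → Star _ a b
      conn′ {a} {b} p q = subst₂ (Star _) (merge-punchIn s≢v a) (merge-punchIn s≢v b)
                            (kleisliStar π step (conn p q))
      edges′ : ∀ {x y} → Graph._~_ K x y → _
      edges′ r with edges r
      ... | a , b , p , q , g = π a , π b , trans (φ-π a) p , trans (φ-π b) q ,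
        contract⇐ G s≢v g λ eq → ~⇒≢ K r (just-injective (trans (sym p) (trans (sym (φ-π a)) (trans (cong φ′ eq) (trans (φ-π b) q)))))

-- Only the branch set of an isolated vertex can be empty, since an edge is realised by vertices in
-- the branch sets of both of its ends.
model⇒≼ : ∀ {k n} {K : Graph k} {G : Graph n} → (∀ x → ∃ λ y → Graph._~_ K x y) → K ≼ᵐ G → K ≼ G
model⇒≼ {K = K} isolated-free M = onto⇒≼ K record
  { branches = M
  ; nonempty = λ x → let (s , _ , p , _) = Model.edges M (proj₂ (isolated-free x)) in s , p }

-- Gluing models along two vertices

module Sides {V U : Set} (_≟_ : DecidableEquality V) {K : U → U → Set} {R₁ R₂ : V → V → Set}
             {A B : V → Set} (A? : ∀ s → Dec (A s)) (B? : ∀ s → Dec (B s))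
             (on₁ : ∀ {s t} → R₁ s t → A s × A t) (on₂ : ∀ {s t} → R₂ s t → B s × B t)
             (M : Model K (λ s t → R₁ s t ⊎ R₂ s t)) where
  open Model M

  Meets : (V → Set) → U → Set
  Meets A x = ∃ λ s → A s × φ s ≡ just x

  Common : U → Set
  Common x = ∃ λ c → A c × B c × φ c ≡ just x

  crossing : ∀ {x s t} → Star (Inside (λ s t → R₁ s t ⊎ R₂ s t) φ x) s t →
             A s → φ s ≡ just x → B t → Common x
  crossing ε a p b = _ , a , b , p
  crossing ((inj₁ r , _ , p) ◅ st) a _ b = crossing st (proj₂ (on₁ r)) p b
  crossing ((inj₂ r , p , _) ◅ st) a _ b = _ , a , proj₁ (on₂ r) , p

  common : ∀ {x} → Meets A x → Meets B x → Common x
  common (s , a , p) (t , b , q) = crossing (conn p q) a p b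

  meets-some : ∀ {x y} → K x y → Meets A x ⊎ Meets B x
  meets-some k with edges k
  ... | v , w , p , q , inj₁ r = inj₁ (v , proj₁ (on₁ r) , p)
  ... | v , w , p , q , inj₂ r = inj₂ (v , proj₁ (on₂ r) , p)

  meets-next : ∀ {x y} → K x y → ¬ Meets A x → Meets B y
  meets-next k ¬m with edges k
  ... | v , w , p , q , inj₁ r = contradiction (v , proj₁ (on₁ r) , p) ¬m
  ... | v , w , p , q , inj₂ r = w , proj₂ (on₂ r) , q

  -- Only R₁ is retained. `bridge` makes up for the connections that a branch set loses between
  -- common vertices when the R₂ edges are dropped.
  module Into {R′ : V → V → Set} {φ′ : V → Maybe U}
              (agree : ∀ {s} → A s → φ′ s ≡ φ s)
              (keep : ∀ {s t} → R₁ s t → R′ s t)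
              (bridge : ∀ {x s t} → A s → B s → A t → B t → s ≢ t →
                        φ s ≡ just x → φ t ≡ just x → Star (Inside R′ φ′ x) s t) where

    -- Each excursion along R₂ leaves A and returns to it at common vertices, and `bridge` replaces
    -- it. In `go`, c is the last vertex of A visited and s the current position.
    project : ∀ {x s t} → A s → A t → φ s ≡ just x → φ t ≡ just x → Star (Inside R′ φ′ x) s t
    project {x} {s₀} {t₀} as at p q = go as p ε (inj₁ refl) (conn p q)
      where
      go : ∀ {c s} → A c → φ c ≡ just x → Star (Inside R′ φ′ x) s₀ c →
           c ≡ s ⊎ (B c × ¬ A s) →
           Star (Inside (λ s t → R₁ s t ⊎ R₂ s t) φ x) s t₀ → Star (Inside R′ φ′ x) s₀ t₀
      go ac pc st (inj₁ refl) ε = st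
      go ac pc st (inj₂ (_ , na)) ε = contradiction at na
      go ac pc st (inj₁ refl) ((inj₁ r , p , q) ◅ w) =
        go (proj₂ (on₁ r)) q
           (st ◅◅ (keep r , trans (agree (proj₁ (on₁ r))) p , trans (agree (proj₂ (on₁ r))) q) ◅ ε)
           (inj₁ refl) w
      go ac pc st (inj₂ (_ , na)) ((inj₁ r , p , q) ◅ w) = contradiction (proj₁ (on₁ r)) na
      go {c} ac pc st j (_◅_ {j = t} (inj₂ r , p , q) w) with A? t
      ... | yes at = go at q (st ◅◅ across) (inj₁ refl) w
        where
        bc : B c
        bc = [ (λ { refl → proj₁ (on₂ r) }) , proj₁ ]′ j
        across : Star (Inside R′ φ′ x) c t
        across with c ≟ t
        ... | yes refl = ε
        ... | no c≢t = bridge ac bc at (proj₂ (on₂ r)) c≢t pc q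
      ... | no na = go ac pc st (inj₂ ([ (λ { refl → proj₁ (on₂ r) }) , proj₁ ]′ j , na)) w

    -- An edge realised in R₁ survives. If it was realised in R₂, both branch sets meet both sides
    -- and so contain common vertices, and `link` has to join these.
    realise : ∀ {x y} → K x y → Meets A x → Meets A y →
              (∀ {c d} → A c → B c → A d → B d → φ c ≡ just x → φ d ≡ just y →
               ∃₂ λ v w → φ′ v ≡ just x × φ′ w ≡ just y × R′ v w) →
              ∃₂ λ v w → φ′ v ≡ just x × φ′ w ≡ just y × R′ v w
    realise k mx my link with edges k
    ... | v , w , p , q , inj₁ r =
      v , w , trans (agree (proj₁ (on₁ r))) p , trans (agree (proj₂ (on₁ r))) q , keep r
    ... | v , w , p , q , inj₂ r
      with common mx (v , proj₁ (on₂ r) , p) | common my (w , proj₂ (on₂ r) , q)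
    ... | c , ac , bc , pc | d , ad , bd , pd = link ac bc ad bd pc pd

swapSides : {V U : Set} {K : U → U → Set} {R₁ R₂ : V → V → Set} →
            Model K (λ s t → R₁ s t ⊎ R₂ s t) → Model K (λ s t → R₂ s t ⊎ R₁ s t)
swapSides M = M ⨾ id-model Sum.swap

-- Incidence in multigraphs and their hats

module _ {n : ℕ} {L : Set} where

  Touches : Fin n → Edge n L → Set
  Touches x e = end₁ e ≡ x ⊎ end₂ e ≡ x

  touches? : ∀ x e → Dec (Touches x e)
  touches? x e = (end₁ e ≟ᶠ x) ⊎-dec (end₂ e ≟ᶠ x)

  joins? : ∀ u v (e : Edge n L) → Dec (Joins u v e)
  joins? u v e = ((end₁ e ≟ᶠ u) ×-dec (end₂ e ≟ᶠ v)) ⊎-dec ((end₁ e ≟ᶠ v) ×-dec (end₂ e ≟ᶠ u))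

  ∈-vertices⁻ : ∀ (M : MultiGraph n L) {x} → x ∈ vertices M → Any (Touches x) M
  ∈-vertices⁻ [] p = contradiction p ∉⊥
  ∈-vertices⁻ (e ∷ M) p with x∈p∪q⁻ _ (vertices M) p
  ... | inj₂ q = there (∈-vertices⁻ M q)
  ... | inj₁ q with x∈p∪q⁻ ⁅ end₁ e ⁆ ⁅ end₂ e ⁆ q
  ... | inj₁ r = here (inj₁ (sym (x∈⁅y⁆⇒x≡y _ r)))
  ... | inj₂ r = here (inj₂ (sym (x∈⁅y⁆⇒x≡y _ r)))

  ∈-vertices⁺ : ∀ {M : MultiGraph n L} {x} → Any (Touches x) M → x ∈ vertices M
  ∈-vertices⁺ (here (inj₁ refl)) = x∈p∪q⁺ (inj₁ (x∈p∪q⁺ (inj₁ (x∈⁅x⁆ _))))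
  ∈-vertices⁺ (here (inj₂ refl)) = x∈p∪q⁺ (inj₁ (x∈p∪q⁺ (inj₂ (x∈⁅x⁆ _))))
  ∈-vertices⁺ (there p) = x∈p∪q⁺ (inj₂ (∈-vertices⁺ p))

  vertices-⊆ : ∀ {M N : MultiGraph n L} → (∀ {x} → Any (Touches x) M → Any (Touches x) N) →
               vertices M ⊆ vertices N
  vertices-⊆ {M} f = ∈-vertices⁺ ∘ f ∘ ∈-vertices⁻ M

  vertices-↭ : ∀ {M N : MultiGraph n L} → M ↭ N → vertices M ≡ vertices N
  vertices-↭ p = ⊆-antisym (vertices-⊆ (Any-resp-↭ p)) (vertices-⊆ (Any-resp-↭ (↭-sym p)))

  joins-touches : ∀ {u v} {e : Edge n L} → Joins u v e → Touches u e × Touches v e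
  joins-touches (inj₁ (p , q)) = inj₁ p , inj₂ q
  joins-touches (inj₂ (p , q)) = inj₂ q , inj₁ p

  joins-sym : ∀ {u v} {e : Edge n L} → Joins u v e → Joins v u e
  joins-sym = Sum.swap

  joins-ends : ∀ (e : Edge n L) → Joins (end₁ e) (end₂ e) e
  joins-ends e = inj₁ (refl , refl)

  touches-ends : ∀ {u v x} {e : Edge n L} → Joins u v e → Touches x e → x ≡ u ⊎ x ≡ v
  touches-ends (inj₁ (refl , refl)) (inj₁ refl) = inj₁ refl
  touches-ends (inj₁ (refl , refl)) (inj₂ refl) = inj₂ refl
  touches-ends (inj₂ (refl , refl)) (inj₁ refl) = inj₂ refl
  touches-ends (inj₂ (refl , refl)) (inj₂ refl) = inj₁ refl

  touches-joins : ∀ {u v} {e : Edge n L} → u ≢ v → Touches u e → Touches v e → Joins u v e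
  touches-joins u≢v (inj₁ refl) (inj₁ refl) = contradiction refl u≢v
  touches-joins u≢v (inj₁ refl) (inj₂ refl) = inj₁ (refl , refl)
  touches-joins u≢v (inj₂ refl) (inj₁ refl) = inj₂ (refl , refl)
  touches-joins u≢v (inj₂ refl) (inj₂ refl) = contradiction refl u≢v

-- A vertex of the host graph, or the subdividing vertex of the virtual edge with the given label.
Point : ℕ → Set
Point n = Fin n ⊎ ℕ

_≟ᵖ_ : ∀ {n} → DecidableEquality (Point n)
inj₁ x ≟ᵖ inj₁ y = map′ (cong inj₁) inj₁-injective (x ≟ᶠ y)
inj₁ x ≟ᵖ inj₂ y = no λ ()
inj₂ x ≟ᵖ inj₁ y = no λ ()
inj₂ x ≟ᵖ inj₂ y = map′ (cong inj₂) inj₂-injective (x ≟ⁿ y)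

_≟ᵏ_ : DecidableEquality Kind
real ≟ᵏ real = yes refl
real ≟ᵏ virtual _ = no λ ()
virtual _ ≟ᵏ real = no λ ()
virtual i ≟ᵏ virtual j = map′ (cong virtual) (λ { refl → refl }) (i ≟ⁿ j)

module _ {n : ℕ} where

  data Link (e : Edge n Kind) : Point n → Point n → Set where
    direct : ∀ {u v} → label e ≡ real → Joins u v e → Link e (inj₁ u) (inj₁ v)
    enter  : ∀ {u ℓ} → label e ≡ virtual ℓ → Touches u e → Link e (inj₁ u) (inj₂ ℓ)
    leave  : ∀ {u ℓ} → label e ≡ virtual ℓ → Touches u e → Link e (inj₂ ℓ) (inj₁ u)

  link-sym : ∀ {e s t} → Link e s t → Link e t s
  link-sym {e} (direct p q) = direct p (joins-sym {e = e} q)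
  link-sym (enter p q) = leave p q
  link-sym (leave p q) = enter p q

  On : Point n → Edge n Kind → Set
  On (inj₁ u) e = Touches u e
  On (inj₂ ℓ) e = label e ≡ virtual ℓ

  on? : ∀ s e → Dec (On s e)
  on? (inj₁ u) e = touches? u e
  on? (inj₂ ℓ) e = label e ≟ᵏ virtual ℓ

  link-on : ∀ {e s t} → Link e s t → On s e × On t e
  link-on {e} (direct p q) = joins-touches {e = e} q
  link-on (enter p q) = q , p
  link-on (leave p q) = p , q

  -- Every virtual edge of M is subdivided once, its label naming the new vertex.
  Hat : MultiGraph n Kind → Point n → Point n → Set
  Hat M s t = Any (λ e → Link e s t) M

  OnM : MultiGraph n Kind → Point n → Set
  OnM M s = Any (On s) M

  onM? : ∀ M s → Dec (OnM M s)
  onM? M s = Any.any? (on? s) M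

  hat-sym : ∀ {M s t} → Hat M s t → Hat M t s
  hat-sym = Any.map link-sym

  hat-on : ∀ {M s t} → Hat M s t → OnM M s × OnM M t
  hat-on p = Any.map (proj₁ ∘ link-on) p , Any.map (proj₂ ∘ link-on) p

  hat-++ : ∀ {E₁ E₂ s t} → Hat (E₁ ++ E₂) s t → Hat E₁ s t ⊎ Hat E₂ s t
  hat-++ {E₁} = AnyP.++⁻ E₁

  onEdge-any? : ∀ {P : Point n → Set} → (∀ s → Dec (P s)) → ∀ e → Dec (∃ λ s → On s e × P s)
  onEdge-any? {P} P? e with P? (inj₁ (end₁ e)) | P? (inj₁ (end₂ e)) | mid
    where
    mid : Dec (∃ λ ℓ → label e ≡ virtual ℓ × P (inj₂ ℓ))
    mid with label e
    ... | real = no λ { (_ , () , _) }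
    ... | virtual ℓ = map′ (λ p → ℓ , refl , p) (λ { (_ , refl , p) → p }) (P? (inj₂ ℓ))
  ... | yes p | _ | _ = yes (_ , inj₁ refl , p)
  ... | no _ | yes p | _ = yes (_ , inj₂ refl , p)
  ... | no _ | no _ | yes (ℓ , q , p) = yes (inj₂ ℓ , q , p)
  ... | no a | no b | no c = no λ { (inj₁ _ , inj₁ refl , p) → a p
                                  ; (inj₁ _ , inj₂ refl , p) → b p
                                  ; (inj₂ ℓ , q , p) → c (ℓ , q , p) }

  onM-any? : ∀ {P : Point n → Set} → (∀ s → Dec (P s)) → ∀ M → Dec (∃ λ s → OnM M s × P s)
  onM-any? {P} P? M = map′ found (λ (s , q , p) → Any.map (λ o → s , o , p) q)
                           (Any.any? (onEdge-any? P?) M)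
    where
    found : ∀ {M} → Any (λ e → ∃ λ s → On s e × P s) M → ∃ λ s → OnM M s × P s
    found (here (s , o , p)) = s , here o , p
    found (there q) = let (s , o , p) = found q in s , there o , p

-- The properties of K₅⁻ and K₃₃⁻ that make their minor models survive on one
-- side of a separation of order at most two: such a separation cuts off at
-- most one vertex, which then has two nonadjacent neighbours.
record Rigid {k} (K : Graph k) : Set where
  open Graph K
  field
    two-nbrs : ∀ p → ∃₂ λ x y → x ≢ y × p ~ x × p ~ y
    apart    : ∀ p {x y} → (∀ {z} → p ~ z → z ≡ x ⊎ z ≡ y) → ¬ (x ~ y)
    -- The optional vertices stand for the branch sets that contain the points of separation;
    -- `nothing` means that such a point is in no branch set.
    cut₁     : ∀ (S : Subset k) {p q} (x : Maybe (Fin k)) → p ∈ S → q ∉ S → just q ≢ x →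
               ∃₂ λ s t → s ∈ S × t ∉ S × just t ≢ x × s ~ t
    cut₂     : ∀ (S : Subset k) {p p′ q q′} (x y : Maybe (Fin k)) → p ∈ S → p′ ∈ S → p ≢ p′ →
               q ∉ S → q′ ∉ S → q ≢ q′ → just q ≢ x → just q ≢ y → just q′ ≢ x → just q′ ≢ y →
               ∃₂ λ s t → s ∈ S × t ∉ S × just t ≢ x × just t ≢ y × s ~ t

⟦_⟧ : ∀ {n} {P : Fin n → Set} → (∀ x → Dec (P x)) → Subset n
⟦ P? ⟧ = Vec.tabulate (does ∘ P?)

∈⟦⟧⁺ : ∀ {n} {P : Fin n → Set} (P? : ∀ x → Dec (P x)) {x} → P x → x ∈ ⟦ P? ⟧
∈⟦⟧⁺ P? {x} p = VecP.lookup⇒[]= x _ (trans (VecP.lookup∘tabulate _ x) (dec-true (P? x) p))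

does-true : ∀ {A : Set} (d : Dec A) → does d ≡ true → A
does-true (yes a) _ = a

∈⟦⟧⁻ : ∀ {n} {P : Fin n → Set} (P? : ∀ x → Dec (P x)) {x} → x ∈ ⟦ P? ⟧ → P x
∈⟦⟧⁻ P? {x} p = does-true (P? x) (trans (sym (VecP.lookup∘tabulate _ x)) (VecP.[]=⇒lookup p))

onE? : ∀ {n} (E : MultiGraph n Kind) {k} (φ : Point n → Maybe (Fin k)) x →
       Dec (∃ λ s → OnM E s × φ s ≡ just x)
onE? E φ x = onM-any? (λ s → Maybe-≡-dec _≟ᶠ_ (φ s) (just x)) E

-- The two sides of a splitting along {a, b}; ℓ is the label of the new virtual edge.
record Glue {n} (E₁ E₂ : MultiGraph n Kind) (a b : Fin n) (ℓ : ℕ) : Set where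
  field
    a≢b    : a ≢ b
    a∈₁    : Any (Touches a) E₁
    b∈₁    : Any (Touches b) E₁
    a∈₂    : Any (Touches a) E₂
    b∈₂    : Any (Touches b) E₂
    shared : ∀ {x} → Any (Touches x) E₁ → Any (Touches x) E₂ → x ≡ a ⊎ x ≡ b
    labels : ∀ {j} → OnM E₁ (inj₂ j) → OnM E₂ (inj₂ j) → ⊥
    fresh₁ : ¬ OnM E₁ (inj₂ ℓ)
    fresh₂ : ¬ OnM E₂ (inj₂ ℓ)

  shared-point : ∀ {s} → OnM E₁ s → OnM E₂ s → s ≡ inj₁ a ⊎ s ≡ inj₁ b
  shared-point {inj₁ x} p q = Sum.map (cong inj₁) (cong inj₁) (shared p q)
  shared-point {inj₂ j} p q = ⊥-elim (labels p q)

Glue-sym : ∀ {n} {E₁ E₂ : MultiGraph n Kind} {a b ℓ} → Glue E₁ E₂ a b ℓ → Glue E₂ E₁ a b ℓ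
Glue-sym g = record
  { a≢b = a≢b ; a∈₁ = a∈₂ ; b∈₁ = b∈₂ ; a∈₂ = a∈₁ ; b∈₂ = b∈₁ ; shared = flip shared
  ; labels = flip labels ; fresh₁ = fresh₂ ; fresh₂ = fresh₁ }
  where open Glue g

module _ {k n : ℕ} {K : Graph k} (rigid : Rigid K) where
  open Rigid rigid
  open Graph K

  module OneSide {E₁ E₂ : MultiGraph n Kind} (M : Model _~_ (λ s t → Hat E₁ s t ⊎ Hat E₂ s t)) where
    open Model M public
    open Sides _≟ᵖ_ (onM? E₁) (onM? E₂) hat-on hat-on M public

  -- With a single common point, a path that leaves E₁ comes back where it left, and no two branch
  -- sets contain common points. So neither connectedness nor an edge is lost.
  restrict₁ : ∀ {E₁ E₂ : MultiGraph n Kind} (M : Model _~_ (λ s t → Hat E₁ s t ⊎ Hat E₂ s t)) →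
              (∀ {s t} → OnM E₁ s → OnM E₂ s → OnM E₁ t → OnM E₂ t → s ≡ t) →
              (∀ x → OneSide.Meets M (OnM E₁) x) → Model _~_ (Hat E₁)
  restrict₁ {E₁} {E₂} M one meets = record
    { φ = φ′
    ; conn = λ {s} {t} p q → let (as , p′) = within₁ {s} p ; (at , q′) = within₁ {t} q in project as at p′ q′
    ; edges = λ {x} {y} r → realise r (meets x) (meets y) λ ac bc ad bd p q →
        contradiction (just-injective (trans (sym p) (trans (cong φ (one ac bc ad bd)) q))) (~⇒≢ K r)
    }
    where
    open OneSide M
    φ′ : Point n → Maybe (Fin k)
    φ′ s with onM? E₁ s
    ... | yes _ = φ s
    ... | no _ = nothing
    agree : ∀ {s} → OnM E₁ s → φ′ s ≡ φ s
    agree {s} a with onM? E₁ s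
    ... | yes _ = refl
    ... | no na = contradiction a na
    within₁ : ∀ {s x} → φ′ s ≡ just x → OnM E₁ s × φ s ≡ just x
    within₁ {s} p with onM? E₁ s
    ... | yes a = a , p
    open Into {R′ = Hat E₁} {φ′} agree id (λ as bs at bt s≢t _ _ → contradiction (one as bs at bt) s≢t)

  module TwoSum {E₁ E₂ : MultiGraph n Kind} {a b : Fin n} {ℓ : ℕ} (glue : Glue E₁ E₂ a b ℓ)
                (M : Model _~_ (λ s t → Hat E₁ s t ⊎ Hat E₂ s t)) where
    open Glue glue
    open OneSide M public

    v : Edge n Kind
    v = edge a b (virtual ℓ)

    module _ (m : Maybe (Fin k)) where
      -- The points of E₁ keep their branch sets, and the new subdividing vertex is put into m.
      φ′ : Point n → Maybe (Fin k)
      φ′ s with onM? E₁ s | s ≟ᵖ inj₂ ℓ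
      ... | yes _ | _ = φ s
      ... | no _ | yes _ = m
      ... | no _ | no _ = nothing
      agree : ∀ {s} → OnM E₁ s → φ′ s ≡ φ s
      agree {s} a with onM? E₁ s | s ≟ᵖ inj₂ ℓ
      ... | yes _ | _ = refl
      ... | no na | _ = contradiction a na
      mid : φ′ (inj₂ ℓ) ≡ m
      mid with onM? E₁ (inj₂ ℓ) | inj₂ ℓ ≟ᵖ inj₂ {A = Fin n} ℓ
      ... | yes p | _ = contradiction p fresh₁
      ... | no _ | yes _ = refl
      ... | no _ | no p = contradiction refl p
      old-or-mid : ∀ {s x} → φ′ s ≡ just x → (OnM E₁ s × φ s ≡ just x) ⊎ (s ≡ inj₂ ℓ × m ≡ just x)
      old-or-mid {s} p with onM? E₁ s | s ≟ᵖ inj₂ ℓ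
      ... | yes o | _ = inj₁ (o , p)
      ... | no _ | yes e = inj₂ (e , p)

      at-a : φ′ (inj₁ a) ≡ φ (inj₁ a)
      at-a = agree a∈₁
      at-b : φ′ (inj₁ b) ≡ φ (inj₁ b)
      at-b = agree b∈₁

    H′ = Hat (v ∷ E₁)
    a→m : H′ (inj₁ a) (inj₂ ℓ)
    a→m = here (enter refl (inj₁ refl))
    m→b : H′ (inj₂ ℓ) (inj₁ b)
    m→b = here (leave refl (inj₂ refl))

    -- The subdividing vertex joins the branch set of a. If b belongs to the same branch set, this
    -- restores its connectedness; if not, it restores the adjacency of the two branch sets.
    swallow : (∀ x → Meets (OnM E₁) x) → Model _~_ H′
    swallow meets = record { φ = φ′ m ; conn = conn′ ; edges = edges′ }
      where
      m = φ (inj₁ a)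
      bridge : ∀ {x s t} → OnM E₁ s → OnM E₂ s → OnM E₁ t → OnM E₂ t → s ≢ t →
               φ s ≡ just x → φ t ≡ just x → Star (Inside H′ (φ′ m) x) s t
      bridge as bs at bt s≢t p q with shared-point as bs | shared-point at bt
      ... | inj₁ refl | inj₁ refl = ε
      ... | inj₂ refl | inj₂ refl = ε
      ... | inj₁ refl | inj₂ refl = (a→m , trans (at-a m) p , trans (mid m) p) ◅
                                    (m→b , trans (mid m) p , trans (at-b m) q) ◅ ε
      ... | inj₂ refl | inj₁ refl = (hat-sym m→b , trans (at-b m) p , trans (mid m) q) ◅
                                    (hat-sym a→m , trans (mid m) q , trans (at-a m) q) ◅ ε
      open Into {R′ = H′} {φ′ m} (agree m) there bridge
      to-a : ∀ {x} → φ (inj₁ a) ≡ just x → Inside H′ (φ′ m) x (inj₂ ℓ) (inj₁ a)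
      to-a p = hat-sym a→m , trans (mid m) p , trans (at-a m) p
      conn′ : ∀ {s t x} → φ′ m s ≡ just x → φ′ m t ≡ just x → Star (Inside H′ (φ′ m) x) s t
      conn′ {s} {t} p q with old-or-mid m {s} p | old-or-mid m {t} q
      ... | inj₁ (as , p′) | inj₁ (at , q′) = project as at p′ q′
      ... | inj₁ (as , p′) | inj₂ (refl , q′) = project as a∈₁ p′ q′ ◅◅ (hat-sym (proj₁ (to-a q′)) , proj₂ (proj₂ (to-a q′)) , proj₁ (proj₂ (to-a q′))) ◅ ε
      ... | inj₂ (refl , p′) | inj₁ (at , q′) = to-a p′ ◅ project a∈₁ at p′ q′
      ... | inj₂ (refl , p′) | inj₂ (refl , q′) = ε
      edges′ : ∀ {x y} → x ~ y → ∃₂ λ s t → φ′ m s ≡ just x × φ′ m t ≡ just y × H′ s t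
      edges′ {x} {y} r = realise r (meets x) (meets y) via
        where
        via : ∀ {c d} → OnM E₁ c → OnM E₂ c → OnM E₁ d → OnM E₂ d → φ c ≡ just x → φ d ≡ just y →
              ∃₂ λ s t → φ′ m s ≡ just x × φ′ m t ≡ just y × H′ s t
        via ac bc ad bd p q with shared-point ac bc | shared-point ad bd
        ... | inj₁ refl | inj₁ refl = contradiction (just-injective (trans (sym p) q)) (~⇒≢ K r)
        ... | inj₂ refl | inj₂ refl = contradiction (just-injective (trans (sym p) q)) (~⇒≢ K r)
        ... | inj₁ refl | inj₂ refl = inj₂ ℓ , inj₁ b , trans (mid m) p , trans (at-b m) q , m→b
        ... | inj₂ refl | inj₁ refl = inj₁ b , inj₂ ℓ , trans (at-b m) p , trans (mid m) q , hat-sym m→b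

    -- The branch set p lies beyond E₁, so each of its neighbours contains a or b. As p has two
    -- neighbours, they are the branch sets of a and of b, and the subdividing vertex can replace
    -- all of p. By `apart` these two are not adjacent, so no edge between them has to be realised.
    subdivide : ∀ p → ¬ Meets (OnM E₁) p → (∀ x → x ≢ p → Meets (OnM E₁) x) → Model _~_ H′
    subdivide p ¬mp meets = record { φ = φ′ (just p) ; conn = conn′ ; edges = edges′ }
      where
      m = just p
      ends : ∀ {z} → p ~ z → φ (inj₁ a) ≡ just z ⊎ φ (inj₁ b) ≡ just z
      ends {z} r with common (meets z (~⇒≢ K (~-sym r))) (meets-next r ¬mp)
      ... | c , ac , bc , e with shared-point ac bc
      ... | inj₁ refl = inj₁ e
      ... | inj₂ refl = inj₂ e
      attachments : ∃₂ λ x y → x ≢ y × φ (inj₁ a) ≡ just x × φ (inj₁ b) ≡ just y × p ~ x × p ~ y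
      attachments with two-nbrs p
      ... | x , y , x≢y , px , py with ends px | ends py
      ... | inj₁ e | inj₂ f = x , y , x≢y , e , f , px , py
      ... | inj₂ e | inj₁ f = y , x , x≢y ∘ sym , f , e , py , px
      ... | inj₁ e | inj₁ f = contradiction (just-injective (trans (sym e) f)) x≢y
      ... | inj₂ e | inj₂ f = contradiction (just-injective (trans (sym e) f)) x≢y
      x₀ = proj₁ attachments
      y₀ = proj₁ (proj₂ attachments)
      x₀≢y₀ = proj₁ (proj₂ (proj₂ attachments))
      φa : φ (inj₁ a) ≡ just x₀
      φa = proj₁ (proj₂ (proj₂ (proj₂ attachments)))
      φb : φ (inj₁ b) ≡ just y₀
      φb = proj₁ (proj₂ (proj₂ (proj₂ (proj₂ attachments))))
      nbrs : ∀ {z} → p ~ z → z ≡ x₀ ⊎ z ≡ y₀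
      nbrs r = Sum.map (λ e → just-injective (trans (sym e) φa)) (λ e → just-injective (trans (sym e) φb)) (ends r)
      bridge : ∀ {x s t} → OnM E₁ s → OnM E₂ s → OnM E₁ t → OnM E₂ t → s ≢ t →
               φ s ≡ just x → φ t ≡ just x → Star (Inside H′ (φ′ m) x) s t
      bridge as bs at bt s≢t p q with shared-point as bs | shared-point at bt
      ... | inj₁ refl | inj₁ refl = ε
      ... | inj₂ refl | inj₂ refl = ε
      ... | inj₁ refl | inj₂ refl = contradiction (just-injective (trans (sym φa) (trans p (trans (sym q) φb)))) x₀≢y₀
      ... | inj₂ refl | inj₁ refl = contradiction (just-injective (trans (sym φa) (trans q (trans (sym p) φb)))) x₀≢y₀
      open Into {R′ = H′} {φ′ m} (agree m) there bridge
      conn′ : ∀ {s t x} → φ′ m s ≡ just x → φ′ m t ≡ just x → Star (Inside H′ (φ′ m) x) s t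
      conn′ {s} {t} e f with old-or-mid m {s} e | old-or-mid m {t} f
      ... | inj₁ (as , e′) | inj₁ (at , f′) = project as at e′ f′
      ... | inj₁ (as , e′) | inj₂ (refl , refl) = contradiction (s , as , e′) ¬mp
      ... | inj₂ (refl , refl) | inj₁ (at , f′) = contradiction (t , at , f′) ¬mp
      ... | inj₂ (refl , _) | inj₂ (refl , _) = ε
      from-p : ∀ {y} → p ~ y → ∃ λ t → φ′ m t ≡ just y × H′ (inj₂ ℓ) t
      from-p r with ends r
      ... | inj₁ e = inj₁ a , trans (at-a m) e , hat-sym a→m
      ... | inj₂ e = inj₁ b , trans (at-b m) e , m→b
      edges′ : ∀ {x y} → x ~ y → ∃₂ λ s t → φ′ m s ≡ just x × φ′ m t ≡ just y × H′ s t
      edges′ {x} {y} r with x ≟ᶠ p | y ≟ᶠ p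
      ... | yes refl | _ = let (t , e , h) = from-p r in inj₂ ℓ , t , mid m , e , h
      ... | no _ | yes refl = let (t , e , h) = from-p (~-sym r) in t , inj₂ ℓ , e , mid m , hat-sym h
      ... | no x≢p | no y≢p = realise r (meets x x≢p) (meets y y≢p) via
        where
        via : ∀ {c d} → OnM E₁ c → OnM E₂ c → OnM E₁ d → OnM E₂ d → φ c ≡ just x → φ d ≡ just y →
              ∃₂ λ s t → φ′ m s ≡ just x × φ′ m t ≡ just y × H′ s t
        via ac bc ad bd e f with shared-point ac bc | shared-point ad bd
        ... | inj₁ refl | inj₁ refl = contradiction (just-injective (trans (sym e) f)) (~⇒≢ K r)
        ... | inj₂ refl | inj₂ refl = contradiction (just-injective (trans (sym e) f)) (~⇒≢ K r)
        ... | inj₁ refl | inj₂ refl = contradiction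
          (subst₂ _~_ (just-injective (trans (sym e) φa)) (just-injective (trans (sym f) φb)) r) (apart p nbrs)
        ... | inj₂ refl | inj₁ refl = contradiction
          (subst₂ _~_ (just-injective (trans (sym f) φa)) (just-injective (trans (sym e) φb)) (~-sym r)) (apart p nbrs)

    data Missed : Set where
      none : (∀ x → Meets (OnM E₁) x) → Missed
      one  : ∀ p → ¬ Meets (OnM E₁) p → (∀ x → x ≢ p → Meets (OnM E₁) x) → Missed
      two  : ∀ p q → p ≢ q → ¬ Meets (OnM E₁) p → ¬ Meets (OnM E₁) q → Missed

    missed : Missed
    missed with any? (λ x → ¬? (onE? E₁ φ x))
    ... | no h = none λ x → decidable-stable (onE? E₁ φ x) λ q → h (x , q)
    ... | yes (p , hp) with any? (λ x → ¬? (x ≟ᶠ p) ×-dec ¬? (onE? E₁ φ x))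
    ... | no h = one p hp λ x x≢p → decidable-stable (onE? E₁ φ x) λ q → h (x , x≢p , q)
    ... | yes (q , q≢p , hq) = two p q (q≢p ∘ sym) hp hq

  -- If one side misses at most one branch set, the model moves there. If both sides miss two,
  -- `cut₂` yields an edge from a branch set s missing E₁ to a branch set t that meets E₁ and
  -- contains neither a nor b. But t also meets E₂, being adjacent to s, so it contains a or b.
  two-sum : ∀ {E₁ E₂ : MultiGraph n Kind} {a b ℓ} → Glue E₁ E₂ a b ℓ →
            Model _~_ (Hat (E₁ ++ E₂)) →
            Model _~_ (Hat (edge a b (virtual ℓ) ∷ E₁)) ⊎ Model _~_ (Hat (edge a b (virtual ℓ) ∷ E₂))
  two-sum {E₁} {E₂} {a} {b} glue M = go T₁.missed T₂.missed
    where
    M₁ = M ⨾ id-model (hat-++ {E₁ = E₁})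
    M₂ = swapSides M₁
    module T₁ = TwoSum glue M₁
    module T₂ = TwoSum (Glue-sym glue) M₂
    missed? : ∀ x → Dec (¬ T₁.Meets (OnM E₁) x)
    missed? x = ¬? (onE? E₁ T₁.φ x)
    S = ⟦ missed? ⟧
    -- `swapSides` composes with an identity model, so the two assignments become equal only after a
    -- case distinction on the value.
    φ₂ : ∀ s → T₂.φ s ≡ T₁.φ s
    φ₂ s with T₁.φ s
    ... | nothing = refl
    ... | just _ = refl
    common⇒ : ∀ {t} → T₁.Meets (OnM E₁) t → T₁.Meets (OnM E₂) t →
              just t ≢ T₁.φ (inj₁ a) → just t ≢ T₁.φ (inj₁ b) → ⊥
    common⇒ m₁ m₂ na nb with T₁.common m₁ m₂
    ... | c , ac , bc , p with Glue.shared-point glue ac bc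
    ... | inj₁ refl = na (sym p)
    ... | inj₂ refl = nb (sym p)
    meets₁ : ∀ {q} → ¬ T₂.Meets (OnM E₂) q → T₁.Meets (OnM E₁) q
    meets₁ {q} ¬m with two-nbrs q
    ... | _ , _ , _ , r , _ with T₁.meets-some r
    ... | inj₁ m = m
    ... | inj₂ (s , o , e) = contradiction (s , o , trans (φ₂ s) e) ¬m
    uncut : ∀ {q s} → ¬ T₂.Meets (OnM E₂) q → OnM E₂ s → just q ≢ T₁.φ s
    uncut {s = s} ¬m o e = ¬m (s , o , trans (φ₂ s) (sym e))
    go : T₁.Missed → T₂.Missed → _
    go (T₁.none m) _ = inj₁ (T₁.swallow m)
    go (T₁.one p h m) _ = inj₁ (T₁.subdivide p h m)
    go (T₁.two _ _ _ _ _) (T₂.none m) = inj₂ (T₂.swallow m)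
    go (T₁.two _ _ _ _ _) (T₂.one p h m) = inj₂ (T₂.subdivide p h m)
    go (T₁.two p p′ p≢p′ hp hp′) (T₂.two q q′ q≢q′ hq hq′)
      with cut₂ S (T₁.φ (inj₁ a)) (T₁.φ (inj₁ b))
             (∈⟦⟧⁺ missed? hp) (∈⟦⟧⁺ missed? hp′) p≢p′
             (λ i → ∈⟦⟧⁻ missed? i (meets₁ hq)) (λ i → ∈⟦⟧⁻ missed? i (meets₁ hq′)) q≢q′
             (uncut hq a∈₂) (uncut hq b∈₂) (uncut hq′ a∈₂) (uncut hq′ b∈₂)
      where open Glue glue
    ... | s , t , s∈ , t∉ , na , nb , r = ⊥-elim (common⇒
      (decidable-stable (onE? E₁ T₁.φ t) λ h → t∉ (∈⟦⟧⁺ missed? h))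
      (T₁.meets-next r (∈⟦⟧⁻ missed? s∈)) na nb)

  -- Suppose p misses E₁ and q misses E₂. Then `cut₁` yields an edge from a branch set missing E₁ to
  -- one that meets E₁ without containing the common point. By adjacency the latter meets E₂ too,
  -- and a connected set that meets both sides contains the common point.
  one-sum : ∀ {E₁ E₂ : MultiGraph n Kind} →
            (∀ {s t} → OnM E₁ s → OnM E₂ s → OnM E₁ t → OnM E₂ t → s ≡ t) →
            Model _~_ (Hat (E₁ ++ E₂)) → Model _~_ (Hat E₁) ⊎ Model _~_ (Hat E₂)
  one-sum {E₁} {E₂} one M with any? (λ x → ¬? (onE? E₁ φ x))
    where open OneSide (M ⨾ id-model (hat-++ {E₁ = E₁}))
  ... | no h = inj₁ (restrict₁ M₁ one λ x → decidable-stable (onE? E₁ φ x) λ q → h (x , q))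
    where
    M₁ = M ⨾ id-model (hat-++ {E₁ = E₁})
    open OneSide M₁
  ... | yes (p , hp) = inj₂ (restrict₁ M₂ (λ a b c d → one b a d c) meets)
    where
    M₁ = M ⨾ id-model (hat-++ {E₁ = E₁})
    M₂ = swapSides M₁
    open OneSide M₁
    φ₂ : ∀ s → Model.φ M₂ s ≡ φ s
    φ₂ s with φ s
    ... | nothing = refl
    ... | just _ = refl
    missed? : ∀ x → Dec (¬ Meets (OnM E₁) x)
    missed? x = ¬? (onE? E₁ φ x)
    S = ⟦ missed? ⟧
    meets : ∀ q → OneSide.Meets M₂ (OnM E₂) q
    meets q with onE? E₂ φ q
    ... | yes (s , o , e) = s , o , trans (φ₂ s) e
    ... | no ¬m₂ = ⊥-elim impossible
      where
      both? = onM-any? (onM? E₂) E₁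
      m₁ : Meets (OnM E₁) q
      m₁ with two-nbrs q
      ... | _ , _ , _ , r , _ with meets-some r
      ... | inj₁ m = m
      ... | inj₂ m = contradiction m ¬m₂
      -- The branch set of the common point; `nothing` also covers sides without a common point.
      at : Maybe (Fin k)
      at with both?
      ... | yes (c , _) = φ c
      ... | no _ = nothing
      at-c : ∀ {c} → OnM E₁ c → OnM E₂ c → φ c ≡ at
      at-c a b with both?
      ... | yes (c , a′ , b′) = cong φ (one a b a′ b′)
      ... | no h = contradiction (_ , a , b) h
      q≢at : just q ≢ at
      q≢at e with both?
      ... | yes (c , _ , b) = ¬m₂ (c , b , sym e)
      impossible : ⊥
      impossible with cut₁ S at (∈⟦⟧⁺ missed? hp) (λ i → ∈⟦⟧⁻ missed? i m₁) q≢at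
      ... | s , t , s∈ , t∉ , na , r
        with common (decidable-stable (onE? E₁ φ t) λ h → t∉ (∈⟦⟧⁺ missed? h)) (meets-next r (∈⟦⟧⁻ missed? s∈))
      ... | c , a , b , e = na (trans (sym e) (at-c a b))

-- Finite checks on K₅⁻ and K₃₃⁻

-- Quantifiers as Boolean functions: a finite check becomes a closed Boolean that is verified by
-- `refl`, and the soundness lemmas translate it back.
allF : ∀ {n} → (Fin n → Bool) → Bool
allF {zero} p = true
allF {suc n} p = p zero ∧ allF (p ∘ suc)

anyF : ∀ {n} → (Fin n → Bool) → Bool
anyF {zero} p = false
anyF {suc n} p = p zero ∨ anyF (p ∘ suc)

allMaybe : ∀ {n} → (Maybe (Fin n) → Bool) → Bool
allMaybe p = p nothing ∧ allF (p ∘ just)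

allVec : ∀ {A : Set} → ((A → Bool) → Bool) → ∀ n → (Vec.Vec A n → Bool) → Bool
allVec all zero p = p Vec.[]
allVec all (suc n) p = all λ a → allVec all n λ v → p (a Vec.∷ v)

allBool : (Bool → Bool) → Bool
allBool p = p true ∧ p false

∧-true : ∀ {a b} → a ∧ b ≡ true → a ≡ true × b ≡ true
∧-true {true} {true} _ = refl , refl

∨-true : ∀ {a b} → a ∨ b ≡ true → a ≡ true ⊎ b ≡ true
∨-true {true} _ = inj₁ refl
∨-true {false} p = inj₂ p

∧-intro : ∀ {a b} → a ≡ true → b ≡ true → a ∧ b ≡ true
∧-intro refl refl = refl

allF-intro : ∀ {n} {p : Fin n → Bool} → (∀ i → p i ≡ true) → allF p ≡ true
allF-intro {zero} f = refl
allF-intro {suc n} f = ∧-intro (f zero) (allF-intro (f ∘ suc))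

not-true : ∀ {a} → not a ≡ true → a ≢ true
not-true {false} _ ()

true-not : ∀ {a} → a ≢ true → not a ≡ true
true-not {true} p = contradiction refl p
true-not {false} _ = refl

implies : ∀ {a b} → not a ∨ b ≡ true → a ≡ true → b ≡ true
implies {true} p refl = p

allF-sound : ∀ {n} (p : Fin n → Bool) → allF p ≡ true → ∀ i → p i ≡ true
allF-sound p e zero = proj₁ (∧-true e)
allF-sound p e (suc i) = allF-sound (p ∘ suc) (proj₂ (∧-true {p zero} e)) i

anyF-sound : ∀ {n} (p : Fin n → Bool) → anyF p ≡ true → ∃ λ i → p i ≡ true
anyF-sound {suc n} p e with ∨-true {p zero} e
... | inj₁ q = zero , q
... | inj₂ q = let (i , r) = anyF-sound (p ∘ suc) q in suc i , r

allMaybe-sound : ∀ {n} (p : Maybe (Fin n) → Bool) → allMaybe p ≡ true → ∀ i → p i ≡ true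
allMaybe-sound p e nothing = proj₁ (∧-true e)
allMaybe-sound p e (just i) = allF-sound (p ∘ just) (proj₂ (∧-true {p nothing} e)) i

allBool-sound : ∀ (p : Bool → Bool) → allBool p ≡ true → ∀ i → p i ≡ true
allBool-sound p e true = proj₁ (∧-true e)
allBool-sound p e false = proj₂ (∧-true {p true} e)

allVec-sound : ∀ {A : Set} {all : (A → Bool) → Bool} → (∀ p → all p ≡ true → ∀ a → p a ≡ true) →
               ∀ {n} (p : Vec.Vec A n → Bool) → allVec all n p ≡ true → ∀ v → p v ≡ true
allVec-sound s p e Vec.[] = e
allVec-sound s p e (a Vec.∷ v) = allVec-sound s (λ w → p (a Vec.∷ w)) (s _ e a) v

infix 7 _==_
_==_ : ∀ {n} → Fin n → Fin n → Bool
zero == zero = true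
zero == suc _ = false
suc _ == zero = false
suc i == suc j = i == j

==-sound : ∀ {n} {i j : Fin n} → i == j ≡ true → i ≡ j
==-sound {i = zero} {zero} _ = refl
==-sound {i = suc i} {suc j} p = cong suc (==-sound p)

==-refl : ∀ {n} (i : Fin n) → i == i ≡ true
==-refl zero = refl
==-refl (suc i) = ==-refl i

≢⇒≠ : ∀ {n} {i j : Fin n} → i ≢ j → not (i == j) ≡ true
≢⇒≠ p = true-not (p ∘ ==-sound)

≠⇒≢ : ∀ {n} {i j : Fin n} → not (i == j) ≡ true → i ≢ j
≠⇒≢ {i = i} p refl = not-true {i == i} p (==-refl i)

atMostOne : ∀ {n} → (Fin n → Bool) → Bool
atMostOne p = allF λ i → allF λ j → not (p i ∧ p j) ∨ i == j

atMostOne-sound : ∀ {n} (p : Fin n → Bool) → atMostOne p ≡ true →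
                  ∀ {i j} → p i ≡ true → p j ≡ true → i ≡ j
atMostOne-sound p e {i} {j} a b = ==-sound (implies (allF-sound _ (allF-sound _ e i) j) (∧-intro a b))

other : ∀ {n} → Maybe (Fin n) → Fin n → Bool
other nothing _ = true
other (just i) j = not (j == i)

other⁺ : ∀ {n} (x : Maybe (Fin n)) {j} → just j ≢ x → other x j ≡ true
other⁺ nothing _ = refl
other⁺ (just i) p = ≢⇒≠ (p ∘ cong just)

other⁻ : ∀ {n} (x : Maybe (Fin n)) {j} → other x j ≡ true → just j ≢ x
other⁻ (just i) p refl = ≠⇒≢ {i = i} {i} p refl

record Table {k} (K : Graph k) : Set where
  open Graph K
  field
    adj  : Fin k → Fin k → Bool
    adj⁺ : ∀ {x y} → x ~ y → adj x y ≡ true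
    adj⁻ : ∀ {x y} → adj x y ≡ true → x ~ y

module _ {k} {K : Graph k} (table : Table K) where
  open Graph K
  open Table table

  private
    isIn : Subset k → Fin k → Bool
    isIn = Vec.lookup

    in⁺ : ∀ {S : Subset k} {x} → x ∈ S → isIn S x ≡ true
    in⁺ = VecP.[]=⇒lookup

    in⁻ : ∀ {S : Subset k} {x} → isIn S x ≡ true → x ∈ S
    in⁻ {S} {x} = VecP.lookup⇒[]= x S

    out⁺ : ∀ {S : Subset k} {x} → x ∉ S → not (isIn S x) ≡ true
    out⁺ p = true-not (p ∘ in⁻)

    out⁻ : ∀ {S : Subset k} {x} → not (isIn S x) ≡ true → x ∉ S
    out⁻ p q = not-true p (in⁺ q)

  two-nbrsᵇ apartᵇ : Fin k → Bool
  two-nbrsᵇ p = anyF λ x → anyF λ y → not (x == y) ∧ adj p x ∧ adj p y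
  apartᵇ p = allF λ x → allF λ y → not (allF λ z → not (adj p z) ∨ z == x ∨ z == y) ∨ not (adj x y)

  exitᵇ : Subset k → Maybe (Fin k) → Maybe (Fin k) → Bool
  exitᵇ S x y = anyF λ s → isIn S s ∧ anyF λ t → (not (isIn S t) ∧ other x t) ∧ (other y t ∧ adj s t)

  cut₁ᵇ : Subset k → Maybe (Fin k) → Bool
  cut₁ᵇ S x = allF (λ p → not (isIn S p)) ∨ allF (λ q → not (not (isIn S q) ∧ other x q)) ∨ exitᵇ S x nothing

  cut₂ᵇ : Subset k → Maybe (Fin k) → Maybe (Fin k) → Bool
  cut₂ᵇ S x y = atMostOne (isIn S) ∨
    atMostOne (λ q → not (isIn S q) ∧ other x q ∧ other y q) ∨ exitᵇ S x y

  exit-sound : ∀ S x y → exitᵇ S x y ≡ true →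
               ∃₂ λ s t → s ∈ S × t ∉ S × just t ≢ x × just t ≢ y × s ~ t
  exit-sound S x y e with anyF-sound _ e
  ... | s , e₁ with ∧-true {isIn S s} e₁
  ... | s∈ , e₂ with anyF-sound _ e₂
  ... | t , e₃ with ∧-true {not (isIn S t) ∧ other x t} e₃
  ... | e₄ , e₅ with ∧-true {not (isIn S t)} e₄ | ∧-true {other y t} e₅
  ... | t∉ , tx | ty , r = s , t , in⁻ s∈ , out⁻ t∉ , other⁻ x tx , other⁻ y ty , adj⁻ r

  rigidᵇ : Bool
  rigidᵇ = allF two-nbrsᵇ ∧ allF apartᵇ ∧
    allVec allBool k (λ S → allMaybe (cut₁ᵇ S)) ∧
    allVec allBool k (λ S → allMaybe λ x → allMaybe (cut₂ᵇ S x))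

  rigid-sound : rigidᵇ ≡ true → Rigid K
  rigid-sound e with ∧-true {allF two-nbrsᵇ} e
  ... | c₁ , e with ∧-true {allF apartᵇ} e
  ... | c₂ , e with ∧-true {allVec allBool k (λ S → allMaybe (cut₁ᵇ S))} e
  ... | c₃ , c₄ = record
    { two-nbrs = λ p → let (x , e₁) = anyF-sound _ (allF-sound two-nbrsᵇ c₁ p)
                           (y , e₂) = anyF-sound _ e₁
                           (ne , e₃) = ∧-true e₂
                           (a , b) = ∧-true e₃
                       in x , y , ≠⇒≢ ne , adj⁻ a , adj⁻ b
    ; apart = λ p {x} {y} f r → not-true
        (implies (allF-sound _ (allF-sound _ (allF-sound apartᵇ c₂ p) x) y)
          (allF-intro λ z → nbr p x y f z)) (adj⁺ r)
    ; cut₁ = λ S {p} {q} x p∈ q∉ q≢ → sound₁ S x p∈ q∉ q≢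
        (allMaybe-sound (cut₁ᵇ S) (allVec-sound allBool-sound _ c₃ S) x)
    ; cut₂ = λ S x y p∈ p′∈ p≢ q∉ q′∉ q≢ qx qy q′x q′y → sound₂ S x y p∈ p′∈ p≢ q∉ q′∉ q≢ qx qy q′x q′y
        (allMaybe-sound (cut₂ᵇ S x) (allMaybe-sound (λ x → allMaybe (cut₂ᵇ S x)) (allVec-sound allBool-sound _ c₄ S) x) y)
    }
    where
    nbr : ∀ p x y → (∀ {z} → p ~ z → z ≡ x ⊎ z ≡ y) → ∀ z → not (adj p z) ∨ z == x ∨ z == y ≡ true
    nbr p x y f z with adj p z in eq
    ... | false = refl
    ... | true with f (adj⁻ eq)
    ... | inj₁ refl rewrite ==-refl z = refl
    ... | inj₂ refl rewrite ==-refl z with z == x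
    ... | true = refl
    ... | false = refl
    sound₁ : ∀ S {p q} x → p ∈ S → q ∉ S → just q ≢ x → cut₁ᵇ S x ≡ true →
             ∃₂ λ s t → s ∈ S × t ∉ S × just t ≢ x × s ~ t
    sound₁ S {p} {q} x p∈ q∉ q≢ e with ∨-true e
    ... | inj₁ e₁ = contradiction (in⁺ p∈) (not-true (allF-sound _ e₁ p))
    ... | inj₂ e₁ with ∨-true {allF (λ q → not (not (isIn S q) ∧ other x q))} e₁
    ... | inj₁ e₂ = contradiction (∧-intro (out⁺ q∉) (other⁺ x q≢)) (not-true (allF-sound _ e₂ q))
    ... | inj₂ e₂ with exit-sound S x nothing e₂
    ... | s , t , s∈ , t∉ , tx , _ , r = s , t , s∈ , t∉ , tx , r
    sound₂ : ∀ S {p p′ q q′} x y → p ∈ S → p′ ∈ S → p ≢ p′ →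
             q ∉ S → q′ ∉ S → q ≢ q′ → just q ≢ x → just q ≢ y → just q′ ≢ x → just q′ ≢ y →
             cut₂ᵇ S x y ≡ true → ∃₂ λ s t → s ∈ S × t ∉ S × just t ≢ x × just t ≢ y × s ~ t
    sound₂ S x y p∈ p′∈ p≢ q∉ q′∉ q≢ qx qy q′x q′y e with ∨-true {atMostOne (isIn S)} e
    ... | inj₁ e₁ = contradiction (atMostOne-sound (isIn S) e₁ (in⁺ p∈) (in⁺ p′∈)) p≢
    ... | inj₂ e₁ with ∨-true {atMostOne (λ q → not (isIn S q) ∧ other x q ∧ other y q)} e₁
    ... | inj₁ e₂ = contradiction (atMostOne-sound _ e₂
      (∧-intro (out⁺ q∉) (∧-intro (other⁺ x qx) (other⁺ y qy)))
      (∧-intro (out⁺ q′∉) (∧-intro (other⁺ x q′x) (other⁺ y q′y)))) q≢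
    ... | inj₂ e₂ = exit-sound S x y e₂

  -- Excludes K as a minor of a multiedge.
  uncoveredᵇ : Maybe (Fin k) → Maybe (Fin k) → Bool
  uncoveredᵇ x y = anyF λ s → (other x s ∧ other y s) ∧ anyF λ t → (other x t ∧ other y t) ∧ adj s t

  uncovered-sound : allMaybe (λ x → allMaybe (uncoveredᵇ x)) ≡ true → ∀ x y → ∃₂ λ s t → just s ≢ x × just s ≢ y × just t ≢ x × just t ≢ y × s ~ t
  uncovered-sound e x y with anyF-sound _ (allMaybe-sound (uncoveredᵇ x) (allMaybe-sound (λ x → allMaybe (uncoveredᵇ x)) e x) y)
  ... | s , e₁ with ∧-true {other x s ∧ other y s} e₁
  ... | os , e₂ with ∧-true {other x s} os | anyF-sound _ e₂
  ... | sx , sy | t , e₃ with ∧-true {other x t ∧ other y t} e₃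
  ... | ot , r with ∧-true {other x t} ot
  ... | tx , ty = s , t , other⁻ x sx , other⁻ y sy , other⁻ x tx , other⁻ y ty , adj⁻ r

  -- Excludes K as a minor of a graph with a vertex whose deletion leaves maximum degree two.
  starᵇ : Maybe (Fin k) → Bool
  starᵇ x = anyF λ s → other x s ∧ anyF λ a → (other x a ∧ adj s a) ∧
    anyF λ b → (other x b ∧ adj s b) ∧ (not (a == b) ∧ anyF λ c → (other x c ∧ adj s c) ∧ (not (a == c) ∧ not (b == c)))

  record Star₃ (x : Maybe (Fin k)) : Set where
    field
      {centre a b c} : Fin k
      s≢ : just centre ≢ x
      a≢ : just a ≢ x
      b≢ : just b ≢ x
      c≢ : just c ≢ x
      sa : centre ~ a
      sb : centre ~ b
      sc : centre ~ c
      a≢b : a ≢ b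
      a≢c : a ≢ c
      b≢c : b ≢ c

  star-sound : allMaybe starᵇ ≡ true → ∀ x → Star₃ x
  star-sound e x with anyF-sound _ (allMaybe-sound starᵇ e x)
  ... | s , e₁ with ∧-true {other x s} e₁
  ... | os , e₂ with anyF-sound _ e₂
  ... | a , e₃ with ∧-true {other x a ∧ adj s a} e₃
  ... | oa , e₄ with anyF-sound _ e₄
  ... | b , e₅ with ∧-true {other x b ∧ adj s b} e₅
  ... | ob , e₆ with ∧-true {not (a == b)} e₆
  ... | ab , e₇ with anyF-sound _ e₇
  ... | c , e₈ with ∧-true {other x c ∧ adj s c} e₈
  ... | oc , e₉ with ∧-true {other x a} oa | ∧-true {other x b} ob | ∧-true {other x c} oc | ∧-true {not (a == c)} e₉
  ... | pa , ra | pb , rb | pc , rc | ac , bc = record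
    { s≢ = other⁻ x os ; a≢ = other⁻ x pa ; b≢ = other⁻ x pb ; c≢ = other⁻ x pc
    ; sa = adj⁻ ra ; sb = adj⁻ rb ; sc = adj⁻ rc
    ; a≢b = ≠⇒≢ ab ; a≢c = ≠⇒≢ ac ; b≢c = ≠⇒≢ bc }

-- Written out by patterns for evaluation; `tabulated` compares it once with the decision procedure
-- of the graph.
adj₅ : Fin 5 → Fin 5 → Bool
adj₅ 0F 1F = false
adj₅ 1F 0F = false
adj₅ x y = not (x == y)

left₆ : Fin 6 → Bool
left₆ 0F = true
left₆ 1F = true
left₆ 2F = true
left₆ _ = false

adj₆ : Fin 6 → Fin 6 → Bool
adj₆ 0F 3F = false
adj₆ 3F 0F = false
adj₆ x y = (left₆ x ∧ not (left₆ y)) ∨ (not (left₆ x) ∧ left₆ y)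

tabulated : ∀ {k} (K : Graph k) (adj : Fin k → Fin k → Bool) →
            True (all? λ x → all? λ y → adj x y ≟ᵇ does (Graph._~?_ K x y)) → Table K
tabulated K adj w = record
  { adj = adj
  ; adj⁺ = λ {x} {y} r → trans (agree x y) (dec-true (Graph._~?_ K x y) r)
  ; adj⁻ = λ {x} {y} e → does-true (Graph._~?_ K x y) (trans (sym (agree x y)) e) }
  where
  agree = toWitness w

table₅ : Table K₅⁻
table₅ = tabulated K₅⁻ adj₅ _

table₆ : Table K₃₃⁻
table₆ = tabulated K₃₃⁻ adj₆ _

rigid₅ : Rigid K₅⁻
rigid₅ = rigid-sound table₅ refl

rigid₆ : Rigid K₃₃⁻
rigid₆ = rigid-sound table₆ refl

-- Three obstructions to a minor: vertex cover, hub, prism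

module _ {k} {K : Graph k} {V : Set} {R : V → V → Set} (M : Model (Graph._~_ K) R) where
  open Model M

  -- At most two branch sets contain p or q. K has an edge avoiding these two, and its realisation
  -- would be an edge of R avoiding the cover.
  vertex-cover-excludes : (∀ x y → ∃₂ λ s t → just s ≢ x × just s ≢ y × just t ≢ x × just t ≢ y × Graph._~_ K s t) →
                          ∀ p q → (∀ {s t} → R s t → s ≡ p ⊎ s ≡ q ⊎ t ≡ p ⊎ t ≡ q) → ⊥
  vertex-cover-excludes uncovered p q covered with uncovered (φ p) (φ q)
  ... | s , t , sp , sq , tp , tq , r with edges r
  ... | v , w , ev , ew , h with covered h
  ... | inj₁ refl = sp (sym ev)
  ... | inj₂ (inj₁ refl) = sq (sym ev)
  ... | inj₂ (inj₂ (inj₁ refl)) = tp (sym ew)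
  ... | inj₂ (inj₂ (inj₂ refl)) = tq (sym ew)

module DegreeTwo {V : Set} (_≟_ : DecidableEquality V) {R : V → V → Set} (R-sym : ∀ {s t} → R s t → R t s)
                 (h : V) (deg : ∀ s → s ≢ h → ∃₂ λ p q → ∀ {t} → R s t → t ≡ h ⊎ t ≡ p ⊎ t ≡ q) where

  -- The length is recorded because it bounds the recursion in `two-exits`.
  data Walk (F : V → Set) : ℕ → V → V → Set where
    stop : ∀ {s} → F s → Walk F 0 s s
    step : ∀ {n s t u} → F s → R s t → Walk F n t u → Walk F (suc n) s u

  start : ∀ {F n s u} → Walk F n s u → F s
  start (stop f) = f
  start (step f _ _) = f

  Without : (V → Set) → V → V → Set
  Without F p s = F s × s ≢ p

  -- Cutting at the last visit to p leaves a shorter walk in the set without p, which is what allows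
  -- p to be stripped off.
  last-exit : ∀ {F n s u} p → u ≢ p → Walk F n s u →
              (s ≢ p × Walk (Without F p) n s u) ⊎
              (∃₂ λ t m → m < n × R p t × Walk (Without F p) m t u)
  last-exit p u≢p (stop f) = inj₁ (u≢p , stop (f , u≢p))
  last-exit {s = s} p u≢p (step f r w) with last-exit p u≢p w
  ... | inj₂ (t , m , m<n , r′ , w′) = inj₂ (t , m , m≤n⇒m≤1+n m<n , r′ , w′)
  ... | inj₁ (_ , w′) with s ≟ p
  ... | yes refl = inj₂ (_ , _ , ≤-refl , r , w′)
  ... | no s≢p = inj₁ (s≢p , step (f , s≢p) r w′)

  first-exit : ∀ {F n p u} → u ≢ p → Walk F n p u → ∃₂ λ t m → m < n × R p t × Walk (Without F p) m t u
  first-exit u≢p w with last-exit _ u≢p w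
  ... | inj₁ (p≢p , _) = contradiction refl p≢p
  ... | inj₂ e = e

  no-three : ∀ {s a b c} → s ≢ h → a ≢ h → b ≢ h → c ≢ h → R s a → R s b → R s c →
             a ≢ b → a ≢ c → b ≢ c → ⊥
  no-three {s} {a} {b} {c} sh ah bh ch ra rb rc ab ac bc with deg s sh
  ... | p , q , only with only ra | only rb | only rc
  ... | inj₁ e | _ | _ = ah e
  ... | inj₂ _ | inj₁ e | _ = bh e
  ... | inj₂ _ | inj₂ _ | inj₁ e = ch e
  ... | inj₂ (inj₁ e) | inj₂ (inj₁ f) | _ = ab (trans e (sym f))
  ... | inj₂ (inj₂ e) | inj₂ (inj₂ f) | _ = ab (trans e (sym f))
  ... | inj₂ (inj₁ e) | inj₂ (inj₂ f) | inj₂ (inj₁ g) = ac (trans e (sym g))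
  ... | inj₂ (inj₁ e) | inj₂ (inj₂ f) | inj₂ (inj₂ g) = bc (trans f (sym g))
  ... | inj₂ (inj₂ e) | inj₂ (inj₁ f) | inj₂ (inj₂ g) = ac (trans e (sym g))
  ... | inj₂ (inj₂ e) | inj₂ (inj₁ f) | inj₂ (inj₁ g) = bc (trans f (sym g))

  -- A connected set in which all degrees are at most two has at most two
  -- edges leaving it: strip off its vertices starting at one such edge.
  two-exits : ∀ N (F : V → Set) → (∀ {s} → F s → s ≢ h) →
              ∀ {n m p p₂ p₃ q q₂ q₃} → n < N → Walk F n p p₂ → Walk F m p p₃ →
              R p q → R p₂ q₂ → R p₃ q₃ → q ≢ h → q₂ ≢ h → q₃ ≢ h →
              ¬ F q → ¬ F q₂ → ¬ F q₃ → q ≢ q₂ → q ≢ q₃ → q₂ ≢ q₃ → ⊥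
  two-exits (suc N) F F≢h {p = p} {p₂} {p₃} n<N w₂ w₃ r r₂ r₃ qh q₂h q₃h f f₂ f₃ qq₂ qq₃ q₂q₃
    with p₂ ≟ p | p₃ ≟ p
  ... | yes refl | yes refl = no-three (F≢h (start w₂)) qh q₂h q₃h r r₂ r₃ qq₂ qq₃ q₂q₃
  ... | yes refl | no p₃≢p = let (t , _ , _ , rt , w) = first-exit p₃≢p w₃ ; (ft , _) = start w in
    no-three (F≢h (start w₂)) qh q₂h (F≢h ft) r r₂ rt qq₂ (λ { refl → f ft }) (λ { refl → f₂ ft })
  ... | no p₂≢p | yes refl = let (t , _ , _ , rt , w) = first-exit p₂≢p w₂ ; (ft , _) = start w in
    no-three (F≢h (start w₂)) qh q₃h (F≢h ft) r r₃ rt qq₃ (λ { refl → f ft }) (λ { refl → f₃ ft })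
  ... | no p₂≢p | no p₃≢p with first-exit p₂≢p w₂ | first-exit p₃≢p w₃
  ... | t , m , m<n , rt , w | t′ , m′ , _ , rt′ , w′ with t ≟ t′
  ... | no t≢t′ = no-three (F≢h fp) qh (F≢h (proj₁ (start w))) (F≢h (proj₁ (start w′))) r rt rt′
                    (λ { refl → f (proj₁ (start w)) }) (λ { refl → f (proj₁ (start w′)) }) t≢t′
    where fp = start w₂
  -- Both walks leave p through the same neighbour t. After p has been removed, t takes its role,
  -- and p is the outside neighbour of t.
  ... | yes refl = two-exits N (Without F p) (F≢h ∘ proj₁) (<-≤-trans m<n (≤-pred n<N)) w w′
                     (R-sym rt) r₂ r₃ (F≢h fp) q₂h q₃h (λ x → proj₂ x refl) (f₂ ∘ proj₁) (f₃ ∘ proj₁)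
                     (λ { refl → f₂ fp }) (λ { refl → f₃ fp }) q₂q₃
    where fp = start w₂

  -- K has a vertex with three neighbours such that none of the four is the branch set of h. The
  -- branch set of that vertex is connected, avoids h and has three edges to different branch sets,
  -- contrary to `two-exits`.
  hub-excludes : ∀ {k} {K : Graph k} (table : Table K) → (∀ x → Star₃ table x) →
                 Model (Graph._~_ K) R → ⊥
  hub-excludes {K = K} table star M with star (Model.φ M h)
  ... | s with edges (Star₃.sa s) | edges (Star₃.sb s) | edges (Star₃.sc s)
    where open Model M
  ... | p₁ , q₁ , e₁ , f₁ , r₁ | p₂ , q₂ , e₂ , f₂ , r₂ | p₃ , q₃ , e₃ , f₃ , r₃
    with walk (conn e₁ e₂) | walk (conn e₁ e₃)
    where
    open Model M
    walk : ∀ {u v x} → Star (Inside R φ x) u v → φ u ≡ just x ⊎ u ≢ v → ∃ λ n → Walk (λ s → φ s ≡ just x) n u v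
    walk ε (inj₁ e) = 0 , stop e
    walk ε (inj₂ e) = contradiction refl e
    walk ((r , e , f) ◅ w) _ = let (n , w′) = walk w (inj₁ f) in suc n , step e r w′
  ... | w₂ | w₃ = let (n , w₂′) = w₂ (inj₁ e₁) ; (m , w₃′) = w₃ (inj₁ e₁) in
    two-exits (suc n) (λ s → φ s ≡ just S.centre) (λ e → away S.s≢ e) ≤-refl w₂′ w₃′ r₁ r₂ r₃
      (away S.a≢ f₁) (away S.b≢ f₂) (away S.c≢ f₃)
      (differ f₁ (~⇒≢ K (Graph.~-sym K S.sa))) (differ f₂ (~⇒≢ K (Graph.~-sym K S.sb)))
      (differ f₃ (~⇒≢ K (Graph.~-sym K S.sc)))
      (λ { refl → differ f₁ S.a≢b f₂ }) (λ { refl → differ f₁ S.a≢c f₃ }) (λ { refl → differ f₂ S.b≢c f₃ })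
    where
    open Model M
    module S = Star₃ s
    away : ∀ {u x} → just x ≢ φ h → φ u ≡ just x → u ≢ h
    away ne e refl = ne (sym e)
    differ : ∀ {u x y} → φ u ≡ just x → x ≢ y → φ u ≢ just y
    differ e ne f = ne (just-injective (trans (sym e) f))

unique-lookup : ∀ {A : Set} {xs : List A} → Unique xs → ∀ i j → lookup xs i ≡ lookup xs j → i ≡ j
unique-lookup (_ ∷ _) zero zero _ = refl
unique-lookup (px ∷ _) zero (suc j) e = contradiction e (All.lookup px (∈-lookup j))
unique-lookup (px ∷ _) (suc i) zero e = contradiction (sym e) (All.lookup px (∈-lookup i))
unique-lookup (_ ∷ u) (suc i) (suc j) e = cong suc (unique-lookup u i j e)

-- `Uses` is a relation, so that a use of the lemma need only exhibit a place for each entry instead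
-- of defining a function on entries.
pigeonholes : ∀ {A : Set} m {xs : List A} {Uses : A → Fin m → Set} → Unique xs →
              (∀ {a} → a ∈ˡ xs → ∃ (Uses a)) → (∀ {a b i} → Uses a i → Uses b i → a ≡ b) → length xs ≤ m
pigeonholes m {xs} {Uses} unique use inj with m <? length xs
... | no ¬p = ≮⇒≥ ¬p
... | yes p with pigeonhole p (λ i → proj₁ (use (∈-lookup {xs = xs} i)))
... | i , j , i<j , e = contradiction
  (cong toℕ (unique-lookup unique i j
    (inj (proj₂ (use (∈-lookup {xs = xs} i))) (subst (Uses _) (sym e) (proj₂ (use (∈-lookup {xs = xs} j)))))))
  (<⇒≢ i<j)

select : {A : Set} → (A → Bool) → List A → List A
select p = filter λ a → p a ≟ᵇ true

-- The prism with its three matching edges subdivided.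
data Prism : Set where
  left mid right : Fin 3 → Prism

data PrismEdge : Prism → Prism → Set where
  ll : ∀ {i j} → i ≢ j → PrismEdge (left i) (left j)
  rr : ∀ {i j} → i ≢ j → PrismEdge (right i) (right j)
  lm : ∀ {i} → PrismEdge (left i) (mid i)
  ml : ∀ {i} → PrismEdge (mid i) (left i)
  mr : ∀ {i} → PrismEdge (mid i) (right i)
  rm : ∀ {i} → PrismEdge (right i) (mid i)

module PrismCount {k} {K : Graph k} (table : Table K) where
  open Graph K
  open Table table

  -- A vertex or an edge (a pair of vertices) of K that occupies one of the
  -- three subdivided matching edges, given which branch sets meet the left
  -- triangle (A) and the right triangle (B).
  crosses : Vec.Vec Bool k → Vec.Vec Bool k → Fin k × Fin k → Bool
  crosses A B (x , y) = if x == y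
    then (Vec.lookup A x ∧ Vec.lookup B x) ∨ (not (Vec.lookup A x) ∧ not (Vec.lookup B x))
    else adj x y ∧ (Vec.lookup A x ∧ not (Vec.lookup B x)) ∧ (not (Vec.lookup A y) ∧ Vec.lookup B y)

  pairs : List (Fin k × Fin k)
  pairs = cartesianProduct (allFin k) (allFin k)

  -- Necessary conditions for a model. Each triangle has three vertices, so at most three branch
  -- sets meet it; a branch set meeting neither is one middle vertex and has at most two neighbours;
  -- and everything counted by `crosses` occupies one of the three matching paths for itself.
  fits : Vec.Vec Bool k → Vec.Vec Bool k → Bool
  fits A B = (length (select (Vec.lookup A) (allFin k)) ≤ᵇ 3) ∧
    (length (select (Vec.lookup B) (allFin k)) ≤ᵇ 3) ∧
    (allF λ x → Vec.lookup A x ∨ Vec.lookup B x ∨ (length (select (adj x) (allFin k)) ≤ᵇ 2)) ∧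
    (length (select (crosses A B) pairs) ≤ᵇ 3)

  never-fits : Bool
  never-fits = allVec allBool k λ A → allVec allBool k λ B → not (fits A B)

  module _ (nonisolated : ∀ x → ∃ λ y → x ~ y) (M : Model _~_ PrismEdge) where
    open Model M

    L? : ∀ x → Dec (∃ λ i → φ (left i) ≡ just x)
    L? x = any? λ i → Maybe-≡-dec _≟ᶠ_ (φ (left i)) (just x)
    R? : ∀ x → Dec (∃ λ i → φ (right i) ≡ just x)
    R? x = any? λ i → Maybe-≡-dec _≟ᶠ_ (φ (right i)) (just x)
    A B : Vec.Vec Bool k
    A = Vec.tabulate (does ∘ L?)
    B = Vec.tabulate (does ∘ R?)

    looks : ∀ {P : Fin k → Set} (P? : ∀ x → Dec (P x)) x {b} →
            Vec.lookup (Vec.tabulate (does ∘ P?)) x ≡ b → does (P? x) ≡ b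
    looks P? x = trans (sym (VecP.lookup∘tabulate _ x))
    no⁻ : ∀ {X : Set} (d : Dec X) → not (does d) ≡ true → ¬ X
    no⁻ (no a) _ = a

    reject : ∀ {P : Fin k → Set} (P? : ∀ x → Dec (P x)) x →
             not (Vec.lookup (Vec.tabulate (does ∘ P?)) x) ≡ true → ¬ P x
    reject P? x e = no⁻ (P? x) (trans (cong not (sym (VecP.lookup∘tabulate (does ∘ P?) x))) e)

    through : ∀ {x i j} → Star (Inside PrismEdge φ x) (left i) (right j) →
              ∃ λ c → φ (left c) ≡ just x × φ (mid c) ≡ just x × φ (right c) ≡ just x
    through ((ll _ , _ , _) ◅ w) = through w
    through ((lm , p , q) ◅ (ml , _ , _) ◅ w) = through w
    through ((lm , p , q) ◅ (mr , _ , r) ◅ w) = _ , p , q , r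

    Mid : Fin k → Fin 3 → Set
    Mid x i = φ (mid i) ≡ just x × φ (left i) ≢ just x × φ (right i) ≢ just x ×
              (∀ {y} → x ~ y → φ (left i) ≡ just y ⊎ φ (right i) ≡ just y)

    -- Every step from a middle vertex enters a triangle, so a branch set that avoids both triangles
    -- is a single middle vertex.
    isMid : ∀ x → ¬ (∃ λ i → φ (left i) ≡ just x) → ¬ (∃ λ i → φ (right i) ≡ just x) → ∃ (Mid x)
    isMid x nl nr with nonisolated x
    ... | y , r with edges r
    ... | left i , _ , e , _ = contradiction (i , e) nl
    ... | right i , _ , e , _ = contradiction (i , e) nr
    ... | mid i , _ , e , _ = i , e , (λ f → nl (i , f)) , (λ f → nr (i , f)) , nbr
      where
      stuck : ∀ {v} → Star (Inside PrismEdge φ x) (mid i) v → v ≡ mid i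
      stuck ε = refl
      stuck ((ml , _ , f) ◅ _) = contradiction (i , f) nl
      stuck ((mr , _ , f) ◅ _) = contradiction (i , f) nr
      nbr : ∀ {y} → x ~ y → φ (left i) ≡ just y ⊎ φ (right i) ≡ just y
      nbr r with edges r
      ... | v , w , ev , ew , h with stuck (conn e ev)
      nbr r | v , w , ev , ew , ml | refl = inj₁ ew
      nbr r | v , w , ev , ew , mr | refl = inj₂ ew

    Straight : Fin k → Fin k → Fin 3 → Set
    Straight x y i = φ (left i) ≡ just x × φ (right i) ≡ just y × (φ (mid i) ≡ just x ⊎ φ (mid i) ≡ just y)

    straight : ∀ {x y} → x ~ y → (∃ λ i → φ (left i) ≡ just x) → ¬ (∃ λ i → φ (right i) ≡ just x) →
               ¬ (∃ λ i → φ (left i) ≡ just y) → (∃ λ i → φ (right i) ≡ just y) → ∃ (Straight x y)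
    straight {x} {y} r (i , xl) nxr nyl (j , yr) with edges r
    ... | _ , _ , ev , ew , ll _ = contradiction (_ , ew) nyl
    ... | _ , _ , ev , ew , rr _ = contradiction (_ , ev) nxr
    ... | _ , _ , ev , ew , ml = contradiction (_ , ew) nyl
    ... | _ , _ , ev , ew , rm = contradiction (_ , ev) nxr
    ... | _ , _ , ev , ew , lm {c} with conn ew yr
    ... | (ml , _ , f) ◅ _ = contradiction (_ , f) nyl
    ... | (mr , _ , f) ◅ _ = c , ev , f , inj₂ ew
    straight {x} {y} r (i , xl) nxr nyl (j , yr)
        | _ , _ , ev , ew , mr {c} with conn ev xl
    ... | (ml , _ , f) ◅ _ = c , f , ew , inj₁ ev
    ... | (mr , _ , f) ◅ _ = contradiction (_ , f) nxr

    Uses : Fin k × Fin k → Fin 3 → Set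
    Uses (x , y) i = Straight x y i ⊎ (x ≡ y × Mid x i)

    uses-injective : ∀ {a b i} → Uses a i → Uses b i → a ≡ b
    uses-injective (inj₁ (p , q , _)) (inj₁ (p′ , q′ , _)) =
      cong₂ _,_ (just-injective (trans (sym p) p′)) (just-injective (trans (sym q) q′))
    uses-injective (inj₁ (p , q , m)) (inj₂ (refl , e , nl , nr , _)) = ⊥-elim
      ([ (λ m → nl (trans p (trans (sym m) e))) , (λ m → nr (trans q (trans (sym m) e))) ]′ m)
    uses-injective (inj₂ (refl , e , nl , nr , _)) (inj₁ (p , q , m)) = ⊥-elim
      ([ (λ m → nl (trans p (trans (sym m) e))) , (λ m → nr (trans q (trans (sym m) e))) ]′ m)
    uses-injective (inj₂ (refl , e , _)) (inj₂ (refl , e′ , _)) =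
      cong (λ x → x , x) (just-injective (trans (sym e) e′))

    use : ∀ p → crosses A B p ≡ true → ∃ (Uses p)
    use (x , y) c with x == y in eq
    use (x , y) c | true with ==-sound {i = x} {y} eq
    use (x , y) c | true | refl with ∨-true {Vec.lookup A x ∧ Vec.lookup B x} c
    ... | inj₁ d with ∧-true d
    ... | a , b with does-true (L? x) (looks L? x a) | does-true (R? x) (looks R? x b)
    ... | _ , l | _ , r = let (c , p , q , s) = through (conn l r) in c , inj₁ (p , s , inj₁ q)
    use (x , y) c | true | refl | inj₂ d with ∧-true d
    ... | a , b = let (i , m) = isMid x (reject L? x a)
                                        (reject R? x b)
                  in i , inj₂ (refl , m)
    use (x , y) c | false with ∧-true {adj x y} c
    ... | r , d with ∧-true {Vec.lookup A x ∧ not (Vec.lookup B x)} d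
    ... | d₁ , d₂ with ∧-true {Vec.lookup A x} d₁ | ∧-true {not (Vec.lookup A y)} d₂
    ... | xa , xb | ya , yb =
      let (i , s) = straight (adj⁻ r)
                      (does-true (L? x) (looks L? x xa)) (reject R? x xb)
                      (reject L? y ya) (does-true (R? y) (looks R? y yb))
      in i , inj₁ s

    selected : ∀ {X : Set} {p : X → Bool} {xs a} → a ∈ˡ select p xs → p a ≡ true
    selected {p = p} {xs} i = proj₂ (∈-filter⁻ (λ a → p a ≟ᵇ true) {xs = xs} i)
    select-unique : ∀ {X : Set} (p : X → Bool) {xs} → Unique xs → Unique (select p xs)
    select-unique p = UniqueP.filter⁺ (λ a → p a ≟ᵇ true)
    ≤⇒≤ᵇ′ : ∀ {m n} → m ≤ n → (m ≤ᵇ n) ≡ true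
    ≤⇒≤ᵇ′ {m} {n} p with m ≤ᵇ n | ≤⇒≤ᵇ p
    ... | true | _ = refl

    small : ∀ x → Vec.lookup A x ∨ Vec.lookup B x ∨ (length (select (adj x) (allFin k)) ≤ᵇ 2) ≡ true
    small x with Vec.lookup A x in ea | Vec.lookup B x in eb
    ... | true | _ = refl
    ... | false | true = refl
    ... | false | false with isMid x (no⁻ (L? x) (cong not (looks L? x ea))) (no⁻ (R? x) (cong not (looks R? x eb)))
    ... | i , _ , _ , _ , nbr = ≤⇒≤ᵇ′ (pigeonholes 2 {Uses = End}
      (select-unique (adj x) (UniqueP.allFin⁺ k)) (λ {y} e → end (nbr (adj⁻ (selected {xs = allFin k} e)))) end-injective)
      where
      End : Fin k → Fin 2 → Set
      End y 0F = φ (left i) ≡ just y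
      End y 1F = φ (right i) ≡ just y
      end : ∀ {y} → φ (left i) ≡ just y ⊎ φ (right i) ≡ just y → ∃ (End y)
      end (inj₁ e) = 0F , e
      end (inj₂ e) = 1F , e
      end-injective : ∀ {a b c} → End a c → End b c → a ≡ b
      end-injective {c = 0F} e f = just-injective (trans (sym e) f)
      end-injective {c = 1F} e f = just-injective (trans (sym e) f)

    fits-AB : fits A B ≡ true
    fits-AB = ∧-intro
      (≤⇒≤ᵇ′ (pigeonholes 3 {Uses = λ x i → φ (left i) ≡ just x} (select-unique _ (UniqueP.allFin⁺ k))
        (λ {x} e → does-true (L? x) (looks L? x (selected {p = Vec.lookup A} {allFin k} e)))
        (λ e f → just-injective (trans (sym e) f))))
      (∧-intro (≤⇒≤ᵇ′ (pigeonholes 3 {Uses = λ x i → φ (right i) ≡ just x} (select-unique _ (UniqueP.allFin⁺ k))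
        (λ {x} e → does-true (R? x) (looks R? x (selected {p = Vec.lookup B} {allFin k} e)))
        (λ e f → just-injective (trans (sym e) f))))
      (∧-intro (allF-intro small)
      (≤⇒≤ᵇ′ (pigeonholes 3 {Uses = Uses} (select-unique _ (UniqueP.cartesianProduct⁺ (UniqueP.allFin⁺ k) (UniqueP.allFin⁺ k)))
        (λ {p} e → use p (selected {p = crosses A B} {pairs} e)) (λ {a} {b} → uses-injective {a} {b})))))

    prism-excludes : never-fits ≡ true → ⊥
    prism-excludes e = not-true
      (allVec-sound allBool-sound (λ B → not (fits A B)) (allVec-sound allBool-sound (λ A → allVec allBool k λ B → not (fits A B)) e A) B) fits-AB

record Excluded {k} (K : Graph k) : Set where
  field
    table     : Table K
    rigid     : Rigid K
    uncovered : ∀ x y → ∃₂ λ s t → just s ≢ x × just s ≢ y × just t ≢ x × just t ≢ y × Graph._~_ K s t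
    star      : ∀ x → Star₃ table x
    no-prism  : ¬ Model (Graph._~_ K) PrismEdge
  nonisolated : ∀ x → ∃ λ y → Graph._~_ K x y
  nonisolated x = let (y , _ , _ , r , _) = Rigid.two-nbrs rigid x in y , r

excluded₅ : Excluded K₅⁻
excluded₅ = record
  { table = table₅ ; rigid = rigid₅
  ; uncovered = uncovered-sound table₅ refl ; star = star-sound table₅ refl
  ; no-prism = λ M → PrismCount.prism-excludes table₅
      (λ x → let (y , _ , _ , r , _) = Rigid.two-nbrs rigid₅ x in y , r) M refl }

excluded₆ : Excluded K₃₃⁻
excluded₆ = record
  { table = table₆ ; rigid = rigid₆
  ; uncovered = uncovered-sound table₆ refl ; star = star-sound table₆ refl
  ; no-prism = λ M → PrismCount.prism-excludes table₆
      (λ x → let (y , _ , _ , r , _) = Rigid.two-nbrs rigid₆ x in y , r) M refl }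

-- Allowed pieces exclude K₅⁻ and K₃₃⁻

allPairs-resp-↭ : ∀ {A : Set} {R : A → A → Set} → Symmetric R → ∀ {xs ys} → xs ↭ ys → AllPairs R xs → AllPairs R ys
allPairs-resp-↭ sm Perm.refl ps = ps
allPairs-resp-↭ sm (Perm.prep x p) (q ∷ ps) = All-resp-↭ p q ∷ allPairs-resp-↭ sm p ps
allPairs-resp-↭ sm (Perm.swap x y p) ((a ∷ b) ∷ c ∷ ps) =
  (sm a ∷ All-resp-↭ p c) ∷ All-resp-↭ p b ∷ allPairs-resp-↭ sm p ps
allPairs-resp-↭ sm (Perm.trans p q) ps = allPairs-resp-↭ sm q (allPairs-resp-↭ sm p ps)

allPairs-lookup : ∀ {A : Set} {R : A → A → Set} → Symmetric R → ∀ {xs} → AllPairs R xs →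
                  ∀ {x y} → x ∈ˡ xs → y ∈ˡ xs → x ≡ y ⊎ R x y
allPairs-lookup sm (p ∷ ps) (here refl) (here refl) = inj₁ refl
allPairs-lookup sm (p ∷ ps) (here refl) (there j) = inj₂ (All.lookup p j)
allPairs-lookup sm (p ∷ ps) (there i) (here refl) = inj₂ (sm (All.lookup p i))
allPairs-lookup sm (p ∷ ps) (there i) (there j) = allPairs-lookup sm ps i j

pointwise-++⁻ : ∀ {A B : Set} {R : A → B → Set} {xs} ys {zs} → Pointwise R xs (ys ++ zs) →
                ∃₂ λ as bs → xs ≡ as ++ bs × Pointwise R as ys × Pointwise R bs zs
pointwise-++⁻ [] p = [] , _ , refl , [] , p
pointwise-++⁻ (y ∷ ys) (r ∷ p) = let (as , bs , e , q , s) = pointwise-++⁻ ys p in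
  _ ∷ as , bs , cong (_ ∷_) e , r ∷ q , s

pointwise-tabulate⁻ : ∀ {A B : Set} {R : A → B → Set} {n} {g : Fin n → B} {xs} → Pointwise R xs (tabulate g) →
                      ∃ λ (f : Fin n → A) → xs ≡ tabulate f × (∀ i → R (f i) (g i))
pointwise-tabulate⁻ {n = zero} [] = (λ ()) , refl , λ ()
pointwise-tabulate⁻ {n = suc n} (r ∷ p) = let (f , e , h) = pointwise-tabulate⁻ p in
  (λ { zero → _ ; (suc i) → f i }) , cong (_ ∷_) e , λ { zero → r ; (suc i) → h i }

module _ {n : ℕ} where

  DistinctLabels : Edge n Kind → Edge n Kind → Set
  DistinctLabels e e′ = ∀ {ℓ} → label e ≡ virtual ℓ → label e′ ≢ virtual ℓ

  distinctLabels-sym : Symmetric DistinctLabels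
  distinctLabels-sym d p q = d q p

  labels-↭ : ∀ {M N} → M ↭ N → AllPairs DistinctLabels M → AllPairs DistinctLabels N
  labels-↭ = allPairs-resp-↭ λ {e} {e′} → distinctLabels-sym {e} {e′}

  same-label : ∀ {M e e′ ℓ} → AllPairs DistinctLabels M → e ∈ˡ M → e′ ∈ˡ M →
               label e ≡ virtual ℓ → label e′ ≡ virtual ℓ → e ≡ e′
  same-label u i j p q with allPairs-lookup (λ {e} {e′} → distinctLabels-sym {e} {e′}) u i j
  ... | inj₁ e = e
  ... | inj₂ d = contradiction q (d p)

  far : Fin n → Edge n Kind → Point n
  far u e with label e | end₁ e ≟ᶠ u
  ... | virtual ℓ | _ = inj₂ ℓ
  ... | real | yes _ = inj₁ (end₂ e)
  ... | real | no _ = inj₁ (end₁ e)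

  far-link : ∀ {u e t} → Link e (inj₁ u) t → t ≡ far u e
  far-link {u} {e} (direct p q) with label e | end₁ e ≟ᶠ u
  far-link (direct refl (inj₁ (refl , refl))) | real | yes _ = refl
  far-link (direct refl (inj₁ (refl , refl))) | real | no ne = contradiction refl ne
  far-link (direct refl (inj₂ (refl , refl))) | real | yes refl = refl
  far-link (direct refl (inj₂ (refl , refl))) | real | no _ = refl
  far-link {u} {e} (enter p q) with label e | end₁ e ≟ᶠ u
  far-link (enter refl q) | virtual ℓ | _ = refl

  joins-unique : ∀ {u v w} {e : Edge n Kind} → Joins u v e → Joins u w e → v ≡ w
  joins-unique (inj₁ (refl , refl)) (inj₁ (_ , eq)) = eq
  joins-unique (inj₁ (refl , refl)) (inj₂ (refl , refl)) = refl
  joins-unique (inj₂ (refl , refl)) (inj₁ (refl , refl)) = refl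
  joins-unique (inj₂ (refl , refl)) (inj₂ (eq , _)) = eq

  -- In the hat, deleting h leaves maximum degree two. A real edge to h disappears with h, whereas a
  -- virtual one would leave its subdividing vertex behind; this is why the spokes of a wheel have
  -- to be real.
  Thin : MultiGraph n Kind → Fin n → Set
  Thin M h = ∀ u → u ≢ h → ∃₂ λ e₁ e₂ → ∀ {e} → e ∈ˡ M → Touches u e →
             e ≡ e₁ ⊎ e ≡ e₂ ⊎ (label e ≡ real × Joins u h e)

  thin-excludes : ∀ {k} {K : Graph k} → Excluded K → ∀ {M h} → AllPairs DistinctLabels M → Thin M h →
                  Model (Graph._~_ K) (Hat M) → ⊥
  thin-excludes X {M} {h} distinct thin =
    DegreeTwo.hub-excludes _≟ᵖ_ hat-sym (inj₁ h) deg table star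
    where
    open Excluded X
    deg : ∀ s → s ≢ inj₁ h → ∃₂ λ p q → ∀ {t} → Hat M s t → t ≡ inj₁ h ⊎ t ≡ p ⊎ t ≡ q
    deg (inj₂ ℓ) _ with Any.any? (λ e → label e ≟ᵏ virtual ℓ) M
    ... | no ¬any = inj₂ 0 , inj₂ 0 , λ p → contradiction (Any.map (λ { (leave q _) → q }) p) ¬any
    ... | yes a with find a
    ... | e₀ , i , p₀ = inj₁ (end₁ e₀) , inj₁ (end₂ e₀) , λ r → case find r of λ
      { (e , j , leave q t) → inj₂ (ends t (same-label distinct j i q p₀)) }
      where
      ends : ∀ {u e} → Touches u e → e ≡ e₀ → inj₁ u ≡ inj₁ (end₁ e₀) ⊎ inj₁ u ≡ inj₁ (end₂ e₀)
      ends (inj₁ refl) refl = inj₁ refl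
      ends (inj₂ refl) refl = inj₂ refl
    deg (inj₁ u) u≢h with thin u (u≢h ∘ cong inj₁)
    ... | e₁ , e₂ , only = far u e₁ , far u e₂ , λ r → let (e , i , l) = find r in
      nbr l (only i (proj₁ (link-on l)))
      where
      nbr : ∀ {e t} → Link e (inj₁ u) t → e ≡ e₁ ⊎ e ≡ e₂ ⊎ (label e ≡ real × Joins u h e) →
            t ≡ inj₁ h ⊎ t ≡ far u e₁ ⊎ t ≡ far u e₂
      nbr l (inj₁ refl) = inj₂ (inj₁ (far-link l))
      nbr l (inj₂ (inj₁ refl)) = inj₂ (inj₂ (far-link l))
      nbr {e} (direct p q) (inj₂ (inj₂ (_ , j))) = inj₁ (cong inj₁ (joins-unique {e = e} q j))
      nbr (enter p _) (inj₂ (inj₂ (q , _))) = case trans (sym p) q of λ ()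

  record Rim {k} (f : Fin (suc k) → Fin n) (M : MultiGraph n Kind) : Set where
    field
      closing : Edge n Kind
      steps   : Fin k → Edge n Kind
      edges   : M ≡ closing ∷ tabulate steps
      closes  : Joins (f (fromℕ k)) (f zero) closing
      joins   : ∀ i → Joins (f (inject₁ i)) (f (suc i)) (steps i)

  rim : ∀ {m k s} {f : Fin m → Fin n} (g : Fin (suc k) → Fin m) {M : MultiGraph n Kind} →
        Pointwise (λ e t → Joins (f (end₁ t)) (f (end₂ t)) e × Permits (label t) (label e)) M
                  (map (λ (i , j) → edge (g i) (g j) s) (cyclePairs (suc k))) →
        Rim (f ∘ g) M
  rim {k = k} {s} {f} g ((j , _) ∷ p) with pointwise-tabulate⁻
    (subst (Pointwise _ _) (ListP.map-tabulate {n = k} (λ i → inject₁ i , suc i) (λ (i , j) → edge (g i) (g j) s)) p)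
  ... | es , refl , js = record { closing = _ ; steps = es ; edges = refl ; closes = j ; joins = λ i → proj₁ (js i) }

  rim-degree : ∀ {k} {f : Fin (suc k) → Fin n} {M} → Injective _≡_ _≡_ f → Rim f M →
               ∀ j → ∃₂ λ e₁ e₂ → ∀ {e} → e ∈ˡ M → Touches (f j) e → e ≡ e₁ ⊎ e ≡ e₂
  rim-degree {k} {f} {M} inj R j = before j , after j , only
    where
    open Rim R
    before after : Fin (suc k) → Edge n Kind
    before zero = closing
    before (suc i) = steps i
    after i with view i
    ... | ‵fromℕ = closing
    ... | ‵inject₁ i = steps i
    after-inject₁ : ∀ i → after (inject₁ i) ≡ steps i
    after-inject₁ i = go refl
      where
      go : ∀ {x} → inject₁ i ≡ x → after x ≡ steps i
      go {x} e with view x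
      ... | ‵fromℕ = contradiction (sym e) fromℕ≢inject₁
      ... | ‵inject₁ i′ = cong steps (sym (inject₁-injective e))
    after-last : after (fromℕ k) ≡ closing
    after-last = go refl
      where
      go : ∀ {x} → fromℕ k ≡ x → after x ≡ closing
      go {x} e with view x
      ... | ‵fromℕ = refl
      ... | ‵inject₁ i = contradiction e fromℕ≢inject₁
    only : ∀ {e} → e ∈ˡ M → Touches (f j) e → e ≡ before j ⊎ e ≡ after j
    only {e} i t with subst (e ∈ˡ_) edges i
    ... | here refl with touches-ends {e = closing} closes t
    ... | inj₁ e = inj₂ (sym (trans (cong after (inj e)) after-last))
    ... | inj₂ e = inj₁ (sym (cong before (inj e)))
    only {e} i t | there i′ with ∈-tabulate⁻ i′
    ... | x , refl with touches-ends {e = steps x} (joins x) t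
    ... | inj₁ e = inj₂ (sym (trans (cong after (inj e)) (after-inject₁ x)))
    ... | inj₂ e = inj₁ (sym (cong before (inj e)))

  rim-touches : ∀ {k} {f : Fin (suc k) → Fin n} {M} → Rim f M → ∀ {e u} → e ∈ˡ M → Touches u e → ∃ λ j → u ≡ f j
  rim-touches {k} R {e} {u} i t with subst (e ∈ˡ_) (Rim.edges R) i
  ... | here refl = [ (λ e → fromℕ k , e) , (λ e → zero , e) ]′ (touches-ends {e = Rim.closing R} (Rim.closes R) t)
  ... | there i′ with ∈-tabulate⁻ i′
  ... | x , refl = [ (λ e → inject₁ x , e) , (λ e → suc x , e) ]′ (touches-ends {e = Rim.steps R x} (Rim.joins R x) t)

  module _ (M : MultiGraph n Kind) (distinct : AllPairs DistinctLabels M)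
           (l r : Fin 3 → Fin n) (m : Fin 3 → Edge n Kind)
           (m∈ : ∀ i → m i ∈ˡ M) (m-joins : ∀ i → Joins (l i) (r i) (m i))
           (m-labels : ∀ {i j ℓ} → label (m i) ≡ virtual ℓ → label (m j) ≡ virtual ℓ → i ≡ j)
           (r-inj : ∀ {i j} → r i ≡ r j → i ≡ j) (l≢r : ∀ {i j} → l i ≢ r j)
           (classify : ∀ {e} → e ∈ˡ M → (∃ λ i → e ≡ m i) ⊎
              (label e ≡ real × ((∃₂ λ i j → i ≢ j × Joins (l i) (l j) e) ⊎ (∃₂ λ i j → i ≢ j × Joins (r i) (r j) e)))) where

    private
      -- A real matching edge has no subdividing vertex of its own, so the middle vertex of the
      -- prism joins the branch set of the left end.
      owner : Fin 3 → Point n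
      owner i with label (m i)
      ... | real = inj₁ (l i)
      ... | virtual ℓ = inj₂ ℓ
      owner-real : ∀ {i} → label (m i) ≡ real → owner i ≡ inj₁ (l i)
      owner-real {i} e rewrite e = refl
      owner-virtual : ∀ {i ℓ} → label (m i) ≡ virtual ℓ → owner i ≡ inj₂ ℓ
      owner-virtual {i} e rewrite e = refl
      owner-cases : ∀ i → (label (m i) ≡ real) ⊎ (∃ λ ℓ → label (m i) ≡ virtual ℓ)
      owner-cases i with label (m i)
      ... | real = inj₁ refl
      ... | virtual ℓ = inj₂ (ℓ , refl)
      φ : Prism → Maybe (Point n)
      φ (left i) = just (inj₁ (l i))
      φ (mid i) = just (owner i)
      φ (right i) = just (inj₁ (r i))

      owner⁻ : ∀ {i u} → owner i ≡ inj₁ u → l i ≡ u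
      owner⁻ {i} e with owner-cases i
      ... | inj₁ p = inj₁-injective (trans (sym (owner-real {i} p)) e)
      ... | inj₂ (ℓ , p) = case trans (sym e) (owner-virtual {i} p) of λ ()

      lefts : ∀ {x i j} → φ (left i) ≡ just x → φ (left j) ≡ just x → Star (Inside PrismEdge φ x) (left i) (left j)
      lefts {i = i} {j} p q with i ≟ᶠ j
      ... | yes refl = ε
      ... | no ne = (ll ne , p , q) ◅ ε

      mid-left : ∀ {x i} → φ (mid i) ≡ just x → ∀ {u} → x ≡ inj₁ u → φ (left i) ≡ just x
      mid-left {i = i} refl e = cong just (trans (cong inj₁ (owner⁻ {i} e)) (sym e))

      -- Each branch set is joined to the left vertex it contains, if any.
      conn : ∀ {v w x} → φ v ≡ just x → φ w ≡ just x → Star (Inside PrismEdge φ x) v w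
      conn {left i} {left j} p q = lefts {i = i} {j} p q
      conn {left i} {mid j} refl q = let q′ = mid-left {i = j} q refl in lefts {i = i} {j} refl q′ ◅◅ (lm , q′ , q) ◅ ε
      conn {left i} {right j} p q = contradiction (inj₁-injective (just-injective (trans p (sym q)))) l≢r
      conn {mid i} {left j} p refl = let p′ = mid-left {i = i} p refl in (ml , p , p′) ◅ lefts {i = i} {j} p′ refl
      conn {mid i} {mid j} p q with owner-cases i
      ... | inj₁ e = let x = sym (trans (sym (cong just (owner-real {i} e))) p)
                         p′ = mid-left {i = i} p (just-injective x)
                         q′ = mid-left {i = j} q (just-injective x) in
                     (ml , p , p′) ◅ lefts {i = i} {j} p′ q′ ◅◅ (lm , q′ , q) ◅ ε
      ... | inj₂ (ℓ , e) with owner-cases j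
      ... | inj₁ e′ = case trans (trans (sym (owner-virtual {i} e)) (just-injective (trans p (sym q)))) (owner-real {j} e′) of λ ()
      ... | inj₂ (ℓ′ , e′) with m-labels {i} {j} e (trans e′ (cong virtual (inj₂-injective
              (trans (trans (sym (owner-virtual {j} e′)) (just-injective (trans q (sym p)))) (owner-virtual {i} e)))))
      ... | refl = ε
      conn {mid i} {right j} p q = contradiction
        (owner⁻ {i} (just-injective (trans p (sym q)))) l≢r
      conn {right i} {left j} p q = contradiction (inj₁-injective (just-injective (trans q (sym p)))) l≢r
      conn {right i} {mid j} p q = contradiction (owner⁻ {j} (just-injective (trans q (sym p)))) l≢r
      conn {right i} {right j} p q with r-inj (inj₁-injective (just-injective (trans p (sym q))))
      ... | refl = ε

      Realised : Point n → Point n → Set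
      Realised s t = ∃₂ λ v w → φ v ≡ just s × φ w ≡ just t × PrismEdge v w

      at : ∀ i {u} → Touches u (m i) → label (m i) ≢ real → Realised (inj₁ u) (owner i) × Realised (owner i) (inj₁ u)
      at i t _ with touches-ends {e = m i} (m-joins i) t
      ... | inj₁ refl = (left i , mid i , refl , refl , lm) , (mid i , left i , refl , refl , ml)
      ... | inj₂ refl = (right i , mid i , refl , refl , rm) , (mid i , right i , refl , refl , mr)

      realised : ∀ {e s t} → e ∈ˡ M → Link e s t → Realised s t
      realised i l′ with classify i
      realised i (enter {u} {ℓ} p t) | inj₁ (c , refl) =
        subst (Realised (inj₁ u)) (owner-virtual {c} p) (proj₁ (at c t λ q → case trans (sym p) q of λ ()))
      realised i (leave {u} {ℓ} p t) | inj₁ (c , refl) =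
        subst (λ s → Realised s (inj₁ u)) (owner-virtual {c} p) (proj₂ (at c t λ q → case trans (sym p) q of λ ()))
      realised i (direct p j) | inj₁ (c , refl) with orient {e = m c} (m-joins c) j
        where
        orient : ∀ {a b u v} {e : Edge n Kind} → Joins a b e → Joins u v e → (u ≡ a × v ≡ b) ⊎ (u ≡ b × v ≡ a)
        orient (inj₁ (refl , refl)) (inj₁ (refl , refl)) = inj₁ (refl , refl)
        orient (inj₁ (refl , refl)) (inj₂ (refl , refl)) = inj₂ (refl , refl)
        orient (inj₂ (refl , refl)) (inj₁ (refl , refl)) = inj₂ (refl , refl)
        orient (inj₂ (refl , refl)) (inj₂ (refl , refl)) = inj₁ (refl , refl)
      ... | inj₁ (refl , refl) = mid c , right c , cong just (owner-real {c} p) , refl , mr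
      ... | inj₂ (refl , refl) = right c , mid c , refl , cong just (owner-real {c} p) , rm
      realised i (enter p t) | inj₂ (q , _) = case trans (sym p) q of λ ()
      realised i (leave p t) | inj₂ (q , _) = case trans (sym p) q of λ ()
      realised i (direct p (inj₁ (refl , refl))) | inj₂ (_ , inj₁ (a , b , ne , inj₁ (refl , refl))) = left a , left b , refl , refl , ll ne
      realised i (direct p (inj₁ (refl , refl))) | inj₂ (_ , inj₁ (a , b , ne , inj₂ (refl , refl))) = left b , left a , refl , refl , ll (ne ∘ sym)
      realised i (direct p (inj₂ (refl , refl))) | inj₂ (_ , inj₁ (a , b , ne , inj₁ (refl , refl))) = left b , left a , refl , refl , ll (ne ∘ sym)
      realised i (direct p (inj₂ (refl , refl))) | inj₂ (_ , inj₁ (a , b , ne , inj₂ (refl , refl))) = left a , left b , refl , refl , ll ne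
      realised i (direct p (inj₁ (refl , refl))) | inj₂ (_ , inj₂ (a , b , ne , inj₁ (refl , refl))) = right a , right b , refl , refl , rr ne
      realised i (direct p (inj₁ (refl , refl))) | inj₂ (_ , inj₂ (a , b , ne , inj₂ (refl , refl))) = right b , right a , refl , refl , rr (ne ∘ sym)
      realised i (direct p (inj₂ (refl , refl))) | inj₂ (_ , inj₂ (a , b , ne , inj₁ (refl , refl))) = right b , right a , refl , refl , rr (ne ∘ sym)
      realised i (direct p (inj₂ (refl , refl))) | inj₂ (_ , inj₂ (a , b , ne , inj₂ (refl , refl))) = right a , right b , refl , refl , rr ne

    prism-model : Model (Hat M) PrismEdge
    prism-model = record
      { φ = φ
      ; conn = λ {v} {w} p q → conn {v} {w} p q
      ; edges = λ h → let (e , i , l′) = find h in realised i l′ }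

  labels-apart : ∀ (m : Fin 3 → Edge n Kind) → AllPairs DistinctLabels (m 0F ∷ m 1F ∷ m 2F ∷ []) →
                 ∀ {i j ℓ} → label (m i) ≡ virtual ℓ → label (m j) ≡ virtual ℓ → i ≡ j
  labels-apart m ((a ∷ b ∷ []) ∷ (c ∷ []) ∷ _) {i} {j} p q = go i j p q
    where
    go : ∀ i j {ℓ} → label (m i) ≡ virtual ℓ → label (m j) ≡ virtual ℓ → i ≡ j
    go 0F 0F _ _ = refl
    go 1F 1F _ _ = refl
    go 2F 2F _ _ = refl
    go 0F 1F p q = contradiction q (a p)
    go 0F 2F p q = contradiction q (b p)
    go 1F 2F p q = contradiction q (c p)
    go 1F 0F p q = contradiction p (a q)
    go 2F 0F p q = contradiction p (b q)
    go 2F 1F p q = contradiction p (c q)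

  permits-real : ∀ {x : Kind} → Permits must-be-real x → x ≡ real
  permits-real real = refl

  hat-↭ : ∀ {M N : MultiGraph n Kind} → M ↭ N → Model (Hat M) (Hat N)
  hat-↭ p = id-model (Any-resp-↭ p)

  allowed-excludes : ∀ {k} {K : Graph k} → Excluded K → ∀ {H : MultiGraph n Kind} → AllPairs DistinctLabels H →
                     Allowed H → Model (Graph._~_ K) (Hat H) → ⊥
  allowed-excludes X distinct (is-cycle {zero} () _)
  allowed-excludes X distinct (is-cycle {suc k} _ (f , inj , H′ , perm , pw)) M =
    thin-excludes X (labels-↭ perm distinct) thin (M ⨾ hat-↭ perm)
    where
    R = rim {f = f} id pw
    -- Any vertex of a cycle can play the hub, since all degrees are two already.
    thin : Thin H′ (f zero)
    thin u _ with any? (λ j → u ≟ᶠ f j)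
    ... | yes (j , refl) = let (e₁ , e₂ , only) = rim-degree inj R j in e₁ , e₂ , λ i t → Sum.map₂ inj₁ (only i t)
    -- No edge touches u, so the two edges named here are arbitrary.
    ... | no ¬any = edge u u real , edge u u real , λ i t → contradiction (rim-touches R i t) ¬any
  allowed-excludes {K = K} X distinct (is-multiedge {k} _ (f , _ , H′ , perm , pw)) M =
    vertex-cover-excludes {K = K} (M ⨾ hat-↭ perm) uncovered (inj₁ (f 0F)) (inj₁ (f 1F)) covered
    where
    open Excluded X
    ends : ∀ {k H′} → Pointwise (λ e t → Joins (f (end₁ t)) (f (end₂ t)) e × Permits (label t) (label e)) H′ (multiedge k) →
           ∀ {e} → e ∈ˡ H′ → Joins (f 0F) (f 1F) e
    ends {suc k} ((j , _) ∷ _) (here refl) = j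
    ends {suc k} (_ ∷ p) (there i) = ends p i
    covered : ∀ {s t} → Hat H′ s t → s ≡ inj₁ (f 0F) ⊎ s ≡ inj₁ (f 1F) ⊎ t ≡ inj₁ (f 0F) ⊎ t ≡ inj₁ (f 1F)
    covered h with find h
    ... | e , i , direct p q = [ (λ x → inj₁ (cong inj₁ x)) , (λ x → inj₂ (inj₁ (cong inj₁ x))) ]′
                                 (touches-ends {e = e} (ends pw i) (proj₁ (joins-touches {e = e} q)))
    ... | e , i , enter p t = [ (λ x → inj₁ (cong inj₁ x)) , (λ x → inj₂ (inj₁ (cong inj₁ x))) ]′
                                 (touches-ends {e = e} (ends pw i) t)
    ... | e , i , leave p t = inj₂ (inj₂ ([ (λ x → inj₁ (cong inj₁ x)) , (λ x → inj₂ (cong inj₁ x)) ]′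
                                 (touches-ends {e = e} (ends pw i) t)))
  allowed-excludes X distinct (is-wheel {zero} () _)
  allowed-excludes X distinct (is-wheel {suc k} _ (f , inj , H′ , perm , pw)) M
    with pointwise-++⁻ (map (λ (i , j) → edge (suc i) (suc j) may-be-virtual) (cyclePairs (suc k))) pw
  ... | rims , spokes , refl , pr , ps =
    thin-excludes X (labels-↭ perm distinct) thin (M ⨾ hat-↭ perm)
    where
    R = rim {f = f} suc pr
    spoke : ∀ {e} → e ∈ˡ spokes → ∃ λ i → Joins (f zero) (f (suc i)) e × label e ≡ real
    spoke i with pointwise-tabulate⁻ {g = λ i → edge zero (suc i) must-be-real} (subst (Pointwise _ _) (ListP.map-tabulate {n = suc k} (λ i → i) (λ i → edge zero (suc i) must-be-real)) ps)
    ... | es , refl , js with ∈-tabulate⁻ {f = es} i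
    ... | x , refl = x , proj₁ (js x) , permits-real (proj₂ (js x))
    to-hub : ∀ {e u} → u ≢ f zero → e ∈ˡ spokes → Touches u e → label e ≡ real × Joins u (f zero) e
    to-hub {e} ne i t with spoke i
    ... | x , j , p with touches-ends {e = e} j t
    ... | inj₁ q = contradiction q ne
    ... | inj₂ refl = p , joins-sym {e = e} j
    thin : Thin (rims ++ spokes) (f zero)
    thin u u≢h with any? (λ j → u ≟ᶠ f (suc j))
    ... | yes (j , refl) = let (e₁ , e₂ , only) = rim-degree (suc-injective ∘ inj) R j in
      e₁ , e₂ , λ i t → case ∈-++⁻ rims i of λ
        { (inj₁ i′) → Sum.map₂ inj₁ (only i′ t) ; (inj₂ i′) → inj₂ (inj₂ (to-hub u≢h i′ t)) }
    ... | no ¬any = edge u u real , edge u u real , λ i t → case ∈-++⁻ rims i of λ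
        { (inj₁ i′) → contradiction (rim-touches R i′ t) ¬any ; (inj₂ i′) → inj₂ (inj₂ (to-hub u≢h i′ t)) }
  allowed-excludes X distinct (is-W₃ (f , inj , H′ , perm , (j₀ , p₀) ∷ (j₁ , p₁) ∷ (j₂ , p₂) ∷ (s₀ , q₀) ∷ (s₁ , q₁) ∷ (s₂ , q₂) ∷ [])) M =
    -- The constant map contracts the left triangle to the hub; the rim is the right triangle.
    Excluded.no-prism X (M ⨾ hat-↭ perm ⨾ prism-model _ distinct′ (λ _ → f 0F) (λ i → f (suc i)) m
      m∈ (λ { 0F → s₀ ; 1F → s₁ ; 2F → s₂ }) m-labels (λ e → suc-injective (inj e)) (λ e → case inj e of λ ()) classify)
    where
    distinct′ = labels-↭ perm distinct
    m : Fin 3 → Edge n Kind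
    m 0F = _
    m 1F = _
    m 2F = _
    m∈ : ∀ i → m i ∈ˡ H′
    m∈ 0F = there (there (there (here refl)))
    m∈ 1F = there (there (there (there (here refl))))
    m∈ 2F = there (there (there (there (there (here refl)))))
    apart : AllPairs DistinctLabels (m 0F ∷ m 1F ∷ m 2F ∷ [])
    apart = AllPairs.tail (AllPairs.tail (AllPairs.tail distinct′))
    m-labels : ∀ {i j ℓ} → label (m i) ≡ virtual ℓ → label (m j) ≡ virtual ℓ → i ≡ j
    m-labels {i} {j} = labels-apart m apart {i} {j}
    classify : ∀ {e} → e ∈ˡ H′ → _
    classify (here refl) = inj₂ (permits-real p₀ , inj₂ (2F , 0F , (λ ()) , j₀))
    classify (there (here refl)) = inj₂ (permits-real p₁ , inj₂ (0F , 1F , (λ ()) , j₁))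
    classify (there (there (here refl))) = inj₂ (permits-real p₂ , inj₂ (1F , 2F , (λ ()) , j₂))
    classify (there (there (there (here refl)))) = inj₁ (0F , refl)
    classify (there (there (there (there (here refl))))) = inj₁ (1F , refl)
    classify (there (there (there (there (there (here refl)))))) = inj₁ (2F , refl)
  allowed-excludes X distinct (is-prism (f , inj , H′ , perm , (j₀ , p₀) ∷ (j₁ , p₁) ∷ (j₂ , p₂) ∷ (j₃ , p₃) ∷ (j₄ , p₄) ∷ (j₅ , p₅) ∷ (s₀ , q₀) ∷ (s₁ , q₁) ∷ (s₂ , q₂) ∷ [])) M =
    Excluded.no-prism X (M ⨾ hat-↭ perm ⨾ prism-model _ distinct′ (f ∘ lo) (f ∘ hi) m
      m∈ (λ { 0F → s₀ ; 1F → s₁ ; 2F → s₂ }) m-labels (hi-inj ∘ inj) (λ {i} {j} e → lo≢hi i j (inj e)) classify)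
    where
    distinct′ = labels-↭ perm distinct
    lo hi : Fin 3 → Fin 6
    lo 0F = 0F
    lo 1F = 1F
    lo 2F = 2F
    hi 0F = 3F
    hi 1F = 4F
    hi 2F = 5F
    hi-inj : ∀ {i j} → hi i ≡ hi j → i ≡ j
    hi-inj {0F} {0F} _ = refl
    hi-inj {0F} {1F} ()
    hi-inj {0F} {2F} ()
    hi-inj {1F} {0F} ()
    hi-inj {1F} {1F} _ = refl
    hi-inj {1F} {2F} ()
    hi-inj {2F} {0F} ()
    hi-inj {2F} {1F} ()
    hi-inj {2F} {2F} _ = refl
    lo≢hi : ∀ i j → lo i ≢ hi j
    lo≢hi 0F 0F ()
    lo≢hi 0F 1F ()
    lo≢hi 0F 2F ()
    lo≢hi 1F 0F ()
    lo≢hi 1F 1F ()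
    lo≢hi 1F 2F ()
    lo≢hi 2F 0F ()
    lo≢hi 2F 1F ()
    lo≢hi 2F 2F ()
    m : Fin 3 → Edge n Kind
    m 0F = _
    m 1F = _
    m 2F = _
    m∈ : ∀ i → m i ∈ˡ H′
    m∈ 0F = there (there (there (there (there (there (here refl))))))
    m∈ 1F = there (there (there (there (there (there (there (here refl)))))))
    m∈ 2F = there (there (there (there (there (there (there (there (here refl))))))))
    apart : AllPairs DistinctLabels (m 0F ∷ m 1F ∷ m 2F ∷ [])
    apart = AllPairs.tail (AllPairs.tail (AllPairs.tail (AllPairs.tail (AllPairs.tail (AllPairs.tail distinct′)))))
    m-labels : ∀ {i j ℓ} → label (m i) ≡ virtual ℓ → label (m j) ≡ virtual ℓ → i ≡ j
    m-labels {i} {j} = labels-apart m apart {i} {j}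
    classify : ∀ {e} → e ∈ˡ H′ → _
    classify (here refl) = inj₂ (permits-real p₀ , inj₁ (0F , 1F , (λ ()) , j₀))
    classify (there (here refl)) = inj₂ (permits-real p₁ , inj₁ (1F , 2F , (λ ()) , j₁))
    classify (there (there (here refl))) = inj₂ (permits-real p₂ , inj₁ (2F , 0F , (λ ()) , j₂))
    classify (there (there (there (here refl)))) = inj₂ (permits-real p₃ , inj₂ (0F , 1F , (λ ()) , j₃))
    classify (there (there (there (there (here refl))))) = inj₂ (permits-real p₄ , inj₂ (1F , 2F , (λ ()) , j₄))
    classify (there (there (there (there (there (here refl)))))) = inj₂ (permits-real p₅ , inj₂ (2F , 0F , (λ ()) , j₅))
    classify (there (there (there (there (there (there (here refl))))))) = inj₁ (0F , refl)
    classify (there (there (there (there (there (there (there (here refl)))))))) = inj₁ (1F , refl)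
    classify (there (there (there (there (there (there (there (there (here refl))))))))) = inj₁ (2F , refl)

-- Splittings

module _ {n : ℕ} {R : Fin n → Fin n → Set} (R? : ∀ x y → Dec (R x y)) where

  record Component (u : Fin n) : Set where
    field
      members : Subset n
      root    : u ∈ members
      reached : ∀ {y} → y ∈ members → Star R u y
      closed  : ∀ {y z} → y ∈ members → R y z → z ∈ members

    closed* : ∀ {y z} → y ∈ members → Star R y z → z ∈ members
    closed* i ε = i
    closed* i (r ◅ st) = closed* (closed i r) st

  -- Reachability is decided by enlarging {u} along edges that leave the set; the number of vertices
  -- outside decreases.
  component : ∀ u → Component u
  component u = grow ⁅ u ⁆ (x∈⁅x⁆ u) (λ i → subst (Star R u) (sym (x∈⁅y⁆⇒x≡y u i)) ε) (<-wellFounded _)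
    where
    grow : ∀ C → u ∈ C → (∀ {y} → y ∈ C → Star R u y) → Acc _<_ (n ∸ ∣ C ∣) → Component u
    grow C root reached (acc rec) with any? (λ y → any? λ z → (y ∈? C) ×-dec ¬? (z ∈? C) ×-dec R? y z)
    ... | no h = record
      { members = C ; root = root ; reached = reached
      ; closed = λ {y} {z} i r → decidable-stable (z ∈? C) λ z∉ → h (y , z , i , z∉ , r) }
    ... | yes (y , z , y∈ , z∉ , r) = grow (⁅ z ⁆ ∪ C) (x∈p∪q⁺ (inj₂ root)) reached′
      (rec (∸-monoʳ-< bigger (∣p∣≤n (⁅ z ⁆ ∪ C))))
      where
      bigger : ∣ C ∣ < ∣ ⁅ z ⁆ ∪ C ∣
      bigger = p⊂q⇒∣p∣<∣q∣ ((λ i → x∈p∪q⁺ (inj₂ i)) , z , x∈p∪q⁺ (inj₁ (x∈⁅x⁆ z)) , z∉)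
      reached′ : ∀ {w} → w ∈ ⁅ z ⁆ ∪ C → Star R u w
      reached′ i with x∈p∪q⁻ ⁅ z ⁆ C i
      ... | inj₁ j = subst (Star R u) (sym (x∈⁅y⁆⇒x≡y z j)) (reached y∈ ◅◅ r ◅ ε)
      ... | inj₂ j = reached j

module _ {n : ℕ} {L : Set} where

  step? : ∀ X (M : MultiGraph n L) u v → Dec (StepAvoiding X M u v)
  step? X M u v = ¬? (u ∈? X) ×-dec ¬? (v ∈? X) ×-dec Any.any? (joins? u v) M

  joined-touches : ∀ {M : MultiGraph n L} {u v} → Any (Joins u v) M → Any (Touches u) M × Any (Touches v) M
  joined-touches j = Any.map (λ {e} → proj₁ ∘ joins-touches {e = e}) j , Any.map (λ {e} → proj₂ ∘ joins-touches {e = e}) j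

  star-avoids : ∀ {X} {M : MultiGraph n L} {u v} → u ∉ X → Star (StepAvoiding X M) u v → v ∉ X
  star-avoids u∉ ε = u∉
  star-avoids _ ((_ , v∉ , _) ◅ st) = star-avoids v∉ st

  star-touches : ∀ {X} {M : MultiGraph n L} {u v} → Any (Touches u) M → Star (StepAvoiding X M) u v → Any (Touches v) M
  star-touches t ε = t
  star-touches _ ((_ , _ , j) ◅ st) = star-touches (proj₂ (joined-touches j)) st

  outside-vertex : ∀ {e : Edge n L} {a b} → end₁ e ≢ end₂ e → ¬ Joins a b e → ∃ λ w → Touches w e × w ≢ a × w ≢ b
  outside-vertex {e} {a} {b} loop nj with end₁ e ≟ᶠ a | end₁ e ≟ᶠ b | end₂ e ≟ᶠ a | end₂ e ≟ᶠ b
  ... | no p | no q | _ | _ = end₁ e , inj₁ refl , p , q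
  ... | _ | _ | no p | no q = end₂ e , inj₂ refl , p , q
  ... | yes p | _ | yes q | _ = contradiction (trans p (sym q)) loop
  ... | yes p | _ | no _ | yes q = contradiction (inj₁ (p , q)) nj
  ... | no _ | yes p | _ | yes q = contradiction (trans p (sym q)) loop
  ... | no _ | yes p | yes q | no _ = contradiction (inj₂ (p , q)) nj

  NonParallel : Edge n L → Edge n L → Set
  NonParallel e e′ = ¬ Parallel e e′

  parallel-sym : ∀ {e e′ : Edge n L} → Parallel e e′ → Parallel e′ e
  parallel-sym (inj₁ (refl , refl)) = inj₁ (refl , refl)
  parallel-sym (inj₂ (refl , refl)) = inj₂ (refl , refl)

  joins-parallel : ∀ {u v} {e e′ : Edge n L} → Joins u v e → Joins u v e′ → Parallel e e′
  joins-parallel (inj₁ (refl , refl)) (inj₁ (refl , refl)) = inj₁ (refl , refl)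
  joins-parallel (inj₁ (refl , refl)) (inj₂ (refl , refl)) = inj₂ (refl , refl)
  joins-parallel (inj₂ (refl , refl)) (inj₁ (refl , refl)) = inj₂ (refl , refl)
  joins-parallel (inj₂ (refl , refl)) (inj₂ (refl , refl)) = inj₁ (refl , refl)

  parallel-joins : ∀ {u v} {e e′ : Edge n L} → Parallel e e′ → Joins u v e′ → Joins u v e
  parallel-joins (inj₁ (refl , refl)) j = j
  parallel-joins (inj₂ (refl , refl)) j = Sum.swap (Sum.map Product.swap Product.swap j)

module _ {n : ℕ} where

  RealParallelFree : Edge n Kind → Edge n Kind → Set
  RealParallelFree e e′ = label e ≡ real → label e′ ≡ real → ¬ Parallel e e′

  -- The invariant of all pieces after k splittings. The bound makes k a fresh label. Parallel edges
  -- may arise, but never two real ones.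
  record Sound (k : ℕ) (H : MultiGraph n Kind) : Set where
    field
      loopless : All (λ e → end₁ e ≢ end₂ e) H
      reals    : AllPairs RealParallelFree H
      labels   : AllPairs DistinctLabels H
      bounded  : All (λ e → ∀ ℓ → label e ≡ virtual ℓ → ℓ < k) H
      two-conn : Unseparated 2 H

  realParallelFree-sym : Symmetric RealParallelFree
  realParallelFree-sym {e} {e′} f p q r = f q p (parallel-sym {e = e′} {e} r)

  splits-sym : ∀ {a b} {H E₁ E₂ : MultiGraph n Kind} → SplitsAlong a b H E₁ E₂ → SplitsAlong a b H E₂ E₁
  splits-sym {E₁ = E₁} {E₂} s = record
    { partition = ↭-trans partition (++-comm E₁ E₂) ; size₁ = size₂ ; size₂ = size₁ ; distinct = distinct
    ; separates = trans (∩-comm (vertices E₂) (vertices E₁)) separates }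
    where open SplitsAlong s

  vertices-resp : ∀ {M N : MultiGraph n Kind} → M ↭ N → ∀ {x} → x ∈ vertices M → x ∈ vertices N
  vertices-resp p = subst (_ ∈_) (vertices-↭ p)

  module _ {a b} {H E₁ E₂ : MultiGraph n Kind} (s : SplitsAlong a b H E₁ E₂) where
    open SplitsAlong s

    splits-shared : ∀ {x} → Any (Touches x) E₁ → Any (Touches x) E₂ → x ≡ a ⊎ x ≡ b
    splits-shared p q with x∈p∪q⁻ ⁅ a ⁆ ⁅ b ⁆ (subst (_ ∈_) separates (x∈p∩q⁺ (∈-vertices⁺ p , ∈-vertices⁺ q)))
    ... | inj₁ i = inj₁ (x∈⁅y⁆⇒x≡y a i)
    ... | inj₂ i = inj₂ (x∈⁅y⁆⇒x≡y b i)

    splits-ends : (Any (Touches a) E₁ × Any (Touches a) E₂) × (Any (Touches b) E₁ × Any (Touches b) E₂)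
    splits-ends = both (x∈p∪q⁺ (inj₁ (x∈⁅x⁆ a))) , both (x∈p∪q⁺ (inj₂ (x∈⁅x⁆ b)))
      where
      both : ∀ {x} → x ∈ ⁅ a ⁆ ∪ ⁅ b ⁆ → Any (Touches x) E₁ × Any (Touches x) E₂
      both i with x∈p∩q⁻ (vertices E₁) (vertices E₂) (subst (_ ∈_) (sym separates) i)
      ... | p , q = ∈-vertices⁻ E₁ p , ∈-vertices⁻ E₂ q

  module _ {a b k} {H E₁ E₂ : MultiGraph n Kind} (S : Sound k H) (s : SplitsAlong a b H E₁ E₂) where
    open SplitsAlong s
    private
      module S = Sound S
      split-shared = splits-shared s
      split-ends = splits-ends s

    labels-++ : AllPairs DistinctLabels (E₁ ++ E₂)
    labels-++ = labels-↭ partition S.labels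

    reals-++ : AllPairs RealParallelFree (E₁ ++ E₂)
    reals-++ = allPairs-resp-↭ (λ {e} {e′} → realParallelFree-sym {e} {e′}) partition S.reals

    loopless-++ : All (λ e → end₁ e ≢ end₂ e) (E₁ ++ E₂)
    loopless-++ = All-resp-↭ partition S.loopless

    bounded-++ : All (λ e → ∀ ℓ → label e ≡ virtual ℓ → ℓ < k) (E₁ ++ E₂)
    bounded-++ = All-resp-↭ partition S.bounded

    split-glue : Glue E₁ E₂ a b k
    split-glue = record
      { a≢b = distinct
      ; a∈₁ = proj₁ (proj₁ split-ends) ; b∈₁ = proj₁ (proj₂ split-ends)
      ; a∈₂ = proj₂ (proj₁ split-ends) ; b∈₂ = proj₂ (proj₂ split-ends)
      ; shared = split-shared
      ; labels = λ p q → let (e , i , x) = find p ; (e′ , j , y) = find q in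
          All.lookup (All.lookup (cross E₁ labels-++) i) j x y
      ; fresh₁ = λ p → let (e , i , x) = find p in <-irrefl refl (All.lookup bounded-++ (∈-++⁺ˡ i) _ x)
      ; fresh₂ = λ p → let (e , i , x) = find p in <-irrefl refl (All.lookup bounded-++ (∈-++⁺ʳ E₁ i) _ x)
      }
      where
      cross : ∀ E {F} → AllPairs DistinctLabels (E ++ F) → All (λ e → All (DistinctLabels e) F) E
      cross [] _ = []
      cross (e ∷ E) (p ∷ ps) = AllP.++⁻ʳ E p ∷ cross E ps

    private
      v = edge a b (virtual k)

      on₁ : ∀ {x} → Any (Touches x) (v ∷ E₁) → Any (Touches x) E₁
      on₁ (here (inj₁ refl)) = proj₁ (proj₁ split-ends)
      on₁ (here (inj₂ refl)) = proj₁ (proj₂ split-ends)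
      on₁ (there p) = p

      -- A path through E₂ between two vertices of E₁ is replaced by the virtual edge.
      detour : Unseparated 2 (v ∷ E₁)
      detour X small x y x∈ y∈ x∉ y∉ = go ax x∉ ε (inj₁ refl) (S.two-conn X small x y (inH ax) (inH ay) x∉ y∉)
        where
        ax = on₁ (∈-vertices⁻ (v ∷ E₁) x∈)
        ay = on₁ (∈-vertices⁻ (v ∷ E₁) y∈)
        inH : ∀ {z} → Any (Touches z) E₁ → z ∈ vertices H
        inH p = vertices-resp (↭-sym partition) (∈-vertices⁺ (AnyP.++⁺ˡ p))
        Path = Star (StepAvoiding X (v ∷ E₁))
        shortcut : ∀ {c t} → Any (Touches c) E₁ → Any (Touches c) E₂ → Any (Touches t) E₁ → Any (Touches t) E₂ →
                   c ∉ X → t ∉ X → Path c t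
        shortcut ac bc at bt c∉ t∉ with split-shared ac bc | split-shared at bt
        ... | inj₁ refl | inj₁ refl = ε
        ... | inj₂ refl | inj₂ refl = ε
        ... | inj₁ refl | inj₂ refl = (c∉ , t∉ , here (inj₁ (refl , refl))) ◅ ε
        ... | inj₂ refl | inj₁ refl = (c∉ , t∉ , here (inj₂ (refl , refl))) ◅ ε
        go : ∀ {c s} → Any (Touches c) E₁ → c ∉ X → Path x c →
             c ≡ s ⊎ (Any (Touches c) E₂ × ¬ Any (Touches s) E₁) → Star (StepAvoiding X H) s y → Path x y
        go ac c∉ st (inj₁ refl) ε = st
        go ac c∉ st (inj₂ (_ , na)) ε = contradiction ay na
        go {c} ac c∉ st j (_◅_ {j = t} (s∉ , t∉ , p) w) with AnyP.++⁻ E₁ (Any-resp-↭ partition p)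
        ... | inj₁ e₁ with j
        ... | inj₁ refl = go (proj₂ (joined-touches e₁)) t∉ (st ◅◅ (s∉ , t∉ , there e₁) ◅ ε) (inj₁ refl) w
        ... | inj₂ (_ , na) = contradiction (proj₁ (joined-touches e₁)) na
        go {c} ac c∉ st j (_◅_ {j = t} (s∉ , t∉ , p) w) | inj₂ e₂ with Any.any? (touches? t) E₁
        ... | yes at = go at t∉ (st ◅◅ shortcut ac bc at (proj₂ (joined-touches e₂)) c∉ t∉) (inj₁ refl) w
          where bc = [ (λ { refl → proj₁ (joined-touches e₂) }) , proj₁ ]′ j
        ... | no na = go ac c∉ st (inj₂ ([ (λ { refl → proj₁ (joined-touches e₂) }) , proj₁ ]′ j , na)) w

    split-sound : Sound (suc k) (v ∷ E₁)
    split-sound = record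
      { loopless = distinct ∷ AllP.++⁻ˡ E₁ loopless-++
      ; reals = All.tabulate (λ _ ()) ∷ left-part reals-++
      ; labels = All.tabulate (λ i → λ { refl q → <-irrefl refl (All.lookup bounded-++ (∈-++⁺ˡ i) _ q) }) ∷ left-part labels-++
      ; bounded = (λ { _ refl → ≤-refl }) ∷ All.map (λ f ℓ p → m≤n⇒m≤1+n (f ℓ p)) (AllP.++⁻ˡ E₁ bounded-++)
      ; two-conn = detour
      }
      where
      left-part : ∀ {R : Edge n Kind → Edge n Kind → Set} {E} → AllPairs R (E ++ E₂) → AllPairs R E
      left-part {E = []} _ = []
      left-part {E = e ∷ E} (p ∷ ps) = AllP.++⁻ˡ E p ∷ left-part ps

    -- A connected set beyond the splitting that is adjacent to a and to b, to serve as branch set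
    -- of the new subdividing vertex. A set is easier to supply than a path, since no route has to
    -- be chosen.
    record Bypass : Set₁ where
      field
        P    : Point n → Set
        P?   : ∀ s → Dec (P s)
        off  : ∀ {s} → P s → ¬ OnM E₁ s
        conn : ∀ {s t} → P s → P t → Star (λ s t → Hat E₂ s t × P s × P t) s t
        at-a : ∃ λ p → P p × Hat E₂ (inj₁ a) p
        at-b : ∃ λ p → P p × Hat E₂ (inj₁ b) p

    expand : Bypass → Model (Hat (v ∷ E₁)) (Hat (E₁ ++ E₂))
    expand B = record { φ = φ ; conn = conn′ ; edges = edges }
      where
      open Bypass B
      φ : Point n → Maybe (Point n)
      φ s with onM? E₁ s | P? s
      ... | yes _ | _ = just s
      ... | no _ | yes _ = just (inj₂ k)
      ... | no _ | no _ = nothing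
      φ-on : ∀ {s} → OnM E₁ s → φ s ≡ just s
      φ-on {s} o with onM? E₁ s | P? s
      ... | yes _ | _ = refl
      ... | no h | _ = contradiction o h
      φ-P : ∀ {s} → P s → φ s ≡ just (inj₂ k)
      φ-P {s} p with onM? E₁ s | P? s
      ... | yes h | _ = contradiction h (off p)
      ... | no _ | yes _ = refl
      ... | no _ | no h = contradiction p h
      cases : ∀ {s x} → φ s ≡ just x → (OnM E₁ s × s ≡ x) ⊎ (P s × x ≡ inj₂ k)
      cases {s} e with onM? E₁ s | P? s
      ... | yes o | _ = inj₁ (o , just-injective e)
      ... | no _ | yes p = inj₂ (p , sym (just-injective e))
      conn′ : ∀ {s t x} → φ s ≡ just x → φ t ≡ just x → Star (Inside (Hat (E₁ ++ E₂)) φ x) s t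
      conn′ {s} {t} p q with cases {s} p | cases {t} q
      ... | inj₁ (_ , refl) | inj₁ (_ , refl) = ε
      ... | inj₁ (o , refl) | inj₂ (_ , refl) = contradiction o (Glue.fresh₁ split-glue)
      ... | inj₂ (_ , refl) | inj₁ (o , refl) = contradiction o (Glue.fresh₁ split-glue)
      ... | inj₂ (ps , refl) | inj₂ (pt , _) = Star-map (λ (h , a , b) → AnyP.++⁺ʳ E₁ h , φ-P a , φ-P b) (conn ps pt)
      edges : ∀ {x y} → Hat (v ∷ E₁) x y → ∃₂ λ s t → φ s ≡ just x × φ t ≡ just y × Hat (E₁ ++ E₂) s t
      edges (there h) = let (p , q) = hat-on h in _ , _ , φ-on p , φ-on q , AnyP.++⁺ˡ h
      edges (here (enter refl (inj₁ refl))) = let (p , i , h) = at-a in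
        _ , p , φ-on (proj₁ (proj₁ split-ends)) , φ-P i , AnyP.++⁺ʳ E₁ h
      edges (here (enter refl (inj₂ refl))) = let (p , i , h) = at-b in
        _ , p , φ-on (proj₁ (proj₂ split-ends)) , φ-P i , AnyP.++⁺ʳ E₁ h
      edges (here (leave refl (inj₁ refl))) = let (p , i , h) = at-a in
        p , _ , φ-P i , φ-on (proj₁ (proj₁ split-ends)) , AnyP.++⁺ʳ E₁ (hat-sym h)
      edges (here (leave refl (inj₂ refl))) = let (p , i , h) = at-b in
        p , _ , φ-P i , φ-on (proj₁ (proj₂ split-ends)) , AnyP.++⁺ʳ E₁ (hat-sym h)

    private
      isVirtual? : ∀ (e : Edge n Kind) → Dec (∃ λ ℓ → label e ≡ virtual ℓ)
      isVirtual? e with label e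
      ... | real = no λ ()
      ... | virtual ℓ = yes (ℓ , refl)

      not-virtual : ∀ {e : Edge n Kind} → ¬ (∃ λ ℓ → label e ≡ virtual ℓ) → label e ≡ real
      not-virtual {e} h with label e
      ... | real = refl
      ... | virtual ℓ = contradiction (ℓ , refl) h

      -- Two edges that both join a and b cannot both be real, and virtual ones are ruled out here;
      -- so among the first two edges of E₂ one has an end other than a and b.
      some-outsider : ¬ Any (λ e → Joins a b e × ∃ λ ℓ → label e ≡ virtual ℓ) E₂ →
                      ∃₂ λ e w → e ∈ˡ E₂ × Touches w e × w ≢ a × w ≢ b
      some-outsider h = go E₂ refl size₂
        where
        go : ∀ F → E₂ ≡ F → 2 ≤ length F → ∃₂ λ e w → e ∈ˡ E₂ × Touches w e × w ≢ a × w ≢ b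
        go (e ∷ []) _ (s≤s ())
        go (e ∷ e′ ∷ F) refl _ with AllP.++⁻ʳ E₁ loopless-++ | joins? a b e | joins? a b e′
        ... | loopless₂ | no nj | _ = let (w , t , p , q) = outside-vertex {e = e} (All.head loopless₂) nj in e , w , here refl , t , p , q
        ... | loopless₂ | yes _ | no nj = let (w , t , p , q) = outside-vertex {e = e′} (All.head (All.tail loopless₂)) nj in e′ , w , there (here refl) , t , p , q
        ... | _ | yes j | yes j′ = contradiction (joins-parallel {e = e} {e′} j j′)
          (All.head (AllPairs.head (right-part E₁ reals-++))
            (not-virtual {e} λ v → h (here (j , v))) (not-virtual {e′} λ v → h (there (here (j′ , v)))))
          where
          right-part : ∀ {R : Edge n Kind → Edge n Kind → Set} E {F} → AllPairs R (E ++ F) → AllPairs R F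
          right-part [] ps = ps
          right-part (e ∷ E) (_ ∷ ps) = right-part E ps

      -- The component of w in E₂ without a and b, together with the subdividing vertices of the
      -- virtual edges that touch it, is connected and off E₁. It is attached to both a and b
      -- because H has no cutvertex.
      component-bypass : ∀ {e w} → e ∈ˡ E₂ → Touches w e → w ≢ a → w ≢ b → Bypass
      component-bypass {e₀} {w} e₀∈ w∈e₀ w≢a w≢b = record
        { P = P ; P? = P? ; off = off ; conn = λ p q → back p ◅◅ Star-reverse flip-step (back q)
        ; at-a = attach (inj₁ refl) ; at-b = attach (inj₂ refl) }
        where
        X = ⁅ a ⁆ ∪ ⁅ b ⁆
        C = component (step? X E₂) w
        open Component C
        ∉X : ∀ x → x ≢ a → x ≢ b → x ∉ X
        ∉X _ p q i = [ (λ j → p (x∈⁅y⁆⇒x≡y a j)) , (λ j → q (x∈⁅y⁆⇒x≡y b j)) ]′ (x∈p∪q⁻ ⁅ a ⁆ ⁅ b ⁆ i)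
        a∈X : a ∈ X
        a∈X = x∈p∪q⁺ (inj₁ (x∈⁅x⁆ a))
        b∈X : b ∈ X
        b∈X = x∈p∪q⁺ (inj₂ (x∈⁅x⁆ b))
        outside : ∀ {y} → y ∈ members → y ∉ X
        outside i = star-avoids (∉X _ w≢a w≢b) (reached i)
        P : Point n → Set
        P (inj₁ y) = y ∈ members
        -- One end in the component is enough, so that virtual edges from the component to a or b
        -- contribute their subdividing vertices too.
        P (inj₂ ℓ) = Any (λ e → label e ≡ virtual ℓ × ∃ λ y → y ∈ members × Touches y e) E₂
        P? : ∀ s → Dec (P s)
        P? (inj₁ y) = y ∈? members
        P? (inj₂ ℓ) = Any.any? (λ e → (label e ≟ᵏ virtual ℓ) ×-dec any? λ y → (y ∈? members) ×-dec touches? y e) E₂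
        in₂ : ∀ {y} → y ∈ members → Any (Touches y) E₂
        in₂ i = star-touches (lose e₀∈ w∈e₀) (reached i)
        not₁ : ∀ {y} → y ∈ members → ¬ Any (Touches y) E₁
        not₁ i o with split-shared o (in₂ i)
        ... | inj₁ refl = outside i a∈X
        ... | inj₂ refl = outside i b∈X
        off : ∀ {s} → P s → ¬ OnM E₁ s
        off {inj₁ y} p = not₁ p
        off {inj₂ ℓ} p o = Glue.labels split-glue o (Any.map proj₁ p)
        Step = λ s t → Hat E₂ s t × P s × P t
        flip-step : ∀ {s t} → Step s t → Step t s
        flip-step (h , p , q) = hat-sym h , q , p
        hop : ∀ {x y e} → e ∈ˡ E₂ → Joins x y e → x ∈ members → y ∈ members → Star Step (inj₁ x) (inj₁ y)
        hop {x} {y} {e} i j mx my with isVirtual? e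
        ... | no h = (lose i (direct (not-virtual {e} h) j) , mx , my) ◅ ε
        ... | yes (ℓ , l) = (lose i (enter l (proj₁ (joins-touches {e = e} j))) , mx , on) ◅
                            (lose i (leave l (proj₂ (joins-touches {e = e} j))) , on , my) ◅ ε
          where on = lose i (l , x , mx , proj₁ (joins-touches {e = e} j))
        along : ∀ {x y} → x ∈ members → Star (StepAvoiding X E₂) x y → Star Step (inj₁ x) (inj₁ y)
        along mx ε = ε
        along mx (s@(_ , _ , j) ◅ st) = let my = closed mx s ; (e , i , j′) = find j in hop i j′ mx my ◅◅ along my st
        back : ∀ {s} → P s → Star Step s (inj₁ w)
        back {inj₁ y} p = Star-reverse flip-step (along root (reached p))
        back {inj₂ ℓ} p with find p
        ... | e , i , l , y , my , t = (lose i (leave l t) , p , my) ◅ Star-reverse flip-step (along root (reached my))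
        attach : ∀ {c} → c ≡ a ⊎ c ≡ b → ∃ λ p → P p × Hat E₂ (inj₁ c) p
        -- With d the other one of a and b, some path from w to c avoids d. It stays in the
        -- component until it enters c.
        attach {c} c∈ = go root (S.two-conn ⁅ d ⁆ (s≤s (≤-reflexive (∣⁅x⁆∣≡1 d))) w c
          (inH (in₂ root)) (inH c∈₂) (λ i → w≢d (x∈⁅y⁆⇒x≡y d i)) (λ i → c≢d (x∈⁅y⁆⇒x≡y d i)))
          where
          opposite : ∃ λ d → c ≢ d × w ≢ d × Any (Touches c) E₂ × (∀ x → x ≢ c → x ≢ d → x ∉ X) × c ∈ X
          opposite = case c∈ of λ
            { (inj₁ refl) → b , distinct , w≢b , proj₂ (proj₁ split-ends) , ∉X , a∈X
            ; (inj₂ refl) → a , distinct ∘ sym , w≢a , proj₂ (proj₂ split-ends) , (λ x p q → ∉X x q p) , b∈X }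
          d = proj₁ opposite
          c≢d = proj₁ (proj₂ opposite)
          w≢d = proj₁ (proj₂ (proj₂ opposite))
          c∈₂ = proj₁ (proj₂ (proj₂ (proj₂ opposite)))
          ∉X′ = proj₁ (proj₂ (proj₂ (proj₂ (proj₂ opposite))))
          c∈X = proj₂ (proj₂ (proj₂ (proj₂ (proj₂ opposite))))
          inH : ∀ {z} → Any (Touches z) E₂ → z ∈ vertices H
          inH p = vertices-resp (↭-sym partition) (∈-vertices⁺ (AnyP.++⁺ʳ E₁ p))
          arrive : ∀ {y e} → e ∈ˡ E₂ → Joins y c e → y ∈ members → ∃ λ p → P p × Hat E₂ (inj₁ c) p
          arrive {y} {e} i j my with isVirtual? e
          ... | no h = inj₁ y , my , lose i (direct (not-virtual {e} h) (joins-sym {e = e} j))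
          ... | yes (ℓ , l) = inj₂ ℓ , lose i (l , y , my , proj₁ (joins-touches {e = e} j)) ,
                              lose i (enter l (proj₂ (joins-touches {e = e} j)))
          go : ∀ {y} → y ∈ members → Star (StepAvoiding ⁅ d ⁆ H) y c → ∃ λ p → P p × Hat E₂ (inj₁ c) p
          go my ε = contradiction c∈X (outside my)
          go my (_◅_ {j = z} (_ , z∉ , j) st) with AnyP.++⁻ E₁ (Any-resp-↭ partition j)
          ... | inj₁ o = contradiction (proj₁ (joined-touches o)) (not₁ my)
          ... | inj₂ j₂ with z ≟ᶠ c
          ... | yes refl = let (e , i , j′) = find j₂ in arrive i j′ my
          ... | no z≢c = go (closed my (outside my , ∉X′ z z≢c (λ { refl → z∉ (x∈⁅x⁆ d) }) , j₂)) st

    -- If E₂ already contains a virtual edge between a and b, its subdividing vertex alone is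
    -- enough; otherwise E₂ has a vertex besides a and b.
    bypass : Bypass
    bypass with Any.any? (λ e → joins? a b e ×-dec isVirtual? e) E₂
    ... | no h = let (e , w , i , t , p , q) = some-outsider h in component-bypass i t p q
    ... | yes h with find h
    ... | e , i , j , ℓ , l = record
      { P = _≡ inj₂ ℓ
      ; P? = _≟ᵖ inj₂ ℓ
      ; off = λ { refl o → Glue.labels split-glue o (lose i l) }
      ; conn = λ { refl refl → ε }
      ; at-a = inj₂ ℓ , refl , lose i (enter l (proj₁ (joins-touches {e = e} j)))
      ; at-b = inj₂ ℓ , refl , lose i (enter l (proj₂ (joins-touches {e = e} j)))
      }

    split-model : Model (Hat (v ∷ E₁)) (Hat H)
    split-model = expand bypass ⨾ hat-↭ (↭-sym partition)

  weaken : ∀ {k H} → Sound k H → Sound (suc k) H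
  weaken s = record
    { loopless = loopless ; reals = reals ; labels = labels ; two-conn = two-conn
    ; bounded = All.map (λ f ℓ p → m≤n⇒m≤1+n (f ℓ p)) bounded }
    where open Sound s

  pieces-sound : ∀ {B k Hs} → Sound 0 B → Splittings B k Hs → All (Sound k) Hs
  pieces-sound s none = s ∷ []
  pieces-sound s (split sp p c) with All-resp-↭ p (pieces-sound s sp)
  ... | h ∷ hs = split-sound h c ∷ split-sound h (splits-sym c) ∷ All.map weaken hs

  piece-model : ∀ {B k Hs H} → Sound 0 B → Splittings B k Hs → H ∈ˡ Hs → Model (Hat H) (Hat B)
  piece-model s none (here refl) = id-model id
  piece-model s (split sp p c) i with All-resp-↭ p (pieces-sound s sp) | i
  ... | h ∷ _ | here refl = split-model h c ⨾ piece-model s sp (∈-resp-↭ (↭-sym p) (here refl))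
  ... | h ∷ _ | there (here refl) = split-model h (splits-sym c) ⨾ piece-model s sp (∈-resp-↭ (↭-sym p) (here refl))
  ... | h ∷ _ | there (there j) = piece-model s sp (∈-resp-↭ (↭-sym p) (there j))

  minor-in-piece : ∀ {k} {K : Graph k} → Rigid K → ∀ {B j Hs} → Sound 0 B → Splittings B j Hs →
                   Model (Graph._~_ K) (Hat B) → Any (λ H → Model (Graph._~_ K) (Hat H)) Hs
  minor-in-piece r s none M = here M
  minor-in-piece r s (split sp p c) M with All-resp-↭ p (pieces-sound s sp) | Any-resp-↭ p (minor-in-piece r s sp M)
  ... | h ∷ _ | there i = there (there i)
  ... | h ∷ _ | here N with two-sum r (split-glue h c) (N ⨾ hat-↭ (SplitsAlong.partition c))
  ... | inj₁ N₁ = here N₁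
  ... | inj₂ N₂ = there (here N₂)

-- Splitting down to cycles, multiedges and 3-connected pieces

∈⇒↭ : ∀ {A : Set} {x : A} {xs} → x ∈ˡ xs → ∃ λ rest → xs ↭ x ∷ rest
∈⇒↭ {x = x} i with ∈-∃++ i
... | ys , zs , refl = ys ++ zs , shift x ys zs

filter-split : ∀ {A : Set} {P : A → Set} (P? : ∀ x → Dec (P x)) xs → xs ↭ filter P? xs ++ filter (¬? ∘ P?) xs
filter-split P? [] = ↭-refl
filter-split P? (x ∷ xs) with P? x
... | yes _ = ↭-prep x (filter-split P? xs)
... | no _ = ↭-trans (↭-prep x (filter-split P? xs)) (↭-sym (shift x (filter P? xs) (filter (¬? ∘ P?) xs)))

find-pair : ∀ {A : Set} {R : A → A → Set} (R? : ∀ x y → Dec (R x y)) xs →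
            AllPairs (λ x y → ¬ R x y) xs ⊎ (∃ λ x → ∃₂ λ y rest → xs ↭ x ∷ y ∷ rest × R x y)
find-pair R? [] = inj₁ []
find-pair R? (x ∷ xs) with Any.any? (R? x) xs | find-pair R? xs
... | yes p | _ = let (y , i , r) = find p ; (rest , q) = ∈⇒↭ i in inj₂ (x , y , rest , ↭-prep x q , r)
... | no p | inj₁ ps = inj₁ (AllP.¬Any⇒All¬ xs p ∷ ps)
... | no _ | inj₂ (y , z , rest , q , r) = inj₂ (y , z , x ∷ rest ,
  ↭-trans (↭-prep x q) (↭-trans (↭-swap x y ↭-refl) (↭-prep y (↭-swap x z ↭-refl))) , r)

card : ∀ {n} {S : Subset n} {xs} → Unique xs → All (_∈ S) xs → length xs ≤ ∣ S ∣
card [] [] = z≤n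
card {xs = x ∷ xs} (p ∷ u) (i ∷ is) = ≤-trans
  (s≤s (card u (All.zipWith (λ (x≢y , y∈) → x∈p∧x≢y⇒x∈p-y y∈ (x≢y ∘ sym)) (p , is)))) (x∈p⇒∣p-x∣<∣p∣ i)

parallel? : ∀ {n L} (e e′ : Edge n L) → Dec (Parallel e e′)
parallel? e e′ = joins? (end₁ e′) (end₂ e′) e

permits-any : ∀ x → Permits may-be-virtual x
permits-any real = real
permits-any (virtual _) = virtual

module _ {n : ℕ} where

  nonParallel-↭ : ∀ {L} {M N : MultiGraph n L} → M ↭ N → AllPairs NonParallel M → AllPairs NonParallel N
  nonParallel-↭ = allPairs-resp-↭ λ {e} {e′} p q → p (parallel-sym {e = e′} {e} q)

  Matches : ∀ {m} (f : Fin m → Fin n) → Edge n Kind → Edge m Status → Set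
  Matches f e t = Joins (f (end₁ t)) (f (end₂ t)) e × Permits (label t) (label e)

  -- `HasType` asks for a reordering of H along T. The edges of H are matched one by one; since both
  -- lists have no parallel edges and f is injective, a matched pair never competes with a later
  -- one.
  hasType-intro : ∀ {m} (f : Fin m → Fin n) → Injective _≡_ _≡_ f → (T : Template m) {H : MultiGraph n Kind} →
                  AllPairs NonParallel H → AllPairs NonParallel T →
                  (∀ {t} → t ∈ˡ T → ∃ λ e → e ∈ˡ H × Matches f e t) →
                  (∀ {e} → e ∈ˡ H → ∃ λ t → t ∈ˡ T × Joins (f (end₁ t)) (f (end₂ t)) e) → H HasType T
  hasType-intro {m} f inj T simple simpleT realised covered =
    let (H′ , p , w) = go T simple simpleT realised covered in f , inj , H′ , p , w
    where
    go : ∀ T {H} → AllPairs NonParallel H → AllPairs NonParallel T →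
         (∀ {t} → t ∈ˡ T → ∃ λ e → e ∈ˡ H × Matches f e t) →
         (∀ {e} → e ∈ˡ H → ∃ λ t → t ∈ˡ T × Joins (f (end₁ t)) (f (end₂ t)) e) →
         ∃ λ H′ → H ↭ H′ × Pointwise (Matches f) H′ T
    go [] {[]} _ _ _ _ = [] , ↭-refl , []
    go [] {e ∷ H} _ _ _ covered = case covered (here refl) of λ ()
    go (t ∷ T) {H} simple (tT ∷ simpleT) realised covered with realised (here refl)
    ... | e , i , m with ∈⇒↭ i
    ... | H₁ , p with nonParallel-↭ p simple
    ... | eH ∷ simple₁ = let (H′ , q , w) = go T simple₁ simpleT realised₁ covered₁ in
      e ∷ H′ , ↭-trans p (↭-prep e q) , m ∷ w
      where
      pull : ∀ {a b c d} {e : Edge n Kind} → Joins (f a) (f b) e → Joins (f c) (f d) e → SamePair a b c d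
      pull (inj₁ (refl , refl)) (inj₁ (x , y)) = inj₁ (inj x , inj y)
      pull (inj₁ (refl , refl)) (inj₂ (x , y)) = inj₂ (inj x , inj y)
      pull (inj₂ (refl , refl)) (inj₁ (x , y)) = inj₂ (inj y , inj x)
      pull (inj₂ (refl , refl)) (inj₂ (x , y)) = inj₁ (inj y , inj x)
      realised₁ : ∀ {t} → t ∈ˡ T → ∃ λ e → e ∈ˡ H₁ × Matches f e t
      realised₁ j with realised (there j)
      ... | e′ , i′ , m′ with ∈-resp-↭ p i′
      ... | here refl = contradiction (pull {e = e} (proj₁ m) (proj₁ m′)) (All.lookup tT j)
      ... | there i″ = e′ , i″ , m′
      covered₁ : ∀ {e} → e ∈ˡ H₁ → ∃ λ t → t ∈ˡ T × Joins (f (end₁ t)) (f (end₂ t)) e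
      covered₁ {e′} i′ with covered (∈-resp-↭ (↭-sym p) (there i′))
      ... | _ , here refl , j = contradiction (joins-parallel {e = e} {e′} (proj₁ m) j) (All.lookup eH i′)
      ... | t′ , there i″ , j = t′ , i″ , j

  Good : MultiGraph n Kind → Set
  Good H = IsCycle H ⊎ IsMultiedge H ⊎ (Simple H × 3-Connected H)

  Splittable : MultiGraph n Kind → Set
  Splittable H = ∃₂ λ a b → ∃₂ λ E₁ E₂ → SplitsAlong a b H E₁ E₂

  two-edges : ∀ {M : MultiGraph n Kind} {x y z} → x ≢ y → x ≢ z → y ≢ z →
              Any (Touches x) M → Any (Touches y) M → Any (Touches z) M → 2 ≤ length M
  two-edges {e ∷ []} xy xz yz (here p) (here q) (here r) with touches-ends {e = e} (touches-joins {e = e} xy p q) r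
  ... | inj₁ eq = contradiction (sym eq) xz
  ... | inj₂ eq = contradiction (sym eq) yz
  two-edges {e ∷ e′ ∷ M} _ _ _ _ _ _ = s≤s (s≤s z≤n)

  split-intro : ∀ {H E₁ E₂ : MultiGraph n Kind} {a b} → H ↭ E₁ ++ E₂ → 2 ≤ length E₁ → 2 ≤ length E₂ → a ≢ b →
                Any (Touches a) E₁ × Any (Touches a) E₂ → Any (Touches b) E₁ × Any (Touches b) E₂ →
                (∀ {x} → Any (Touches x) E₁ → Any (Touches x) E₂ → x ≡ a ⊎ x ≡ b) → SplitsAlong a b H E₁ E₂
  split-intro {E₁ = E₁} {E₂} {a} {b} p size₁ size₂ a≢b (a₁ , a₂) (b₁ , b₂) shared = record
    { partition = p ; size₁ = size₁ ; size₂ = size₂ ; distinct = a≢b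
    ; separates = ⊆-antisym
        (λ i → let (p , q) = x∈p∩q⁻ (vertices E₁) (vertices E₂) i in
               x∈p∪q⁺ (Sum.map (λ { refl → x∈⁅x⁆ a }) (λ { refl → x∈⁅x⁆ b }) (shared (∈-vertices⁻ E₁ p) (∈-vertices⁻ E₂ q))))
        (λ i → case x∈p∪q⁻ ⁅ a ⁆ ⁅ b ⁆ i of λ
          { (inj₁ j) → subst (_∈ vertices E₁ ∩ vertices E₂) (sym (x∈⁅y⁆⇒x≡y a j)) (x∈p∩q⁺ (∈-vertices⁺ a₁ , ∈-vertices⁺ a₂))
          ; (inj₂ j) → subst (_∈ vertices E₁ ∩ vertices E₂) (sym (x∈⁅y⁆⇒x≡y b j)) (x∈p∩q⁺ (∈-vertices⁺ b₁ , ∈-vertices⁺ b₂)) }) }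

  singleton-small : ∀ (x : Fin n) → ∣ ⁅ x ⁆ ∣ < 2
  singleton-small x = s≤s (≤-reflexive (∣⁅x⁆∣≡1 x))

  off : ∀ {x y : Fin n} → x ≢ y → x ∉ ⁅ y ⁆
  off {y = y} ne i = ne (x∈⁅y⁆⇒x≡y y i)

  last-step : ∀ {X} {M : MultiGraph n Kind} {x y} → x ≢ y → Star (StepAvoiding X M) x y → ∃ λ z → StepAvoiding X M z y
  last-step ne ε = contradiction refl ne
  last-step {y = y} ne (_◅_ {j = z} s st) with z ≟ᶠ y
  ... | yes refl = _ , s
  ... | no ne′ = last-step ne′ st

  first-step : ∀ {X} {M : MultiGraph n Kind} {x y} → x ≢ y → Star (StepAvoiding X M) x y → ∃ λ z → StepAvoiding X M x z
  first-step ne ε = contradiction refl ne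
  first-step ne (s ◅ _) = _ , s

  all-parallel : ∀ {M : MultiGraph n Kind} {a b} → a ≢ b → All (Joins a b) M → 3 ≤ length M → IsMultiedge M
  all-parallel {M} {a} {b} a≢b joins size = length M , size , f , (λ {x} {y} → f-inj {x} {y}) , M , ↭-refl , bond joins
    where
    f : Fin 2 → Fin n
    f 0F = a
    f 1F = b
    f-inj : ∀ {x y} → f x ≡ f y → x ≡ y
    f-inj {0F} {0F} _ = refl
    f-inj {0F} {1F} q = contradiction q a≢b
    f-inj {1F} {0F} q = contradiction (sym q) a≢b
    f-inj {1F} {1F} _ = refl
    bond : ∀ {M} → All (Joins a b) M → Pointwise (Matches f) M (multiedge (length M))
    bond [] = []
    bond {g ∷ _} (j ∷ js) = (j , permits-any (label g)) ∷ bond js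

  -- If some further edge is not parallel to e and e′, these two are split off. Both of their ends
  -- also lie on the remaining edges: a path from w that avoids one end must reach the other by an
  -- edge different from e and e′.
  bond-or-split : ∀ {k H e e′ rest} → Sound k H → 3 ≤ length H → H ↭ e ∷ e′ ∷ rest → Parallel e e′ →
                  IsMultiedge H ⊎ Splittable H
  bond-or-split {k} {H} {e} {e′} {rest} S size p par with All.all? (joins? (end₁ e′) (end₂ e′)) rest
  ... | yes all = inj₁ (all-parallel (All.head (All.tail (All-resp-↭ p (Sound.loopless S))))
                         (All-resp-↭ (↭-sym p) (par ∷ joins-ends e′ ∷ all)) size)
  ... | no ¬all with find (AllP.¬All⇒Any¬ (joins? (end₁ e′) (end₂ e′)) rest ¬all)
  ... | g , i , nj with outside-vertex {e = g} (All.lookup (All-resp-↭ p (Sound.loopless S)) (there (there i))) nj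
  ... | w , t , w≢a , w≢b = inj₂ (a , b , e ∷ e′ ∷ [] , rest ,
      split-intro p (s≤s (s≤s z≤n)) (two-edges w≢a w≢b a≢b (lose i t) a∈ b∈) a≢b
        (there (here (inj₁ refl)) , a∈) (there (here (inj₂ refl)) , b∈) (λ q _ → ends q))
    where
    a = end₁ e′
    b = end₂ e′
    a≢b = All.head (All.tail (All-resp-↭ p (Sound.loopless S)))
    in-H : ∀ {x} → Any (Touches x) (e ∷ e′ ∷ rest) → x ∈ vertices H
    in-H q = ∈-vertices⁺ (Any-resp-↭ (↭-sym p) q)
    ends : ∀ {x} → Any (Touches x) (e ∷ e′ ∷ []) → x ≡ a ⊎ x ≡ b
    ends (here q) = touches-ends {e = e} par q
    ends (there (here q)) = touches-ends {e = e′} (joins-ends e′) q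
    orient : ∀ {c d} {e : Edge n Kind} → (c ≡ a × d ≡ b) ⊎ (c ≡ b × d ≡ a) → Joins a b e → Joins c d e
    orient (inj₁ (refl , refl)) j = j
    orient (inj₂ (refl , refl)) j = Sum.swap j
    reach : ∀ {c d} → (c ≡ a × d ≡ b) ⊎ (c ≡ b × d ≡ a) → c ≢ d → w ≢ c → w ≢ d → Any (Touches c) rest
    reach {c} {d} cd c≢d w≢c w≢d with last-step w≢c (Sound.two-conn S ⁅ d ⁆ (singleton-small d) w c
      (in-H (there (there (lose i t)))) (in-H (there (here ([ (λ (q , _) → inj₁ (sym q)) , (λ (q , _) → inj₂ (sym q)) ]′ cd)))) (off w≢d) (off c≢d))
    ... | z , z∉ , c∉ , j with Any-resp-↭ p j
    ... | there (there r) = proj₂ (joined-touches r)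
    ... | here r = contradiction (subst (_∈ ⁅ d ⁆) (sym (joins-unique {e = e} (Sum.swap r) (orient {e = e} cd par))) (x∈⁅x⁆ d)) z∉
    ... | there (here r) = contradiction (subst (_∈ ⁅ d ⁆) (sym (joins-unique {e = e′} (Sum.swap r) (orient {e = e′} cd (joins-ends e′)))) (x∈⁅x⁆ d)) z∉
    a∈ = reach (inj₁ (refl , refl)) a≢b w≢a w≢b
    b∈ = reach (inj₂ (refl , refl)) (a≢b ∘ sym) w≢b w≢a

  -- Two nonparallel edges give three vertices a, b and w, and there is no fourth. Deleting a or b
  -- leaves w adjacent to the other, which supplies the missing sides.
  triangle : ∀ {k H} → Sound k H → 3 ≤ length H → AllPairs NonParallel H → ¬ (order H > 3) → IsCycle H
  triangle {k} {[]} S () simple small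
  triangle {k} {e ∷ []} S (s≤s ()) simple small
  triangle {k} {H@(e ∷ e′ ∷ M)} S size simple small
    with outside-vertex {e = e′} (All.head (All.tail (Sound.loopless S)))
           (λ j → All.head (AllPairs.head simple) (parallel-sym {e = e′} {e} j))
  ... | w , t , w≢a , w≢b = 3 , ≤-refl , hasType-intro f (λ {x} {y} → f-inj x y) (cycle 3) simple distinct-pairs realised covered
    where
    a = end₁ e
    b = end₂ e
    a≢b : a ≢ b
    a≢b = All.head (Sound.loopless S)
    a∈ : a ∈ vertices H
    a∈ = ∈-vertices⁺ {M = H} (here (inj₁ refl))
    b∈ : b ∈ vertices H
    b∈ = ∈-vertices⁺ {M = H} (here (inj₂ refl))
    w∈ : w ∈ vertices H
    w∈ = ∈-vertices⁺ {M = H} (there (here t))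
    only : ∀ {y} → y ∈ vertices H → y ≡ a ⊎ y ≡ b ⊎ y ≡ w
    only {y} y∈ with y ≟ᶠ a | y ≟ᶠ b | y ≟ᶠ w
    ... | yes p | _ | _ = inj₁ p
    ... | no _ | yes p | _ = inj₂ (inj₁ p)
    ... | no _ | no _ | yes p = inj₂ (inj₂ p)
    ... | no p | no q | no r = contradiction
      (card {xs = y ∷ a ∷ b ∷ w ∷ []}
        ((p ∷ q ∷ r ∷ []) ∷ (a≢b ∷ (w≢a ∘ sym) ∷ []) ∷ ((w≢b ∘ sym) ∷ []) ∷ [] ∷ [])
        (y∈ ∷ a∈ ∷ b∈ ∷ w∈ ∷ [])) small
    loop : ∀ {y e} → e ∈ˡ H → Joins y y e → ⊥
    loop i (inj₁ (refl , q)) = All.lookup (Sound.loopless S) i (sym q)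
    loop i (inj₂ (refl , q)) = All.lookup (Sound.loopless S) i (sym q)
    side : ∀ {c d} → c ∈ vertices H → w ≢ c → w ≢ d → c ≢ d → (∀ {y} → y ∈ vertices H → y ≡ c ⊎ y ≡ d ⊎ y ≡ w) → Any (Joins w c) H
    side {c} {d} c∈ w≢c w≢d c≢d cases with first-step w≢c (Sound.two-conn S ⁅ d ⁆ (singleton-small d) w c w∈ c∈ (off w≢d) (off c≢d))
    ... | z , _ , z∉ , j with cases (∈-vertices⁺ (proj₂ (joined-touches j)))
    ... | inj₁ refl = j
    ... | inj₂ (inj₁ refl) = contradiction (x∈⁅x⁆ d) z∉
    ... | inj₂ (inj₂ refl) = let (e , i , j′) = find j in ⊥-elim (loop i j′)
    wa = side a∈ w≢a w≢b a≢b only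
    wb = side b∈ w≢b w≢a (a≢b ∘ sym) (λ i → case only i of λ { (inj₁ p) → inj₂ (inj₁ p) ; (inj₂ (inj₁ p)) → inj₁ p ; (inj₂ (inj₂ p)) → inj₂ (inj₂ p) })
    f : Fin 3 → Fin n
    f 0F = a
    f 1F = b
    f 2F = w
    f-inj : ∀ x y → f x ≡ f y → x ≡ y
    f-inj 0F 0F _ = refl
    f-inj 0F 1F q = contradiction q a≢b
    f-inj 0F 2F q = contradiction (sym q) w≢a
    f-inj 1F 0F q = contradiction (sym q) a≢b
    f-inj 1F 1F _ = refl
    f-inj 1F 2F q = contradiction (sym q) w≢b
    f-inj 2F 0F q = contradiction q w≢a
    f-inj 2F 1F q = contradiction q w≢b
    f-inj 2F 2F _ = refl
    distinct-pairs : AllPairs NonParallel (cycle 3)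
    distinct-pairs = ((λ { (inj₁ (() , _)) ; (inj₂ (() , _)) }) ∷ (λ { (inj₁ (() , _)) ; (inj₂ (_ , ())) }) ∷ [])
      ∷ ((λ { (inj₁ (() , _)) ; (inj₂ (() , _)) }) ∷ []) ∷ [] ∷ []
    pick : ∀ {u v} → Any (Joins u v) H → ∃ λ e → e ∈ˡ H × Joins u v e × Permits may-be-virtual (label e)
    pick j = let (e , i , q) = find j in e , i , q , permits-any (label e)
    realised : ∀ {t} → t ∈ˡ cycle 3 → ∃ λ e → e ∈ˡ H × Matches f e t
    realised (here refl) = pick wa
    realised (there (here refl)) = pick (here (joins-ends e))
    realised (there (there (here refl))) = pick (Any.map (λ {e} → joins-sym {e = e}) wb)
    covered : ∀ {e} → e ∈ˡ H → ∃ λ t → t ∈ˡ cycle 3 × Joins (f (end₁ t)) (f (end₂ t)) e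
    covered {g} i with only (∈-vertices⁺ (lose i (inj₁ refl))) | only (∈-vertices⁺ (lose i (inj₂ refl)))
    ... | inj₁ p | inj₁ q = ⊥-elim (loop i (inj₁ (p , q)))
    ... | inj₁ p | inj₂ (inj₁ q) = _ , there (here refl) , inj₁ (p , q)
    ... | inj₁ p | inj₂ (inj₂ q) = _ , here refl , inj₂ (p , q)
    ... | inj₂ (inj₁ p) | inj₁ q = _ , there (here refl) , inj₂ (p , q)
    ... | inj₂ (inj₁ p) | inj₂ (inj₁ q) = ⊥-elim (loop i (inj₁ (p , q)))
    ... | inj₂ (inj₁ p) | inj₂ (inj₂ q) = _ , there (there (here refl)) , inj₁ (p , q)
    ... | inj₂ (inj₂ p) | inj₁ q = _ , here refl , inj₁ (p , q)
    ... | inj₂ (inj₂ p) | inj₂ (inj₁ q) = _ , there (there (here refl)) , inj₂ (p , q)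
    ... | inj₂ (inj₂ p) | inj₂ (inj₂ q) = ⊥-elim (loop i (inj₁ (p , q)))

  two-elements : ∀ (X : Subset n) → ¬ (∣ X ∣ < 2) → ∣ X ∣ < 3 → Fin n →
                 ∃₂ λ a b → a ≢ b × a ∈ X × b ∈ X × (∀ {c} → c ∈ X → c ≡ a ⊎ c ≡ b)
  two-elements X ≥2 <3 u with any? (_∈? X)
  ... | no none′ = contradiction (≤-<-trans (p⊆q⇒∣p∣≤∣q∣ {p = X} {⁅ u ⁆} (λ i → contradiction (_ , i) none′)) (singleton-small u)) ≥2
  ... | yes (a , a∈) with any? (λ b → ¬? (a ≟ᶠ b) ×-dec (b ∈? X))
  ... | no none′ = contradiction (≤-<-trans (p⊆q⇒∣p∣≤∣q∣ {p = X} {⁅ a ⁆} λ {c} i →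
          subst (_∈ ⁅ a ⁆) (decidable-stable (a ≟ᶠ c) λ ne → none′ (c , ne , i)) (x∈⁅x⁆ a)) (singleton-small a)) ≥2
  ... | yes (b , a≢b , b∈) = a , b , a≢b , a∈ , b∈ , only
    where
    only : ∀ {c} → c ∈ X → c ≡ a ⊎ c ≡ b
    only {c} c∈ with c ≟ᶠ a | c ≟ᶠ b
    ... | yes p | _ = inj₁ p
    ... | no _ | yes p = inj₂ p
    ... | no p | no q = contradiction (card {xs = c ∷ a ∷ b ∷ []} ((p ∷ q ∷ []) ∷ (a≢b ∷ []) ∷ [] ∷ []) (c∈ ∷ a∈ ∷ b∈ ∷ [])) (λ h → <-irrefl refl (<-≤-trans <3 h))

  module _ {L : Set} (M : MultiGraph n L) (X : Subset n) where
    joined? : ∀ u v → Dec (Star (StepAvoiding X M) u v)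
    joined? u v with v ∈? Component.members (component (step? X M) u)
    ... | yes i = yes (Component.reached (component (step? X M) u) i)
    ... | no h = no λ st → h (Component.closed* (component (step? X M) u) (Component.root (component (step? X M) u)) st)

  record Separated {L : Set} (m : ℕ) (M : MultiGraph n L) : Set where
    field
      X     : Subset n
      small : ∣ X ∣ < m
      {u v} : Fin n
      u∈    : u ∈ vertices M
      v∈    : v ∈ vertices M
      u∉    : u ∉ X
      v∉    : v ∉ X
      apart : ¬ Star (StepAvoiding X M) u v

  unseparated? : ∀ {L} m (M : MultiGraph n L) → Unseparated m M ⊎ Separated m M
  unseparated? m M with anySubset? (λ X → (∣ X ∣ <? m) ×-dec any? λ u → any? λ v →
    (u ∈? vertices M) ×-dec (v ∈? vertices M) ×-dec ¬? (u ∈? X) ×-dec ¬? (v ∈? X) ×-dec ¬? (joined? M X u v))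
  ... | yes (X , small , u , v , u∈ , v∈ , u∉ , v∉ , ap) = inj₂ record
    { X = X ; small = small ; u∈ = u∈ ; v∈ = v∈ ; u∉ = u∉ ; v∉ = v∉ ; apart = ap }
  ... | no h = inj₁ λ X small u v u∈ v∈ u∉ v∉ →
    decidable-stable (joined? M X u v) λ ap → h (X , small , u , v , u∈ , v∈ , u∉ , v∉ , ap)

  -- The edges are sorted by whether they meet the component of u in M without X; the two classes
  -- have only vertices of X in common. Cutvertices and pairs of vertices are treated alike.
  module CutOff {L : Set} (M : MultiGraph n L) (X : Subset n) {u : Fin n} (u∈ : u ∈ vertices M) (u∉ : u ∉ X) where
    open Component (component (step? X M) u) public

    avoids : ∀ {y} → y ∈ members → y ∉ X
    avoids i = star-avoids u∉ (reached i)

    Meets : Edge n L → Set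
    Meets e = end₁ e ∈ members ⊎ end₂ e ∈ members

    meets? : ∀ e → Dec (Meets e)
    meets? e = (end₁ e ∈? members) ⊎-dec (end₂ e ∈? members)

    meets : ∀ {y e} → Touches y e → y ∈ members → Meets e
    meets (inj₁ refl) i = inj₁ i
    meets (inj₂ refl) i = inj₂ i

    near far-away : MultiGraph n L
    near = filter meets? M
    far-away = filter (¬? ∘ meets?) M

    in-near : ∀ {x e} → e ∈ˡ M → Touches x e → Meets e → Any (Touches x) near
    in-near i t m = lose (∈-filter⁺ meets? i m) t

    in-far-away : ∀ {x e} → e ∈ˡ M → Touches x e → ¬ Meets e → Any (Touches x) far-away
    in-far-away i t m = lose (∈-filter⁺ (¬? ∘ meets?) i m) t

    cross : ∀ {x y e} → e ∈ˡ M → Touches y e → y ∈ members → Touches x e → x ∉ members → x ∈ X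
    cross {x} {y} {e} i ty my tx nx with x ∈? X
    ... | yes x∈ = x∈
    ... | no x∉ = contradiction (closed my (avoids my , x∉ , lose i (touches-joins {e = e} (λ { refl → nx my }) ty tx))) nx

    root-near : Any (Touches u) near
    root-near = let (e , i , t) = find (∈-vertices⁻ M u∈) in in-near i t (meets {e = e} t root)

    other-far-away : ∀ {v} → v ∈ vertices M → v ∉ X → v ∉ members → Any (Touches v) far-away
    other-far-away v∈ v∉ nv = let (e , i , t) = find (∈-vertices⁻ M v∈) in in-far-away i t λ
      { (inj₁ m) → v∉ (cross {e = e} i (inj₁ refl) m t nv) ; (inj₂ m) → v∉ (cross {e = e} i (inj₂ refl) m t nv) }

    shared : ∀ {x} → Any (Touches x) near → Any (Touches x) far-away → x ∈ X
    shared {x} p q with find p | find q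
    ... | e , i , t | e′ , i′ , t′ with ∈-filter⁻ meets? {xs = M} i | ∈-filter⁻ (¬? ∘ meets?) {xs = M} i′
    ... | e∈ , inj₁ m | _ , nm = cross {e = e} e∈ (inj₁ refl) m t λ mx → nm (meets {e = e′} t′ mx)
    ... | e∈ , inj₂ m | _ , nm = cross {e = e} e∈ (inj₂ refl) m t λ mx → nm (meets {e = e′} t′ mx)

  -- As H has no cutvertex, X consists of exactly two vertices. Each of them lies on edges of both
  -- classes, for otherwise the other one alone would separate u from v.
  separation-split : ∀ {k H} → Sound k H → Separated 3 H → Splittable H
  separation-split {k} {H} S sep = found (two-elements X (λ s → apart (Sound.two-conn S X s u v u∈ v∈ u∉ v∉)) small u)
    where
    open Separated sep
    open CutOff H X u∈ u∉
    v∉C : v ∉ members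
    v∉C i = apart (reached i)
    v₂ = other-far-away v∈ v∉ v∉C
    found : (∃₂ λ a b → a ≢ b × a ∈ X × b ∈ X × (∀ {c} → c ∈ X → c ≡ a ⊎ c ≡ b)) → Splittable H
    found (a , b , a≢b , a∈ , b∈ , only) = a , b , near , far-away ,
      split-intro (filter-split meets? H)
        (two-edges (λ { refl → u∉ a∈ }) (λ { refl → u∉ b∈ }) a≢b root-near (proj₁ both-a) (proj₁ both-b))
        (two-edges (λ { refl → v∉ a∈ }) (λ { refl → v∉ b∈ }) a≢b v₂ (proj₂ both-a) (proj₂ both-b))
        a≢b both-a both-b (λ p q → only (shared p q))
      where
      -- Every path between u and v that avoids d runs through c.
      leave-C : ∀ {c d x} → (∀ {x} → x ∈ X → x ≡ c ⊎ x ≡ d) → x ∈ members → Star (StepAvoiding ⁅ d ⁆ H) x v → Any (Touches c) near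
      leave-C on mx ε = contradiction mx v∉C
      leave-C {c} {d} on mx (_◅_ {j = z} (_ , z∉ , j) st) with z ∈? members
      ... | yes mz = leave-C on mz st
      ... | no nz with find j
      ... | e , i , j′ with joins-touches {e = e} j′
      ... | tx , tz with on (cross {e = e} i tx mx tz nz)
      ... | inj₁ refl = in-near i tz (meets {e = e} tx mx)
      ... | inj₂ refl = contradiction (x∈⁅x⁆ d) z∉
      reach-C : ∀ {c d x} → (∀ {x} → x ∈ X → x ≡ c ⊎ x ≡ d) → x ∉ members → x ∉ X → Star (StepAvoiding ⁅ d ⁆ H) x u → Any (Touches c) far-away
      reach-C on nx x∉ ε = contradiction root nx
      reach-C {c} {d} {x} on nx x∉ (_◅_ {j = z} (_ , z∉ , j) st) with find j
      ... | e , i , j′ with joins-touches {e = e} j′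
      ... | tx , tz with z ∈? members
      ... | yes mz = contradiction (cross {e = e} i tz mz tx nx) x∉
      ... | no nz with z ≟ᶠ c
      ... | no z≢c = reach-C on nz (λ z∈ → [ z≢c , (λ { refl → z∉ (x∈⁅x⁆ d) }) ]′ (on z∈)) st
      ... | yes refl = in-far-away i tz λ
        { (inj₁ m) → x∉ (cross {e = e} i (inj₁ refl) m tx nx)
        ; (inj₂ m) → x∉ (cross {e = e} i (inj₂ refl) m tx nx) }
      both : ∀ {c d} → d ∈ X → c ≢ d →
             (∀ {x} → x ∈ X → x ≡ c ⊎ x ≡ d) → Any (Touches c) near × Any (Touches c) far-away
      both {c} {d} d∈ c≢d on =
        leave-C on root (Sound.two-conn S ⁅ d ⁆ (singleton-small d) u v u∈ v∈ (off λ { refl → u∉ d∈ }) (off λ { refl → v∉ d∈ })) ,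
        reach-C on v∉C v∉ (Sound.two-conn S ⁅ d ⁆ (singleton-small d) v u v∈ u∈ (off λ { refl → v∉ d∈ }) (off λ { refl → u∉ d∈ }))
      both-a = both b∈ a≢b only
      both-b = both a∈ (a≢b ∘ sym) (Sum.swap ∘ only)

  good-or-split : ∀ {k} H → Sound k H → 3 ≤ length H → Good H ⊎ Splittable H
  good-or-split H S size with find-pair parallel? H
  ... | inj₂ (e , e′ , rest , p , par) = Sum.map₁ (inj₂ ∘ inj₁) (bond-or-split S size p par)
  ... | inj₁ simple with 3 <? order H
  ... | no small = inj₁ (inj₁ (triangle S size simple small))
  ... | yes big with unseparated? 3 H
  ... | inj₁ conn = inj₁ (inj₂ (inj₂ ((Sound.loopless S , simple) , big , conn)))
  ... | inj₂ sep = inj₂ (separation-split S sep)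

  shorter : ∀ (E : MultiGraph n Kind) {F m} → 2 ≤ length F → m ≡ length (E ++ F) → suc (suc (length E)) ≤ m
  shorter E {F} two refl = ≤-trans (≤-reflexive (+-comm 2 (length E)))
    (≤-trans (+-mono-≤ (≤-refl {length E}) two) (≤-reflexive (sym (ListP.length-++ E))))

  -- A part consists of one side and a virtual edge, while the other side has at least two edges; so
  -- the parts are shorter than H. `refine` works on one piece and leaves the others in Rest
  -- untouched.
  good-splitting : ∀ {B} → Sound 0 B → 3 ≤ length B → ∃₂ λ k Hs → Splittings B k Hs × All Good Hs
  good-splitting {B} S size with refine (length B) none ↭-refl size ≤-refl
    where
    refine : ∀ N {k Hs H Rest} → Splittings B k Hs → Hs ↭ H ∷ Rest → 3 ≤ length H → length H ≤ N →
             ∃₂ λ k′ Hs′ → ∃ λ new → Splittings B k′ Hs′ × Hs′ ↭ new ++ Rest × All Good new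
    refine zero sp p size bound = contradiction (≤-trans size bound) λ ()
    refine (suc N) {k} {Hs} {H} {Rest} sp p size bound
      with good-or-split H (All.head (All-resp-↭ p (pieces-sound S sp))) size
    ... | inj₁ g = k , Hs , [ H ] , sp , p , g ∷ []
    ... | inj₂ (a , b , E₁ , E₂ , c)
      with refine N (split sp p c) ↭-refl (s≤s (SplitsAlong.size₁ c)) (≤-pred (≤-trans (shorter E₁ (SplitsAlong.size₂ c) (↭-length (SplitsAlong.partition c))) bound))
    ... | k₁ , Hs₁ , new₁ , sp₁ , p₁ , g₁
      with refine N sp₁ (↭-trans p₁ (shift _ new₁ _)) (s≤s (SplitsAlong.size₂ c)) (≤-pred (≤-trans (shorter E₂ (SplitsAlong.size₁ c) (trans (↭-length (SplitsAlong.partition c)) (↭-length (++-comm E₁ E₂)))) bound))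
    ... | k₂ , Hs₂ , new₂ , sp₂ , p₂ , g₂ =
      k₂ , Hs₂ , new₂ ++ new₁ , sp₂ , ↭-trans p₂ (↭-sym (++-assoc-↭ new₂ new₁ Rest)) , AllP.++⁺ g₂ g₁
  ... | k , Hs , new , sp , p , g = k , Hs , sp , All-resp-↭ (↭-sym (↭-trans p (++-identityʳ new))) g

-- Existence of canonical decompositions

∈-concat-split : ∀ {A : Set} {x : A} {xs ys zs} → xs ↭ ys ++ zs → x ∈ˡ xs →
                 (∃ λ ys′ → ys ↭ x ∷ ys′) ⊎ (∃ λ zs′ → zs ↭ x ∷ zs′)
∈-concat-split {ys = ys} p i with ∈-++⁻ ys (∈-resp-↭ p i)
... | inj₁ j = inj₁ (∈⇒↭ j)
... | inj₂ j = inj₂ (∈⇒↭ j)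

-- Splittings are numbered consecutively, so once splitting ℓ is omitted all later labels drop by
-- one.
lower : ℕ → ℕ → ℕ
lower ℓ j with ℓ <? j
... | yes _ = pred j
... | no _ = j

lower-> : ∀ {ℓ j} → ℓ < suc j → lower ℓ (suc j) ≡ j
lower-> {ℓ} {j} p with ℓ <? suc j
... | yes _ = refl
... | no h = contradiction p h

lower-≤ : ∀ {ℓ j} → ¬ (ℓ < j) → lower ℓ j ≡ j
lower-≤ {ℓ} {j} p with ℓ <? j
... | yes q = contradiction q p
... | no _ = refl

relabelKind : (ℕ → ℕ) → Kind → Kind
relabelKind f real = real
relabelKind f (virtual j) = virtual (f j)

module _ {n : ℕ} where

  relabelEdge : (ℕ → ℕ) → Edge n Kind → Edge n Kind
  relabelEdge f e = edge (end₁ e) (end₂ e) (relabelKind f (label e))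

  relabel : (ℕ → ℕ) → MultiGraph n Kind → MultiGraph n Kind
  relabel f = map (relabelEdge f)

  relabel-touches⁻ : ∀ {f x M} → Any (Touches x) (relabel f M) → Any (Touches x) M
  relabel-touches⁻ p = AnyP.map⁻ p

  relabel-touches⁺ : ∀ {f x M} → Any (Touches x) M → Any (Touches x) (relabel f M)
  relabel-touches⁺ p = AnyP.map⁺ p

  relabel-vertices : ∀ f (M : MultiGraph n Kind) → vertices (relabel f M) ≡ vertices M
  relabel-vertices f [] = refl
  relabel-vertices f (e ∷ M) = cong ((⁅ end₁ e ⁆ ∪ ⁅ end₂ e ⁆) ∪_) (relabel-vertices f M)

  relabel-bounded : ∀ {ℓ} (M : MultiGraph n Kind) → All (λ e → ∀ j → label e ≡ virtual j → j < ℓ) M → relabel (lower ℓ) M ≡ M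
  relabel-bounded [] _ = refl
  relabel-bounded {ℓ} (edge x y real ∷ M) (b ∷ bs) = cong (_ ∷_) (relabel-bounded M bs)
  relabel-bounded {ℓ} (edge x y (virtual j) ∷ M) (b ∷ bs) =
    cong₂ _∷_ (cong (λ i → edge x y (virtual i)) (lower-≤ λ q → <-irrefl refl (<-trans q (b j refl)))) (relabel-bounded M bs)

  splits-++ : ∀ {a b} {H E₁ E₂ : MultiGraph n Kind} → SplitsAlong a b H E₁ E₂ → SplitsAlong a b (E₁ ++ E₂) E₁ E₂
  splits-++ s = record { partition = ↭-refl ; size₁ = size₁ ; size₂ = size₂ ; distinct = distinct ; separates = separates }
    where open SplitsAlong s

  -- Splitting ℓ undone in hindsight. H₁ and H₂ are the two pieces that carry its virtual edge at
  -- the end, and Hs′ are the pieces obtained by performing all other splittings without it.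
  record Unsplit (B : MultiGraph n Kind) (k : ℕ) (Hs : List (MultiGraph n Kind)) (ℓ : ℕ) : Set where
    field
      {a b}       : Fin n
      {C₁ C₂}     : MultiGraph n Kind
      {H₁ H₂}     : MultiGraph n Kind
      {Rest}      : List (MultiGraph n Kind)
      perm        : Hs ↭ H₁ ∷ H₂ ∷ Rest
      perm₁       : H₁ ↭ edge a b (virtual ℓ) ∷ C₁
      perm₂       : H₂ ↭ edge a b (virtual ℓ) ∷ C₂
      glued       : SplitsAlong a b (C₁ ++ C₂) C₁ C₂
      absent      : All (λ H → ¬ OnM H (inj₂ ℓ)) Rest
      {Hs′}       : List (MultiGraph n Kind)
      {merged}    : MultiGraph n Kind
      splittings  : Splittings B k Hs′
      merged-perm : merged ↭ relabel (lower ℓ) (C₁ ++ C₂)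
      perm′       : Hs′ ↭ merged ∷ map (relabel (lower ℓ)) Rest

  unsplit-swap : ∀ {B k Hs ℓ} → Unsplit B k Hs ℓ → Unsplit B k Hs ℓ
  unsplit-swap {ℓ = ℓ} U = record
    { perm = ↭-trans perm (↭-swap _ _ ↭-refl) ; perm₁ = perm₂ ; perm₂ = perm₁
    ; glued = splits-++ (splits-sym glued)
    ; absent = absent ; splittings = splittings
    ; merged-perm = ↭-trans merged-perm (map⁺ (relabelEdge (lower ℓ)) (++-comm C₁ C₂)) ; perm′ = perm′ }
    where open Unsplit U

  module _ {B k a₀ b₀} {Hs₀ Hs′ Hs : List (MultiGraph n Kind)} {H₀ E₁ E₂ : MultiGraph n Kind} {ℓ}
           (ℓ<k : ℓ < suc k) (U : Unsplit B k Hs₀ ℓ) (p₀ : Hs₀ ↭ H₀ ∷ Hs′)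
           (c : SplitsAlong a₀ b₀ H₀ E₁ E₂)
           (p : Hs ↭ (edge a₀ b₀ (virtual (suc k)) ∷ E₁) ∷ (edge a₀ b₀ (virtual (suc k)) ∷ E₂) ∷ Hs′) where
    private
      open Unsplit U hiding (Hs′)
      v = edge a₀ b₀ (virtual (suc k))
      r = relabel (lower ℓ)
      r-v : relabelEdge (lower ℓ) v ≡ edge a₀ b₀ (virtual k)
      r-v = cong (λ i → edge a₀ b₀ (virtual i)) (lower-> ℓ<k)
      module c = SplitsAlong c
      module g = SplitsAlong glued
      v-absent : ∀ {E} → ¬ OnM E (inj₂ ℓ) → ¬ OnM (v ∷ E) (inj₂ ℓ)
      v-absent h (here refl) = <-irrefl refl ℓ<k
      v-absent h (there q) = h q

    -- The last splitting cuts a piece without the virtual edge ℓ, so it commutes with the undoing.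
    resplit-other : ∀ {Rest′} → Rest ↭ H₀ ∷ Rest′ → Hs′ ↭ H₁ ∷ H₂ ∷ Rest′ → Unsplit B (suc k) Hs ℓ
    resplit-other {Rest′} q q′ = record
      { perm = ↭-trans p (↭-trans (↭-prep _ (↭-prep _ q′)) (shifts ((v ∷ E₁) ∷ (v ∷ E₂) ∷ []) (H₁ ∷ H₂ ∷ []) {Rest′}))
      ; perm₁ = perm₁ ; perm₂ = perm₂ ; glued = glued
      ; absent = case All-resp-↭ q absent of λ
          { (h ∷ hs) → v-absent (λ o → h (Any-resp-↭ (↭-sym c.partition) (AnyP.++⁺ˡ o))) ∷
                       v-absent (λ o → h (Any-resp-↭ (↭-sym c.partition) (AnyP.++⁺ʳ E₁ o))) ∷ hs }
      ; splittings = split splittings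
          (↭-trans perm′ (↭-trans (↭-prep merged (map⁺ r q)) (↭-swap merged (r H₀) ↭-refl)))
          (split-intro (↭-trans (map⁺ _ c.partition) (↭-reflexive (ListP.map-++ _ E₁ E₂)))
            (subst (2 ≤_) (sym (ListP.length-map _ E₁)) c.size₁) (subst (2 ≤_) (sym (ListP.length-map _ E₂)) c.size₂) c.distinct
            (Product.map relabel-touches⁺ relabel-touches⁺ (proj₁ (splits-ends c)))
            (Product.map relabel-touches⁺ relabel-touches⁺ (proj₂ (splits-ends c)))
            (λ x y → splits-shared c (relabel-touches⁻ x) (relabel-touches⁻ y)))
      ; merged-perm = merged-perm
      ; perm′ = subst (λ w → (edge a₀ b₀ (virtual k) ∷ r E₁) ∷ (edge a₀ b₀ (virtual k) ∷ r E₂) ∷ merged ∷ map r Rest′ ↭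
                             merged ∷ (w ∷ r E₁) ∷ (w ∷ r E₂) ∷ map r Rest′) (sym r-v)
                 (shifts ((edge a₀ b₀ (virtual k) ∷ r E₁) ∷ (edge a₀ b₀ (virtual k) ∷ r E₂) ∷ []) (merged ∷ []) {map r Rest′}) }

    -- The last splitting cuts H₁, and the virtual edge ℓ stays in E₁, whose other edges are D₁.
    -- Without splitting ℓ, the merged piece is cut along the same pair into D₁ together with C₂,
    -- and E₂.
    resplit-first : ∀ {D₁} → ¬ OnM C₁ (inj₂ ℓ) → H₀ ≡ H₁ → Hs′ ↭ H₂ ∷ Rest → E₁ ↭ edge a b (virtual ℓ) ∷ D₁ → Unsplit B (suc k) Hs ℓ
    resplit-first {D₁} nℓ refl q s = record
      { perm = ↭-trans p (↭-prep _ (↭-trans (↭-prep _ q) (↭-swap _ _ ↭-refl)))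
      ; perm₁ = ↭-trans (↭-prep v s) (↭-swap _ _ ↭-refl)
      ; perm₂ = perm₂
      ; glued = split-intro ↭-refl (subst (2 ≤_) (↭-length s) c.size₁) g.size₂ g.distinct
          (left-end (inj₁ refl) (proj₁ (proj₁ (splits-ends glued))) , proj₂ (proj₁ (splits-ends glued)))
          (left-end (inj₂ refl) (proj₁ (proj₂ (splits-ends glued))) , proj₂ (proj₂ (splits-ends glued)))
          (λ x y → splits-shared glued (in-C₁ x) y)
      ; absent = v-absent (λ o → nℓ (Any-resp-↭ (↭-sym C₁-perm) (AnyP.++⁺ʳ D₁ o))) ∷ absent
      ; splittings = split splittings perm′ (split-intro
          (↭-trans merged-perm (↭-trans (map⁺ _ regroup) (↭-reflexive (ListP.map-++ _ (D₁ ++ C₂) E₂))))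
          (subst (2 ≤_) (sym (trans (ListP.length-map _ (D₁ ++ C₂)) (ListP.length-++ D₁))) (≤-trans g.size₂ (m≤n+m _ _)))
          (subst (2 ≤_) (sym (ListP.length-map _ E₂)) c.size₂) c.distinct
          (relabel-touches⁺ (right-end (proj₁ (proj₁ (splits-ends c)))) , relabel-touches⁺ (proj₂ (proj₁ (splits-ends c))))
          (relabel-touches⁺ (right-end (proj₁ (proj₂ (splits-ends c)))) , relabel-touches⁺ (proj₂ (proj₂ (splits-ends c))))
          (λ x y → shared (AnyP.++⁻ D₁ (relabel-touches⁻ x)) (relabel-touches⁻ y)))
      ; merged-perm = ↭-reflexive (cong (_∷ r (D₁ ++ C₂)) (sym r-v))
      ; perm′ = ↭-prep _ (↭-reflexive (cong (λ w → (w ∷ r E₂) ∷ map r Rest) (sym r-v))) }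
      where
      C₁-perm : C₁ ↭ D₁ ++ E₂
      C₁-perm = drop-∷ (↭-trans (↭-sym perm₁) (↭-trans c.partition (++⁺ʳ E₂ s)))
      regroup : C₁ ++ C₂ ↭ (D₁ ++ C₂) ++ E₂
      regroup = ↭-trans (++⁺ʳ C₂ C₁-perm) (↭-trans (++-assoc-↭ D₁ E₂ C₂)
                  (↭-trans (++⁺ˡ D₁ (++-comm E₂ C₂)) (↭-sym (++-assoc-↭ D₁ C₂ E₂))))
      in-C₁ : ∀ {x} → Any (Touches x) (v ∷ D₁) → Any (Touches x) C₁
      in-C₁ (here (inj₁ refl)) = Any-resp-↭ (↭-sym C₁-perm) (AnyP.++⁺ʳ D₁ (proj₂ (proj₁ (splits-ends c))))
      in-C₁ (here (inj₂ refl)) = Any-resp-↭ (↭-sym C₁-perm) (AnyP.++⁺ʳ D₁ (proj₂ (proj₂ (splits-ends c))))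
      in-C₁ (there x) = Any-resp-↭ (↭-sym C₁-perm) (AnyP.++⁺ˡ x)
      left-end : ∀ {x} → x ≡ a ⊎ x ≡ b → Any (Touches x) C₁ → Any (Touches x) (v ∷ D₁)
      left-end x∈ t with AnyP.++⁻ D₁ (Any-resp-↭ C₁-perm t)
      ... | inj₁ t′ = there t′
      ... | inj₂ t′ with splits-shared c (Any-resp-↭ (↭-sym s) (here (Sum.map sym sym x∈))) t′
      ... | inj₁ refl = here (inj₁ refl)
      ... | inj₂ refl = here (inj₂ refl)
      right-end : ∀ {x} → Any (Touches x) E₁ → Any (Touches x) (D₁ ++ C₂)
      right-end t with Any-resp-↭ s t
      ... | there t′ = AnyP.++⁺ˡ t′
      ... | here (inj₁ refl) = AnyP.++⁺ʳ D₁ (proj₂ (proj₁ (splits-ends glued)))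
      ... | here (inj₂ refl) = AnyP.++⁺ʳ D₁ (proj₂ (proj₂ (splits-ends glued)))
      shared : ∀ {x} → Any (Touches x) D₁ ⊎ Any (Touches x) C₂ → Any (Touches x) E₂ → x ≡ a₀ ⊎ x ≡ b₀
      shared (inj₁ t) t′ = splits-shared c (Any-resp-↭ (↭-sym s) (there t)) t′
      shared (inj₂ t) t′ with splits-shared glued (Any-resp-↭ (↭-sym C₁-perm) (AnyP.++⁺ʳ D₁ t′)) t
      ... | inj₁ refl = splits-shared c (Any-resp-↭ (↭-sym s) (here (inj₁ refl))) t′
      ... | inj₂ refl = splits-shared c (Any-resp-↭ (↭-sym s) (here (inj₂ refl))) t′

  label-absent : ∀ {k H ℓ a b} {C : MultiGraph n Kind} → Sound k H → H ↭ edge a b (virtual ℓ) ∷ C → ¬ OnM C (inj₂ ℓ)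
  label-absent S p o with labels-↭ p (Sound.labels S)
  ... | d ∷ _ = let (e , i , q) = find o in All.lookup d i refl q

  -- Induction on the splittings. If the last one has label ℓ it is dropped, and lowering changes
  -- nothing because all other labels are smaller; otherwise ℓ is undone earlier and the last
  -- splitting is performed again.
  unsplit : ∀ {B k Hs} → Sound 0 B → Splittings B (suc k) Hs → ∀ ℓ → ℓ < suc k → Unsplit B k Hs ℓ
  unsplit {k = k} S (split {Hs′ = Hs′} {E₁ = E₁} {E₂} sp p c) ℓ ℓ<k with ℓ ≟ⁿ k
  ... | yes refl = record
    { perm = ↭-refl ; perm₁ = ↭-refl ; perm₂ = ↭-refl
    ; glued = splits-++ c
    ; absent = All.map (λ s o → let (e , i , q) = find o in <-irrefl refl (All.lookup (Sound.bounded s) i _ q)) (All.tail sounds)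
    ; splittings = sp
    ; merged-perm = ↭-trans c.partition (↭-reflexive (sym (relabel-bounded (E₁ ++ E₂) (All-resp-↭ c.partition (Sound.bounded (All.head sounds))))))
    ; perm′ = ↭-trans p (↭-prep _ (↭-reflexive (sym (same Hs′ (All.tail sounds))))) }
    where
    module c = SplitsAlong c
    sounds = All-resp-↭ p (pieces-sound S sp)
    same : ∀ Hs → All (Sound ℓ) Hs → map (relabel (lower ℓ)) Hs ≡ Hs
    same [] [] = refl
    same (H ∷ Hs) (s ∷ ss) = cong₂ _∷_ (relabel-bounded H (Sound.bounded s)) (same Hs ss)
  unsplit {k = zero} S (split sp p c) ℓ (s≤s z≤n) | no ne = contradiction refl ne
  unsplit {k = suc k} S (split {Hs = Hs} {H} {Hs′} {a₀} {b₀} {E₁} {E₂} sp p c) ℓ ℓ<k | no ne = place U (∈-resp-↭ perm (∈-resp-↭ (↭-sym p) (here refl)))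
    where
    ℓ<k′ : ℓ < suc k
    ℓ<k′ = ≤∧≢⇒< (≤-pred ℓ<k) ne
    U = unsplit S sp ℓ ℓ<k′
    open Unsplit U using (perm)
    sound : ∀ {H} → H ∈ˡ Hs → Sound (suc k) H
    sound i = All.lookup (pieces-sound S sp) i
    absent₁ : ∀ (U : Unsplit _ k Hs ℓ) → ¬ OnM (Unsplit.C₁ U) (inj₂ ℓ)
    absent₁ U = label-absent (sound (∈-resp-↭ (↭-sym (Unsplit.perm U)) (here refl))) (Unsplit.perm₁ U)
    rest : ∀ (U : Unsplit _ k Hs ℓ) → H ≡ Unsplit.H₁ U → Hs′ ↭ Unsplit.H₂ U ∷ Unsplit.Rest U
    rest U refl = drop-∷ (↭-trans (↭-sym p) (Unsplit.perm U))
    first : ∀ (U : Unsplit _ k Hs ℓ) → H ≡ Unsplit.H₁ U → Unsplit _ (suc k) _ ℓ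
    first U eq with ∈-concat-split (SplitsAlong.partition c) (subst (edge _ _ (virtual ℓ) ∈ˡ_) (sym eq) (∈-resp-↭ (↭-sym perm₁) (here refl)))
      where open Unsplit U
    ... | inj₁ (D , s) = resplit-first ℓ<k′ U p c ↭-refl (absent₁ U) eq (rest U eq) s
    ... | inj₂ (D , s) = resplit-first ℓ<k′ U p (splits-sym c) (↭-swap _ _ ↭-refl) (absent₁ U) eq (rest U eq) s
    place : ∀ (U : Unsplit _ k Hs ℓ) → H ∈ˡ Unsplit.H₁ U ∷ Unsplit.H₂ U ∷ Unsplit.Rest U → Unsplit _ (suc k) _ ℓ
    place U (here eq) = first U eq
    place U (there (here eq)) = first (unsplit-swap U) eq
    place U (there (there i)) with ∈⇒↭ i
    ... | Rest′ , q = resplit-other ℓ<k′ U p c ↭-refl q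
      (drop-∷ (↭-trans (↭-sym p) (↭-trans (Unsplit.perm U)
        (↭-trans (↭-prep _ (↭-prep _ q)) (shifts (Unsplit.H₁ U ∷ Unsplit.H₂ U ∷ []) (H ∷ []) {Rest′})))))

-- Cycles as closed trails, and merging of pieces

module _ {n : ℕ} where

  data Trail : Fin n → Fin n → MultiGraph n Kind → List (Fin n) → Set where
    stop : ∀ {a} → Trail a a [] [ a ]
    step : ∀ {a c b e E vs} → Joins a c e → Trail c b E vs → Trail a b (e ∷ E) (a ∷ vs)

  trail-cut : ∀ {a b E vs e} → Trail a b E vs → e ∈ˡ E → ∃₂ λ c d → ∃₂ λ E₁ E₂ → ∃₂ λ vs₁ vs₂ →
              E ≡ E₁ ++ e ∷ E₂ × vs ≡ vs₁ ++ vs₂ × Trail a c E₁ vs₁ × Joins c d e × Trail d b E₂ vs₂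
  trail-cut (step j t) (here refl) = _ , _ , [] , _ , _ , _ , refl , refl , stop , j , t
  trail-cut (step j t) (there i) with trail-cut t i
  ... | c , d , E₁ , E₂ , vs₁ , vs₂ , refl , refl , t₁ , j′ , t₂ =
    c , d , _ ∷ E₁ , E₂ , _ ∷ vs₁ , vs₂ , refl , refl , step j t₁ , j′ , t₂

  trail-glue : ∀ {a b c d E₁ E₂ vs₁ vs₂ e} → Trail a b E₁ vs₁ → Joins b c e → Trail c d E₂ vs₂ →
               Trail a d (E₁ ++ e ∷ E₂) (vs₁ ++ vs₂)
  trail-glue stop j t = step j t
  trail-glue (step j′ t′) j t = step j′ (trail-glue t′ j t)

  trail-reverse : ∀ {a b E vs} → Trail a b E vs → ∃₂ λ E′ vs′ → E′ ↭ E × vs′ ↭ vs × Trail b a E′ vs′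
  trail-reverse stop = _ , _ , ↭-refl , ↭-refl , stop
  trail-reverse (step {a = a} {e = e} j t) with trail-reverse t
  ... | E′ , vs′ , p , q , t′ = E′ ++ [ e ] , vs′ ++ [ a ] ,
    ↭-trans (++-comm E′ [ e ]) (↭-prep e p) , ↭-trans (++-comm vs′ [ a ]) (↭-prep a q) ,
    trail-glue t′ (joins-sym {e = e} j) stop

  trail-touches : ∀ {a b E vs x} → Trail a b E vs → x ∈ˡ vs → x ≡ b ⊎ Any (Touches x) E
  trail-touches stop (here refl) = inj₁ refl
  trail-touches (step {e = e} j t) (here refl) = inj₂ (here (proj₁ (joins-touches {e = e} j)))
  trail-touches (step j t) (there i) = Sum.map₂ there (trail-touches t i)

  unique-↭ : ∀ {A : Set} {xs ys : List A} → xs ↭ ys → Unique xs → Unique ys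
  unique-↭ = allPairs-resp-↭ (λ p q → p (sym q))

  -- A cycle seen from one of its edges. Unlike the indexed template, this form can be opened at any
  -- edge, such as the shared virtual one.
  record Closed (H : MultiGraph n Kind) (e : Edge n Kind) : Set where
    field
      {a b}  : Fin n
      {E}    : MultiGraph n Kind
      {vs}   : List (Fin n)
      perm   : H ↭ e ∷ E
      closes : Joins b a e
      trail  : Trail a b E vs
      unique : Unique vs

  close-at : ∀ {H e e′} → Closed H e → e′ ∈ˡ H → Closed H e′
  close-at {H} {e} {e′} C i with ∈-resp-↭ perm i
    where open Closed C
  ... | here refl = C
  ... | there j with trail-cut (Closed.trail C) j
  ... | c , d , E₁ , E₂ , vs₁ , vs₂ , refl , refl , t₁ , j′ , t₂ = record
    { perm = ↭-trans perm (↭-trans (↭-prep e (shift e′ E₁ E₂)) (↭-trans (↭-swap e e′ ↭-refl)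
               (↭-prep e′ (↭-trans (↭-prep e (++-comm E₁ E₂)) (↭-sym (shift e E₂ E₁))))))
    ; closes = j′
    ; trail = trail-glue t₂ closes t₁
    ; unique = unique-↭ (++-comm vs₁ vs₂) unique }
    where open Closed C

  rim-trail : ∀ {k} (f : Fin (suc k) → Fin n) (es : Fin k → Edge n Kind) →
              (∀ i → Joins (f (inject₁ i)) (f (suc i)) (es i)) → Trail (f zero) (f (fromℕ k)) (tabulate es) (tabulate f)
  rim-trail {zero} f es js = stop
  rim-trail {suc k} f es js = step (js zero) (rim-trail (f ∘ suc) (es ∘ suc) (js ∘ suc))

  cycle⇒closed : ∀ {H e} → IsCycle H → e ∈ˡ H → Closed H e
  cycle⇒closed (zero , () , _)
  cycle⇒closed (suc k , _ , f , inj , H′ , p , pw) = close-at record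
    { perm = ↭-trans p (↭-reflexive edges) ; closes = closes
    ; trail = rim-trail f steps joins ; unique = UniqueP.tabulate⁺ inj }
    where open Rim (rim {f = f} id pw)

  closed⇒cycle : ∀ {H e} → Closed H e → 3 ≤ length H → IsCycle H
  closed⇒cycle {H} {e} C size = suc (length E) , subst (3 ≤_) (↭-length perm) size , f trail , inj trail unique , e ∷ E , perm ,
    (subst₂ (λ x y → Joins x y e) (sym (f-last trail)) (sym (f-zero trail)) closes , permits-any (label e)) ∷
    subst (Pointwise (Matches (f trail)) E) (sym (ListP.map-tabulate (λ i → inject₁ i , suc i) (λ (i , j) → edge i j may-be-virtual)))
      (subst (λ F → Pointwise (Matches (f trail)) F (tabulate λ i → edge (inject₁ i) (suc i) may-be-virtual)) (ListP.tabulate-lookup E) (PW.tabulate⁺ λ i → f-joins trail i , permits-any (label (lookup E i))))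
    where
    open Closed C
    f : ∀ {a b E vs} → Trail a b E vs → Fin (suc (length E)) → Fin n
    f {a} _ zero = a
    f (step _ t) (suc i) = f t i
    f-zero : ∀ {a b E vs} (t : Trail a b E vs) → f t zero ≡ a
    f-zero _ = refl
    f-last : ∀ {a b E vs} (t : Trail a b E vs) → f t (fromℕ (length E)) ≡ b
    f-last stop = refl
    f-last (step _ t) = f-last t
    f-∈ : ∀ {a b E vs} (t : Trail a b E vs) i → f t i ∈ˡ vs
    f-∈ stop zero = here refl
    f-∈ (step _ t) zero = here refl
    f-∈ (step _ t) (suc i) = there (f-∈ t i)
    inj : ∀ {a b E vs} (t : Trail a b E vs) → Unique vs → Injective _≡_ _≡_ (f t)
    inj t u {zero} {zero} _ = refl
    inj (step _ t) (p ∷ u) {zero} {suc j} q = contradiction q (All.lookup p (f-∈ t j))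
    inj (step _ t) (p ∷ u) {suc i} {zero} q = contradiction (sym q) (All.lookup p (f-∈ t i))
    inj (step _ t) (p ∷ u) {suc i} {suc j} q = cong suc (inj t u q)
    f-joins : ∀ {a b E vs} (t : Trail a b E vs) i → Joins (f t (inject₁ i)) (f t (suc i)) (lookup E i)
    f-joins (step j stop) zero = j
    f-joins (step j (step _ _)) zero = j
    f-joins (step j t) (suc i) = f-joins t i

  open-trail : ∀ {H a b ℓ C} → IsCycle H → H ↭ edge a b (virtual ℓ) ∷ C → ∃₂ λ E vs → C ↭ E × Unique vs × Trail a b E vs
  open-trail {a = a} {b} {ℓ} cyc p with cycle⇒closed {e = edge a b (virtual ℓ)} cyc (∈-resp-↭ (↭-sym p) (here refl))
  ... | record { E = E ; vs = vs ; perm = q ; closes = inj₂ (refl , refl) ; trail = t ; unique = u } =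
    E , vs , drop-∷ (↭-trans (↭-sym p) q) , u , t
  ... | record { E = E ; vs = vs ; perm = q ; closes = inj₁ (refl , refl) ; trail = t ; unique = u } with trail-reverse t
  ... | E′ , vs′ , pE , pvs , t′ = E′ , vs′ , ↭-trans (drop-∷ (↭-trans (↭-sym p) q)) (↭-sym pE) , unique-↭ (↭-sym pvs) u , t′

  -- Opened at the virtual edge, the two cycles become trails between a and b. Since the sides share
  -- no other vertex, the trails close up to one cycle.
  merge-cycles : ∀ {a b ℓ H₁ H₂ C₁ C₂} → SplitsAlong a b (C₁ ++ C₂) C₁ C₂ →
                 H₁ ↭ edge a b (virtual ℓ) ∷ C₁ → H₂ ↭ edge a b (virtual ℓ) ∷ C₂ →
                 IsCycle H₁ → IsCycle H₂ → IsCycle (C₁ ++ C₂)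
  merge-cycles {a} {b} {ℓ} {C₁ = C₁} {C₂} s p₁ p₂ c₁ c₂ with open-trail c₁ p₁ | open-trail c₂ p₂
  ... | E₁ , vs₁ , q₁ , u₁ , t₁ | E₂ , vs₂ , q₂ , u₂ , t₂ with trail-reverse t₂
  ... | E₂′ , vs₂′ , r , r′ , t₂′ = go t₁ t₂′ u₁ (unique-↭ (↭-sym r′) u₂) q₁ (↭-trans q₂ (↭-sym r))
    where
    open SplitsAlong s
    go : ∀ {E₁ vs₁ E₂ vs₂} → Trail a b E₁ vs₁ → Trail b a E₂ vs₂ → Unique vs₁ → Unique vs₂ →
         C₁ ↭ E₁ → C₂ ↭ E₂ → IsCycle (C₁ ++ C₂)
    go stop _ _ _ _ _ = contradiction refl distinct
    go (step _ _) stop _ _ _ _ = contradiction refl distinct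
    go {E₁} {_ ∷ vs₁} {E₂} {_ ∷ vs₂} tr₁@(step {e = e₁} {E₁′} j₁ t₁) tr₂@(step {e = e₂} {E₂′} j₂ t₂) (a∉ ∷ u₁) (b∉ ∷ u₂) q₁ q₂ =
      closed⇒cycle {e = e₂} record
        { perm = ↭-trans (++⁺-↭ q₁ q₂) (↭-trans (++-comm E₁ E₂) (↭-refl))
        ; closes = j₂ ; trail = trail-glue t₂ j₁ t₁
        ; unique = UniqueP.++⁺ u₂ u₁ disjoint }
        (≤-trans (s≤s (s≤s (s≤s z≤n))) (≤-trans (+-mono-≤ size₁ size₂) (≤-reflexive (sym (ListP.length-++ C₁)))))
      where
      on₁ : ∀ {x} → x ∈ˡ vs₁ → Any (Touches x) C₁
      on₁ i with trail-touches tr₁ (there i)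
      ... | inj₁ refl = proj₁ (proj₂ (splits-ends s))
      ... | inj₂ t = Any-resp-↭ (↭-sym q₁) t
      on₂ : ∀ {x} → x ∈ˡ vs₂ → Any (Touches x) C₂
      on₂ i with trail-touches tr₂ (there i)
      ... | inj₁ refl = proj₂ (proj₁ (splits-ends s))
      ... | inj₂ t = Any-resp-↭ (↭-sym q₂) t
      disjoint : ∀ {x} → ¬ (x ∈ˡ vs₂ × x ∈ˡ vs₁)
      disjoint (i , j) with splits-shared s (on₁ j) (on₂ i)
      ... | inj₁ refl = All.lookup a∉ j refl
      ... | inj₂ refl = All.lookup b∉ i refl

  multiedge-joins : ∀ {H : MultiGraph n Kind} {e} → IsMultiedge H → e ∈ˡ H → All (Joins (end₁ e) (end₂ e)) H
  multiedge-joins {H} {e} (k , _ , f , _ , H′ , p , pw) i =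
    All.tabulate λ {e′} j → joins-parallel {e = e′} {e} (all pw (∈-resp-↭ p j)) (all pw (∈-resp-↭ p i))
    where
    all : ∀ {k H′} → Pointwise (Matches f) H′ (multiedge k) → ∀ {e} → e ∈ˡ H′ → Joins (f 0F) (f 1F) e
    all {suc k} ((j , _) ∷ _) (here refl) = j
    all {suc k} (_ ∷ w) (there i) = all w i

  merge-multiedges : ∀ {a b ℓ} {H₁ H₂ C₁ C₂ : MultiGraph n Kind} → SplitsAlong a b (C₁ ++ C₂) C₁ C₂ →
                     H₁ ↭ edge a b (virtual ℓ) ∷ C₁ → H₂ ↭ edge a b (virtual ℓ) ∷ C₂ →
                     IsMultiedge H₁ → IsMultiedge H₂ → IsMultiedge (C₁ ++ C₂)
  merge-multiedges {C₁ = C₁} s p₁ p₂ m₁ m₂ = all-parallel distinct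
    (AllP.++⁺ (All.tail (All-resp-↭ p₁ (multiedge-joins m₁ (∈-resp-↭ (↭-sym p₁) (here refl)))))
              (All.tail (All-resp-↭ p₂ (multiedge-joins m₂ (∈-resp-↭ (↭-sym p₂) (here refl))))))
    (≤-trans (s≤s (s≤s (s≤s z≤n))) (≤-trans (+-mono-≤ size₁ size₂) (≤-reflexive (sym (ListP.length-++ C₁)))))
    where open SplitsAlong s

  hasType-relabel : ∀ {m} (T : Template m) {H : MultiGraph n Kind} {f} → H HasType T → relabel f H HasType T
  hasType-relabel T {f = g} (f , inj , H′ , p , w) = f , inj , relabel g H′ , map⁺ _ p , go w
    where
    permits : ∀ {s x} → Permits s x → Permits s (relabelKind g x)
    permits real = real
    permits virtual = virtual
    go : ∀ {H T} → Pointwise (Matches f) H T → Pointwise (Matches f) (relabel g H) T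
    go [] = []
    go ((j , q) ∷ w) = (j , permits q) ∷ go w

  hasType-↭ : ∀ {m} (T : Template m) {H H′ : MultiGraph n Kind} → H ↭ H′ → H HasType T → H′ HasType T
  hasType-↭ T p (f , inj , H″ , q , w) = f , inj , H″ , ↭-trans (↭-sym p) q , w

  unseparated-relabel : ∀ {m f} (M : MultiGraph n Kind) → Unseparated m M → Unseparated m (relabel f M)
  unseparated-relabel {m} {f} M h X small u v u∈ v∈ u∉ v∉ =
    Star-map (λ (a , b , j) → a , b , AnyP.map⁺ j)
      (h X small u v (subst (u ∈_) (relabel-vertices f M) u∈) (subst (v ∈_) (relabel-vertices f M) v∈) u∉ v∉)

  good-relabel : ∀ {f H} → Good H → Good (relabel f H)
  good-relabel (inj₁ (k , p , t)) = inj₁ (k , p , hasType-relabel (cycle k) t)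
  good-relabel (inj₂ (inj₁ (k , p , t))) = inj₂ (inj₁ (k , p , hasType-relabel (multiedge k) t))
  good-relabel {f} {H} (inj₂ (inj₂ ((loop , par) , big , conn))) = inj₂ (inj₂
    ((AllP.map⁺ loop , AllPairsP.map⁺ par) , subst (λ S → ∣ S ∣ > 3) (sym (relabel-vertices f H)) big , unseparated-relabel H conn))

  allPairs-intro : ∀ {A : Set} {R : A → A → Set} xs → (∀ {x y rest} → xs ↭ x ∷ y ∷ rest → R x y) → AllPairs R xs
  allPairs-intro [] h = []
  allPairs-intro (x ∷ xs) h =
    All.tabulate (λ i → h (↭-prep x (proj₂ (∈⇒↭ i)))) ∷
    allPairs-intro xs λ {y} {z} {rest} p → h {rest = x ∷ rest} (↭-trans (↭-prep x p) (↭-trans (↭-swap x y ↭-refl) (↭-prep y (↭-swap x z ↭-refl))))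

  -- Applied to the pieces that carry a given label: two such pieces must be the pair created by
  -- that splitting, in one order or the other.
  same-pair : ∀ {A : Set} {P : A → Set} {x y x′ y′ : A} {rest rest′} → x ∷ y ∷ rest ↭ x′ ∷ y′ ∷ rest′ →
              P x → P y → All (λ z → ¬ P z) rest′ → (x ≡ x′ × y ≡ y′) ⊎ (x ≡ y′ × y ≡ x′)
  same-pair p px py none′ with ∈-resp-↭ p (here refl)
  ... | there (there i) = contradiction px (All.lookup none′ i)
  ... | here refl with ∈-resp-↭ (drop-∷ p) (here refl)
  ... | here refl = inj₁ (refl , refl)
  ... | there i = contradiction py (All.lookup none′ i)
  same-pair p px py none′ | there (here refl) with ∈-resp-↭ (drop-∷ (↭-trans p (↭-swap _ _ ↭-refl))) (here refl)
  ... | here refl = inj₂ (refl , refl)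
  ... | there i = contradiction py (All.lookup none′ i)

  -- Among the decompositions into good pieces one with the fewest splits is canonical.
  no-splitting : ∀ {B} → Sound 0 B → (∀ Hs → ¬ TutteDecomposition B Hs) →
                 ∀ k {Hs} → Splittings B k Hs → All Good Hs → ⊥
  no-splitting {B} S ¬D k {Hs} sp good = ¬D Hs record
    { obtained = sp ; pieces = good ; canonical = allPairs-intro Hs (canonical k sp good) }
    where
    merged-good : ∀ {k Hs ℓ} (U : Unsplit B k Hs ℓ) → All Good Hs →
                  IsCycle (Unsplit.C₁ U ++ Unsplit.C₂ U) ⊎ IsMultiedge (Unsplit.C₁ U ++ Unsplit.C₂ U) → All Good (Unsplit.Hs′ U)
    merged-good {ℓ = ℓ} U good m with All-resp-↭ (Unsplit.perm U) good
    ... | _ ∷ _ ∷ gs = All-resp-↭ (↭-sym perm′) (merged-is m ∷ AllP.map⁺ (All.map good-relabel gs))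
      where
      open Unsplit U
      merged-is : IsCycle (C₁ ++ C₂) ⊎ IsMultiedge (C₁ ++ C₂) → Good merged
      merged-is (inj₁ (k , p , t)) = inj₁ (k , p , hasType-↭ (cycle k) (↭-sym merged-perm) (hasType-relabel (cycle k) t))
      merged-is (inj₂ (k , p , t)) = inj₂ (inj₁ (k , p , hasType-↭ (multiedge k) (↭-sym merged-perm) (hasType-relabel (multiedge k) t)))
    canonical : ∀ k {Hs} → Splittings B k Hs → All Good Hs → ∀ {H H′ rest} → Hs ↭ H ∷ H′ ∷ rest →
                ShareVirtualEdge H H′ → ¬ (IsCycle H × IsCycle H′) × ¬ (IsMultiedge H × IsMultiedge H′)
    canonical zero none good p = case ↭-length p of λ ()
    canonical (suc k) {Hs} sp good {H} {H′} p (ℓ , h , h′) = cycles , multiedges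
      where
      ℓ<k : ℓ < suc k
      ℓ<k = let (e , i , q) = find h in All.lookup (Sound.bounded (All.head (All-resp-↭ p (pieces-sound S sp)))) i ℓ q
      U = unsplit S sp ℓ ℓ<k
      open Unsplit U
      which : (H ≡ H₁ × H′ ≡ H₂) ⊎ (H ≡ H₂ × H′ ≡ H₁)
      which = same-pair {P = λ X → OnM X (inj₂ ℓ)} (↭-trans (↭-sym p) perm) h h′ absent
      cycles : ¬ (IsCycle H × IsCycle H′)
      cycles (c , c′) with which
      ... | inj₁ (e , e′) = no-splitting S ¬D k splittings (merged-good U good (inj₁ (merge-cycles glued perm₁ perm₂ (subst IsCycle e c) (subst IsCycle e′ c′))))
      ... | inj₂ (e , e′) = no-splitting S ¬D k splittings (merged-good U good (inj₁ (merge-cycles glued perm₁ perm₂ (subst IsCycle e′ c′) (subst IsCycle e c))))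
      multiedges : ¬ (IsMultiedge H × IsMultiedge H′)
      multiedges (c , c′) with which
      ... | inj₁ (e , e′) = no-splitting S ¬D k splittings (merged-good U good (inj₂ (merge-multiedges glued perm₁ perm₂ (subst IsMultiedge e c) (subst IsMultiedge e′ c′))))
      ... | inj₂ (e , e′) = no-splitting S ¬D k splittings (merged-good U good (inj₂ (merge-multiedges glued perm₁ perm₂ (subst IsMultiedge e′ c′) (subst IsMultiedge e c))))

  -- The double negation avoids deciding which pieces are cycles or multiedges, and is enough for
  -- deriving a contradiction from a minor.
  decomposition-exists : ∀ {B} → Sound 0 B → 3 ≤ length B → ¬ (∀ Hs → ¬ TutteDecomposition B Hs)
  decomposition-exists S size ¬D = let (k , Hs , sp , g) = good-splitting S size in no-splitting S ¬D k sp g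

-- From allowed components back to the graph

module _ {n : ℕ} (G : Graph n) where
  open Graph G

  private
    Ordered : Fin n × Fin n → Set
    Ordered (i , j) = toℕ i < toℕ j × i ~ j
    ordered? : ∀ p → Dec (Ordered p)
    ordered? (i , j) = (toℕ i <? toℕ j) ×-dec (i ~? j)
    pairs = cartesianProduct (allFin n) (allFin n)

  edgesOf : MultiGraph n Kind
  edgesOf = map (λ (i , j) → edge i j real) (filter ordered? pairs)

  edgesOf-subgraph : Subgraph G edgesOf
  edgesOf-subgraph =
    (AllP.map⁺ (All.map (λ (lt , _) eq → <-irrefl (cong toℕ eq) lt) ordered) ,
     AllPairsP.map⁺ (nonparallel ordered (UniqueP.filter⁺ ordered? (UniqueP.cartesianProduct⁺ (UniqueP.allFin⁺ n) (UniqueP.allFin⁺ n))))) ,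
    AllP.map⁺ (All.map (λ (_ , r) → r , refl) ordered)
    where
    ordered = AllP.all-filter ordered? pairs
    nonparallel : ∀ {xs} → All Ordered xs → Unique xs →
                  AllPairs (λ (i , j) (k , l) → ¬ Parallel {n} {Kind} (edge i j real) (edge k l real)) xs
    nonparallel [] [] = []
    nonparallel {(i , j) ∷ xs} ((lt , _) ∷ os) (x∉ ∷ u) = All.zipWith (λ { ((lt′ , _) , ne) → λ
      { (inj₁ (refl , refl)) → ne refl
      ; (inj₂ (refl , refl)) → <-irrefl refl (<-trans lt lt′) } }) (os , x∉) ∷ nonparallel os u

  edgesOf-hat : ∀ {u v} → u ~ v → Hat edgesOf (inj₁ u) (inj₁ v)
  edgesOf-hat {u} {v} r with <-cmp (toℕ u) (toℕ v)
  ... | tri< lt _ _ = lose (∈-map⁺ _ (∈-filter⁺ ordered? (∈-cartesianProduct⁺ (∈-allFin u) (∈-allFin v)) (lt , r)))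
                            (direct refl (inj₁ (refl , refl)))
  ... | tri≈ _ eq _ = contradiction (toℕ-injective eq) (~⇒≢ G r)
  ... | tri> _ _ gt = lose (∈-map⁺ _ (∈-filter⁺ ordered? (∈-cartesianProduct⁺ (∈-allFin v) (∈-allFin u)) (gt , ~-sym r)))
                            (direct refl (inj₂ (refl , refl)))

  edgesOf-model : Model _~_ (Hat edgesOf)
  edgesOf-model = record { φ = φ ; conn = λ {v} {w} → conn {v} {w} ; edges = λ r → _ , _ , refl , refl , edgesOf-hat r }
    where
    φ : Point n → Maybe (Fin n)
    φ (inj₁ x) = just x
    φ (inj₂ _) = nothing
    conn : ∀ {v w x} → φ v ≡ just x → φ w ≡ just x → Star (Inside (Hat edgesOf) φ x) v w
    conn {inj₁ x} {inj₁ _} refl refl = ε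

  subgraph-sound : ∀ {S} → Subgraph G S → Unseparated 2 S → Sound 0 S
  subgraph-sound ((loop , par) , re) conn = record
    { loopless = loop
    ; reals = AllPairs.map (λ p _ _ → p) par
    ; labels = allReal re
    ; bounded = All.map (λ { (_ , r) _ v → case trans (sym r) v of λ () }) re
    ; two-conn = conn }
    where
    allReal : ∀ {S} → All (λ e → end₁ e ~ end₂ e × label e ≡ real) S → AllPairs DistinctLabels S
    allReal [] = []
    allReal ((_ , r) ∷ rs) = All.tabulate (λ _ v → case trans (sym r) v of λ ()) ∷ allReal rs

  subgraph-model : ∀ {S B} → Subgraph G S → Subgraph G B → _⊑_ G S B → Model (Hat S) (Hat B)
  subgraph-model {S} {B} (_ , rs) (_ , rb) sub = id-model λ h →
    let (e , i , l) = find h ; (e′ , j , p) = find (All.lookup sub i) in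
    lose j (transfer (proj₂ (All.lookup rs i)) (proj₂ (All.lookup rb j)) p l)
    where
    transfer : ∀ {e e′ s t} → label e ≡ real → label e′ ≡ real → Parallel e e′ → Link e s t → Link e′ s t
    transfer {e} {e′} r r′ p (direct _ j) = direct r′ (parallel-joins {e = e′} {e} (parallel-sym {e = e} {e′} p) j)
    transfer r r′ p (enter v _) = case trans (sym r) v of λ ()
    transfer r r′ p (leave v _) = case trans (sym r) v of λ ()

  subgraph-bound : ∀ {S} → Subgraph G S → length S ≤ n * n
  subgraph-bound {S} ((_ , par) , rs) = pigeonholes (n * n) {Uses = Uses}
    (AllPairs.map (λ { {e} np refl → np (joins-ends e) }) par)
    (λ {e} i → combine (end₁ e) (end₂ e) , refl , proj₂ (All.lookup rs i)) inj
    where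
    Uses : Edge n Kind → Fin (n * n) → Set
    Uses e i = combine (end₁ e) (end₂ e) ≡ i × label e ≡ real
    inj : ∀ {a b i} → Uses a i → Uses b i → a ≡ b
    inj {edge x y _} {edge x′ y′ _} (p , refl) (q , refl) with combine-injective x y x′ y′ (trans p (sym q))
    ... | refl , refl = refl

  -- S extended by an edge of B that has no parallel in S still injects into the edges of B.
  ⊑-longer : ∀ {S B} → Subgraph G S → Subgraph G B → _⊑_ G S B → ¬ (_⊑_ G B S) → length S < length B
  ⊑-longer {S} {B} ((_ , parS) , _) _ sub ¬sub with find (AllP.¬All⇒Any¬ (λ e → Any.any? (parallel? e) S) B ¬sub)
  ... | g , g∈ , new = pigeonholes (length B) {xs = g ∷ S} {Uses} (AllPairs.map (λ { {e} np refl → np (joins-ends e) }) simple) use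
    inj
    where
    Uses : Edge n Kind → Fin (length B) → Set
    Uses e i = e ∈ˡ g ∷ S × Parallel e (lookup B i)
    nonparallel-sym : Symmetric (NonParallel {n} {Kind})
    nonparallel-sym {x} {y} np p = np (parallel-sym {e = y} {x} p)
    simple : AllPairs NonParallel (g ∷ S)
    simple = AllP.¬Any⇒All¬ S new ∷ parS
    inj : ∀ {e e′ i} → Uses e i → Uses e′ i → e ≡ e′
    inj {e} {e′} {i} (e∈ , p) (e′∈ , q) with allPairs-lookup (λ {x} {y} → nonparallel-sym {x} {y}) simple e∈ e′∈
    ... | inj₁ eq = eq
    ... | inj₂ np = contradiction (parallel-joins {e = e} {lookup B i} p (parallel-sym {e = e′} {lookup B i} q)) np
    use : ∀ {e} → e ∈ˡ g ∷ S → ∃ (Uses e)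
    use (here refl) = Any.index g∈ , here refl , subst (Parallel g) (AnyP.lookup-index g∈) (joins-ends g)
    use {e} (there i) = let p = All.lookup sub i in Any.index p , there i , AnyP.lookup-index p

  module _ {k} {K : Graph k} (X : Excluded K) where
    private module X = Excluded X

    -- A vertex of K with three neighbours forces three edges and three vertices in S. The first is
    -- what a splitting into good pieces requires, the second what `ThreeConnectedComponent`
    -- requires of a block.
    module Large {S} (sub : Subgraph G S) (M : Model (Graph._~_ K) (Hat S)) where
      open Model M
      open Star₃ (X.star nothing)

      Arm : Fin k → Edge n Kind → Set
      Arm x e = x ≢ centre × ∃₂ λ v w → Joins v w e × φ (inj₁ v) ≡ just centre × φ (inj₁ w) ≡ just x

      arm : ∀ {x} → Graph._~_ K centre x → ∃ λ e → e ∈ˡ S × Arm x e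
      arm r with edges r
      ... | v , w , p , q , h with find h
      ... | e , i , direct _ j = e , i , ~⇒≢ K (Graph.~-sym K r) , _ , _ , j , p , q
      ... | e , i , enter l _ = case trans (sym (proj₂ (All.lookup (proj₂ sub) i))) l of λ ()
      ... | e , i , leave l _ = case trans (sym (proj₂ (All.lookup (proj₂ sub) i))) l of λ ()

      arm-injective : ∀ {x y e} → Arm x e → Arm y e → x ≡ y
      arm-injective {e = e} (x≢ , v , w , j , p , q) (y≢ , v′ , w′ , j′ , p′ , q′) with touches-ends {e = e} j (proj₂ (joins-touches {e = e} j′))
      ... | inj₁ refl = contradiction (just-injective (trans (sym q′) p)) y≢
      ... | inj₂ refl = just-injective (trans (sym q) q′)

      three : Unique (a ∷ b ∷ c ∷ [])
      three = (a≢b ∷ a≢c ∷ []) ∷ (b≢c ∷ []) ∷ [] ∷ []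

      many-edges : 3 ≤ length S
      many-edges = pigeonholes (length S) {Uses = λ x i → Arm x (lookup S i)} three
        (λ { (here refl) → use sa ; (there (here refl)) → use sb ; (there (there (here refl))) → use sc })
        (λ {x} {y} {i} → arm-injective {x} {y} {lookup S i})
        where
        use : ∀ {x} → Graph._~_ K centre x → ∃ λ i → Arm x (lookup S i)
        use {x} r = let (e , i , m) = arm r in Any.index i , subst (Arm x) (AnyP.lookup-index i) m

      large-order : order S > 2
      large-order = card {xs = tip sa ∷ tip sb ∷ tip sc ∷ []}
        ((differ sa sb a≢b ∷ differ sa sc a≢c ∷ []) ∷ (differ sb sc b≢c ∷ []) ∷ [] ∷ [])
        (tip∈ sa ∷ tip∈ sb ∷ tip∈ sc ∷ [])
        where
        tip : ∀ {x} → Graph._~_ K centre x → Fin n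
        tip r = let (_ , _ , _ , _ , w , _) = arm r in w
        tip∈ : ∀ {x} (r : Graph._~_ K centre x) → tip r ∈ vertices S
        tip∈ r = let (e , i , _ , _ , _ , j , _) = arm r in ∈-vertices⁺ (lose i (proj₂ (joins-touches {e = e} j)))
        tip-φ : ∀ {x} (r : Graph._~_ K centre x) → φ (inj₁ (tip r)) ≡ just x
        tip-φ r = let (_ , _ , _ , _ , _ , _ , _ , q) = arm r in q
        differ : ∀ {x y} (r : Graph._~_ K centre x) (s : Graph._~_ K centre y) → x ≢ y → tip r ≢ tip s
        differ r s ne eq = ne (just-injective (trans (sym (tip-φ r)) (trans (cong (φ ∘ inj₁) eq) (tip-φ s))))

    module _ (allowed : ∀ H → ThreeConnectedComponent G H → Allowed H) where

      -- If S is not maximal, the minor persists in a larger subgraph without a cutvertex, and the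
      -- number of edges is bounded. If S is maximal it is a block, and the minor would lie in the
      -- hat of one of its components.
      two-connected-free : ∀ N {S} → n * n ∸ length S < N → Subgraph G S → Unseparated 2 S → ¬ Model (Graph._~_ K) (Hat S)
      two-connected-free (suc N) {S} bound sub conn M =
        decomposition-exists sound many-edges λ Hs D →
          let open TutteDecomposition D
              (H , H∈ , M′) = find (minor-in-piece X.rigid sound obtained M) in
          allowed-excludes X (Sound.labels (All.lookup (pieces-sound sound obtained) H∈))
            (allowed H (S , (sub , conn , maximal) , large-order , Hs , D , H∈)) M′
        where
        open Large sub M
        sound = subgraph-sound sub conn
        maximal : ∀ B → Subgraph G B → Unseparated 2 B → _⊑_ G S B → _⊑_ G B S
        maximal B subB connB S⊑B with All.all? (λ e → Any.any? (parallel? e) S) B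
        ... | yes p = p
        ... | no ¬p = ⊥-elim (two-connected-free N
          (<-≤-trans (∸-monoʳ-< (⊑-longer sub subB S⊑B ¬p) (subgraph-bound subB)) (≤-pred bound))
          subB connB (M ⨾ subgraph-model sub subB S⊑B))

      -- If at most one vertex separates S, the edges fall into two smaller subgraphs with at most
      -- one common vertex, and by `one-sum` the minor lies in one of them.
      subgraph-free : ∀ N {S} → length S < N → Subgraph G S → ¬ Model (Graph._~_ K) (Hat S)
      subgraph-free (suc N) {S} bound sub@((loop , par) , re) M with unseparated? 2 S
      ... | inj₁ conn = two-connected-free _ ≤-refl sub conn M
      ... | inj₂ sep = [ subgraph-free N (shrinks near-shorter) (part meets?) , subgraph-free N (shrinks far-shorter) (part (¬? ∘ meets?)) ]′
                         (one-sum X.rigid {near} {far-away} one (M ⨾ hat-↭ (filter-split meets? S)))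
        where
        open Separated sep renaming (X to Y)
        open CutOff S Y u∈ u∉
        real-only : ∀ {ℓ E} → (∀ {e} → e ∈ˡ E → e ∈ˡ S) → ¬ OnM E (inj₂ ℓ)
        real-only in-S o = let (e , i , l) = find o in case trans (sym (proj₂ (All.lookup re (in-S i)))) l of λ ()
        one : ∀ {s t} → OnM near s → OnM far-away s → OnM near t → OnM far-away t → s ≡ t
        one {inj₂ _} p = contradiction p (real-only (proj₁ ∘ ∈-filter⁻ meets? {xs = S}))
        one {inj₁ _} {inj₂ _} _ _ p = contradiction p (real-only (proj₁ ∘ ∈-filter⁻ meets? {xs = S}))
        one {inj₁ x} {inj₁ y} p q p′ q′ with x ≟ᶠ y
        ... | yes eq = cong inj₁ eq
        ... | no ne = contradiction (card {xs = x ∷ y ∷ []} ((ne ∷ []) ∷ [] ∷ []) (shared p q ∷ shared p′ q′ ∷ []))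
                        (λ h → <-irrefl refl (<-≤-trans small h))
        nonempty : ∀ {P : Edge n Kind → Set} {M} → Any P M → 1 ≤ length M
        nonempty (here _) = s≤s z≤n
        nonempty (there _) = s≤s z≤n
        total : length S ≡ length near + length far-away
        total = trans (↭-length (filter-split meets? S)) (ListP.length-++ near)
        near-shorter : length near < length S
        near-shorter = subst (length near <_) (sym total)
          (≤-trans (≤-reflexive (+-comm 1 _)) (+-mono-≤ (≤-refl {length near}) (nonempty (other-far-away v∈ v∉ (apart ∘ reached)))))
        far-shorter : length far-away < length S
        far-shorter = subst (length far-away <_) (sym total) (+-mono-≤ (nonempty root-near) (≤-refl {length far-away}))
        shrinks : ∀ {m} → m < length S → m < N
        shrinks p = <-≤-trans p (≤-pred bound)
        part : ∀ {P : Edge n Kind → Set} (P? : ∀ e → Dec (P e)) → Subgraph G (filter P? S)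
        part P? = (AllP.filter⁺ P? loop , AllPairsP.filter⁺ P? par) , AllP.filter⁺ P? re

      allowed⇒free : ¬ (K ≼ G)
      allowed⇒free p = subgraph-free _ ≤-refl edgesOf-subgraph (≼⇒model p ⨾ edgesOf-model)

allowed⇒FP : ∀ {n} (G : Graph n) → (∀ H → ThreeConnectedComponent G H → Allowed H) → FP G
allowed⇒FP G allowed = allowed⇒free G excluded₅ allowed , allowed⇒free G excluded₆ allowed

-- Contractible edges

module _ {n : ℕ} (G : Graph n) where
  open Graph G

  -- a and b may coincide, which covers cutvertices. C need not be connected.
  record Separation₂ : Set where
    field
      C       : Subset n
      {s t}   : Fin n
      a b     : Fin n
      s∈      : s ∈ C
      t∉      : t ∉ C
      a∉      : a ∉ C
      b∉      : b ∉ C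
      t≢a     : t ≢ a
      t≢b     : t ≢ b
      closed  : ∀ {x y} → x ∈ C → x ~ y → y ∈ C ⊎ y ≡ a ⊎ y ≡ b

  TriConnected : Set
  TriConnected = ¬ Separation₂

  triconnected? : TriConnected ⊎ Separation₂
  triconnected? with anySubset? (λ C → any? λ s → any? λ t → any? λ a → any? λ b →
    (s ∈? C) ×-dec ¬? (t ∈? C) ×-dec ¬? (a ∈? C) ×-dec ¬? (b ∈? C) ×-dec ¬? (t ≟ᶠ a) ×-dec ¬? (t ≟ᶠ b) ×-dec
    all? λ x → all? λ y → (x ∈? C) →-dec ((x ~? y) →-dec ((y ∈? C) ⊎-dec ((y ≟ᶠ a) ⊎-dec (y ≟ᶠ b)))))
  ... | yes (C , s , t , a , b , s∈ , t∉ , a∉ , b∉ , ta , tb , cl) = inj₂ record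
    { C = C ; a = a ; b = b ; s∈ = s∈ ; t∉ = t∉ ; a∉ = a∉ ; b∉ = b∉ ; t≢a = ta ; t≢b = tb ; closed = λ {x} {y} → cl x y }
  ... | no h = inj₁ λ S → let open Separation₂ S in
    h (C , _ , _ , a , b , s∈ , t∉ , a∉ , b∉ , t≢a , t≢b , λ _ _ → closed)

  -- C is a parameter because the descent below is measured by its size. The three vertices are not
  -- assumed distinct.
  record Separation₃ (x y z : Fin n) (C : Subset n) : Set where
    field
      {s t}   : Fin n
      s∈      : s ∈ C
      t∉      : t ∉ C
      x∉      : x ∉ C
      y∉      : y ∉ C
      z∉      : z ∉ C
      t≢x     : t ≢ x
      t≢y     : t ≢ y
      t≢z     : t ≢ z
      closed  : ∀ {p q} → p ∈ C → p ~ q → q ∈ C ⊎ q ≡ x ⊎ q ≡ y ⊎ q ≡ z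

  -- {x, y} alone separates as soon as z has no neighbour in C.
  attached : ∀ {x y z C} → TriConnected → Separation₃ x y z C → ∃ λ v → v ∈ C × z ~ v
  attached {x} {y} {z} {C} tri S with any? (λ v → (v ∈? C) ×-dec (z ~? v))
  ... | yes p = p
  ... | no none′ = contradiction (record
    { C = C ; a = x ; b = y ; s∈ = s∈ ; t∉ = t∉ ; a∉ = x∉ ; b∉ = y∉ ; t≢a = t≢x ; t≢b = t≢y
    ; closed = λ i r → case closed i r of λ
        { (inj₁ j) → inj₁ j ; (inj₂ (inj₁ e)) → inj₂ (inj₁ e) ; (inj₂ (inj₂ (inj₁ e))) → inj₂ (inj₂ e)
        ; (inj₂ (inj₂ (inj₂ refl))) → contradiction (_ , i , ~-sym r) none′ } }) tri
    where open Separation₃ S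

  rotate₃ : ∀ {x y z C} → Separation₃ x y z C → Separation₃ z x y C
  rotate₃ S = record
    { s∈ = s∈ ; t∉ = t∉ ; x∉ = z∉ ; y∉ = x∉ ; z∉ = y∉ ; t≢x = t≢z ; t≢y = t≢x ; t≢z = t≢y
    ; closed = λ i r → case closed i r of λ
        { (inj₁ j) → inj₁ j ; (inj₂ (inj₁ e)) → inj₂ (inj₂ (inj₁ e))
        ; (inj₂ (inj₂ (inj₁ e))) → inj₂ (inj₂ (inj₂ e)) ; (inj₂ (inj₂ (inj₂ e))) → inj₂ (inj₁ e) } }
    where open Separation₃ S

  opposite₃ : ∀ {x y z C} → Separation₃ x y z C →
              ∃ λ D → Separation₃ x y z D × (∀ {p} → p ∈ C → p ∉ D) × (∀ {p q} → p ∈ C → p ~ q → q ∉ D)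
  opposite₃ {x} {y} {z} {C} S = D , record
    { s∈ = ∈⟦⟧⁺ D? (t∉ , t≢x , t≢y , t≢z) ; t∉ = λ i → proj₁ (∈⟦⟧⁻ D? i) s∈
    ; x∉ = λ i → proj₁ (proj₂ (∈⟦⟧⁻ D? i)) refl ; y∉ = λ i → proj₁ (proj₂ (proj₂ (∈⟦⟧⁻ D? i))) refl
    ; z∉ = λ i → proj₂ (proj₂ (proj₂ (∈⟦⟧⁻ D? i))) refl
    ; t≢x = λ { refl → x∉ s∈ } ; t≢y = λ { refl → y∉ s∈ } ; t≢z = λ { refl → z∉ s∈ }
    ; closed = closed′ } , (λ i j → proj₁ (∈⟦⟧⁻ D? j) i) , apart
    where
    open Separation₃ S
    D? : ∀ p → Dec (p ∉ C × p ≢ x × p ≢ y × p ≢ z)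
    D? p = ¬? (p ∈? C) ×-dec ¬? (p ≟ᶠ x) ×-dec ¬? (p ≟ᶠ y) ×-dec ¬? (p ≟ᶠ z)
    D = ⟦ D? ⟧
    apart : ∀ {p q} → p ∈ C → p ~ q → q ∉ D
    apart i r j with closed i r | ∈⟦⟧⁻ D? j
    ... | inj₁ k | h , _ = h k
    ... | inj₂ (inj₁ e) | _ , h , _ = h e
    ... | inj₂ (inj₂ (inj₁ e)) | _ , _ , h , _ = h e
    ... | inj₂ (inj₂ (inj₂ e)) | _ , _ , _ , h = h e
    closed′ : ∀ {p q} → p ∈ D → p ~ q → q ∈ D ⊎ q ≡ x ⊎ q ≡ y ⊎ q ≡ z
    closed′ {p} {q} i r with q ≟ᶠ x | q ≟ᶠ y | q ≟ᶠ z
    ... | yes e | _ | _ = inj₂ (inj₁ e)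
    ... | no _ | yes e | _ = inj₂ (inj₂ (inj₁ e))
    ... | no _ | no _ | yes e = inj₂ (inj₂ (inj₂ e))
    ... | no a | no b | no c = inj₁ (∈⟦⟧⁺ D? ((λ j → apart j (~-sym r) i) , a , b , c))

avoid : ∀ {n} (xs : List (Fin n)) → length xs < n → ∃ λ t → t ∉ˡ xs
avoid {n} xs small with any? (λ t → ¬? (Any.any? (t ≟ᶠ_) xs))
... | yes p = p
... | no none′ = contradiction (≤-trans small (≤-trans (≤-reflexive (sym (ListP.length-tabulate {n = n} id)))
    (pigeonholes (length xs) {Uses = λ t i → lookup xs i ≡ t} (UniqueP.allFin⁺ n)
      (λ {t} _ → let i = decidable-stable (Any.any? (t ≟ᶠ_) xs) (λ h → none′ (t , h)) in Any.index i , sym (AnyP.lookup-index i))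
      (λ p q → trans (sym p) q)))) (<-irrefl refl)

-- Otherwise a and b would separate x from a fourth vertex. Applied repeatedly, this gives minimum
-- degree three.
third-neighbour : ∀ {n} (G : Graph n) → 4 ≤ n → TriConnected G → ∀ {x a b} → a ≢ x → b ≢ x →
                  ∃ λ t → Graph._~_ G x t × t ≢ a × t ≢ b
third-neighbour G big tri {x} {a} {b} a≢x b≢x with any? (λ t → Graph._~?_ G x t ×-dec ¬? (t ≟ᶠ a) ×-dec ¬? (t ≟ᶠ b))
... | yes p = p
... | no none′ = contradiction (record
  { C = ⁅ x ⁆ ; a = a ; b = b ; s∈ = x∈⁅x⁆ x ; t∉ = off t≢x ; a∉ = off a≢x ; b∉ = off b≢x ; t≢a = t≢a ; t≢b = t≢b
  ; closed = closed }) tri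
  where
  free = avoid (x ∷ a ∷ b ∷ []) big
  t≢x = λ e → proj₂ free (here e)
  t≢a = λ e → proj₂ free (there (here e))
  t≢b = λ e → proj₂ free (there (there (here e)))
  closed : ∀ {p q} → p ∈ ⁅ x ⁆ → Graph._~_ G p q → q ∈ ⁅ x ⁆ ⊎ q ≡ a ⊎ q ≡ b
  closed {q = q} i r with x∈⁅y⁆⇒x≡y x i | q ≟ᶠ a | q ≟ᶠ b
  ... | refl | yes e | _ = inj₂ (inj₁ e)
  ... | refl | no _ | yes e = inj₂ (inj₂ e)
  ... | refl | no p | no p′ = contradiction (q , r , p , p′) none′

module _ {n : ℕ} (G : Graph (suc n)) (tri : TriConnected G) where
  open Graph G

  -- The preimage D of C is closed except for the preimages of the two separating vertices. If
  -- neither of these were the contracted vertex, two vertices would separate G. So one of them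
  -- comes from both u and v, and the other one is z.
  pull-back : ∀ {u v} → u ~ v → Separation₂ (contract G u v) → ∃₂ λ z C → Separation₃ G u v z C
  pull-back {u} {v} r S = through (a ≟ᶠ π u) (b ≟ᶠ π u)
    where
    open Separation₂ S
    v≢u = ~⇒≢ G (~-sym r)
    π = merge v≢u
    D? = λ x → π x ∈? C
    D = ⟦ D? ⟧
    ι = punchIn v
    π-ι = merge-punchIn v≢u
    in-D : ∀ {i} → i ∈ C → ι i ∈ D
    in-D {i} p = ∈⟦⟧⁺ D? (subst (_∈ C) (sym (π-ι i)) p)
    not-D : ∀ {x i} → π x ≡ i → i ∉ C → x ∉ D
    not-D refl p q = p (∈⟦⟧⁻ D? q)
    step′ : ∀ {x y} → x ∈ D → x ~ y → y ∈ D ⊎ π y ≡ a ⊎ π y ≡ b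
    step′ {x} {y} i xy with π x ≟ᶠ π y
    ... | yes e = inj₁ (∈⟦⟧⁺ D? (subst (_∈ C) e (∈⟦⟧⁻ D? i)))
    ... | no ne with closed (∈⟦⟧⁻ D? i) (contract⇐ G v≢u xy ne)
    ... | inj₁ j = inj₁ (∈⟦⟧⁺ D? j)
    ... | inj₂ e = inj₂ e
    lies : ∀ {y i} → π y ≡ i → y ≡ ι i ⊎ y ≡ v
    lies {y} {i} e with merge-fibre v≢u (trans e (sym (π-ι i)))
    ... | inj₁ q = inj₁ q
    ... | inj₂ (inj₁ (q , _)) = inj₂ q
    ... | inj₂ (inj₂ (_ , q)) = contradiction q (punchInᵢ≢i v i)
    fused : ∀ {y} → π y ≡ π u → y ≡ u ⊎ y ≡ v
    fused e with merge-fibre v≢u e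
    ... | inj₁ q = inj₁ q
    ... | inj₂ (inj₁ (q , _)) = inj₂ q
    ... | inj₂ (inj₂ (q , _)) = inj₁ q
    ι-≢ : ∀ {i j} → i ≢ j → ι i ≢ ι j
    ι-≢ ne e = ne (punchIn-injective v _ _ e)
    -- One of the two separating vertices is the contracted one, and c is the other.
    fused-case : ∀ c → c ∉ C → t ≢ c → (∀ {y} → π y ≡ a ⊎ π y ≡ b → π y ≡ π u ⊎ π y ≡ c) → π u ∉ C → t ≢ π u →
                 ∃₂ λ z C → Separation₃ G u v z C
    fused-case c c∉ t≢c sort u∉ t≢u = ι c , D , record
      { s∈ = in-D s∈ ; t∉ = not-D (π-ι _) t∉ ; x∉ = not-D refl u∉ ; y∉ = not-D (merge-v v≢u) u∉ ; z∉ = not-D (π-ι c) c∉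
      ; t≢x = λ e → t≢u (trans (sym (π-ι _)) (cong π e)) ; t≢y = punchInᵢ≢i v _ ; t≢z = ι-≢ t≢c
      ; closed = λ i xy → case step′ i xy of λ
          { (inj₁ j) → inj₁ j
          ; (inj₂ e) → case sort e of λ
            { (inj₁ e′) → inj₂ (Sum.map₂ inj₁ (fused e′))
            ; (inj₂ e′) → [ (λ q → inj₂ (inj₂ (inj₂ q))) , (λ q → inj₂ (inj₂ (inj₁ q))) ]′ (lies e′) } } }
    through : Dec (a ≡ π u) → Dec (b ≡ π u) → ∃₂ λ z C → Separation₃ G u v z C
    through (yes a≡) _ = fused-case b b∉ t≢b (Sum.map₁ (λ e → trans e a≡)) (subst (_∉ C) a≡ a∉) (λ e → t≢a (trans e (sym a≡)))
    through (no _) (yes b≡) = fused-case a a∉ t≢a (Sum.swap ∘ Sum.map₂ (λ e → trans e b≡)) (subst (_∉ C) b≡ b∉) (λ e → t≢b (trans e (sym b≡)))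
    through (no a≢) (no b≢) = contradiction (record
      { C = D ; a = ι a ; b = ι b ; s∈ = in-D s∈ ; t∉ = not-D (π-ι _) t∉ ; a∉ = not-D (π-ι a) a∉ ; b∉ = not-D (π-ι b) b∉
      ; t≢a = ι-≢ t≢a ; t≢b = ι-≢ t≢b
      ; closed = λ i xy → Sum.map₂ (Sum.map (lies′ a≢) (lies′ b≢)) (step′ i xy) }) tri
      where
      lies′ : ∀ {y i} → i ≢ π u → π y ≡ i → y ≡ ι i
      lies′ ne e with lies e
      ... | inj₁ q = q
      ... | inj₂ refl = contradiction (trans (sym e) (merge-v v≢u)) ne

  -- Thomassen: starting from any edge whose contraction is separable, pass to a
  -- separation that cuts off fewer vertices until a contractible edge appears.
  descend : ∀ {x y z C} → x ~ y → Separation₃ G x y z C → Acc _<_ ∣ C ∣ → ∃₂ λ u v → u ~ v × TriConnected (contract G u v)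
  descend {x} {y} {z} {C} x~y S (acc rec) with attached G tri S
  ... | v , v∈C , z~v with triconnected? (contract G z v)
  ... | inj₁ tri′ = z , v , z~v , tri′
  ... | inj₂ S′ with pull-back z~v S′
  ... | w , D , T with opposite₃ G T
  ... | D′ , T′ , disjoint , apart = choose (x ∈? D) (y ∈? D)
    where
    module S = Separation₃ S
    x≢y = ~⇒≢ G x~y
    -- x and y are adjacent, so one of the two sides of T contains neither; E is that side. The new
    -- set C ∩ E is smaller than C because it lacks v.
    via : ∀ {E} → Separation₃ G z v w E → x ∉ E → y ∉ E → ∃₂ λ u v → u ~ v × TriConnected (contract G u v)
    via {E} U x∉E y∉E = descend z~v smaller (rec (p⊂q⇒∣p∣<∣q∣ ((λ i → proj₁ (x∈p∩q⁻ C E i)) , v , v∈C , λ i → U.y∉ (proj₂ (x∈p∩q⁻ C E i)))))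
      where
      module U = Separation₃ U
      -- v has a neighbour in E, which lies in C because v does.
      inner : ∃ λ p → p ∈ C ∩ E
      inner with attached G tri (rotate₃ G U)
      ... | p , p∈E , v~p with S.closed v∈C v~p
      ... | inj₁ p∈C = p , x∈p∩q⁺ (p∈C , p∈E)
      ... | inj₂ (inj₁ refl) = contradiction p∈E x∉E
      ... | inj₂ (inj₂ (inj₁ refl)) = contradiction p∈E y∉E
      ... | inj₂ (inj₂ (inj₂ refl)) = contradiction p∈E U.x∉
      z≢x : z ≢ x
      z≢x refl = tri record { C = C ; a = x ; b = y ; s∈ = S.s∈ ; t∉ = S.t∉ ; a∉ = S.x∉ ; b∉ = S.y∉ ; t≢a = S.t≢x ; t≢b = S.t≢y
        ; closed = λ i r → Sum.map₂ (λ { (inj₁ e) → inj₁ e ; (inj₂ (inj₁ e)) → inj₂ e ; (inj₂ (inj₂ e)) → inj₁ e }) (S.closed i r) }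
      z≢y : z ≢ y
      z≢y refl = tri record { C = C ; a = x ; b = y ; s∈ = S.s∈ ; t∉ = S.t∉ ; a∉ = S.x∉ ; b∉ = S.y∉ ; t≢a = S.t≢x ; t≢b = S.t≢y
        ; closed = λ i r → Sum.map₂ (λ { (inj₁ e) → inj₁ e ; (inj₂ (inj₁ e)) → inj₂ e ; (inj₂ (inj₂ e)) → inj₂ e }) (S.closed i r) }
      out : ∃ λ t → t ∉ C × t ≢ z × t ≢ v × t ≢ w
      out with x ≟ᶠ w
      ... | no x≢w = x , S.x∉ , z≢x ∘ sym , (λ { refl → S.x∉ v∈C }) , x≢w
      ... | yes refl = y , S.y∉ , z≢y ∘ sym , (λ { refl → S.y∉ v∈C }) , x≢y ∘ sym
      smaller : Separation₃ G z v w (C ∩ E)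
      smaller = record
        { s∈ = proj₂ inner ; t∉ = λ i → proj₁ (proj₂ out) (proj₁ (x∈p∩q⁻ C E i))
        ; x∉ = λ i → U.x∉ (proj₂ (x∈p∩q⁻ C E i)) ; y∉ = λ i → U.y∉ (proj₂ (x∈p∩q⁻ C E i)) ; z∉ = λ i → U.z∉ (proj₂ (x∈p∩q⁻ C E i))
        ; t≢x = proj₁ (proj₂ (proj₂ out)) ; t≢y = proj₁ (proj₂ (proj₂ (proj₂ out))) ; t≢z = proj₂ (proj₂ (proj₂ (proj₂ out)))
        ; closed = closed′ }
        where
        closed′ : ∀ {p q} → p ∈ C ∩ E → p ~ q → q ∈ C ∩ E ⊎ q ≡ z ⊎ q ≡ v ⊎ q ≡ w
        closed′ i r with x∈p∩q⁻ C E i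
        ... | iC , iE with U.closed iE r | S.closed iC r
        ... | inj₂ e | _ = inj₂ e
        ... | inj₁ j | inj₁ k = inj₁ (x∈p∩q⁺ (k , j))
        ... | inj₁ j | inj₂ (inj₁ refl) = contradiction j x∉E
        ... | inj₁ j | inj₂ (inj₂ (inj₁ refl)) = contradiction j y∉E
        ... | inj₁ j | inj₂ (inj₂ (inj₂ e)) = inj₂ (inj₁ e)
    choose : Dec (x ∈ D) → Dec (y ∈ D) → ∃₂ λ u v → u ~ v × TriConnected (contract G u v)
    choose (yes x∈) _ = via T′ (disjoint x∈) (apart x∈ x~y)
    choose (no _) (yes y∈) = via T′ (apart y∈ (~-sym x~y)) (disjoint y∈)
    choose (no x∉) (no y∉) = via T x∉ y∉

  contractible-edge : 4 ≤ suc n → ∃₂ λ u v → u ~ v × TriConnected (contract G u v)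
  -- Any edge can start the descent; the excluded vertex 1F only has to differ from 0.
  contractible-edge big with third-neighbour G big tri {zero} {suc-of big} {suc-of big} (suc-≢ big) (suc-≢ big)
    where
    suc-of : 4 ≤ suc n → Fin (suc n)
    suc-of (s≤s (s≤s _)) = 1F
    suc-≢ : ∀ b → suc-of b ≢ zero
    suc-≢ (s≤s (s≤s _)) ()
  ... | v , r , _ with triconnected? (contract G zero v)
  ... | inj₁ tri′ = zero , v , r , tri′
  ... | inj₂ S with pull-back r S
  ... | z , C , T = descend r T (<-wellFounded _)

-- Uncontracting wheels and the prism

Adj : ℕ → Set
Adj m = Fin m → Fin m → Bool

Holds : ∀ {m} → Adj m → Fin m → Fin m → Set
Holds A x y = A x y ≡ true

anyF-intro : ∀ {n} {p : Fin n → Bool} i → p i ≡ true → anyF p ≡ true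
anyF-intro {p = p} zero e rewrite e = refl
anyF-intro {p = p} (suc i) e with p zero
... | true = refl
... | false = anyF-intro i e

module _ {k} {K : Graph k} (table : Table K) {m} (A : Adj m) where
  open Table table

  realisedᵇ : Vec.Vec (Fin k) m → Fin k → Fin k → Bool
  realisedᵇ φ x y = anyF λ a → (Vec.lookup φ a == x) ∧ anyF λ b → (Vec.lookup φ b == y) ∧ A a b

  -- Requiring cliques turns connectedness into a check on pairs. Nothing is lost for the lists
  -- below, whose branch sets have at most two vertices.
  cliqueᵇ : Vec.Vec (Fin k) m → Fin m → Fin m → Bool
  cliqueᵇ φ a b = not (Vec.lookup φ a == Vec.lookup φ b) ∨ (a == b ∨ A a b)

  modelᵇ : Vec.Vec (Fin k) m → Bool
  modelᵇ φ = allF (λ a → allF (cliqueᵇ φ a)) ∧ allF λ x → allF λ y → not (adj x y) ∨ realisedᵇ φ x y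

  modelᵇ-sound : ∀ φ → modelᵇ φ ≡ true → Model (Graph._~_ K) (Holds A)
  modelᵇ-sound φ e with ∧-true {allF (λ a → allF (cliqueᵇ φ a))} e
  ... | cliques , realised = record { φ = just ∘ Vec.lookup φ ; conn = conn ; edges = edges }
    where
    conn : ∀ {a b x} → just (Vec.lookup φ a) ≡ just x → just (Vec.lookup φ b) ≡ just x → Star _ a b
    conn {a} {b} p q with ∨-true {a == b} (implies {Vec.lookup φ a == Vec.lookup φ b} (allF-sound (cliqueᵇ φ a) (allF-sound _ cliques a) b)
      (subst (λ y → Vec.lookup φ a == y ≡ true) (just-injective (trans p (sym q))) (==-refl (Vec.lookup φ a))))
    ... | inj₁ eq with ==-sound {i = a} {b} eq
    ... | refl = ε
    conn {a} {b} p q | inj₂ r = (r , p , q) ◅ ε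
    edges : ∀ {x y} → Graph._~_ K x y → ∃₂ λ a b → just (Vec.lookup φ a) ≡ just x × just (Vec.lookup φ b) ≡ just y × Holds A a b
    edges {x} {y} r with anyF-sound _ (implies {adj x y} (allF-sound (λ y → not (adj x y) ∨ realisedᵇ φ x y) (allF-sound (λ x → allF λ y → not (adj x y) ∨ realisedᵇ φ x y) realised x) y) (adj⁺ r))
    ... | a , e with ∧-true {Vec.lookup φ a == x} e
    ... | ea , e′ with anyF-sound _ e′
    ... | b , e″ with ∧-true {Vec.lookup φ b == y} e″
    ... | eb , h = a , b , cong just (==-sound ea) , cong just (==-sound eb) , h

  some-model : List (Vec.Vec (Fin k) m) → Bool
  some-model [] = false
  some-model (φ ∷ φs) = modelᵇ φ ∨ some-model φs

  some-model-sound : ∀ φs → some-model φs ≡ true → Model (Graph._~_ K) (Holds A)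
  some-model-sound (φ ∷ φs) e with ∨-true {modelᵇ φ} e
  ... | inj₁ p = modelᵇ-sound φ p
  ... | inj₂ p = some-model-sound φs p

record Iso {m n} (T : Adj m) (G : Graph n) : Set where
  field
    f     : Fin m → Fin n
    inj   : ∀ {i j} → f i ≡ f j → i ≡ j
    onto  : ∀ x → ∃ λ i → f i ≡ x
    adj⁺  : ∀ {i j} → Graph._~_ G (f i) (f j) → T i j ≡ true
    adj⁻  : ∀ {i j} → T i j ≡ true → Graph._~_ G (f i) (f j)

iso-model : ∀ {m n} {T : Adj m} {G : Graph n} → Iso T G → Model (Holds T) (Graph._~_ G)
iso-model I = injection-model (λ x → just (proj₁ (onto x)))
  (λ p q → trans (sym (proj₂ (onto _))) (trans (cong f (just-injective (trans p (sym q)))) (proj₂ (onto _))))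
  (λ {i} {j} r → f i , f j , cong just (inj (proj₂ (onto (f i)))) , cong just (inj (proj₂ (onto (f j)))) , adj⁻ r)
  where open Iso I

module _ {m} (T A : Adj m) where

  agreeᵇ : Vec.Vec (Fin m) m → Fin m → Fin m → Bool
  agreeᵇ π i j = (not (T i j) ∨ A (Vec.lookup π i) (Vec.lookup π j)) ∧ (not (A (Vec.lookup π i) (Vec.lookup π j)) ∨ T i j)

  isoᵇ : Vec.Vec (Fin m) m → Bool
  isoᵇ π = allF (λ i → allF λ j → not (Vec.lookup π i == Vec.lookup π j) ∨ i == j) ∧
    allF (λ x → anyF λ i → Vec.lookup π i == x) ∧ allF (λ i → allF (agreeᵇ π i))

  some-iso : List (Vec.Vec (Fin m) m) → Bool
  some-iso [] = false
  some-iso (π ∷ πs) = isoᵇ π ∨ some-iso πs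

  some-iso-sound : ∀ {n} {G : Graph n} πs → some-iso πs ≡ true → Iso A G → Iso T G
  some-iso-sound (π ∷ πs) e I with ∨-true {isoᵇ π} e
  ... | inj₂ p = some-iso-sound πs p I
  ... | inj₁ p with ∧-true {allF (λ i → allF λ j → not (Vec.lookup π i == Vec.lookup π j) ∨ i == j)} p
  ... | p₁ , p′ with ∧-true {allF (λ x → anyF λ i → Vec.lookup π i == x)} p′
  ... | p₂ , p₃ = record
    { f = I.f ∘ Vec.lookup π
    ; inj = λ {i} {j} e → ==-sound (implies (allF-sound (λ j → not (Vec.lookup π i == Vec.lookup π j) ∨ i == j) (allF-sound _ p₁ i) j)
        (subst (λ y → Vec.lookup π i == y ≡ true) (I.inj e) (==-refl (Vec.lookup π i))))
    ; onto = λ x → let (a , ea) = I.onto x ; (i , ei) = anyF-sound _ (allF-sound (λ x → anyF λ i → Vec.lookup π i == x) p₂ a) in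
        i , trans (cong I.f (==-sound ei)) ea
    ; adj⁺ = λ {i} {j} r → implies (proj₂ (∧-true {not (T i j) ∨ A (Vec.lookup π i) (Vec.lookup π j)} (at i j))) (I.adj⁺ r)
    ; adj⁻ = λ {i} {j} r → I.adj⁻ (implies (proj₁ (∧-true (at i j))) r) }
    where
    module I = Iso I
    at : ∀ i j → agreeᵇ π i j ≡ true
    at i j = allF-sound (agreeᵇ π i) (allF-sound (λ i → allF (agreeᵇ π i)) p₃ i) j

nextᵇ : ∀ k → Adj k
nextᵇ k i j = (toℕ j ≡ᵇ suc (toℕ i)) ∨ ((suc (toℕ i) ≡ᵇ k) ∧ (toℕ j ≡ᵇ 0))

cycleAdj : ∀ k → Adj k
cycleAdj k i j = nextᵇ k i j ∨ nextᵇ k j i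

wheelAdj : ∀ k → Adj (suc k)
wheelAdj k zero zero = false
wheelAdj k zero (suc _) = true
wheelAdj k (suc _) zero = true
wheelAdj k (suc i) (suc j) = cycleAdj k i j

prismAdj : Adj 6
prismAdj i j = (upper i ∧ upper j ∧ not (i == j)) ∨ (not (upper i) ∧ not (upper j) ∧ not (i == j)) ∨ opposite i j ∨ opposite j i
  where
  upper : Fin 6 → Bool
  upper i = toℕ i ≤ᵇ 2
  opposite : Fin 6 → Fin 6 → Bool
  opposite i j = toℕ j ≡ᵇ 3 + toℕ i

-- The ways to pass on a neighbour of the split vertex: it remains adjacent to at least one of the
-- two new vertices.
data Attach : Set where
  toU toV toBoth : Attach

allAttach : (Attach → Bool) → Bool
allAttach p = p toU ∧ p toV ∧ p toBoth

allAttach-sound : ∀ (p : Attach → Bool) → allAttach p ≡ true → ∀ i → p i ≡ true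
allAttach-sound p e toU = proj₁ (∧-true e)
allAttach-sound p e toV = proj₁ (∧-true (proj₂ (∧-true {p toU} e)))
allAttach-sound p e toBoth = proj₂ (∧-true {p toV} (proj₂ (∧-true {p toU} e)))

onU onV : Attach → Bool
onU toV = false
onU _ = true
onV toU = false
onV _ = true

-- The vertices 0 and 1 arise by splitting a vertex with neighbourhood nb of a
-- graph whose other vertices, with adjacency B, are shifted by two.
splitAdj : ∀ {m} → Adj m → (Fin m → Bool) → Vec.Vec Attach m → Adj (2 + m)
splitAdj B nb lab zero zero = false
splitAdj B nb lab zero (suc zero) = true
splitAdj B nb lab zero (suc (suc i)) = nb i ∧ onU (Vec.lookup lab i)
splitAdj B nb lab (suc zero) zero = true
splitAdj B nb lab (suc zero) (suc zero) = false
splitAdj B nb lab (suc zero) (suc (suc i)) = nb i ∧ onV (Vec.lookup lab i)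
splitAdj B nb lab (suc (suc i)) zero = nb i ∧ onU (Vec.lookup lab i)
splitAdj B nb lab (suc (suc i)) (suc zero) = nb i ∧ onV (Vec.lookup lab i)
splitAdj B nb lab (suc (suc i)) (suc (suc j)) = B i j

twoᵇ : ∀ {m} → (Fin m → Bool) → Bool
twoᵇ p = anyF λ i → p i ∧ anyF λ j → p j ∧ not (i == j)

twoᵇ-intro : ∀ {m} (p : Fin m → Bool) {i j} → i ≢ j → p i ≡ true → p j ≡ true → twoᵇ p ≡ true
twoᵇ-intro p {i} {j} ne pi pj = anyF-intro i (∧-intro pi (anyF-intro j (∧-intro pj (≢⇒≠ ne))))

-- Together with the edge between them, both new vertices have degree at least three, as
-- 3-connectedness demands.
properᵇ : ∀ {m} → (Fin m → Bool) → Vec.Vec Attach m → Bool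
properᵇ nb lab = twoᵇ (λ i → nb i ∧ onU (Vec.lookup lab i)) ∧ twoᵇ (λ i → nb i ∧ onV (Vec.lookup lab i))

record Split {m n} (B : Adj m) (nb : Fin m → Bool) (G : Graph n) : Set where
  open Graph G
  field
    u v     : Fin n
    q       : Fin m → Fin n
    u~v     : u ~ v
    q-inj   : ∀ {i j} → q i ≡ q j → i ≡ j
    q≢u     : ∀ i → q i ≢ u
    q≢v     : ∀ i → q i ≢ v
    onto    : ∀ x → x ≡ u ⊎ x ≡ v ⊎ ∃ λ i → q i ≡ x
    adj⁺    : ∀ {i j} → q i ~ q j → B i j ≡ true
    adj⁻    : ∀ {i j} → B i j ≡ true → q i ~ q j
    nb⁺     : ∀ {i} → u ~ q i ⊎ v ~ q i → nb i ≡ true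
    nb⁻     : ∀ {i} → nb i ≡ true → u ~ q i ⊎ v ~ q i
    two-u   : ∃₂ λ i j → i ≢ j × u ~ q i × u ~ q j
    two-v   : ∃₂ λ i j → i ≢ j × v ~ q i × v ~ q j

  attach : Fin m → Attach
  attach i with u ~? q i | v ~? q i
  ... | yes _ | yes _ = toBoth
  ... | yes _ | no _ = toU
  ... | no _ | _ = toV

  lab : Vec.Vec Attach m
  lab = Vec.tabulate attach

  splitTable : Adj (2 + m)
  splitTable = splitAdj B nb lab

  u⁺ : ∀ {i} → u ~ q i → nb i ∧ onU (Vec.lookup lab i) ≡ true
  u⁺ {i} r = ∧-intro (nb⁺ (inj₁ r)) (trans (cong onU (VecP.lookup∘tabulate attach i)) on)
    where
    on : onU (attach i) ≡ true
    on with u ~? q i | v ~? q i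
    ... | yes _ | yes _ = refl
    ... | yes _ | no _ = refl
    ... | no h | _ = contradiction r h

  v⁺ : ∀ {i} → v ~ q i → nb i ∧ onV (Vec.lookup lab i) ≡ true
  v⁺ {i} r = ∧-intro (nb⁺ (inj₂ r)) (trans (cong onV (VecP.lookup∘tabulate attach i)) on)
    where
    on : onV (attach i) ≡ true
    on with u ~? q i | v ~? q i
    ... | yes _ | yes _ = refl
    ... | yes _ | no h = contradiction r h
    ... | no h | _ = refl

  u⁻ : ∀ {i} → nb i ∧ onU (Vec.lookup lab i) ≡ true → u ~ q i
  u⁻ {i} e = on (trans (cong onU (sym (VecP.lookup∘tabulate attach i))) (proj₂ (∧-true {nb i} e)))
    where
    on : onU (attach i) ≡ true → u ~ q i
    on o with u ~? q i | v ~? q i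
    ... | yes r | _ = r

  v⁻ : ∀ {i} → nb i ∧ onV (Vec.lookup lab i) ≡ true → v ~ q i
  v⁻ {i} e = on (trans (cong onV (sym (VecP.lookup∘tabulate attach i))) (proj₂ (∧-true {nb i} e)))
    where
    on : onV (attach i) ≡ true → v ~ q i
    on o with u ~? q i | v ~? q i
    ... | yes _ | yes r = r
    ... | no h | _ with nb⁻ (proj₁ (∧-true {nb i} e))
    ... | inj₁ r = contradiction r h
    ... | inj₂ r = r

  proper : properᵇ nb lab ≡ true
  proper = let (i , j , ne , r , s) = two-u ; (i′ , j′ , ne′ , r′ , s′) = two-v in
    ∧-intro (twoᵇ-intro (λ i → nb i ∧ onU (Vec.lookup lab i)) ne (u⁺ r) (u⁺ s))
            (twoᵇ-intro (λ i → nb i ∧ onV (Vec.lookup lab i)) ne′ (v⁺ r′) (v⁺ s′))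

  place : Fin (2 + m) → Fin n
  place zero = u
  place (suc zero) = v
  place (suc (suc i)) = q i

  split-iso : Iso splitTable G
  split-iso = record
    { f = place ; inj = λ {i} {j} → inj i j
    ; onto = λ x → case onto x of λ
        { (inj₁ e) → zero , sym e ; (inj₂ (inj₁ e)) → suc zero , sym e ; (inj₂ (inj₂ (i , e))) → suc (suc i) , e }
    ; adj⁺ = λ {i} {j} → to i j ; adj⁻ = λ {i} {j} → from i j }
    where
    inj : ∀ i j → place i ≡ place j → i ≡ j
    inj zero zero _ = refl
    inj zero (suc zero) e = contradiction e (~⇒≢ G u~v)
    inj zero (suc (suc j)) e = contradiction (sym e) (q≢u j)
    inj (suc zero) zero e = contradiction (sym e) (~⇒≢ G u~v)
    inj (suc zero) (suc zero) _ = refl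
    inj (suc zero) (suc (suc j)) e = contradiction (sym e) (q≢v j)
    inj (suc (suc i)) zero e = contradiction e (q≢u i)
    inj (suc (suc i)) (suc zero) e = contradiction e (q≢v i)
    inj (suc (suc i)) (suc (suc j)) e = cong (λ z → suc (suc z)) (q-inj e)
    to : ∀ i j → place i ~ place j → splitAdj B nb lab i j ≡ true
    to zero zero r = contradiction refl (~⇒≢ G r)
    to zero (suc zero) r = refl
    to zero (suc (suc j)) r = u⁺ r
    to (suc zero) zero r = refl
    to (suc zero) (suc zero) r = contradiction refl (~⇒≢ G r)
    to (suc zero) (suc (suc j)) r = v⁺ r
    to (suc (suc i)) zero r = u⁺ (~-sym r)
    to (suc (suc i)) (suc zero) r = v⁺ (~-sym r)
    to (suc (suc i)) (suc (suc j)) r = adj⁺ r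
    from : ∀ i j → splitAdj B nb lab i j ≡ true → place i ~ place j
    from zero (suc zero) e = u~v
    from zero (suc (suc j)) e = u⁻ e
    from (suc zero) zero e = ~-sym u~v
    from (suc zero) (suc (suc j)) e = v⁻ e
    from (suc (suc i)) zero e = ~-sym (u⁻ e)
    from (suc (suc i)) (suc zero) e = ~-sym (v⁻ e)
    from (suc (suc i)) (suc (suc j)) e = adj⁻ e

removed : ∀ {m} → Adj (suc m) → Fin (suc m) → Adj m
removed B j i i′ = B (punchIn j i) (punchIn j i′)

-- Undoing the contraction of uv splits the vertex j. Both ends have two neighbours among the old
-- vertices because every degree in G is at least three.
contract-split : ∀ {m n} {B : Adj (suc m)} (G : Graph (suc n)) → 4 ≤ suc n → TriConnected G →
                 ∀ {u v} → Graph._~_ G u v → (v≢u : v ≢ u) (I : Iso B (contract G u v)) →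
                 ∀ j → Iso.f I j ≡ merge v≢u u → Split (removed B j) (λ i → B j (punchIn j i)) G
contract-split {m} {B = B} G big tri {u} {v} r v≢u I j fj = record
  { u = u ; v = v ; q = q ; u~v = r
  ; q-inj = λ e → punchIn-injective j _ _ (I.inj (punchIn-injective v _ _ e))
  ; q≢u = λ i e → punchInᵢ≢i j i (I.inj (trans (sym (π-q i)) (trans (cong π e) (sym fj))))
  ; q≢v = λ i → punchInᵢ≢i v _
  ; onto = onto
  ; adj⁺ = λ {i} {i′} e → I.adj⁺ (subst₂ (Graph._~_ (contract G u v)) (π-q i) (π-q i′)
      (contract⇐ G v≢u e λ eq → ~⇒≢ G e (cong (punchIn v) (trans (sym (π-q i)) (trans eq (π-q i′))))))
  ; adj⁻ = λ {i} {i′} e → lower-edge (I.adj⁻ e) (away i) (away i′)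
  ; nb⁺ = nb⁺ ; nb⁻ = nb⁻ ; two-u = two u v r onto
  ; two-v = two v u (~-sym r) λ z → case onto z of λ { (inj₁ e) → inj₂ (inj₁ e) ; (inj₂ (inj₁ e)) → inj₁ e ; (inj₂ (inj₂ e)) → inj₂ (inj₂ e) } }
  where
  open Graph G
  module I = Iso I
  π = merge v≢u
  q : Fin m → Fin _
  q i = punchIn v (I.f (punchIn j i))
  π-q : ∀ i → π (q i) ≡ I.f (punchIn j i)
  π-q i = merge-punchIn v≢u _
  away : ∀ i → I.f (punchIn j i) ≢ π u
  away i e = punchInᵢ≢i j i (I.inj (trans e (sym fj)))
  lies : ∀ {x y} → y ≢ π u → π x ≡ y → x ≡ punchIn v y
  lies {x} {y} ne e with merge-fibre v≢u (trans e (sym (merge-punchIn v≢u y)))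
  ... | inj₁ p = p
  ... | inj₂ (inj₁ (refl , _)) = contradiction (trans (sym e) (merge-v v≢u)) ne
  ... | inj₂ (inj₂ (_ , p)) = contradiction p (punchInᵢ≢i v y)
  lower-edge : ∀ {x y} → Graph._~_ (contract G u v) x y → x ≢ π u → y ≢ π u → punchIn v x ~ punchIn v y
  lower-edge (_ , a , b , p , p′ , e) nx ny =
    subst₂ _~_ (lies nx (becomes⇒merge v≢u p)) (lies ny (becomes⇒merge v≢u p′)) e
  onto : ∀ x → x ≡ u ⊎ x ≡ v ⊎ ∃ λ i → q i ≡ x
  onto x with v ≟ᶠ x
  ... | yes e = inj₂ (inj₁ (sym e))
  ... | no v≢x with I.onto (π x)
  ... | i , e with j ≟ᶠ i
  ... | no ne = inj₂ (inj₂ (punchOut ne , trans (cong (λ z → punchIn v (I.f z)) (punchIn-punchOut ne)) (trans (cong (punchIn v) e) (punchIn-merge v≢u v≢x))))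
  ... | yes refl with merge-fibre v≢u (trans (sym e) fj)
  ... | inj₁ p = inj₁ p
  ... | inj₂ (inj₁ (p , _)) = inj₂ (inj₁ p)
  ... | inj₂ (inj₂ (p , _)) = inj₁ p
  nb⁺ : ∀ {i} → u ~ q i ⊎ v ~ q i → B j (punchIn j i) ≡ true
  nb⁺ {i} h = I.adj⁺ (subst₂ (Graph._~_ (contract G u v)) (sym fj) (π-q i) (up h))
    where
    up : u ~ q i ⊎ v ~ q i → Graph._~_ (contract G u v) (π u) (π (q i))
    up (inj₁ e) = contract⇐ G v≢u e λ eq → away i (sym (trans eq (π-q i)))
    up (inj₂ e) = subst (λ z → Graph._~_ (contract G u v) z (π (q i))) (merge-v v≢u)
                    (contract⇐ G v≢u e λ eq → away i (sym (trans (sym (merge-v v≢u)) (trans eq (π-q i)))))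
  nb⁻ : ∀ {i} → B j (punchIn j i) ≡ true → u ~ q i ⊎ v ~ q i
  nb⁻ {i} e with I.adj⁻ e
  ... | _ , a , b , p , p′ , ab with lies (away i) (becomes⇒merge v≢u p′)
  ... | refl with merge-fibre v≢u (trans (becomes⇒merge v≢u p) fj)
  ... | inj₁ refl = inj₁ ab
  ... | inj₂ (inj₁ (refl , _)) = inj₂ ab
  ... | inj₂ (inj₂ (refl , _)) = inj₁ ab
  two : ∀ x y → x ~ y → (∀ z → z ≡ x ⊎ z ≡ y ⊎ ∃ λ i → q i ≡ z) → ∃₂ λ i i′ → i ≢ i′ × x ~ q i × x ~ q i′
  two x y e cover with third-neighbour G big tri {x} {y} {y} (~⇒≢ G (~-sym e)) (~⇒≢ G (~-sym e))
  ... | t , et , t≢y , _ with third-neighbour G big tri {x} {y} {t} (~⇒≢ G (~-sym e)) (~⇒≢ G (~-sym et))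
  ... | t′ , et′ , t′≢y , t′≢t with cover t | cover t′
  ... | inj₁ refl | _ = contradiction refl (~⇒≢ G et)
  ... | inj₂ (inj₁ p) | _ = contradiction p t≢y
  ... | inj₂ (inj₂ _) | inj₁ refl = contradiction refl (~⇒≢ G et′)
  ... | inj₂ (inj₂ _) | inj₂ (inj₁ p) = contradiction p t′≢y
  ... | inj₂ (inj₂ (i , refl)) | inj₂ (inj₂ (i′ , refl)) = i , i′ , (λ { refl → t′≢t refl }) , et , et′

infixr 5 _∷ᵛ_
pattern _∷ᵛ_ x xs = Vec._∷_ x xs
pattern []ᵛ = Vec.[]

-- The lists of maps below were found by a computer search: the models send each
-- vertex to its branch set, the isomorphisms each template vertex to its image,
-- and every proper splitting has one of them.
K₄-models : List (Vec.Vec (Fin 5) 5)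
K₄-models =
  (0F ∷ᵛ 2F ∷ᵛ 1F ∷ᵛ 3F ∷ᵛ 4F ∷ᵛ []ᵛ) ∷
  (0F ∷ᵛ 2F ∷ᵛ 3F ∷ᵛ 1F ∷ᵛ 4F ∷ᵛ []ᵛ) ∷
  (0F ∷ᵛ 2F ∷ᵛ 3F ∷ᵛ 4F ∷ᵛ 1F ∷ᵛ []ᵛ) ∷
  (2F ∷ᵛ 0F ∷ᵛ 1F ∷ᵛ 3F ∷ᵛ 4F ∷ᵛ []ᵛ) ∷
  (2F ∷ᵛ 0F ∷ᵛ 3F ∷ᵛ 1F ∷ᵛ 4F ∷ᵛ []ᵛ) ∷
  (2F ∷ᵛ 0F ∷ᵛ 3F ∷ᵛ 4F ∷ᵛ 1F ∷ᵛ []ᵛ) ∷ []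

K₄-isos : List (Vec.Vec (Fin 5) 5)
K₄-isos =
  (2F ∷ᵛ 0F ∷ᵛ 1F ∷ᵛ 3F ∷ᵛ 4F ∷ᵛ []ᵛ) ∷
  (2F ∷ᵛ 0F ∷ᵛ 1F ∷ᵛ 4F ∷ᵛ 3F ∷ᵛ []ᵛ) ∷
  (3F ∷ᵛ 0F ∷ᵛ 1F ∷ᵛ 2F ∷ᵛ 4F ∷ᵛ []ᵛ) ∷
  (3F ∷ᵛ 0F ∷ᵛ 1F ∷ᵛ 4F ∷ᵛ 2F ∷ᵛ []ᵛ) ∷
  (4F ∷ᵛ 0F ∷ᵛ 1F ∷ᵛ 2F ∷ᵛ 3F ∷ᵛ []ᵛ) ∷
  (4F ∷ᵛ 0F ∷ᵛ 1F ∷ᵛ 3F ∷ᵛ 2F ∷ᵛ []ᵛ) ∷ []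

W₄-models : List (Vec.Vec (Fin 6) 6)
W₄-models =
  (0F ∷ᵛ 4F ∷ᵛ 1F ∷ᵛ 3F ∷ᵛ 2F ∷ᵛ 5F ∷ᵛ []ᵛ) ∷
  (1F ∷ᵛ 3F ∷ᵛ 4F ∷ᵛ 0F ∷ᵛ 5F ∷ᵛ 2F ∷ᵛ []ᵛ) ∷
  (0F ∷ᵛ 4F ∷ᵛ 1F ∷ᵛ 5F ∷ᵛ 2F ∷ᵛ 3F ∷ᵛ []ᵛ) ∷
  (1F ∷ᵛ 3F ∷ᵛ 0F ∷ᵛ 4F ∷ᵛ 2F ∷ᵛ 5F ∷ᵛ []ᵛ) ∷
  (1F ∷ᵛ 3F ∷ᵛ 2F ∷ᵛ 4F ∷ᵛ 0F ∷ᵛ 5F ∷ᵛ []ᵛ) ∷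
  (0F ∷ᵛ 4F ∷ᵛ 3F ∷ᵛ 1F ∷ᵛ 5F ∷ᵛ 2F ∷ᵛ []ᵛ) ∷
  (0F ∷ᵛ 4F ∷ᵛ 5F ∷ᵛ 1F ∷ᵛ 3F ∷ᵛ 2F ∷ᵛ []ᵛ) ∷
  (1F ∷ᵛ 3F ∷ᵛ 4F ∷ᵛ 2F ∷ᵛ 5F ∷ᵛ 0F ∷ᵛ []ᵛ) ∷ []

W₄-isos : List (Vec.Vec (Fin 6) 6)
W₄-isos =
  (0F ∷ᵛ 2F ∷ᵛ 3F ∷ᵛ 1F ∷ᵛ 5F ∷ᵛ 4F ∷ᵛ []ᵛ) ∷
  (0F ∷ᵛ 2F ∷ᵛ 5F ∷ᵛ 1F ∷ᵛ 3F ∷ᵛ 4F ∷ᵛ []ᵛ) ∷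
  (0F ∷ᵛ 3F ∷ᵛ 4F ∷ᵛ 1F ∷ᵛ 2F ∷ᵛ 5F ∷ᵛ []ᵛ) ∷
  (0F ∷ᵛ 4F ∷ᵛ 5F ∷ᵛ 1F ∷ᵛ 3F ∷ᵛ 2F ∷ᵛ []ᵛ) ∷ []

prism-models : List (Vec.Vec (Fin 6) 7)
prism-models =
  (0F ∷ᵛ 4F ∷ᵛ 1F ∷ᵛ 1F ∷ᵛ 3F ∷ᵛ 5F ∷ᵛ 2F ∷ᵛ []ᵛ) ∷
  (0F ∷ᵛ 4F ∷ᵛ 1F ∷ᵛ 5F ∷ᵛ 3F ∷ᵛ 2F ∷ᵛ 2F ∷ᵛ []ᵛ) ∷
  (0F ∷ᵛ 4F ∷ᵛ 3F ∷ᵛ 1F ∷ᵛ 1F ∷ᵛ 2F ∷ᵛ 5F ∷ᵛ []ᵛ) ∷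
  (0F ∷ᵛ 4F ∷ᵛ 5F ∷ᵛ 1F ∷ᵛ 2F ∷ᵛ 2F ∷ᵛ 3F ∷ᵛ []ᵛ) ∷
  (1F ∷ᵛ 3F ∷ᵛ 4F ∷ᵛ 2F ∷ᵛ 0F ∷ᵛ 2F ∷ᵛ 5F ∷ᵛ []ᵛ) ∷
  (1F ∷ᵛ 3F ∷ᵛ 0F ∷ᵛ 4F ∷ᵛ 4F ∷ᵛ 5F ∷ᵛ 2F ∷ᵛ []ᵛ) ∷
  (1F ∷ᵛ 3F ∷ᵛ 2F ∷ᵛ 4F ∷ᵛ 5F ∷ᵛ 5F ∷ᵛ 0F ∷ᵛ []ᵛ) ∷
  (0F ∷ᵛ 4F ∷ᵛ 1F ∷ᵛ 3F ∷ᵛ 1F ∷ᵛ 2F ∷ᵛ 5F ∷ᵛ []ᵛ) ∷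
  (0F ∷ᵛ 4F ∷ᵛ 1F ∷ᵛ 3F ∷ᵛ 1F ∷ᵛ 5F ∷ᵛ 2F ∷ᵛ []ᵛ) ∷
  (0F ∷ᵛ 4F ∷ᵛ 1F ∷ᵛ 5F ∷ᵛ 2F ∷ᵛ 3F ∷ᵛ 2F ∷ᵛ []ᵛ) ∷
  (0F ∷ᵛ 4F ∷ᵛ 5F ∷ᵛ 1F ∷ᵛ 2F ∷ᵛ 3F ∷ᵛ 2F ∷ᵛ []ᵛ) ∷
  (1F ∷ᵛ 3F ∷ᵛ 1F ∷ᵛ 0F ∷ᵛ 4F ∷ᵛ 5F ∷ᵛ 2F ∷ᵛ []ᵛ) ∷
  (1F ∷ᵛ 3F ∷ᵛ 2F ∷ᵛ 0F ∷ᵛ 4F ∷ᵛ 2F ∷ᵛ 5F ∷ᵛ []ᵛ) ∷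
  (1F ∷ᵛ 3F ∷ᵛ 2F ∷ᵛ 4F ∷ᵛ 0F ∷ᵛ 2F ∷ᵛ 5F ∷ᵛ []ᵛ) ∷
  (1F ∷ᵛ 3F ∷ᵛ 2F ∷ᵛ 4F ∷ᵛ 2F ∷ᵛ 0F ∷ᵛ 5F ∷ᵛ []ᵛ) ∷
  (1F ∷ᵛ 3F ∷ᵛ 4F ∷ᵛ 2F ∷ᵛ 0F ∷ᵛ 1F ∷ᵛ 5F ∷ᵛ []ᵛ) ∷
  (1F ∷ᵛ 3F ∷ᵛ 4F ∷ᵛ 2F ∷ᵛ 1F ∷ᵛ 0F ∷ᵛ 5F ∷ᵛ []ᵛ) ∷ []

ring-models : List (Vec.Vec (Fin 6) 7)
ring-models =
  (0F ∷ᵛ 4F ∷ᵛ 1F ∷ᵛ 1F ∷ᵛ 3F ∷ᵛ 2F ∷ᵛ 5F ∷ᵛ []ᵛ) ∷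
  (1F ∷ᵛ 3F ∷ᵛ 4F ∷ᵛ 4F ∷ᵛ 0F ∷ᵛ 5F ∷ᵛ 2F ∷ᵛ []ᵛ) ∷
  (0F ∷ᵛ 4F ∷ᵛ 1F ∷ᵛ 5F ∷ᵛ 2F ∷ᵛ 3F ∷ᵛ 1F ∷ᵛ []ᵛ) ∷
  (1F ∷ᵛ 3F ∷ᵛ 4F ∷ᵛ 2F ∷ᵛ 5F ∷ᵛ 0F ∷ᵛ 4F ∷ᵛ []ᵛ) ∷
  (0F ∷ᵛ 4F ∷ᵛ 3F ∷ᵛ 1F ∷ᵛ 5F ∷ᵛ 5F ∷ᵛ 2F ∷ᵛ []ᵛ) ∷
  (1F ∷ᵛ 3F ∷ᵛ 0F ∷ᵛ 4F ∷ᵛ 2F ∷ᵛ 2F ∷ᵛ 5F ∷ᵛ []ᵛ) ∷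
  (0F ∷ᵛ 4F ∷ᵛ 1F ∷ᵛ 1F ∷ᵛ 5F ∷ᵛ 2F ∷ᵛ 3F ∷ᵛ []ᵛ) ∷
  (0F ∷ᵛ 4F ∷ᵛ 1F ∷ᵛ 3F ∷ᵛ 2F ∷ᵛ 2F ∷ᵛ 5F ∷ᵛ []ᵛ) ∷
  (1F ∷ᵛ 3F ∷ᵛ 4F ∷ᵛ 0F ∷ᵛ 5F ∷ᵛ 2F ∷ᵛ 2F ∷ᵛ []ᵛ) ∷
  (1F ∷ᵛ 3F ∷ᵛ 4F ∷ᵛ 2F ∷ᵛ 2F ∷ᵛ 5F ∷ᵛ 0F ∷ᵛ []ᵛ) ∷ []

private
  resolvesᵇ : ∀ {m} → Adj m → (Fin m → Bool) → (Adj (2 + m) → Bool) → Bool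
  resolvesᵇ {m} B nb p = allVec allAttach m λ lab → not (properᵇ nb lab) ∨ p (splitAdj B nb lab)

  resolves : ∀ {m n} {B : Adj m} {nb} {G : Graph n} (p : Adj (2 + m) → Bool) → resolvesᵇ B nb p ≡ true →
             (S : Split B nb G) → p (Split.splitTable S) ≡ true
  resolves {B = B} {nb} p e S = implies
    (allVec-sound allAttach-sound (λ lab → not (properᵇ nb lab) ∨ p (splitAdj B nb lab)) e (Split.lab S)) (Split.proper S)

-- If only one neighbour is passed on to both new vertices, the result is W₄; if two or three are,
-- it contains K₅⁻.
split-K₄ : ∀ {n} {G : Graph n} j → Split (removed (wheelAdj 3) j) (λ i → wheelAdj 3 j (punchIn j i)) G →
           (K₅⁻ ≼ᵐ G) ⊎ Iso (wheelAdj 4) G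
split-K₄ {G = G} j S with ∨-true {some-model table₅ (Split.splitTable S) K₄-models}
    (resolves (λ A → some-model table₅ A K₄-models ∨ some-iso (wheelAdj 4) A K₄-isos) (all j) S)
  where
  all : ∀ j → resolvesᵇ (removed (wheelAdj 3) j) (λ i → wheelAdj 3 j (punchIn j i))
                (λ A → some-model table₅ A K₄-models ∨ some-iso (wheelAdj 4) A K₄-isos) ≡ true
  all 0F = refl
  all 1F = refl
  all 2F = refl
  all 3F = refl
... | inj₁ p = inj₁ (some-model-sound table₅ (Split.splitTable S) K₄-models p ⨾ iso-model (Split.split-iso S))
... | inj₂ p = inj₂ (some-iso-sound (wheelAdj 4) (Split.splitTable S) K₄-isos p (Split.split-iso S))

-- The prism arises exactly if each new vertex receives two consecutive rim vertices and none is
-- shared. Two opposite rim vertices each give K₃₃ itself.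
split-W₄-hub : ∀ {n} {G : Graph n} → Split (removed (wheelAdj 4) 0F) (λ i → wheelAdj 4 0F (punchIn 0F i)) G →
               (K₃₃⁻ ≼ᵐ G) ⊎ Iso prismAdj G
split-W₄-hub {G = G} S with ∨-true {some-model table₆ (Split.splitTable S) W₄-models}
    (resolves (λ A → some-model table₆ A W₄-models ∨ some-iso prismAdj A W₄-isos) refl S)
... | inj₁ p = inj₁ (some-model-sound table₆ (Split.splitTable S) W₄-models p ⨾ iso-model (Split.split-iso S))
... | inj₂ p = inj₂ (some-iso-sound prismAdj (Split.splitTable S) W₄-isos p (Split.split-iso S))

split-prism : ∀ {n} {G : Graph n} j → Split (removed prismAdj j) (λ i → prismAdj j (punchIn j i)) G → K₃₃⁻ ≼ᵐ G
split-prism {G = G} j S = some-model-sound table₆ (Split.splitTable S) prism-models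
    (resolves (λ A → some-model table₆ A prism-models) (all j) S) ⨾ iso-model (Split.split-iso S)
  where
  all : ∀ j → resolvesᵇ (removed prismAdj j) (λ i → prismAdj j (punchIn j i)) (λ A → some-model table₆ A prism-models) ≡ true
  all 0F = refl
  all 1F = refl
  all 2F = refl
  all 3F = refl
  all 4F = refl
  all 5F = refl

-- The case of five spokes with the hub split; longer rims are contracted to this one, so a single
-- evaluation serves all of them.
ring-model : ∀ lab → properᵇ {5} (const true) lab ≡ true → Model (Graph._~_ K₃₃⁻) (Holds (splitAdj (cycleAdj 5) (const true) lab))
ring-model lab p = some-model-sound table₆ (splitAdj (cycleAdj 5) (const true) lab) ring-models (implies
  (allVec-sound allAttach-sound (λ lab → not (properᵇ (const true) lab) ∨ some-model table₆ (splitAdj (cycleAdj 5) (const true) lab) ring-models) refl lab) p)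

-- K₃₃⁻ in graphs of unbounded size

module _ {k} {K : Graph k} {V : Set} {R : V → V → Set} (B : Fin k → V → Set) (B? : ∀ i v → Dec (B i v))
         (disjoint : ∀ {i j v} → B i v → B j v → i ≡ j)
         (conn : ∀ {i v w} → B i v → B i w → Star (λ s t → R s t × B i s × B i t) v w)
         (edges : ∀ {x y} → Graph._~_ K x y → ∃₂ λ v w → B x v × B y w × R v w) where

  -- Branch sets as disjoint decidable predicates: convenient where they contain paths of arbitrary
  -- length, for which no table can be written.
  branch-model : Model (Graph._~_ K) R
  branch-model = record
    { φ = φ
    ; conn = λ {v} {w} p q → Star-map (λ (r , a , b) → r , φ⁺ a , φ⁺ b) (conn (φ⁻ {v} p) (φ⁻ {w} q))
    ; edges = λ r → let (v , w , a , b , e) = edges r in v , w , φ⁺ a , φ⁺ b , e }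
    where
    φ : V → Maybe (Fin k)
    φ v with any? (λ i → B? i v)
    ... | yes (i , _) = just i
    ... | no _ = nothing
    φ⁺ : ∀ {i v} → B i v → φ v ≡ just i
    φ⁺ {i} {v} b with any? (λ i → B? i v)
    ... | yes (j , b′) = cong just (disjoint b′ b)
    ... | no h = contradiction (i , b) h
    φ⁻ : ∀ {v i} → φ v ≡ just i → B i v
    φ⁻ {v} e with any? (λ i → B? i v)
    φ⁻ {v} refl | yes (i , b) = b

K₃₃⁻-edges : (P : Fin 6 → Fin 6 → Set) → (∀ {x y} → P x y → P y x) →
             P 0F 4F → P 0F 5F → P 1F 3F → P 1F 4F → P 1F 5F → P 2F 3F → P 2F 4F → P 2F 5F →
             ∀ {x y} → Graph._~_ K₃₃⁻ x y → P x y
K₃₃⁻-edges P s p₀₄ p₀₅ p₁₃ p₁₄ p₁₅ p₂₃ p₂₄ p₂₅ {x} {y} r = go x y (Table.adj⁺ table₆ r)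
  where
  go : ∀ x y → adj₆ x y ≡ true → P x y
  go 0F 4F _ = p₀₄
  go 0F 5F _ = p₀₅
  go 1F 3F _ = p₁₃
  go 1F 4F _ = p₁₄
  go 1F 5F _ = p₁₅
  go 2F 3F _ = p₂₃
  go 2F 4F _ = p₂₄
  go 2F 5F _ = p₂₅
  go 4F 0F _ = s p₀₄
  go 5F 0F _ = s p₀₅
  go 3F 1F _ = s p₁₃
  go 4F 1F _ = s p₁₄
  go 5F 1F _ = s p₁₅
  go 3F 2F _ = s p₂₃
  go 4F 2F _ = s p₂₄
  go 5F 2F _ = s p₂₅
  go 0F 0F ()
  go 0F 1F ()
  go 0F 2F ()
  go 0F 3F ()
  go 1F 0F ()
  go 1F 1F ()
  go 1F 2F ()
  go 2F 0F ()
  go 2F 1F ()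
  go 2F 2F ()
  go 3F 0F ()
  go 3F 3F ()
  go 3F 4F ()
  go 3F 5F ()
  go 4F 3F ()
  go 4F 4F ()
  go 4F 5F ()
  go 5F 3F ()
  go 5F 4F ()
  go 5F 5F ()

module _ {V : Set} (_≟_ : DecidableEquality V) {R : V → V → Set} (R-sym : ∀ {s t} → R s t → R t s) where

  -- The four-cycle h a u b, whose opposite pairs are joined by v and by Q.
  crossed-cycle : ∀ {h u v a b} (Q : V → Set) → (∀ x → Dec (Q x)) → Unique (h ∷ u ∷ v ∷ a ∷ b ∷ []) →
                  All (¬_ ∘ Q) (h ∷ u ∷ v ∷ a ∷ b ∷ []) →
                  (∀ {x y} → Q x → Q y → Star (λ s t → R s t × Q s × Q t) x y) →
                  (∃ λ x → Q x × R x a) → (∃ λ x → Q x × R x b) →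
                  R h v → R h a → R h b → R u v → R u a → R u b → Model (Graph._~_ K₃₃⁻) R
  crossed-cycle {h} {u} {v} {a} {b} Q Q? ((hu ∷ hv ∷ ha ∷ hb ∷ []) ∷ (uv ∷ ua ∷ ub ∷ []) ∷ (va ∷ vb ∷ []) ∷ (ab ∷ []) ∷ [] ∷ [])
    (qh ∷ qu ∷ qv ∷ qa ∷ qb ∷ []) Q-conn (x , qx , xa) (y , qy , yb) Rhv Rha Rhb Ruv Rua Rub =
    branch-model {K = K₃₃⁻} B B? (λ {i} {j} → disjoint i j) (λ {i} → conn i)
      (K₃₃⁻-edges (λ x y → ∃₂ λ s t → B x s × B y t × R s t) (λ (s , t , p , q , r) → t , s , q , p , R-sym r)
        (x , a , qx , refl , xa) (y , b , qy , refl , yb)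
        (h , v , refl , refl , Rhv) (h , a , refl , refl , Rha) (h , b , refl , refl , Rhb)
        (u , v , refl , refl , Ruv) (u , a , refl , refl , Rua) (u , b , refl , refl , Rub))
    where
    B : Fin 6 → V → Set
    B 0F = Q
    B 1F = _≡ h
    B 2F = _≡ u
    B 3F = _≡ v
    B 4F = _≡ a
    B 5F = _≡ b
    B? : ∀ i x → Dec (B i x)
    B? 0F = Q?
    B? 1F = _≟ h
    B? 2F = _≟ u
    B? 3F = _≟ v
    B? 4F = _≟ a
    B? 5F = _≟ b
    conn : ∀ i {v w} → B i v → B i w → Star (λ s t → R s t × B i s × B i t) v w
    conn 0F p q = Q-conn p q
    conn 1F refl refl = ε
    conn 2F refl refl = ε
    conn 3F refl refl = ε
    conn 4F refl refl = ε
    conn 5F refl refl = ε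
    point : Fin 5 → V
    point 0F = h
    point 1F = u
    point 2F = v
    point 3F = a
    point 4F = b
    off-Q : ∀ i → ¬ Q (point i)
    off-Q 0F = qh
    off-Q 1F = qu
    off-Q 2F = qv
    off-Q 3F = qa
    off-Q 4F = qb
    at : ∀ i {w} → B (suc i) w → w ≡ point i
    at 0F e = e
    at 1F e = e
    at 2F e = e
    at 3F e = e
    at 4F e = e
    points : Unique (tabulate point)
    points = (hu ∷ hv ∷ ha ∷ hb ∷ []) ∷ (uv ∷ ua ∷ ub ∷ []) ∷ (va ∷ vb ∷ []) ∷ (ab ∷ []) ∷ [] ∷ []
    point-lookup : ∀ i → lookup (tabulate point) i ≡ point i
    point-lookup 0F = refl
    point-lookup 1F = refl
    point-lookup 2F = refl
    point-lookup 3F = refl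
    point-lookup 4F = refl
    disjoint : ∀ i j {w} → B i w → B j w → i ≡ j
    disjoint zero zero _ _ = refl
    disjoint zero (suc j) p q = contradiction (subst Q (at j q) p) (off-Q j)
    disjoint (suc i) zero p q = contradiction (subst Q (at i p) q) (off-Q i)
    disjoint (suc i) (suc j) p q = cong suc (unique-lookup points i j
      (trans (point-lookup i) (trans (sym (at i p)) (trans (at j q) (sym (point-lookup j))))))

  path-connected : ∀ {m} (g : Fin (suc m) → V) (P : V → Set) → (∀ i → P (g i)) →
                   (∀ i → R (g (inject₁ i)) (g (suc i))) → ∀ i j → Star (λ s t → R s t × P s × P t) (g i) (g j)
  path-connected g P on steps i j =
    Star-reverse (λ (r , p , q) → R-sym r , q , p) (from-start g on steps i) ◅◅ from-start g on steps j
    where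
    from-start : ∀ {m} (g : Fin (suc m) → V) → (∀ i → P (g i)) → (∀ i → R (g (inject₁ i)) (g (suc i))) →
                 ∀ i → Star (λ s t → R s t × P s × P t) (g zero) (g i)
    from-start g on steps zero = ε
    from-start {suc m} g on steps (suc i) = (steps zero , on zero , on 1F) ◅ from-start (g ∘ suc) (on ∘ suc) (steps ∘ suc) i

-- The cyclic order of the rim and splittings of large wheels

≡ᵇ-sound : ∀ {m n} → (m ≡ᵇ n) ≡ true → m ≡ n
≡ᵇ-sound {m} {n} e = ≡ᵇ⇒≡ m n (subst T (sym e) _)

≡ᵇ-refl : ∀ m → (m ≡ᵇ m) ≡ true
≡ᵇ-refl zero = refl
≡ᵇ-refl (suc m) = ≡ᵇ-refl m

∨-introˡ : ∀ {a b} → a ≡ true → a ∨ b ≡ true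
∨-introˡ refl = refl

∨-introʳ : ∀ {a b} → b ≡ true → a ∨ b ≡ true
∨-introʳ {true} _ = refl
∨-introʳ {false} e = e

next : ∀ {k} → Fin (suc k) → Fin (suc k)
next i with view i
... | ‵fromℕ = zero
... | ‵inject₁ i = suc i

next-fromℕ : ∀ k → next (fromℕ k) ≡ zero
next-fromℕ k = go refl
  where
  go : ∀ {x} → x ≡ fromℕ k → next x ≡ zero
  go {x} e with view x
  ... | ‵fromℕ = refl
  ... | ‵inject₁ i = contradiction (sym e) fromℕ≢inject₁

next-inject₁ : ∀ {k} (i : Fin k) → next (inject₁ i) ≡ suc i
next-inject₁ i = go refl
  where
  go : ∀ {x} → x ≡ inject₁ i → next x ≡ suc i
  go {x} e with view x
  ... | ‵fromℕ = contradiction e fromℕ≢inject₁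
  ... | ‵inject₁ j = cong suc (inject₁-injective e)

next-sound : ∀ {k} {i j : Fin (suc k)} → nextᵇ (suc k) i j ≡ true → j ≡ next i
next-sound {k} {i} {j} e with view i
next-sound {k} {_} {j} e | ‵fromℕ with ∨-true {toℕ j ≡ᵇ suc (toℕ (fromℕ k))} e
... | inj₁ p = contradiction (toℕ<n j) λ lt → <-irrefl refl (subst (_< suc k) (trans (≡ᵇ-sound p) (cong suc (toℕ-fromℕ k))) lt)
... | inj₂ p = toℕ-injective (≡ᵇ-sound (proj₂ (∧-true {toℕ (fromℕ k) ≡ᵇ k} p)))
next-sound {k} {_} {j} e | ‵inject₁ i with ∨-true {toℕ j ≡ᵇ suc (toℕ (inject₁ i))} e
... | inj₁ p = toℕ-injective (trans (≡ᵇ-sound p) (cong suc (toℕ-inject₁ i)))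
... | inj₂ p = contradiction (toℕ<n i) (<-irrefl (trans (sym (toℕ-inject₁ i)) (≡ᵇ-sound (proj₁ (∧-true {toℕ (inject₁ i) ≡ᵇ k} p)))))

next-complete : ∀ {k} (i : Fin (suc k)) → nextᵇ (suc k) i (next i) ≡ true
next-complete {k} i with view i
... | ‵fromℕ = ∨-introʳ {0 ≡ᵇ suc (toℕ (fromℕ k))} (∧-intro (subst (λ x → (x ≡ᵇ k) ≡ true) (sym (toℕ-fromℕ k)) (≡ᵇ-refl k)) refl)
... | ‵inject₁ j = ∨-introˡ (subst (λ x → (toℕ j ≡ᵇ x) ≡ true) (sym (toℕ-inject₁ j)) (≡ᵇ-refl (toℕ j)))

next-injective : ∀ {k} {i j : Fin (suc k)} → next i ≡ next j → i ≡ j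
next-injective {i = i} {j} e with view i | view j
... | ‵fromℕ | ‵fromℕ = refl
... | ‵inject₁ i | ‵inject₁ j = cong inject₁ (suc-injective e)

next-onto : ∀ {k} (i : Fin (suc k)) → ∃ λ j → next j ≡ i
next-onto {k} zero = fromℕ k , next-fromℕ k
next-onto (suc i) = inject₁ i , next-inject₁ i

cycle-step : ∀ {k} (i : Fin (suc k)) → cycleAdj (suc k) i (next i) ≡ true
cycle-step i = ∨-introˡ (next-complete i)

cycle-sym : ∀ {k} {i j : Fin k} → cycleAdj k i j ≡ true → cycleAdj k j i ≡ true
cycle-sym {k} {i} {j} e = [ ∨-introʳ {nextᵇ k j i} , ∨-introˡ ]′ (∨-true {nextᵇ k i j} e)

cycle-cases : ∀ {k} {i j : Fin (suc k)} → cycleAdj (suc k) i j ≡ true → j ≡ next i ⊎ i ≡ next j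
cycle-cases {k} {i} {j} e = Sum.map next-sound next-sound (∨-true {nextᵇ (suc k) i j} e)

rotate : ∀ {k n} {G : Graph n} → Iso (wheelAdj (suc k)) G → Iso (wheelAdj (suc k)) G
rotate {k} {n} {G} I = record
  { f = f ∘ turn ; inj = λ {i} {j} e → turn-inj i j (inj e)
  ; onto = λ x → let (i , e) = onto x ; (j , e′) = turn-onto i in j , trans (cong f e′) e
  ; adj⁺ = λ {i} {j} r → back i j (adj⁺ r) ; adj⁻ = λ {i} {j} r → adj⁻ (forth i j r) }
  where
  open Iso I
  turn : Fin (suc (suc k)) → Fin (suc (suc k))
  turn zero = zero
  turn (suc i) = suc (next i)
  turn-inj : ∀ i j → turn i ≡ turn j → i ≡ j
  turn-inj zero zero _ = refl
  turn-inj (suc i) (suc j) e = cong suc (next-injective (suc-injective e))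
  turn-onto : ∀ i → ∃ λ j → turn j ≡ i
  turn-onto zero = zero , refl
  turn-onto (suc i) = let (j , e) = next-onto i in suc j , cong suc e
  back : ∀ i j → wheelAdj (suc k) (turn i) (turn j) ≡ true → wheelAdj (suc k) i j ≡ true
  back zero (suc j) _ = refl
  back (suc i) zero _ = refl
  back (suc i) (suc j) r with cycle-cases {i = next i} {next j} r
  ... | inj₁ e with next-injective e
  ... | refl = cycle-step i
  back (suc i) (suc j) r | inj₂ e with next-injective e
  ... | refl = cycle-sym {i = j} {i} (cycle-step j)
  forth : ∀ i j → wheelAdj (suc k) i j ≡ true → wheelAdj (suc k) (turn i) (turn j) ≡ true
  forth zero (suc j) _ = refl
  forth (suc i) zero _ = refl
  forth (suc i) (suc j) r with cycle-cases {i = i} {j} r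
  ... | inj₁ refl = cycle-step (next i)
  ... | inj₂ refl = cycle-sym {i = next j} {next (next j)} (cycle-step (next j))

-- By symmetry, a statement about one spoke or one rim vertex needs proof only at position 1F.
rotate-to : ∀ {k n} {G : Graph n} (I : Iso (wheelAdj (suc k)) G) (j : Fin (suc k)) →
            ∃ λ (I′ : Iso (wheelAdj (suc k)) G) → Iso.f I′ 1F ≡ Iso.f I (suc j) × Iso.f I′ zero ≡ Iso.f I zero
rotate-to I j = go (toℕ j) I j refl
  where
  go : ∀ {k n} {G : Graph n} m (I : Iso (wheelAdj (suc k)) G) (j : Fin (suc k)) → toℕ j ≡ m →
       ∃ λ (I′ : Iso (wheelAdj (suc k)) G) → Iso.f I′ 1F ≡ Iso.f I (suc j) × Iso.f I′ zero ≡ Iso.f I zero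
  go zero I zero _ = I , refl , refl
  go (suc m) I (suc j) e with go m (rotate I) (inject₁ j) (trans (toℕ-inject₁ j) (ℕ-suc-injective e))
  ... | I′ , p , q = I′ , trans p (cong (λ i → Iso.f I (suc i)) (next-inject₁ j)) , q

split-swap : ∀ {m n} {B : Adj m} {nb} {G : Graph n} → Split B nb G → Split B nb G
split-swap {G = G} S = record
  { u = v ; v = u ; q = q ; u~v = Graph.~-sym G u~v ; q-inj = q-inj ; q≢u = q≢v ; q≢v = q≢u
  ; onto = λ x → case onto x of λ { (inj₁ e) → inj₂ (inj₁ e) ; (inj₂ (inj₁ e)) → inj₁ e ; (inj₂ (inj₂ e)) → inj₂ (inj₂ e) }
  ; adj⁺ = adj⁺ ; adj⁻ = adj⁻ ; nb⁺ = nb⁺ ∘ Sum.swap ; nb⁻ = Sum.swap ∘ nb⁻ ; two-u = two-v ; two-v = two-u }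
  where open Split S

module RimSplit {m n : ℕ} (G : Graph n) where
  open Graph G

  private
    k = 4 + m

  RimSplitting : Set
  RimSplitting = Split (removed (wheelAdj k) 1F) (λ i → wheelAdj k 1F (punchIn 1F i)) G

  module At (S : RimSplitting) where
    open Split S public

    -- The hub and the two rim neighbours of the split vertex; `between` is the rest of the rim,
    -- nonempty since there are at least four spokes.
    h a b : Fin n
    h = q zero
    a = q 1F
    b = q (suc (fromℕ (2 + m)))

    between : Fin (suc m) → Fin n
    between i = q (suc (suc (inject₁ i)))

    along : ∀ (i : Fin (2 + m)) → q (suc (inject₁ i)) ~ q (suc (suc i))
    along i = adj⁻ (subst (λ x → cycleAdj k (suc (inject₁ i)) (suc x) ≡ true) (next-inject₁ i) (∨-introˡ (consecutive i)))
      where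
      consecutive : ∀ i → nextᵇ k (suc (inject₁ i)) (suc (next (inject₁ i))) ≡ true
      consecutive i = subst (λ x → nextᵇ k (suc (inject₁ i)) (suc x) ≡ true) (sym (next-inject₁ i))
        (∨-introˡ (subst (λ x → (toℕ i ≡ᵇ x) ≡ true) (sym (toℕ-inject₁ i)) (≡ᵇ-refl (toℕ i))))

    h~ : ∀ i → h ~ q (suc i)
    h~ i = adj⁻ refl

    neighbours : ∀ {i} → u ~ q i ⊎ v ~ q i → i ≡ zero ⊎ i ≡ 1F ⊎ i ≡ suc (fromℕ (2 + m))
    neighbours {zero} _ = inj₁ refl
    neighbours {suc i} r with cycle-cases {i = zero} {suc i} (nb⁺ r)
    ... | inj₁ e = inj₂ (inj₁ e)
    ... | inj₂ e = inj₂ (inj₂ (next-injective (trans (sym e) (sym (next-fromℕ (3 + m))))))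

    a≢b : a ≢ b
    a≢b e = case suc-injective (q-inj e) of λ ()

    -- In the four-cycle h a u b, the opposite vertices h and u are joined through v, and a and b
    -- through the rest of the rim.
    spoke-split : u ~ a → u ~ b → v ~ h → K₃₃⁻ ≼ᵐ G
    spoke-split ua ub vh = crossed-cycle _≟ᶠ_ ~-sym {h} {u} {v} {a} {b} (λ x → ∃ λ i → between i ≡ x) (λ x → any? λ i → between i ≟ᶠ x)
      ((q≢u _ ∷ q≢v _ ∷ ~⇒≢ G (h~ _) ∷ ~⇒≢ G (h~ _) ∷ []) ∷ (~⇒≢ G u~v ∷ (q≢u _ ∘ sym) ∷ (q≢u _ ∘ sym) ∷ []) ∷
       ((q≢v _ ∘ sym) ∷ (q≢v _ ∘ sym) ∷ []) ∷ (a≢b ∷ []) ∷ [] ∷ [])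
      ((λ { (i , e) → case q-inj e of λ () }) ∷ (λ { (i , e) → q≢u _ e }) ∷ (λ { (i , e) → q≢v _ e }) ∷
       (λ { (i , e) → case q-inj e of λ () }) ∷ (λ { (i , e) → fromℕ≢inject₁ (sym (suc-injective (suc-injective (q-inj e)))) }) ∷ [])
      (λ { (i , refl) (j , refl) → path-connected _≟ᶠ_ ~-sym between _ (λ i → i , refl) (λ i → along (suc (inject₁ i))) i j })
      (between zero , (zero , refl) , ~-sym (along zero))
      (between (fromℕ m) , (fromℕ m , refl) , along (suc (fromℕ m)))
      (~-sym vh) (h~ _) (h~ _) u~v ua ub

    -- The path b v u a takes the place of the split vertex on the rim.
    bigger-wheel : u ~ h → v ~ h → u ~ a → ¬ (u ~ b) → v ~ b → ¬ (v ~ a) → Iso (wheelAdj (suc k)) G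
    bigger-wheel uh vh ua ¬ub vb ¬va = record
      { f = f ; inj = λ {i} {j} → inj i j
      ; onto = λ x → case onto x of λ
          { (inj₁ e) → 2F , sym e ; (inj₂ (inj₁ e)) → 1F , sym e
          ; (inj₂ (inj₂ (zero , e))) → zero , e ; (inj₂ (inj₂ (suc i , e))) → suc (suc (suc i)) , e }
      ; adj⁺ = λ {i} {j} → to i j ; adj⁻ = λ {i} {j} → from i j }
      where
      f : Fin (2 + k) → Fin n
      f zero = h
      f (suc zero) = v
      f (suc (suc zero)) = u
      f (suc (suc (suc i))) = q (suc i)
      inj : ∀ i j → f i ≡ f j → i ≡ j
      inj zero zero _ = refl
      inj zero (suc zero) e = contradiction e (q≢v _)
      inj zero (suc (suc zero)) e = contradiction e (q≢u _)
      inj zero (suc (suc (suc j))) e = case q-inj e of λ ()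
      inj (suc zero) zero e = contradiction (sym e) (q≢v _)
      inj (suc zero) (suc zero) _ = refl
      inj (suc zero) (suc (suc zero)) e = contradiction (sym e) (~⇒≢ G u~v)
      inj (suc zero) (suc (suc (suc j))) e = contradiction (sym e) (q≢v _)
      inj (suc (suc zero)) zero e = contradiction (sym e) (q≢u _)
      inj (suc (suc zero)) (suc zero) e = contradiction e (~⇒≢ G u~v)
      inj (suc (suc zero)) (suc (suc zero)) _ = refl
      inj (suc (suc zero)) (suc (suc (suc j))) e = contradiction (sym e) (q≢u _)
      inj (suc (suc (suc i))) zero e = case q-inj e of λ ()
      inj (suc (suc (suc i))) (suc zero) e = contradiction e (q≢v _)
      inj (suc (suc (suc i))) (suc (suc zero)) e = contradiction e (q≢u _)
      inj (suc (suc (suc i))) (suc (suc (suc j))) e = cong (λ z → suc (suc z)) (q-inj e)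
      u-nbr : ∀ {i} → u ~ q (suc i) → i ≡ zero
      u-nbr r with neighbours (inj₁ r)
      ... | inj₂ (inj₁ refl) = refl
      ... | inj₂ (inj₂ refl) = contradiction r ¬ub
      v-nbr : ∀ {i} → v ~ q (suc i) → i ≡ fromℕ (2 + m)
      v-nbr r with neighbours (inj₂ r)
      ... | inj₂ (inj₁ refl) = contradiction r ¬va
      ... | inj₂ (inj₂ e) = suc-injective e
      last-next : ∀ {i} → i ≡ fromℕ (2 + m) → cycleAdj (suc k) (suc (suc i)) zero ≡ true
      last-next refl = subst (λ x → cycleAdj (suc k) (fromℕ k) x ≡ true) (next-fromℕ k) (cycle-step (fromℕ k))
      to : ∀ i j → f i ~ f j → wheelAdj (suc k) i j ≡ true
      to zero zero r = contradiction refl (~⇒≢ G r)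
      to zero (suc j) r = refl
      to (suc i) zero r = refl
      to (suc zero) (suc zero) r = contradiction refl (~⇒≢ G r)
      to (suc zero) (suc (suc zero)) r = refl
      to (suc zero) (suc (suc (suc j))) r = cycle-sym {i = suc (suc j)} {zero} (last-next (v-nbr r))
      to (suc (suc zero)) (suc zero) r = refl
      to (suc (suc zero)) (suc (suc zero)) r = contradiction refl (~⇒≢ G r)
      to (suc (suc zero)) (suc (suc (suc j))) r with u-nbr r
      ... | refl = refl
      to (suc (suc (suc i))) (suc zero) r = last-next (v-nbr (~-sym r))
      to (suc (suc (suc i))) (suc (suc zero)) r with u-nbr (~-sym r)
      ... | refl = refl
      to (suc (suc (suc i))) (suc (suc (suc j))) r = adj⁺ r
      u-edge : ∀ {j : Fin (3 + m)} → cycleAdj (suc k) 1F (suc (suc j)) ≡ true → u ~ q (suc j)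
      u-edge {j} e with cycle-cases {i = 1F} {suc (suc j)} e
      ... | inj₁ e′ with trans e′ (next-inject₁ 1F)
      ... | refl = ua
      u-edge {j} e | inj₂ e′ with next-injective {i = zero} {suc (suc j)} (trans (next-inject₁ zero) e′)
      ... | ()
      v-edge : ∀ {j : Fin (3 + m)} → cycleAdj (suc k) zero (suc (suc j)) ≡ true → v ~ q (suc j)
      v-edge {j} e with cycle-cases {i = zero} {suc (suc j)} e
      ... | inj₁ e′ = case trans e′ (next-inject₁ zero) of λ ()
      ... | inj₂ e′ with next-injective {i = suc (suc j)} {fromℕ k} (trans (sym e′) (sym (next-fromℕ k)))
      ... | refl = vb
      from : ∀ i j → wheelAdj (suc k) i j ≡ true → f i ~ f j
      from zero (suc zero) e = ~-sym vh
      from zero (suc (suc zero)) e = ~-sym uh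
      from zero (suc (suc (suc j))) e = h~ j
      from (suc zero) zero e = vh
      from (suc (suc zero)) zero e = uh
      from (suc (suc (suc i))) zero e = ~-sym (h~ i)
      from (suc zero) (suc zero) e = case cycle-cases {i = zero} {zero} e of λ { (inj₁ x) → case trans x (next-inject₁ {k} zero) of λ () ; (inj₂ x) → case trans x (next-inject₁ {k} zero) of λ () }
      from (suc zero) (suc (suc zero)) e = ~-sym u~v
      from (suc (suc zero)) (suc zero) e = u~v
      from (suc (suc zero)) (suc (suc zero)) e = case cycle-cases {i = 1F} {1F} e of λ { (inj₁ x) → case trans x (next-inject₁ {k} 1F) of λ () ; (inj₂ x) → case trans x (next-inject₁ {k} 1F) of λ () }
      from (suc zero) (suc (suc (suc j))) e = v-edge e
      from (suc (suc zero)) (suc (suc (suc j))) e = u-edge e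
      from (suc (suc (suc i))) (suc zero) e = ~-sym (v-edge (cycle-sym {i = suc (suc i)} {zero} e))
      from (suc (suc (suc i))) (suc (suc zero)) e = ~-sym (u-edge (cycle-sym {i = suc (suc i)} {1F} e))
      from (suc (suc (suc i))) (suc (suc (suc j))) e = adj⁻ e

    degree-u : (u ~ h × (u ~ a ⊎ u ~ b)) ⊎ (u ~ a × u ~ b)
    degree-u with two-u
    ... | i , j , ne , r , s with neighbours (inj₁ r) | neighbours (inj₁ s)
    ... | inj₁ refl | inj₁ refl = contradiction refl ne
    ... | inj₁ refl | inj₂ (inj₁ refl) = inj₁ (r , inj₁ s)
    ... | inj₁ refl | inj₂ (inj₂ refl) = inj₁ (r , inj₂ s)
    ... | inj₂ (inj₁ refl) | inj₁ refl = inj₁ (s , inj₁ r)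
    ... | inj₂ (inj₁ refl) | inj₂ (inj₁ refl) = contradiction refl ne
    ... | inj₂ (inj₁ refl) | inj₂ (inj₂ refl) = inj₂ (r , s)
    ... | inj₂ (inj₂ refl) | inj₁ refl = inj₁ (s , inj₂ r)
    ... | inj₂ (inj₂ refl) | inj₂ (inj₁ refl) = inj₂ (s , r)
    ... | inj₂ (inj₂ refl) | inj₂ (inj₂ refl) = contradiction refl ne

  -- If u or v is adjacent to both a and b, `spoke-split` applies to one of them. Otherwise u and v
  -- have one of a and b each, and degree three forces both to be adjacent to the hub.
  rim-split : RimSplitting → (K₃₃⁻ ≼ᵐ G) ⊎ Iso (wheelAdj (suc k)) G
  rim-split S = decide (u ~? a) (u ~? b) (v ~? a) (v ~? b)
    where
    open At S
    module S′ = At (split-swap S)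
    u-or-v~h : u ~ h ⊎ v ~ h
    u-or-v~h = nb⁻ refl
    end-a : u ~ a ⊎ v ~ a
    end-a = nb⁻ refl
    end-b : u ~ b ⊎ v ~ b
    end-b = nb⁻ (cycle-sym {i = fromℕ (3 + m)} {zero} (subst (λ x → cycleAdj k (fromℕ (3 + m)) x ≡ true) (next-fromℕ (3 + m)) (cycle-step (fromℕ (3 + m)))))
    double-u : u ~ a → u ~ b → K₃₃⁻ ≼ᵐ G
    double-u ua ub with S′.degree-u | v ~? h
    ... | _ | yes vh = spoke-split ua ub vh
    ... | inj₁ (vh , _) | no ¬vh = contradiction vh ¬vh
    ... | inj₂ (va , vb) | no ¬vh = S′.spoke-split va vb ([ id , (λ vh → contradiction vh ¬vh) ]′ u-or-v~h)
    double-v : v ~ a → v ~ b → K₃₃⁻ ≼ᵐ G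
    double-v va vb with degree-u | u ~? h
    ... | _ | yes uh = S′.spoke-split va vb uh
    ... | inj₁ (uh , _) | no ¬uh = contradiction uh ¬uh
    ... | inj₂ (ua , ub) | no ¬uh = spoke-split ua ub ([ (λ uh → contradiction uh ¬uh) , id ]′ u-or-v~h)
    uh : ¬ (u ~ a × u ~ b) → u ~ h
    uh h = [ proj₁ , (λ d → contradiction d h) ]′ degree-u
    vh : ¬ (v ~ a × v ~ b) → v ~ h
    vh h = [ proj₁ , (λ d → contradiction d h) ]′ S′.degree-u
    decide : Dec (u ~ a) → Dec (u ~ b) → Dec (v ~ a) → Dec (v ~ b) → (K₃₃⁻ ≼ᵐ G) ⊎ Iso (wheelAdj (suc k)) G
    decide (yes ua) (yes ub) _ _ = inj₁ (double-u ua ub)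
    decide _ _ (yes va) (yes vb) = inj₁ (double-v va vb)
    decide (yes ua) (no ¬ub) (no ¬va) (yes vb) = inj₂ (bigger-wheel (uh (¬ub ∘ proj₂)) (vh (¬va ∘ proj₁)) ua ¬ub vb ¬va)
    decide (no ¬ua) (yes ub) (yes va) (no ¬vb) = inj₂ (S′.bigger-wheel (vh (¬vb ∘ proj₂)) (uh (¬ua ∘ proj₁)) va ¬vb ub ¬ua)
    decide (no ¬ua) _ (no ¬va) _ = contradiction end-a [ ¬ua , ¬va ]′
    decide _ (no ¬ub) _ (no ¬vb) = contradiction end-b [ ¬ub , ¬vb ]′

pinch-step : ∀ {m} (j : Fin (suc m)) (i : Fin m) → ∃ λ (i₀ : Fin (suc m)) →
             pinch j (inject₁ i₀) ≡ inject₁ i × pinch j (suc i₀) ≡ suc i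
pinch-step zero i = suc i , refl , refl
pinch-step {suc m} (suc j) zero = zero , refl , cong suc (pinch-zero j)
  where
  pinch-zero : ∀ {m} (j : Fin (suc m)) → pinch j zero ≡ zero
  pinch-zero zero = refl
  pinch-zero (suc j) = refl
pinch-step {suc m} (suc j) (suc i) with pinch-step j i
... | i₀ , p , q = suc i₀ , cong suc p , cong suc q

pinch-last : ∀ {m} (j : Fin (suc m)) → pinch j (fromℕ (suc m)) ≡ fromℕ m
pinch-last zero = refl
pinch-last {suc m} (suc j) = cong suc (pinch-last j)

pinch-first : ∀ {m} (j : Fin (suc m)) → pinch j zero ≡ zero
pinch-first zero = refl
pinch-first (suc j) = refl

pinch-fibre : ∀ {m} (j : Fin (suc m)) {s t : Fin (suc (suc m))} → pinch j s ≡ pinch j t →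
              s ≡ t ⊎ (s ≡ inject₁ j × t ≡ suc j) ⊎ (s ≡ suc j × t ≡ inject₁ j)
pinch-fibre zero {zero} {zero} _ = inj₁ refl
pinch-fibre zero {zero} {suc t} refl = inj₂ (inj₁ (refl , refl))
pinch-fibre zero {suc s} {zero} refl = inj₂ (inj₂ (refl , refl))
pinch-fibre zero {suc s} {suc t} refl = inj₁ refl
pinch-fibre (suc j) {zero} {zero} _ = inj₁ refl
pinch-fibre {suc m} (suc j) {suc s} {suc t} e with pinch-fibre j {s} {t} (suc-injective e)
... | inj₁ refl = inj₁ refl
... | inj₂ (inj₁ (p , q)) = inj₂ (inj₁ (cong suc p , cong suc q))
... | inj₂ (inj₂ (p , q)) = inj₂ (inj₂ (cong suc p , cong suc q))

pinch-onto : ∀ {m} (j : Fin (suc m)) t → ∃ λ s → pinch j s ≡ t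
pinch-onto zero t = suc t , refl
pinch-onto (suc j) zero = zero , refl
pinch-onto {suc m} (suc j) (suc t) = let (s , e) = pinch-onto j t in suc s , cong suc e

module HubSplit {n} (G : Graph n) {u v : Fin n} (u~v : Graph._~_ G u v) where
  open Graph G

  -- The rim of the wheel, contracted to suc m connected sets.
  record Ring (m : ℕ) : Set where
    field
      c       : Fin n → Maybe (Fin (suc m))
      c-u     : c u ≡ nothing
      c-v     : c v ≡ nothing
      conn    : ∀ {x y t} → c x ≡ just t → c y ≡ just t → Star (Inside _~_ c t) x y
      steps   : ∀ (i : Fin m) → ∃₂ λ x y → c x ≡ just (inject₁ i) × c y ≡ just (suc i) × x ~ y
      closing : ∃₂ λ x y → c x ≡ just (fromℕ m) × c y ≡ just zero × x ~ y

    Sees : Fin n → Fin (suc m) → Set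
    Sees w t = ∃ λ x → c x ≡ just t × w ~ x

    field
      covered : ∀ t → Sees u t ⊎ Sees v t
      two-u   : ∃₂ λ s t → s ≢ t × Sees u s × Sees u t
      two-v   : ∃₂ λ s t → s ≢ t × Sees v s × Sees v t

    sees? : ∀ w t → Dec (Sees w t)
    sees? w t = any? λ x → Maybe-≡-dec _≟ᶠ_ (c x) (just t) ×-dec (w ~? x)

  -- Pinching j merges the sets j and j + 1; it keeps s and t apart if suc j is neither of them.
  shrink : ∀ {m} → 4 ≤ m → Ring (suc m) → Ring m
  shrink {m} big R with R.two-u | R.two-v
    where module R = Ring R
  -- Five indices are excluded: zero, so that the choice has the form `suc j`, and the four that u
  -- and v are known to see. A ring of six or more sets has another index, which is why the
  -- shrinking stops at five.
  ... | s , t , s≢t , us , ut | s′ , t′ , s′≢t′ , vs , vt with avoid {suc (suc m)} (zero ∷ s ∷ t ∷ s′ ∷ t′ ∷ []) (s≤s (s≤s big))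
  ... | zero , j∉ = contradiction (here refl) j∉
  ... | suc j , j∉ = record
    { c = c ; c-u = cong (Maybe.map (pinch j)) R.c-u ; c-v = cong (Maybe.map (pinch j)) R.c-v
    ; conn = conn
    ; steps = λ i → let (i₀ , p , q) = pinch-step j i ; (x , y , a , b , r) = R.steps i₀ in
        x , y , image a p , image b q , r
    ; closing = let (x , y , a , b , r) = R.closing in x , y , image a (pinch-last j) , image b (pinch-first j) , r
    ; covered = λ t → let (s , e) = pinch-onto j t in Sum.map (sees e) (sees e) (R.covered s)
    ; two-u = pinch j s , pinch j t , separate (there (here refl)) (there (there (here refl))) s≢t , sees refl us , sees refl ut
    ; two-v = pinch j s′ , pinch j t′ , separate (there (there (there (here refl)))) (there (there (there (there (here refl))))) s′≢t′ , sees refl vs , sees refl vt }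
    where
    module R = Ring R
    c : Fin n → Maybe (Fin (suc m))
    c x = Maybe.map (pinch j) (R.c x)
    image : ∀ {x s t} → R.c x ≡ just s → pinch j s ≡ t → c x ≡ just t
    image p q = trans (cong (Maybe.map (pinch j)) p) (cong just q)
    preimage : ∀ {x t} → c x ≡ just t → ∃ λ s → R.c x ≡ just s × pinch j s ≡ t
    preimage {x} e with R.c x
    preimage refl | just s = s , refl , refl
    sees : ∀ {w s t} → pinch j s ≡ t → R.Sees w s → ∃ λ x → c x ≡ just t × w ~ x
    sees e (x , p , r) = x , image p e , r
    chosen = zero ∷ s ∷ t ∷ s′ ∷ t′ ∷ []
    separate : ∀ {x y} → x ∈ˡ chosen → y ∈ˡ chosen → x ≢ y → pinch j x ≢ pinch j y
    separate {x} {y} x∈ y∈ ne e with pinch-fibre j {x} {y} e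
    ... | inj₁ eq = ne eq
    ... | inj₂ (inj₁ (_ , refl)) = j∉ y∈
    ... | inj₂ (inj₂ (refl , _)) = j∉ x∈
    within : ∀ {s t x y} → pinch j s ≡ t → Star (Inside _~_ R.c s) x y → Star (Inside _~_ c t) x y
    within e = Star-map λ (r , p , q) → r , image p e , image q e
    conn : ∀ {x y t} → c x ≡ just t → c y ≡ just t → Star (Inside _~_ c t) x y
    conn p q with preimage p | preimage q
    ... | s₁ , a , ea | s₂ , b , eb with pinch-fibre j {s₁} {s₂} (trans ea (sym eb))
    ... | inj₁ refl = within ea (R.conn a b)
    ... | inj₂ (inj₁ (refl , refl)) = let (x , y , a′ , b′ , r) = R.steps j in
      within ea (R.conn a a′) ◅◅ (r , image a′ ea , image b′ eb) ◅ within eb (R.conn b′ b)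
    ... | inj₂ (inj₂ (refl , refl)) = let (y , x , b′ , a′ , r) = R.steps j in
      within ea (R.conn a a′) ◅◅ (~-sym r , image a′ ea , image b′ eb) ◅ within eb (R.conn b′ b)

  shrink-to-five : ∀ d → Ring (d + 4) → Ring 4
  shrink-to-five zero R = R
  shrink-to-five (suc d) R = shrink-to-five d (shrink (m≤n+m 4 d) R)

  module _ (R : Ring 4) where
    open Ring R

    private
      attach : Fin 5 → Attach
      attach t with sees? u t | sees? v t
      ... | yes _ | yes _ = toBoth
      ... | yes _ | no _ = toU
      ... | no _ | _ = toV
      lab : Vec.Vec Attach 5
      lab = Vec.tabulate attach
      look : ∀ {b} (f : Attach → Bool) t → f (attach t) ≡ b → f (Vec.lookup lab t) ≡ b
      look f t e = trans (cong f (VecP.lookup∘tabulate attach t)) e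
      kool : ∀ {b} (f : Attach → Bool) t → f (Vec.lookup lab t) ≡ b → f (attach t) ≡ b
      kool f t e = trans (cong f (sym (VecP.lookup∘tabulate attach t))) e
      sees-u : ∀ {t} → Sees u t → onU (attach t) ≡ true
      sees-u {t} s with sees? u t | sees? v t
      ... | yes _ | yes _ = refl
      ... | yes _ | no _ = refl
      ... | no h | _ = contradiction s h
      sees-v : ∀ {t} → Sees v t → onV (attach t) ≡ true
      sees-v {t} s with sees? u t | sees? v t
      ... | yes _ | yes _ = refl
      ... | yes _ | no h = contradiction s h
      ... | no _ | _ = refl
      seen-u : ∀ t → onU (attach t) ≡ true → Sees u t
      seen-u t e with sees? u t | sees? v t
      ... | yes s | _ = s
      seen-v : ∀ t → onV (attach t) ≡ true → Sees v t
      seen-v t e with sees? u t | sees? v t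
      ... | yes _ | yes s = s
      ... | no h | _ = [ (λ s → contradiction s h) , id ]′ (covered t)

      φ : Fin n → Maybe (Fin 7)
      φ x with x ≟ᶠ u | x ≟ᶠ v
      ... | yes _ | _ = just 0F
      ... | no _ | yes _ = just 1F
      ... | no _ | no _ = Maybe.map (λ t → suc (suc t)) (c x)
      φ-u : φ u ≡ just 0F
      φ-u with u ≟ᶠ u
      ... | yes _ = refl
      ... | no h = contradiction refl h
      φ-v : φ v ≡ just 1F
      φ-v with v ≟ᶠ u | v ≟ᶠ v
      ... | yes e | _ = contradiction (sym e) (~⇒≢ G u~v)
      ... | no _ | yes _ = refl
      ... | no _ | no h = contradiction refl h
      φ-c : ∀ {x t} → c x ≡ just t → φ x ≡ just (suc (suc t))
      φ-c {x} e with x ≟ᶠ u | x ≟ᶠ v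
      ... | yes refl | _ = case trans (sym e) c-u of λ ()
      ... | no _ | yes refl = case trans (sym e) c-v of λ ()
      ... | no _ | no _ rewrite e = refl
      φ⁻ : ∀ {x} i → φ x ≡ just i → (i ≡ 0F × x ≡ u) ⊎ (i ≡ 1F × x ≡ v) ⊎ ∃ λ t → i ≡ suc (suc t) × c x ≡ just t
      φ⁻ {x} i e with x ≟ᶠ u | x ≟ᶠ v
      ... | yes p | _ = inj₁ (sym (just-injective e) , p)
      ... | no _ | yes p = inj₂ (inj₁ (sym (just-injective e) , p))
      ... | no _ | no _ with c x
      φ⁻ i refl | no _ | no _ | just t = inj₂ (inj₂ (t , refl , refl))

      Realised : Fin 7 → Fin 7 → Set
      Realised i j = ∃₂ λ x y → φ x ≡ just i × φ y ≡ just j × x ~ y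
      flip-edge : ∀ {i j} → Realised i j → Realised j i
      flip-edge (x , y , p , q , r) = y , x , q , p , ~-sym r
      from-u : ∀ t → onU (Vec.lookup lab t) ≡ true → Realised 0F (suc (suc t))
      from-u t e = let (x , p , r) = seen-u t (kool onU t e) in u , x , φ-u , φ-c p , r
      from-v : ∀ t → onV (Vec.lookup lab t) ≡ true → Realised 1F (suc (suc t))
      from-v t e = let (x , p , r) = seen-v t (kool onV t e) in v , x , φ-v , φ-c p , r
      forward : ∀ s → Realised (suc (suc s)) (suc (suc (next s)))
      forward s with view s
      ... | ‵fromℕ = let (x , y , p , q , r) = closing in x , y , φ-c p , φ-c q , r
      ... | ‵inject₁ i = let (x , y , p , q , r) = steps i in x , y , φ-c p , φ-c q , r
      around : ∀ s t → cycleAdj 5 s t ≡ true → Realised (suc (suc s)) (suc (suc t))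
      around s t e with cycle-cases {i = s} {t} e
      ... | inj₁ refl = forward s
      ... | inj₂ refl = flip-edge (forward t)
      edges : ∀ i j → splitAdj (cycleAdj 5) (const true) lab i j ≡ true → Realised i j
      edges zero (suc zero) _ = u , v , φ-u , φ-v , u~v
      edges zero (suc (suc t)) e = from-u t e
      edges (suc zero) zero _ = v , u , φ-v , φ-u , ~-sym u~v
      edges (suc zero) (suc (suc t)) e = from-v t e
      edges (suc (suc s)) zero e = flip-edge (from-u s e)
      edges (suc (suc s)) (suc zero) e = flip-edge (from-v s e)
      edges (suc (suc s)) (suc (suc t)) e = around s t e
      connected : ∀ {x y i} → φ x ≡ just i → φ y ≡ just i → Star (Inside _~_ φ i) x y
      connected {x} {y} {i} p q with φ⁻ {x} i p | φ⁻ {y} i q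
      ... | inj₁ (_ , refl) | inj₁ (_ , refl) = ε
      ... | inj₂ (inj₁ (_ , refl)) | inj₂ (inj₁ (_ , refl)) = ε
      ... | inj₂ (inj₂ (t , refl , a)) | inj₂ (inj₂ (.t , refl , b)) = Star-map (λ (r , a , b) → r , φ-c a , φ-c b) (conn a b)
      ... | inj₁ (refl , _) | inj₂ (inj₁ (() , _))
      ... | inj₁ (refl , _) | inj₂ (inj₂ (_ , () , _))
      ... | inj₂ (inj₁ (refl , _)) | inj₁ (() , _)
      ... | inj₂ (inj₁ (refl , _)) | inj₂ (inj₂ (_ , () , _))
      ... | inj₂ (inj₂ (_ , refl , _)) | inj₁ (() , _)
      ... | inj₂ (inj₂ (_ , refl , _)) | inj₂ (inj₁ (() , _))

    five-ring : K₃₃⁻ ≼ᵐ G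
    five-ring = ring-model lab proper ⨾ record { φ = φ ; conn = λ {x} {y} → connected {x} {y} ; edges = λ {i} {j} → edges i j }
      where
      proper : properᵇ {5} (const true) lab ≡ true
      proper = let (s , t , ne , p , q) = two-u ; (s′ , t′ , ne′ , p′ , q′) = two-v in
        ∧-intro (twoᵇ-intro (onU ∘ Vec.lookup lab) ne (look onU s (sees-u p)) (look onU t (sees-u q)))
                (twoᵇ-intro (onV ∘ Vec.lookup lab) ne′ (look onV s′ (sees-v p′)) (look onV t′ (sees-v q′)))

-- Every rim vertex is a set of the initial ring. Contracting it to five sets keeps each of u and v
-- adjacent to two different sets, which is all that `ring-model` requires besides covering.
hub-split : ∀ {m n} {G : Graph n} → Split (removed (wheelAdj (5 + m)) 0F) (λ i → wheelAdj (5 + m) 0F (punchIn 0F i)) G → K₃₃⁻ ≼ᵐ G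
hub-split {m} {n} {G} S = five-ring (shrink-to-five m (subst Ring (+-comm 4 m) ring))
  where
  open Split S
  open Graph G
  open HubSplit G u~v
  c : Fin n → Maybe (Fin (5 + m))
  c x with any? (λ i → q i ≟ᶠ x)
  ... | yes (i , _) = just i
  ... | no _ = nothing
  c-q : ∀ i → c (q i) ≡ just i
  c-q i with any? (λ j → q j ≟ᶠ q i)
  ... | yes (j , e) = cong just (q-inj e)
  ... | no h = contradiction (i , refl) h
  c⁻ : ∀ {x i} → c x ≡ just i → q i ≡ x
  c⁻ {x} e with any? (λ i → q i ≟ᶠ x)
  c⁻ refl | yes (i , p) = p
  off-q : ∀ {x} → (∀ i → q i ≢ x) → c x ≡ nothing
  off-q {x} h with any? (λ i → q i ≟ᶠ x)
  ... | yes (i , p) = contradiction p (h i)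
  ... | no _ = refl
  hop : ∀ i → q i ~ q (next i)
  hop i = adj⁻ (cycle-step i)
  ring : Ring (4 + m)
  ring = record
    { c = c ; c-u = off-q q≢u ; c-v = off-q q≢v
    ; conn = λ p p′ → case trans (sym (c⁻ p)) (c⁻ p′) of λ { refl → ε }
    ; steps = λ i → q (inject₁ i) , q (suc i) , c-q _ , c-q _ , subst (λ z → q (inject₁ i) ~ q z) (next-inject₁ i) (hop (inject₁ i))
    ; closing = q (fromℕ (4 + m)) , q zero , c-q _ , c-q _ , subst (λ z → q (fromℕ (4 + m)) ~ q z) (next-fromℕ (4 + m)) (hop (fromℕ (4 + m)))
    ; covered = λ t → Sum.map (λ r → q t , c-q t , r) (λ r → q t , c-q t , r) (nb⁻ refl)
    ; two-u = let (i , j , ne , r , s) = two-u in i , j , ne , (q i , c-q i , r) , (q j , c-q j , s)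
    ; two-v = let (i , j , ne , r , s) = two-v in i , j , ne , (q i , c-q i , r) , (q j , c-q j , s) }

small-list : ∀ {n} {xs : List (Fin n)} → Unique xs → length xs ≤ n
small-list {n} u = pigeonholes n {Uses = λ t i → t ≡ i} u (λ {t} _ → t , refl) (λ p q → trans p (sym q))

-- A third neighbour of i other than the two remaining vertices can only be j.
complete-on-four : (G : Graph 4) → TriConnected G → Iso (wheelAdj 3) G
complete-on-four G tri = record
  { f = id ; inj = id ; onto = λ x → x , refl ; adj⁺ = λ {i} {j} r → full i j (~⇒≢ G r) ; adj⁻ = λ {i} {j} r → joined (unfull i j r) }
  where
  open Graph G
  full : ∀ i j → i ≢ j → wheelAdj 3 i j ≡ true
  full = toWitness {a? = all? λ i → all? λ j → ¬? (i ≟ᶠ j) →-dec (wheelAdj 3 i j ≟ᵇ true)} _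
  unfull : ∀ i j → wheelAdj 3 i j ≡ true → i ≢ j
  unfull = toWitness {a? = all? λ i → all? λ j → (wheelAdj 3 i j ≟ᵇ true) →-dec ¬? (i ≟ᶠ j)} _
  joined : ∀ {i j} → i ≢ j → i ~ j
  joined {i} {j} i≢j with avoid (i ∷ j ∷ []) (s≤s (s≤s (s≤s z≤n)))
  ... | a , a∉ with avoid (i ∷ j ∷ a ∷ []) ≤-refl
  ... | b , b∉ with third-neighbour G ≤-refl tri {i} {a} {b} (λ e → a∉ (here e)) (λ e → b∉ (here e))
  ... | t , r , t≢a , t≢b with t ≟ᶠ j
  ... | yes refl = r
  ... | no t≢j = contradiction (small-list {xs = t ∷ i ∷ j ∷ a ∷ b ∷ []}
    (((λ e → ~⇒≢ G r (sym e)) ∷ t≢j ∷ t≢a ∷ t≢b ∷ []) ∷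
     (i≢j ∷ (λ e → a∉ (here (sym e))) ∷ (λ e → b∉ (here (sym e))) ∷ []) ∷
     ((λ e → a∉ (there (here (sym e)))) ∷ (λ e → b∉ (there (here (sym e)))) ∷ []) ∷
     ((λ e → b∉ (there (there (here (sym e))))) ∷ []) ∷ [] ∷ []))
    λ { (s≤s (s≤s (s≤s (s≤s ())))) }

-- The induction for wheels and the prism

WheelOrPrism : ∀ {n} → Graph n → Set
WheelOrPrism G = (∃ λ k → Iso (wheelAdj (3 + k)) G) ⊎ Iso prismAdj G

module Uncontract {n} (G : Graph (suc n)) (big : 4 ≤ suc n) (tri : TriConnected G)
                  (no₅ : ¬ (K₅⁻ ≼ᵐ G)) (no₆ : ¬ (K₃₃⁻ ≼ᵐ G)) {u v : Fin (suc n)} (r : Graph._~_ G u v) where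

  private
    v≢u = ~⇒≢ G (Graph.~-sym G r)

    cut-at : ∀ {m} (B : Adj (suc m)) (I : Iso B (contract G u v)) j → Iso.f I j ≡ merge v≢u u →
             Split (removed B j) (λ i → B j (punchIn j i)) G
    cut-at B I j e = contract-split {B = B} G big tri r v≢u I j e

  from-prism : Iso prismAdj (contract G u v) → WheelOrPrism G
  from-prism I = let (j , e) = Iso.onto I (merge v≢u u) in
    contradiction (split-prism j (cut-at prismAdj I j e)) no₆

  from-K₄ : Iso (wheelAdj 3) (contract G u v) → WheelOrPrism G
  from-K₄ I = let (j , e) = Iso.onto I (merge v≢u u) in
    [ (λ M → contradiction M no₅) , (λ J → inj₁ (1 , J)) ]′ (split-K₄ j (cut-at (wheelAdj 3) I j e))

  from-wheel : ∀ k → Iso (wheelAdj (4 + k)) (contract G u v) → WheelOrPrism G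
  from-wheel k I = let (j , e) = Iso.onto I (merge v≢u u) in outcome k I j e
    where
    outcome : ∀ k (I : Iso (wheelAdj (4 + k)) (contract G u v)) j → Iso.f I j ≡ merge v≢u u → WheelOrPrism G
    outcome zero I zero e = [ (λ M → contradiction M no₆) , inj₂ ]′ (split-W₄-hub (cut-at (wheelAdj 4) I zero e))
    outcome (suc k) I zero e = contradiction (hub-split {k} (cut-at (wheelAdj (5 + k)) I zero e)) no₆
    outcome k I (suc i) e = let (I′ , e′ , _) = rotate-to I i in
      [ (λ M → contradiction M no₆) , (λ J → inj₁ (2 + k , J)) ]′
        (RimSplit.rim-split {k} G (cut-at (wheelAdj (4 + k)) I′ 1F (trans e′ e)))

wheel-or-prism : ∀ n (G : Graph n) → 4 ≤ n → TriConnected G → ¬ (K₅⁻ ≼ᵐ G) → ¬ (K₃₃⁻ ≼ᵐ G) → WheelOrPrism G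
wheel-or-prism 1 _ (s≤s ())
wheel-or-prism 2 _ (s≤s (s≤s ()))
wheel-or-prism 3 _ (s≤s (s≤s (s≤s ())))
wheel-or-prism 4 G _ tri _ _ = inj₁ (0 , complete-on-four G tri)
wheel-or-prism (suc (suc (suc (suc (suc n))))) G big tri no₅ no₆ =
  let (u , v , r , tri′) = contractible-edge G tri big
      open Uncontract G big tri no₅ no₆ r
      found = wheel-or-prism (suc (suc (suc (suc n)))) (contract G u v) (s≤s (s≤s (s≤s (s≤s z≤n)))) tri′
                (λ M → no₅ (M ⨾ contract-model G r)) (λ M → no₆ (M ⨾ contract-model G r))
  in [ (λ { (zero , I) → from-K₄ I ; (suc k , I) → from-wheel k I }) , from-prism ]′ found

-- Virtual edges of the 3-connected components

∣p∪q∣≤∣p∣+∣q∣ : ∀ {n} (p q : Subset n) → ∣ p ∪ q ∣ ≤ ∣ p ∣ + ∣ q ∣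
∣p∪q∣≤∣p∣+∣q∣ Vec.[] Vec.[] = z≤n
∣p∪q∣≤∣p∣+∣q∣ (true Vec.∷ p) (true Vec.∷ q) = s≤s (≤-trans (∣p∪q∣≤∣p∣+∣q∣ p q) (+-mono-≤ (≤-refl {∣ p ∣}) (m≤n⇒m≤1+n ≤-refl)))
∣p∪q∣≤∣p∣+∣q∣ (true Vec.∷ p) (false Vec.∷ q) = s≤s (∣p∪q∣≤∣p∣+∣q∣ p q)
∣p∪q∣≤∣p∣+∣q∣ (false Vec.∷ p) (true Vec.∷ q) = ≤-trans (s≤s (∣p∪q∣≤∣p∣+∣q∣ p q)) (≤-reflexive (sym (+-suc ∣ p ∣ ∣ q ∣)))
∣p∪q∣≤∣p∣+∣q∣ (false Vec.∷ p) (false Vec.∷ q) = ∣p∪q∣≤∣p∣+∣q∣ p q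

enumerate : ∀ {n} (S : Subset n) → Σ (Fin ∣ S ∣ → Fin n) λ f → (∀ {i j} → f i ≡ f j → i ≡ j) × (∀ i → f i ∈ S) × (∀ {x} → x ∈ S → ∃ λ i → f i ≡ x)
enumerate Vec.[] = (λ ()) , (λ { {()} }) , (λ ()) , λ ()
enumerate (true Vec.∷ S) with enumerate S
... | f , inj , f∈ , onto = g , (λ {i} {j} → g-inj i j) , g∈ , g-onto
  where
  g : Fin (suc ∣ S ∣) → Fin _
  g zero = zero
  g (suc i) = suc (f i)
  g-inj : ∀ i j → g i ≡ g j → i ≡ j
  g-inj zero zero _ = refl
  g-inj (suc i) (suc j) e = cong suc (inj (suc-injective e))
  g∈ : ∀ i → g i ∈ true Vec.∷ S
  g∈ zero = Vec.here
  g∈ (suc i) = Vec.there (f∈ i)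
  g-onto : ∀ {x} → x ∈ true Vec.∷ S → ∃ λ i → g i ≡ x
  g-onto Vec.here = zero , refl
  g-onto (Vec.there p) = let (i , e) = onto p in suc i , cong suc e
enumerate (false Vec.∷ S) with enumerate S
... | f , inj , f∈ , onto = suc ∘ f , (λ e → inj (suc-injective e)) , (λ i → Vec.there (f∈ i)) ,
  λ { (Vec.there p) → let (i , e) = onto p in i , cong suc e }

-- Ties a template, whose edges carry statuses, to the Boolean adjacency used in the finite checks.
record Matched {m} (T : Template m) (A : Adj m) : Set where
  field
    simple  : AllPairs NonParallel T
    sound   : ∀ {t} → t ∈ˡ T → A (end₁ t) (end₂ t) ≡ true
    present : ∀ {i j} → A i j ≡ true → ∃ λ t → t ∈ˡ T × SamePair (end₁ t) (end₂ t) i j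

wheel-edges : ∀ rim spoke k {t} → t ∈ˡ wheel rim spoke k →
              (∃₂ λ i j → (i , j) ∈ˡ cyclePairs k × t ≡ edge (suc i) (suc j) rim) ⊎ (∃ λ i → t ≡ edge zero (suc i) spoke)
wheel-edges rim spoke k t∈ with ∈-++⁻ (map (λ (i , j) → edge (suc i) (suc j) rim) (cyclePairs k)) t∈
... | inj₁ p = let ((i , j) , q , e) = ∈-map⁻ (λ (i , j) → edge (suc i) (suc j) rim) p in inj₁ (i , j , q , e)
... | inj₂ p = let (i , _ , e) = ∈-map⁻ (λ i → edge zero (suc i) spoke) p in inj₂ (i , e)

wheel-matched : ∀ rim spoke k → Matched (wheel rim spoke (3 + k)) (wheelAdj (3 + k))
wheel-matched rim spoke k = record { simple = simple ; sound = sound ; present = λ {i} {j} → present i j }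
  where
  n = 3 + k
  W = wheel rim spoke n
  rimEdge : Fin n × Fin n → Edge (suc n) Status
  rimEdge (i , j) = edge (suc i) (suc j) rim
  spokeEdge : Fin n → Edge (suc n) Status
  spokeEdge i = edge zero (suc i) spoke
  sound : ∀ {t} → t ∈ˡ W → wheelAdj n (end₁ t) (end₂ t) ≡ true
  sound t∈ with wheel-edges rim spoke n t∈
  ... | inj₂ (_ , refl) = refl
  ... | inj₁ (_ , _ , here refl , refl) = subst (λ x → cycleAdj n (fromℕ (2 + k)) x ≡ true) (next-fromℕ (2 + k)) (cycle-step (fromℕ (2 + k)))
  ... | inj₁ (_ , _ , there p , refl) with ∈-tabulate⁻ {f = λ i → inject₁ i , suc i} p
  ... | x , refl = subst (λ y → cycleAdj n (inject₁ x) y ≡ true) (next-inject₁ x) (cycle-step (inject₁ x))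
  rim-present : ∀ i → ∃ λ t → t ∈ˡ W × end₁ t ≡ suc i × end₂ t ≡ suc (next i)
  rim-present i with view i
  ... | ‵fromℕ = _ , here refl , refl , refl
  ... | ‵inject₁ i = rimEdge (inject₁ i , suc i) , ∈-++⁺ˡ (∈-map⁺ rimEdge (there (∈-tabulate⁺ {f = λ i → inject₁ i , suc i} i))) , refl , refl
  present : ∀ i j → wheelAdj n i j ≡ true → ∃ λ t → t ∈ˡ W × SamePair (end₁ t) (end₂ t) i j
  present zero (suc j) _ = spokeEdge j , ∈-++⁺ʳ (map rimEdge (cyclePairs n)) (∈-map⁺ spokeEdge (∈-allFin j)) , inj₁ (refl , refl)
  present (suc i) zero _ = spokeEdge i , ∈-++⁺ʳ (map rimEdge (cyclePairs n)) (∈-map⁺ spokeEdge (∈-allFin i)) , inj₂ (refl , refl)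
  present (suc i) (suc j) r with cycle-cases {i = i} {j} r
  ... | inj₁ refl = let (t , p , e , e′) = rim-present i in t , p , inj₁ (e , e′)
  ... | inj₂ refl = let (t , p , e , e′) = rim-present j in t , p , inj₂ (e , e′)
  simple : AllPairs NonParallel W
  simple = AllPairsP.++⁺ rims spokes cross
    where
    spokes : AllPairs NonParallel (map spokeEdge (allFin n))
    spokes = AllPairsP.map⁺ (AllPairs.map (λ { ne (inj₁ (_ , e)) → ne (suc-injective e) ; ne (inj₂ (() , _)) }) (UniqueP.allFin⁺ n))
    cross : All (λ t → All (NonParallel t) (map spokeEdge (allFin n))) (map rimEdge (cyclePairs n))
    cross = AllP.map⁺ (All.universal (λ _ → AllP.map⁺ (All.universal (λ _ → λ { (inj₁ (() , _)) ; (inj₂ (_ , ())) }) (allFin n))) (cyclePairs n))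
    rims : AllPairs NonParallel (map rimEdge (cyclePairs n))
    rims = AllPairsP.map⁺ (AllP.tabulate⁺ closing ∷ AllPairsP.tabulate⁺ consecutive)
      where
      closing : ∀ i → NonParallel (rimEdge (fromℕ (2 + k) , zero)) (rimEdge (inject₁ i , suc i))
      closing i (inj₁ (_ , ()))
      closing zero (inj₂ (() , _))
      closing (suc i) (inj₂ (_ , ()))
      consecutive : ∀ {i j} → i ≢ j → NonParallel (rimEdge (inject₁ i , suc i)) (rimEdge (inject₁ j , suc j))
      consecutive ne (inj₁ (_ , e)) = ne (suc-injective (suc-injective e))
      consecutive {i} {j} _ (inj₂ (e , e′)) = <-irrefl
        (trans (sym (toℕ-inject₁ i)) (trans (cong toℕ (suc-injective e)) (cong suc (trans (sym (toℕ-inject₁ j)) (sym (cong toℕ (suc-injective e′)))))))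
        (m≤n⇒m≤1+n ≤-refl)

prism-matched : Matched prism prismAdj
prism-matched = record
  { simple = toWitness {a? = AllPairs.allPairs? (λ e e′ → ¬? (parallel? e e′)) prism} _
  ; sound = λ {t} i → All.lookup sound i
  ; present = λ {i} {j} r → let (t , p , q) = find (present i j r) in t , p , q }
  where
  sound : All (λ t → prismAdj (end₁ t) (end₂ t) ≡ true) prism
  sound = refl ∷ refl ∷ refl ∷ refl ∷ refl ∷ refl ∷ refl ∷ refl ∷ refl ∷ []
  present : ∀ i j → prismAdj i j ≡ true → Any (λ t → SamePair (end₁ t) (end₂ t) i j) prism
  present = toWitness {a? = all? λ i → all? λ j → (prismAdj i j ≟ᵇ true) →-dec
    Any.any? (λ t → joins? i j t) prism} _

module _ {n : ℕ} where

  module Component₃ {k} {H : MultiGraph n Kind} (S : Sound k H) (simple : Simple H) (conn : 3-Connected H) where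

    private
      m = order H
      numbering = enumerate (vertices H)

    ι : Fin m → Fin n
    ι = proj₁ numbering

    ι-inj : ∀ {i j} → ι i ≡ ι j → i ≡ j
    ι-inj = proj₁ (proj₂ numbering)

    ι∈ : ∀ i → ι i ∈ vertices H
    ι∈ = proj₁ (proj₂ (proj₂ numbering))

    number : ∀ {x} → x ∈ vertices H → ∃ λ i → ι i ≡ x
    number = proj₂ (proj₂ (proj₂ numbering))

    underlying : Graph m
    underlying = record
      { _~_ = λ i j → Any (Joins (ι i) (ι j)) H
      ; ~-sym = Any.map (λ {e} → joins-sym {e = e})
      ; ~-irrefl = λ { refl r → let (e , i , j) = find r in All.lookup (proj₁ simple) i (loop {e} j) }
      ; _~?_ = λ i j → Any.any? (joins? (ι i) (ι j)) H }
      where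
      loop : ∀ {e : Edge n Kind} {x} → Joins x x e → end₁ e ≡ end₂ e
      loop (inj₁ (p , q)) = trans p (sym q)
      loop (inj₂ (p , q)) = trans p (sym q)

    open Graph underlying

    underlying-tri : TriConnected underlying
    underlying-tri Sep = escape s∈ (walk (proj₂ conn X (≤-trans (s≤s small) ≤-refl) (ι s) (ι t) (ι∈ s) (ι∈ t)
      (outside (λ { refl → a∉ s∈ }) (λ { refl → b∉ s∈ })) (outside t≢a t≢b)) s t refl refl)
      where
      open Separation₂ Sep
      X = ⁅ ι a ⁆ ∪ ⁅ ι b ⁆
      small : ∣ X ∣ ≤ 2
      small = ≤-trans (∣p∪q∣≤∣p∣+∣q∣ ⁅ ι a ⁆ ⁅ ι b ⁆) (≤-reflexive (cong₂ _+_ (∣⁅x⁆∣≡1 (ι a)) (∣⁅x⁆∣≡1 (ι b))))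
      outside : ∀ {i} → i ≢ a → i ≢ b → ι i ∉ X
      outside p q x with x∈p∪q⁻ ⁅ ι a ⁆ ⁅ ι b ⁆ x
      ... | inj₁ e = p (ι-inj (x∈⁅y⁆⇒x≡y _ e))
      ... | inj₂ e = q (ι-inj (x∈⁅y⁆⇒x≡y _ e))
      walk : ∀ {x y} → Star (StepAvoiding X H) x y → ∀ i j → ι i ≡ x → ι j ≡ y → Star (λ i j → i ~ j × ι j ∉ X) i j
      walk ε i j p q with ι-inj (trans p (sym q))
      ... | refl = ε
      walk ((_ , z∉ , e) ◅ st) i j refl q with number (∈-vertices⁺ (proj₂ (joined-touches e)))
      ... | l , refl = (e , z∉) ◅ walk st l j refl q
      escape : ∀ {i} → i ∈ C → Star (λ i j → i ~ j × ι j ∉ X) i t → ⊥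
      escape i∈ ε = t∉ i∈
      escape i∈ ((r , z∉) ◅ st) with closed i∈ r
      ... | inj₁ j∈ = escape j∈ st
      ... | inj₂ (inj₁ refl) = z∉ (x∈p∪q⁺ (inj₁ (x∈⁅x⁆ _)))
      ... | inj₂ (inj₂ refl) = z∉ (x∈p∪q⁺ (inj₂ (x∈⁅x⁆ _)))

    -- The underlying graph with the virtual edges whose labels satisfy P subdivided.
    module Partly (P : ℕ → Set) (P? : ∀ ℓ → Dec (P ℓ)) where

      Chosen : Edge n Kind → Set
      Chosen e = ∃ λ ℓ → label e ≡ virtual ℓ × P ℓ

      data PartLink (e : Edge n Kind) : Fin m ⊎ ℕ → Fin m ⊎ ℕ → Set where
        direct : ∀ {i j} → ¬ Chosen e → Joins (ι i) (ι j) e → PartLink e (inj₁ i) (inj₁ j)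
        enter  : ∀ {i ℓ} → label e ≡ virtual ℓ → P ℓ → Touches (ι i) e → PartLink e (inj₁ i) (inj₂ ℓ)
        leave  : ∀ {i ℓ} → label e ≡ virtual ℓ → P ℓ → Touches (ι i) e → PartLink e (inj₂ ℓ) (inj₁ i)

      PartHat : Fin m ⊎ ℕ → Fin m ⊎ ℕ → Set
      PartHat s t = Any (λ e → PartLink e s t) H

      partHat-sym : ∀ {s t} → PartHat s t → PartHat t s
      partHat-sym = Any.map partLink-sym
        where
        partLink-sym : ∀ {e s t} → PartLink e s t → PartLink e t s
        partLink-sym {e} (direct p j) = direct p (joins-sym {e = e} j)
        partLink-sym (enter p q t) = leave p q t
        partLink-sym (leave p q t) = enter p q t

      private
        -- An unchosen subdividing vertex is absorbed by the first end of its edge.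
        owner : ∀ ℓ → Dec (Any (λ e → label e ≡ virtual ℓ) H) → Maybe (Fin m ⊎ ℕ)
        owner ℓ (no _) = nothing
        owner ℓ (yes p) = let (e , i , _) = find p in just (inj₁ (proj₁ (number (∈-vertices⁺ (lose i (inj₁ refl))))))

        labelled? : ∀ ℓ → Dec (Any (λ e → label e ≡ virtual ℓ) H)
        labelled? ℓ = Any.any? (λ e → label e ≟ᵏ virtual ℓ) H

        φ : Point n → Maybe (Fin m ⊎ ℕ)
        φ (inj₁ x) with x ∈? vertices H
        ... | yes p = just (inj₁ (proj₁ (number p)))
        ... | no _ = nothing
        φ (inj₂ ℓ) with P? ℓ
        ... | yes _ = just (inj₂ ℓ)
        ... | no _ = owner ℓ (labelled? ℓ)

        φ-ι : ∀ i → φ (inj₁ (ι i)) ≡ just (inj₁ i)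
        φ-ι i with ι i ∈? vertices H
        ... | yes p = cong (just ∘ inj₁) (ι-inj (proj₂ (number p)))
        ... | no h = contradiction (ι∈ i) h

        φ-chosen : ∀ {ℓ} → P ℓ → φ (inj₂ ℓ) ≡ just (inj₂ ℓ)
        φ-chosen {ℓ} p with P? ℓ
        ... | yes _ = refl
        ... | no h = contradiction p h

        φ-owned : ∀ {e i ℓ} → e ∈ˡ H → label e ≡ virtual ℓ → ¬ P ℓ → end₁ e ≡ ι i → φ (inj₂ ℓ) ≡ just (inj₁ i)
        φ-owned {e} {i} {ℓ} e∈ l ¬p q with P? ℓ
        ... | yes p = contradiction p ¬p
        ... | no _ with labelled? ℓ
        ... | no h = contradiction (lose e∈ l) h
        ... | yes p with find p
        ... | e′ , e′∈ , l′ with same-label (Sound.labels S) e∈ e′∈ l l′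
        ... | refl = cong (just ∘ inj₁) (ι-inj (trans (proj₂ (number (∈-vertices⁺ (lose e′∈ (inj₁ refl))))) q))

        data Preimage : Point n → Fin m ⊎ ℕ → Set where
          vertex  : ∀ i → Preimage (inj₁ (ι i)) (inj₁ i)
          chosen  : ∀ ℓ → Preimage (inj₂ ℓ) (inj₂ ℓ)
          owned   : ∀ {e ℓ} i → e ∈ˡ H → label e ≡ virtual ℓ → end₁ e ≡ ι i → Preimage (inj₂ ℓ) (inj₁ i)

        preimage : ∀ {s x} → φ s ≡ just x → Preimage s x
        preimage {inj₁ x} e with x ∈? vertices H
        preimage {inj₁ x} refl | yes p = subst (λ y → Preimage (inj₁ y) (inj₁ (proj₁ (number p)))) (proj₂ (number p)) (vertex _)
        preimage {inj₂ ℓ} e with P? ℓ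
        preimage {inj₂ ℓ} refl | yes _ = chosen ℓ
        ... | no _ with labelled? ℓ
        preimage {inj₂ ℓ} refl | no _ | yes p = let (e , e∈ , l) = find p in
          owned _ e∈ l (sym (proj₂ (number (∈-vertices⁺ (lose e∈ (inj₁ refl))))))

        to-vertex : ∀ {s i} → φ s ≡ just (inj₁ i) → Star (Inside (Hat H) φ (inj₁ i)) s (inj₁ (ι i))
        to-vertex {s} e with preimage {s} e
        ... | vertex i = ε
        ... | owned i e∈ l q = (lose e∈ (leave l (inj₁ q)) , e , φ-ι i) ◅ ε

        conn-φ : ∀ {s t x} → φ s ≡ just x → φ t ≡ just x → Star (Inside (Hat H) φ x) s t
        conn-φ {x = inj₁ i} p q = to-vertex p ◅◅ Star-reverse (λ (h , a , b) → hat-sym h , b , a) (to-vertex q)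
        conn-φ {s} {t} {inj₂ ℓ} p q with preimage {s} p | preimage {t} q
        ... | chosen _ | chosen _ = ε

        edges-φ : ∀ {s t} → PartHat s t → ∃₂ λ v w → φ v ≡ just s × φ w ≡ just t × Hat H v w
        edges-φ h with find h
        ... | e , e∈ , enter l p t = _ , _ , φ-ι _ , φ-chosen p , lose e∈ (enter l t)
        ... | e , e∈ , leave l p t = _ , _ , φ-chosen p , φ-ι _ , lose e∈ (leave l t)
        ... | e , e∈ , direct {i} {j} ¬c jn with label e in l
        ... | real = _ , _ , φ-ι i , φ-ι j , lose e∈ (direct l jn)
        ... | virtual ℓ with jn
        ... | inj₁ (p , q) = _ , _ , φ-owned e∈ l (λ c → ¬c (ℓ , refl , c)) p , φ-ι j , lose e∈ (leave l (inj₂ q))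
        ... | inj₂ (p , q) = _ , _ , φ-ι i , φ-owned e∈ l (λ c → ¬c (ℓ , refl , c)) p , lose e∈ (enter l (inj₂ q))

      partly-model : Model PartHat (Hat H)
      partly-model = record { φ = φ ; conn = λ {s} {t} → conn-φ {s} {t} ; edges = edges-φ }

-- The vertex 0 subdivides the edge between x and y, all other vertices being shifted by one.
subdividedAdj : ∀ {m} → Adj m → Fin m → Fin m → Adj (suc m)
subdividedAdj A x y zero zero = false
subdividedAdj A x y zero (suc j) = j == x ∨ j == y
subdividedAdj A x y (suc i) zero = i == x ∨ i == y
subdividedAdj A x y (suc i) (suc j) = A i j ∧ not ((i == x ∧ j == y) ∨ (i == y ∧ j == x))

subdivided-prism-models : List (Vec.Vec (Fin 6) 7)
subdivided-prism-models =
  (0F ∷ᵛ 1F ∷ᵛ 1F ∷ᵛ 3F ∷ᵛ 4F ∷ᵛ 5F ∷ᵛ 2F ∷ᵛ []ᵛ) ∷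
  (0F ∷ᵛ 1F ∷ᵛ 3F ∷ᵛ 1F ∷ᵛ 4F ∷ᵛ 2F ∷ᵛ 5F ∷ᵛ []ᵛ) ∷
  (0F ∷ᵛ 1F ∷ᵛ 4F ∷ᵛ 5F ∷ᵛ 3F ∷ᵛ 2F ∷ᵛ 2F ∷ᵛ []ᵛ) ∷
  (0F ∷ᵛ 3F ∷ᵛ 1F ∷ᵛ 1F ∷ᵛ 2F ∷ᵛ 4F ∷ᵛ 5F ∷ᵛ []ᵛ) ∷
  (0F ∷ᵛ 4F ∷ᵛ 1F ∷ᵛ 5F ∷ᵛ 2F ∷ᵛ 3F ∷ᵛ 2F ∷ᵛ []ᵛ) ∷
  (0F ∷ᵛ 4F ∷ᵛ 5F ∷ᵛ 1F ∷ᵛ 2F ∷ᵛ 2F ∷ᵛ 3F ∷ᵛ []ᵛ) ∷ []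

-- The six triangle edges are settled by evaluation; for the matching edges the premise is false.
subdivided-prism : All (λ t → label t ≡ must-be-real → Model (Graph._~_ K₃₃⁻) (Holds (subdividedAdj prismAdj (end₁ t) (end₂ t)))) prism
subdivided-prism =
  (λ _ → found 0F 1F refl) ∷ (λ _ → found 1F 2F refl) ∷ (λ _ → found 2F 0F refl) ∷
  (λ _ → found 3F 4F refl) ∷ (λ _ → found 4F 5F refl) ∷ (λ _ → found 5F 3F refl) ∷
  (λ ()) ∷ (λ ()) ∷ (λ ()) ∷ []
  where
  found : ∀ x y → some-model table₆ (subdividedAdj prismAdj x y) subdivided-prism-models ≡ true →
          Model (Graph._~_ K₃₃⁻) (Holds (subdividedAdj prismAdj x y))
  found x y = some-model-sound table₆ (subdividedAdj prismAdj x y) subdivided-prism-models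

-- All vertices of K₄ are alike, so exchanging 0 with x makes x the hub.
transpose-iso : ∀ {n} {G : Graph n} → Fin 4 → Iso (wheelAdj 3) G → Iso (wheelAdj 3) G
transpose-iso x I = record
  { f = f ∘ transpose zero x ; inj = λ {i} {j} e → t-inj x i j (inj e)
  ; onto = λ y → let (i , e) = onto y in transpose zero x i , trans (cong f (t-inv x i)) e
  ; adj⁺ = λ {i} {j} r → proj₁ (t-adj x i j) (adj⁺ r) ; adj⁻ = λ {i} {j} r → adj⁻ (proj₂ (t-adj x i j) r) }
  where
  open Iso I
  t-inj : ∀ x i j → transpose zero x i ≡ transpose zero x j → i ≡ j
  t-inj = toWitness {a? = all? λ x → all? λ i → all? λ j → (transpose zero x i ≟ᶠ transpose zero x j) →-dec (i ≟ᶠ j)} _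
  t-inv : ∀ x i → transpose zero x (transpose zero x i) ≡ i
  t-inv = toWitness {a? = all? λ x → all? λ i → transpose zero x (transpose zero x i) ≟ᶠ i} _
  t-adj : ∀ x i j → (wheelAdj 3 (transpose zero x i) (transpose zero x j) ≡ true → wheelAdj 3 i j ≡ true) ×
                    (wheelAdj 3 i j ≡ true → wheelAdj 3 (transpose zero x i) (transpose zero x j) ≡ true)
  t-adj = toWitness {a? = all? λ x → all? λ i → all? λ j →
    ((wheelAdj 3 (transpose zero x i) (transpose zero x j) ≟ᵇ true) →-dec (wheelAdj 3 i j ≟ᵇ true)) ×-dec
    ((wheelAdj 3 i j ≟ᵇ true) →-dec (wheelAdj 3 (transpose zero x i) (transpose zero x j) ≟ᵇ true))} _

module _ {n : ℕ} {k} {H : MultiGraph n Kind} (S : Sound k H) (simple : Simple H) (conn : 3-Connected H)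
         (no₅ : ¬ Model (Graph._~_ K₅⁻) (Hat H)) (no₆ : ¬ Model (Graph._~_ K₃₃⁻) (Hat H)) where
  open Component₃ S simple conn

  private
    underlying-model : Model (Graph._~_ underlying) (Hat H)
    underlying-model = injection-model φ inj edges ⨾ partly-model
      where
      open Partly (λ _ → ⊥) (λ _ → no id)
      φ : Fin (order H) ⊎ ℕ → Maybe (Fin (order H))
      φ (inj₁ i) = just i
      φ (inj₂ _) = nothing
      inj : ∀ {v w x} → φ v ≡ just x → φ w ≡ just x → v ≡ w
      inj {inj₁ _} {inj₁ _} refl refl = refl
      edges : ∀ {i j} → Graph._~_ underlying i j → ∃₂ λ v w → φ v ≡ just i × φ w ≡ just j × PartHat v w
      edges r = _ , _ , refl , refl , Any.map (λ j → direct (λ { (_ , _ , ()) }) j) r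

    same-ends : ∀ {a b x y} {e : Edge n Kind} → Joins a b e → Joins x y e → SamePair a b x y
    same-ends (inj₁ (refl , refl)) (inj₁ (refl , refl)) = inj₁ (refl , refl)
    same-ends (inj₁ (refl , refl)) (inj₂ (refl , refl)) = inj₂ (refl , refl)
    same-ends (inj₂ (refl , refl)) (inj₁ (refl , refl)) = inj₂ (refl , refl)
    same-ends (inj₂ (refl , refl)) (inj₂ (refl , refl)) = inj₁ (refl , refl)

  module Shape {m} {A : Adj m} (I : Iso A underlying) where
    open Iso I public

    F : Fin m → Fin n
    F = ι ∘ f

    F-inj : ∀ {i j} → F i ≡ F j → i ≡ j
    F-inj = inj ∘ ι-inj

    RealAt : Fin m → Fin m → Set
    RealAt i j = ∀ {e} → e ∈ˡ H → Joins (F i) (F j) e → label e ≡ real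

    VirtualAt : Fin m → Fin m → ℕ → Set
    VirtualAt i j ℓ = ∃ λ e → e ∈ˡ H × Joins (F i) (F j) e × label e ≡ virtual ℓ

    status : ∀ i j → RealAt i j ⊎ ∃ (VirtualAt i j)
    status i j with Any.any? (λ e → joins? (F i) (F j) e ×-dec ¬? (label e ≟ᵏ real)) H
    ... | no h = inj₁ λ {e} e∈ je → decidable-stable (label e ≟ᵏ real) λ v → h (lose e∈ (je , v))
    ... | yes p with find p
    ... | e , e∈ , je , v with label e in l
    ... | real = contradiction refl v
    ... | virtual ℓ = inj₂ (ℓ , e , e∈ , je , l)

    real-sym : ∀ {i j} → RealAt i j → RealAt j i
    real-sym r {e} e∈ j = r e∈ (joins-sym {e = e} j)

    has-type : ∀ {T : Template m} → Matched T A → (∀ {t} → t ∈ˡ T → label t ≡ must-be-real → RealAt (end₁ t) (end₂ t)) → H HasType T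
    has-type {T} matched re = hasType-intro F F-inj T (proj₂ simple) T.simple realised covered
      where
      module T = Matched matched
      realised : ∀ {t} → t ∈ˡ T → ∃ λ e → e ∈ˡ H × Matches F e t
      realised {t} t∈ with find (adj⁻ (T.sound t∈)) | label t in l
      ... | e , e∈ , j | may-be-virtual = e , e∈ , j , permits-any (label e)
      ... | e , e∈ , j | must-be-real = e , e∈ , j , subst (Permits must-be-real) (sym (re t∈ l e∈ j)) real
      covered : ∀ {e} → e ∈ˡ H → ∃ λ t → t ∈ˡ T × Joins (F (end₁ t)) (F (end₂ t)) e
      covered {e} e∈ with number (∈-vertices⁺ (lose e∈ (inj₁ refl))) | number (∈-vertices⁺ (lose e∈ (inj₂ refl)))
      ... | a , p | b , q with onto a | onto b
      ... | i , refl | j , refl with T.present (adj⁺ (lose e∈ (inj₁ (sym p , sym q))))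
      ... | t , t∈ , inj₁ (refl , refl) = t , t∈ , inj₁ (sym p , sym q)
      ... | t , t∈ , inj₂ (refl , refl) = t , t∈ , inj₂ (sym p , sym q)

    module Marked (P : ℕ → Set) (P? : ∀ ℓ → Dec (P ℓ)) where
      open Partly P P? public

      plain-edge : ∀ {i j} → A i j ≡ true → (∀ {ℓ} → P ℓ → ¬ VirtualAt i j ℓ) → PartHat (inj₁ (f i)) (inj₁ (f j))
      plain-edge r h with find (adj⁻ r)
      ... | e , e∈ , j = lose e∈ (direct (λ (ℓ , l , p) → h p (e , e∈ , j , l)) j)

      half-edge : ∀ {i j ℓ} → P ℓ → VirtualAt i j ℓ → PartHat (inj₁ (f i)) (inj₂ ℓ) × PartHat (inj₁ (f j)) (inj₂ ℓ)
      half-edge p (e , e∈ , j , l) = lose e∈ (enter l p (proj₁ (joins-touches {e = e} j))) ,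
                                     lose e∈ (enter l p (proj₂ (joins-touches {e = e} j)))

      point-≢ : ∀ {i j} → i ≢ j → _≢_ {A = Fin (order H) ⊎ ℕ} (inj₁ (f i)) (inj₁ (f j))
      point-≢ ne e = ne (inj (inj₁-injective e))

    one-place : ∀ {i j i′ j′ ℓ} → VirtualAt i j ℓ → VirtualAt i′ j′ ℓ → SamePair i j i′ j′
    one-place (e , e∈ , je , l) (e′ , e′∈ , je′ , l′) with same-label (Sound.labels S) e∈ e′∈ l l′
    ... | refl = Sum.map (Product.map F-inj F-inj) (Product.map F-inj F-inj) (same-ends {e = e} je je′)

  subdivided : ∀ {m} {A : Adj m} (I : Iso A underlying) {x y ℓ} → Shape.VirtualAt I x y ℓ →
               Model (Holds (subdividedAdj A x y)) (Hat H)
  subdivided {m} {A} I {x} {y} {ℓ} vir = injection-model φ φ-inj (λ {i} {j} → edges i j) ⨾ partly-model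
    where
    open Shape I
    open Marked (_≡ ℓ) (_≟ⁿ ℓ)
    φ : Fin (order H) ⊎ ℕ → Maybe (Fin (suc m))
    φ (inj₁ i) = just (suc (proj₁ (onto i)))
    φ (inj₂ j) with j ≟ⁿ ℓ
    ... | yes _ = just zero
    ... | no _ = nothing
    φ-ℓ : φ (inj₂ ℓ) ≡ just zero
    φ-ℓ with ℓ ≟ⁿ ℓ
    ... | yes _ = refl
    ... | no h = contradiction refl h
    φ-f : ∀ i → φ (inj₁ (f i)) ≡ just (suc i)
    φ-f i = cong (just ∘ suc) (inj (proj₂ (onto (f i))))
    φ-inj : ∀ {v w z} → φ v ≡ just z → φ w ≡ just z → v ≡ w
    φ-inj {inj₁ i} {inj₁ j} p q = cong inj₁ (trans (sym (proj₂ (onto i)))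
      (trans (cong f (suc-injective (just-injective (trans p (sym q))))) (proj₂ (onto j))))
    φ-inj {inj₁ i} {inj₂ j} p q with j ≟ⁿ ℓ
    ... | yes _ = case just-injective (trans p (sym q)) of λ ()
    φ-inj {inj₂ i} {inj₁ j} p q with i ≟ⁿ ℓ
    ... | yes _ = case just-injective (trans p (sym q)) of λ ()
    φ-inj {inj₂ i} {inj₂ j} p q with i ≟ⁿ ℓ | j ≟ⁿ ℓ
    ... | yes refl | yes refl = refl
    Realised : Fin (suc m) → Fin (suc m) → Set
    Realised i j = ∃₂ λ v w → φ v ≡ just i × φ w ≡ just j × PartHat v w
    end : ∀ j → j == x ∨ j == y ≡ true → PartHat (inj₁ (f j)) (inj₂ ℓ)
    end j r with ∨-true {j == x} r
    ... | inj₁ e with ==-sound {i = j} {x} e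
    ... | refl = proj₁ (half-edge refl vir)
    end j r | inj₂ e with ==-sound {i = j} {y} e
    ... | refl = proj₂ (half-edge refl vir)
    edges : ∀ i j → subdividedAdj A x y i j ≡ true → Realised i j
    edges zero (suc j) r = _ , _ , φ-ℓ , φ-f j , partHat-sym (end j r)
    edges (suc i) zero r = _ , _ , φ-f i , φ-ℓ , end i r
    edges (suc i) (suc j) r with ∧-true {A i j} r
    ... | r₁ , r₂ = _ , _ , φ-f i , φ-f j , plain-edge r₁ λ { refl v → not-true r₂ (same (one-place v vir)) }
      where
      same : SamePair i j x y → (i == x ∧ j == y) ∨ (i == y ∧ j == x) ≡ true
      same (inj₁ (refl , refl)) = ∨-introˡ (∧-intro (==-refl i) (==-refl j))
      same (inj₂ (refl , refl)) = ∨-introʳ {i == j ∧ j == i} (∧-intro (==-refl i) (==-refl j))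

  prism-allowed : Iso prismAdj underlying → Allowed H
  prism-allowed I = is-prism (has-type prism-matched re)
    where
    open Shape I
    re : ∀ {t} → t ∈ˡ prism → label t ≡ must-be-real → RealAt (end₁ t) (end₂ t)
    re {t} t∈ l with status (end₁ t) (end₂ t)
    ... | inj₁ r = r
    ... | inj₂ (_ , vir) = contradiction (All.lookup subdivided-prism t∈ l ⨾ subdivided I vir) no₆

  -- The hub and the rim vertex are opposite in a four-cycle through the two rim neighbours of the
  -- latter. The subdividing vertex joins the one pair, the rest of the rim the other; the latter
  -- exists because there are at least four spokes.
  no-virtual-spoke : ∀ {k ℓ} (I : Iso (wheelAdj (4 + k)) underlying) → ¬ Shape.VirtualAt I zero 1F ℓ
  no-virtual-spoke {k} {ℓ} I vir = no₆ (crossed-cycle _≟ᵖ_ partHat-sym {pt zero} {pt 1F} {inj₂ ℓ} {pt 2F} {pt last} Q Q?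
    ((point-≢ (λ ()) ∷ (λ ()) ∷ point-≢ (λ ()) ∷ point-≢ (λ ()) ∷ []) ∷ ((λ ()) ∷ point-≢ (λ ()) ∷ point-≢ (λ ()) ∷ []) ∷
     ((λ ()) ∷ (λ ()) ∷ []) ∷ (point-≢ (λ ()) ∷ []) ∷ [] ∷ [])
    ((λ { (i , e) → point-≢ (λ ()) e }) ∷ (λ { (i , e) → point-≢ (λ ()) e }) ∷ (λ { (i , ()) }) ∷ (λ { (i , e) → point-≢ (λ ()) e }) ∷
     (λ { (i , e) → point-≢ (λ e → fromℕ≢inject₁ (sym (suc-injective (suc-injective (suc-injective e))))) e }) ∷ [])
    (λ { (i , refl) (j , refl) → path-connected _≟ᵖ_ partHat-sym between Q (λ i → i , refl) (λ i → hop (suc (suc (inject₁ i)))) i j })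
    (between zero , (zero , refl) , partHat-sym (hop 1F))
    (between (fromℕ k) , (fromℕ k , refl) , hop (suc (suc (fromℕ k))))
    (proj₁ (half-edge refl vir)) (far-edge {zero} refl) (far-edge {zero} refl)
    (proj₂ (half-edge refl vir)) (hop zero)
    (far-edge (cycle-sym {i = fromℕ (3 + k)} {zero} (subst (λ x → cycleAdj (4 + k) (fromℕ (3 + k)) x ≡ true) (next-fromℕ (3 + k)) (cycle-step (fromℕ (3 + k))))))
    ⨾ partly-model)
    where
    open Shape I
    open Marked (_≡ ℓ) (_≟ⁿ ℓ)
    pt : Fin (5 + k) → Fin (order H) ⊎ ℕ
    pt i = inj₁ (f i)
    last = suc (suc (fromℕ (2 + k)))
    between : Fin (suc k) → Fin (order H) ⊎ ℕ
    between i = pt (suc (suc (suc (inject₁ i))))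
    Q : Fin (order H) ⊎ ℕ → Set
    Q x = ∃ λ i → between i ≡ x
    Q? : ∀ x → Dec (Q x)
    Q? x = any? λ i → between i ≟ᵖ x
    far-edge : ∀ {i} {j : Fin (3 + k)} → wheelAdj (4 + k) i (suc (suc j)) ≡ true → PartHat (pt i) (pt (suc (suc j)))
    far-edge r = plain-edge r λ { refl v → case one-place v vir of λ { (inj₁ (_ , ())) ; (inj₂ (_ , ())) } }
    hop : ∀ (i : Fin (3 + k)) → PartHat (pt (suc (inject₁ i))) (pt (suc (suc i)))
    hop i = far-edge (subst (λ x → cycleAdj (4 + k) (inject₁ i) x ≡ true) (next-inject₁ i) (cycle-step (inject₁ i)))

  wheel-allowed : ∀ k → Iso (wheelAdj (4 + k)) underlying → Allowed H
  wheel-allowed k I = is-wheel {k = 4 + k} (s≤s (s≤s (s≤s z≤n))) (has-type (wheel-matched may-be-virtual must-be-real (1 + k)) re)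
    where
    open Shape I
    spoke-real : ∀ i → RealAt zero (suc i)
    spoke-real i with status zero (suc i)
    ... | inj₁ r = r
    ... | inj₂ (ℓ , e , e∈ , j , l) = let (I′ , p , q) = rotate-to I i in
      contradiction (e , e∈ , subst₂ (λ x y → Joins (ι x) (ι y) e) (sym q) (sym p) j , l) (no-virtual-spoke I′)
    re : ∀ {t} → t ∈ˡ wheel may-be-virtual must-be-real (4 + k) → label t ≡ must-be-real → RealAt (end₁ t) (end₂ t)
    re t∈ l with wheel-edges may-be-virtual must-be-real (4 + k) t∈
    re t∈ () | inj₁ (_ , _ , _ , refl)
    re t∈ l | inj₂ (i , refl) = spoke-real i

  module FourVertices (I : Iso (wheelAdj 3) underlying) where
    open Shape I

    complete₄ : ∀ i j → i ≢ j → wheelAdj 3 i j ≡ true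
    complete₄ = toWitness {a? = all? λ i → all? λ j → ¬? (i ≟ᶠ j) →-dec (wheelAdj 3 i j ≟ᵇ true)} _

    -- In the four-cycle a c b d both opposite pairs are joined through subdividing vertices, which
    -- is a crossed cycle.
    opposite : ∀ {a b c d ℓ ℓ′} → Unique (a ∷ b ∷ c ∷ d ∷ []) → VirtualAt a b ℓ → VirtualAt c d ℓ′ → ⊥
    opposite {a} {b} {c} {d} {ℓ} {ℓ′} ((ab ∷ ac ∷ ad ∷ []) ∷ (bc ∷ bd ∷ []) ∷ (cd ∷ []) ∷ [] ∷ []) vir vir′ =
      no₆ (crossed-cycle _≟ᵖ_ partHat-sym {inj₁ (f a)} {inj₁ (f b)} {inj₂ ℓ} {inj₁ (f c)} {inj₁ (f d)} (_≡ inj₂ ℓ′) (_≟ᵖ inj₂ ℓ′)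
        ((point-≢ ab ∷ (λ ()) ∷ point-≢ ac ∷ point-≢ ad ∷ []) ∷ ((λ ()) ∷ point-≢ bc ∷ point-≢ bd ∷ []) ∷
         ((λ ()) ∷ (λ ()) ∷ []) ∷ (point-≢ cd ∷ []) ∷ [] ∷ [])
        ((λ ()) ∷ (λ ()) ∷ (λ e → ℓ≢ℓ′ (inj₂-injective e)) ∷ (λ ()) ∷ (λ ()) ∷ [])
        (λ { refl refl → ε })
        (inj₂ ℓ′ , refl , partHat-sym (proj₁ (half-edge (inj₂ refl) vir′)))
        (inj₂ ℓ′ , refl , partHat-sym (proj₂ (half-edge (inj₂ refl) vir′)))
        (proj₁ (half-edge (inj₁ refl) vir)) (straight ac ad (ac ∘ sym) (bc ∘ sym) ac) (straight ac ad (ad ∘ sym) (bd ∘ sym) ad)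
        (proj₂ (half-edge (inj₁ refl) vir)) (straight bc bd (ac ∘ sym) (bc ∘ sym) bc) (straight bc bd (ad ∘ sym) (bd ∘ sym) bd)
        ⨾ partly-model)
      where
      open Marked (λ j → j ≡ ℓ ⊎ j ≡ ℓ′) (λ j → (j ≟ⁿ ℓ) ⊎-dec (j ≟ⁿ ℓ′))
      ℓ≢ℓ′ : ℓ ≢ ℓ′
      ℓ≢ℓ′ refl = case one-place vir vir′ of λ { (inj₁ (e , _)) → ac e ; (inj₂ (e , _)) → ad e }
      straight : ∀ {x y} → x ≢ c → x ≢ d → y ≢ a → y ≢ b → x ≢ y → PartHat (inj₁ (f x)) (inj₁ (f y))
      straight xc xd ya yb xy = plain-edge (complete₄ _ _ xy) λ
        { (inj₁ refl) v → case one-place v vir of λ { (inj₁ (_ , e)) → yb e ; (inj₂ (_ , e)) → ya e }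
        ; (inj₂ refl) v → case one-place v vir′ of λ { (inj₁ (e , _)) → xc e ; (inj₂ (e , _)) → xd e } }

    one-real : ∀ {a b c d} → Unique (a ∷ b ∷ c ∷ d ∷ []) → RealAt a b ⊎ RealAt c d
    one-real {a} {b} {c} {d} u with status a b | status c d
    ... | inj₁ r | _ = inj₁ r
    ... | inj₂ _ | inj₁ r = inj₂ r
    ... | inj₂ (_ , v) | inj₂ (_ , v′) = ⊥-elim (opposite u v v′)

  private
    t-suc : ∀ (x : Fin 4) i → transpose zero x (suc i) ≢ x
    t-suc = toWitness {a? = all? λ x → all? λ i → ¬? (transpose zero x (suc i) ≟ᶠ x)} _

    t-distinct : ∀ (x : Fin 4) i j → i ≢ j → transpose zero x i ≢ transpose zero x j
    t-distinct = toWitness {a? = all? λ x → all? λ i → all? λ j → ¬? (i ≟ᶠ j) →-dec ¬? (transpose zero x i ≟ᶠ transpose zero x j)} _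

  -- All edges at x are real, so that x serves as hub of the wheel W₃ with virtual rim edges.
  star-allowed : (I : Iso (wheelAdj 3) underlying) → ∀ x → (∀ y → y ≢ x → Shape.RealAt I x y) → Allowed H
  star-allowed I x real-at = is-wheel {k = 3} ≤-refl (Shape.has-type (transpose-iso x I) (wheel-matched may-be-virtual must-be-real 0) re)
    where
    re : ∀ {t} → t ∈ˡ wheel may-be-virtual must-be-real 3 → label t ≡ must-be-real → Shape.RealAt (transpose-iso x I) (end₁ t) (end₂ t)
    re t∈ l with wheel-edges may-be-virtual must-be-real 3 t∈
    re t∈ () | inj₁ (_ , _ , _ , refl)
    re t∈ l | inj₂ (i , refl) = real-at (transpose zero x (suc i)) (t-suc x i)

  -- The edges avoiding x are real, so that x serves as hub of the wheel W₃ with virtual spokes.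
  triangle-allowed : (I : Iso (wheelAdj 3) underlying) → ∀ x → (∀ y z → y ≢ x → z ≢ x → y ≢ z → Shape.RealAt I y z) → Allowed H
  triangle-allowed I x real-at = is-W₃ (Shape.has-type (transpose-iso x I) (wheel-matched must-be-real may-be-virtual 0) re)
    where
    re : ∀ {t} → t ∈ˡ wheel must-be-real may-be-virtual 3 → label t ≡ must-be-real → Shape.RealAt (transpose-iso x I) (end₁ t) (end₂ t)
    distinct : ∀ {i j} → (i , j) ∈ˡ cyclePairs 3 → i ≢ j
    distinct (here refl) ()
    distinct (there (here refl)) ()
    distinct (there (there (here refl))) ()
    re t∈ l with wheel-edges must-be-real may-be-virtual 3 t∈
    re t∈ () | inj₂ (_ , refl)
    re t∈ l | inj₁ (i , j , q , refl) = real-at _ _ (t-suc x i) (t-suc x j) (t-distinct x (suc i) (suc j) (distinct q ∘ suc-injective))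

  -- By `one-real` each of the three perfect matchings of K₄ has a real edge. Three edges, one from
  -- each matching, form either a star, so that its centre is a hub with real spokes, or a triangle,
  -- so that the fourth vertex is a hub with a real rim.
  K₄-allowed : Iso (wheelAdj 3) underlying → Allowed H
  K₄-allowed I = choose (one-real {0F} {1F} {2F} {3F} (distinct 0F 1F 2F 3F _)) (one-real {0F} {2F} {1F} {3F} (distinct 0F 2F 1F 3F _))
                        (one-real {0F} {3F} {1F} {2F} (distinct 0F 3F 1F 2F _))
    where
    open FourVertices I
    open Shape I
    distinct : ∀ (a b c d : Fin 4) → True (AllPairs.allPairs? (λ x y → ¬? (x ≟ᶠ y)) (a ∷ b ∷ c ∷ d ∷ [])) → Unique (a ∷ b ∷ c ∷ d ∷ [])
    distinct _ _ _ _ w = toWitness w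
    star : ∀ x a b c → True (all? λ y → ¬? (y ≟ᶠ x) →-dec ((y ≟ᶠ a) ⊎-dec ((y ≟ᶠ b) ⊎-dec (y ≟ᶠ c)))) →
           RealAt x a → RealAt x b → RealAt x c → Allowed H
    star x a b c w ra rb rc = star-allowed I x λ y y≢x → case toWitness w y y≢x of λ
      { (inj₁ refl) → ra ; (inj₂ (inj₁ refl)) → rb ; (inj₂ (inj₂ refl)) → rc }
    tri : ∀ x a b c → True (all? λ y → ¬? (y ≟ᶠ x) →-dec ((y ≟ᶠ a) ⊎-dec ((y ≟ᶠ b) ⊎-dec (y ≟ᶠ c)))) →
          RealAt a b → RealAt a c → RealAt b c → Allowed H
    tri x a b c w ab ac bc = triangle-allowed I x λ y z y≢x z≢x y≢z → pick (toWitness w y y≢x) (toWitness w z z≢x) y≢z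
      where
      pick : ∀ {y z} → y ≡ a ⊎ y ≡ b ⊎ y ≡ c → z ≡ a ⊎ z ≡ b ⊎ z ≡ c → y ≢ z → RealAt y z
      pick (inj₁ refl) (inj₁ refl) ne = contradiction refl ne
      pick (inj₁ refl) (inj₂ (inj₁ refl)) _ = ab
      pick (inj₁ refl) (inj₂ (inj₂ refl)) _ = ac
      pick (inj₂ (inj₁ refl)) (inj₁ refl) _ = real-sym ab
      pick (inj₂ (inj₁ refl)) (inj₂ (inj₁ refl)) ne = contradiction refl ne
      pick (inj₂ (inj₁ refl)) (inj₂ (inj₂ refl)) _ = bc
      pick (inj₂ (inj₂ refl)) (inj₁ refl) _ = real-sym ac
      pick (inj₂ (inj₂ refl)) (inj₂ (inj₁ refl)) _ = real-sym bc
      pick (inj₂ (inj₂ refl)) (inj₂ (inj₂ refl)) ne = contradiction refl ne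
    choose : RealAt 0F 1F ⊎ RealAt 2F 3F → RealAt 0F 2F ⊎ RealAt 1F 3F → RealAt 0F 3F ⊎ RealAt 1F 2F → Allowed H
    choose (inj₁ r) (inj₁ s) (inj₁ t) = star 0F 1F 2F 3F _ r s t
    choose (inj₁ r) (inj₁ s) (inj₂ t) = tri 3F 0F 1F 2F _ r s t
    choose (inj₁ r) (inj₂ s) (inj₁ t) = tri 2F 0F 1F 3F _ r t s
    choose (inj₁ r) (inj₂ s) (inj₂ t) = star 1F 0F 2F 3F _ (real-sym r) t s
    choose (inj₂ r) (inj₁ s) (inj₁ t) = tri 1F 0F 2F 3F _ s t r
    choose (inj₂ r) (inj₁ s) (inj₂ t) = star 2F 0F 1F 3F _ (real-sym s) (real-sym t) r
    choose (inj₂ r) (inj₂ s) (inj₁ t) = star 3F 0F 1F 2F _ (real-sym t) (real-sym s) (real-sym r)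
    choose (inj₂ r) (inj₂ s) (inj₂ t) = tri 0F 1F 2F 3F _ t s r

  3-connected-allowed : Allowed H
  3-connected-allowed with wheel-or-prism (order H) underlying (proj₁ conn) underlying-tri
                             (λ M → no₅ (M ⨾ underlying-model)) (λ M → no₆ (M ⨾ underlying-model))
  ... | inj₁ (zero , I) = K₄-allowed I
  ... | inj₁ (suc k , I) = wheel-allowed k I
  ... | inj₂ I = prism-allowed I

-- The components of a graph in FP, and the equivalence

module _ {n : ℕ} (G : Graph n) where

  block-model : ∀ {B} → Subgraph G B → Model (Hat B) (Graph._~_ G)
  block-model {B} (_ , real-edges) = injection-model (just ∘ inj₁) (λ { refl refl → refl }) edges
    where
    edges : ∀ {s t} → Hat B s t → ∃₂ λ v w → just (inj₁ v) ≡ just s × just (inj₁ w) ≡ just t × Graph._~_ G v w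
    edges h with find h
    ... | e , e∈ , direct _ (inj₁ (refl , refl)) = _ , _ , refl , refl , proj₁ (All.lookup real-edges e∈)
    ... | e , e∈ , direct _ (inj₂ (refl , refl)) = _ , _ , refl , refl , Graph.~-sym G (proj₁ (All.lookup real-edges e∈))
    ... | e , e∈ , enter l _ = case trans (sym (proj₂ (All.lookup real-edges e∈))) l of λ ()
    ... | e , e∈ , leave l _ = case trans (sym (proj₂ (All.lookup real-edges e∈))) l of λ ()

  FP⇒allowed : FP G → ∀ H → ThreeConnectedComponent G H → Allowed H
  FP⇒allowed (no₅ , no₆) H (B , (sub , conn , _) , _ , Hs , D , H∈) with All.lookup (TutteDecomposition.pieces D) H∈
  ... | inj₁ (k , big , t) = is-cycle big t
  ... | inj₂ (inj₁ (k , big , t)) = is-multiedge big t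
  ... | inj₂ (inj₂ (simple , 3-conn)) = 3-connected-allowed (All.lookup (pieces-sound sound obtained) H∈) simple 3-conn
      (λ M → no₅ (model⇒≼ (Excluded.nonisolated excluded₅) (M ⨾ to-G)))
      (λ M → no₆ (model⇒≼ (Excluded.nonisolated excluded₆) (M ⨾ to-G)))
    where
    open TutteDecomposition D using (obtained)
    sound = subgraph-sound G sub conn
    to-G : Model (Hat H) (Graph._~_ G)
    to-G = piece-model sound obtained H∈ ⨾ block-model sub

corollary11 : ∀ {n : ℕ} (G : Graph n) →
    FP G ⇔ (∀ H → ThreeConnectedComponent G H → Allowed H)
corollary11 G = mk⇔ (FP⇒allowed G) (allowed⇒FP G)
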